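{- Let $q$ be an odd prime power and $d\ge 2$. Let $E\subseteq\mathbb{F}_q^d$ and $R\subseteq\mathbb{F}_q\setminus\{0\}$. Let $0<\epsilon\le 1/2$ and let $\ell=2\lceil\epsilon^{ -1}\rceil+16$. Suppose $|E|>C=200|R|^{1/2+\epsilon}q^{(1+\epsilon)(d+1)/2}$. Let $\mathcal{H}$ be an $R$-distance subdivision of a complete graph $K_\Delta$ with distance at least $\ell$ between each pair of branching vertices. If $d>2$ and $|V(\mathcal{H})|\le|E|-C$, then $E$ contains $\mathcal{H}$. If $d=2$, $\Delta\le q^{ -1}|E|/4$ and $|V(\mathcal{H})|\le |E|-C$, then $E$ contains $\mathcal{H}$.
   Context: For $x\in\mathbb{F}_q^d$, $\|x\|=x_1^2+\dots+x_d^2$. A distance graph is a simple graph $H$ with a function $f:E(H)\to\mathbb{F}_q^*$; it is an $R$-distance graph if $f$ takes values in $R$. An $R$-distance subdivision of $K_\Delta$ is an $R$-distance graph whose underlying graph is obtained from $K_\Delta$ by replacing edges with internally vertex-disjoint paths; the $\Delta$ original vertices are branching vertices, and "distance at least $\ell$ between branching vertices" means each such path has length at least $\ell$. $E$ contains $(H,f)$ if there is an injective $\phi:V(H)\to E$ with $\|\phi(u)-\phi(v)\|=f(uv)$ for every edge $uv$.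
   Formalization: The parameter ε is taken to be a positive rational number a/b ≤ 1/2 rather than an arbitrary real; the real case follows by replacing ε with 1/⌈1/ε⌉, which keeps ℓ and does not increase C. -}

module Defs where

open import Level using (0ℓ)
open import Algebra.Bundles using (CommutativeRing)
open import Data.Nat using (ℕ; suc; _≤_; _<_; NonZero)
import Data.Nat as N
open import Data.Nat.DivMod using (_/_)
open import Data.Nat.Primality using (Prime)
open import Data.Fin using (Fin; inject₁; fromℕ; toℕ) renaming (zero to fzero; suc to fsuc; _<_ to _<ᶠ_)
open import Data.Vec using (Vec; foldr; zipWith; map; lookup)
open import Data.List using (List; length)
import Data.List
open import Data.List.Relation.Unary.Any using (Any)
open import Data.List.Relation.Unary.All using (All)
open import Data.List.Relation.Unary.AllPairs using (AllPairs)
open import Data.Product using (Σ; ∃; ∃-syntax; _×_; _,_)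
open import Data.Sum using (_⊎_)
open import Relation.Nullary using (¬_)
open import Relation.Binary.PropositionalEquality using (_≡_)

OddPrimePower : ℕ → Set
OddPrimePower q = Σ ℕ λ p → Σ ℕ λ k → Prime p × (Σ ℕ λ m → p ≡ suc (2 N.* m)) × 1 ≤ k × q ≡ p N.^ k

record Field : Set₁ where
  field
    commRing : CommutativeRing 0ℓ 0ℓ
  open CommutativeRing commRing public
  field
    1≉0     : ¬ (1# ≈ 0#)
    inverse : ∀ x → ¬ (x ≈ 0#) → Σ Carrier λ y → x * y ≈ 1#

record HasCard (F : Field) (q : ℕ) : Set where
  open Field F
  field
    enum       : Fin q → Carrier
    enum-inj   : ∀ i j → enum i ≈ enum j → i ≡ j
    enum-surj  : ∀ x → Σ (Fin q) λ i → enum i ≈ x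

module _ (F : Field) where
  open Field F

  Point : ℕ → Set
  Point d = Vec Carrier d

  _≈ᵥ_ : ∀ {d} → Point d → Point d → Set
  x ≈ᵥ y = ∀ i → lookup x i ≈ lookup y i

  _−ᵥ_ : ∀ {d} → Point d → Point d → Point d
  x −ᵥ y = zipWith (λ a b → a - b) x y

  ‖_‖ : ∀ {d} → Point d → Carrier
  ‖ x ‖ = foldr _ _+_ 0# (map (λ a → a * a) x)

  record PointSet (d : ℕ) : Set where
    field
      elems    : List (Point d)
      distinct : AllPairs (λ x y → ¬ (x ≈ᵥ y)) elems

  card : ∀ {d} → PointSet d → ℕ
  card E = length (PointSet.elems E)

  _∈ᴱ_ : ∀ {d} → Point d → PointSet d → Set
  x ∈ᴱ E = Any (λ y → x ≈ᵥ y) (PointSet.elems E)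

  record DistSet : Set where
    field
      elems    : List Carrier
      distinct : AllPairs (λ x y → ¬ (x ≈ y)) elems
      nonzero  : All (λ x → ¬ (x ≈ 0#)) elems

  _∈ᴿ_ : Carrier → DistSet → Set
  x ∈ᴿ R = Any (λ y → x ≈ y) (DistSet.elems R)

  -- An R-distance subdivision of K_Δ on the vertex set Fin n.
  -- Branching vertices: branch i (i : Fin Δ).  For each pair i < j there is a
  -- path  path i j p 0 = branch i, path i j p 1, …, path i j p len = branch j
  -- of length len i j; its k-th edge joins positions k and k+1 and carries the
  -- distance label label i j p k ∈ R.  Internal vertices (positions 0<k<len)
  -- are pairwise distinct and distinct from branching vertices, and every vertex
  -- is branching or internal (so n = |V(H)|).  The edges of H are exactly the
  -- consecutive pairs on these paths.
  record Subdivision (R : DistSet) (n Δ : ℕ) : Set where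
    field
      branch       : Fin Δ → Fin n
      branch-inj   : ∀ i j → branch i ≡ branch j → i ≡ j
      len          : Fin Δ → Fin Δ → ℕ
      path         : (i j : Fin Δ) → i <ᶠ j → Fin (suc (len i j)) → Fin n
      path-start   : ∀ i j (p : i <ᶠ j) → path i j p fzero ≡ branch i
      path-end     : ∀ i j (p : i <ᶠ j) → path i j p (fromℕ (len i j)) ≡ branch j
      internal-inj : ∀ i j (p : i <ᶠ j) k i′ j′ (p′ : i′ <ᶠ j′) k′ →
                     0 < toℕ k → toℕ k < len i j →
                     0 < toℕ k′ → toℕ k′ < len i′ j′ →
                     path i j p k ≡ path i′ j′ p′ k′ →
                     i ≡ i′ × j ≡ j′ × toℕ k ≡ toℕ k′
      internal-not-branch : ∀ i j (p : i <ᶠ j) k b →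
                     0 < toℕ k → toℕ k < len i j →
                     ¬ (path i j p k ≡ branch b)
      covering     : ∀ v → (Σ (Fin Δ) λ b → branch b ≡ v) ⊎
                     (Σ (Fin Δ) λ i → Σ (Fin Δ) λ j → Σ (i <ᶠ j) λ p →
                       Σ (Fin (suc (len i j))) λ k →
                       0 < toℕ k × toℕ k < len i j × path i j p k ≡ v)
      label        : (i j : Fin Δ) → i <ᶠ j → Fin (len i j) → Carrier
      label-in-R   : ∀ i j (p : i <ᶠ j) k → label i j p k ∈ᴿ R

  MinBranchDist : ∀ {R n Δ} → Subdivision R n Δ → ℕ → Set
  MinBranchDist {Δ = Δ} H ℓ = ∀ (i j : Fin Δ) (p : i <ᶠ j) → ℓ ≤ Subdivision.len H i j

  Contains : ∀ {d R n Δ} → PointSet d → Subdivision R n Δ → Set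
  Contains {d} {R} {n} {Δ} E H =
    Σ (Fin n → Point d) λ φ →
      (∀ v → φ v ∈ᴱ E) ×
      (∀ u v → φ u ≈ᵥ φ v → u ≡ v) ×
      (∀ (i j : Fin Δ) (p : i <ᶠ j) (k : Fin (len i j)) →
         ‖ φ (path i j p (inject₁ k)) −ᵥ φ (path i j p (fsuc k)) ‖ ≈ label i j p k)
    where open Subdivision H

⌈_/_⌉ : (b a : ℕ) → .{{NonZero a}} → ℕ
⌈ b / a ⌉ = (b N.+ (a N.∸ 1)) / a

dcard : (F : Field) → DistSet F → ℕ
dcard F R = Data.List.length (DistSet.elems R)

{-# OPTIONS --safe #-}
module Submission where

-- For each r ≠ 0 the graph of pairs at distance r is pseudorandom: (q e(A,B) - |A||B|)² ≤ 9 q^(d+1) |A||B|. Expanding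
-- the sphere in additive characters reduces this to bounds for Kloosterman sums (d even) and Salié sums (d odd). As there
-- are no complex numbers here, characters are replaced by translations acting on functions with zero sum. Kloosterman
-- sums over the tower of quadratic extensions satisfy a quadratic recursion, under which a sum exceeding Weil's bound would
-- grow faster than Stepanov's method allows; Salié sums are bounded by a self-improving inequality.
--
-- The embedding uses the extendability method of Friedman and Pippenger: after removing few points, every small set of
-- (point, colour) pairs expands by a factor D ≈ (|R|² q^(d+1))^ε, so the endpoints of a path can be grown into trees of
-- depth about 1/ε, which are joined by an edge of prescribed colour; all other tree vertices are then released again.
-- The branching vertices are centres of disjoint stars with prescribed colours, chosen greedily from a reserved part.

open import Data.Nat as ℕ using (ℕ; zero; suc)
open import Data.Product using (Σ; ∃; _×_; _,_; proj₁; proj₂)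
open import Data.Sum using (_⊎_; inj₁; inj₂)
open import Data.Empty using (⊥; ⊥-elim)
open import Data.Bool as Bool using (Bool; true; false)
open import Data.Fin as Fin using (Fin)
open import Data.List as List using (List)
open import Data.Vec as Vec using (Vec)
open import Relation.Nullary using (¬_; Dec; yes; no; does)
open import Function using (_∘_)
open import Data.Nat.Primality using (Prime)
open import Data.List.Relation.Unary.Unique.Propositional using (Unique)
open import Data.List.Relation.Unary.All as All using (All)
open import Level using (0ℓ)
open import Relation.Binary.PropositionalEquality hiding (setoid; isEquivalence; J; [_])
import Data.Nat.Properties as ℕP
import Data.Fin.Properties as FinP
import Data.List.Properties as ListP
import Data.List.Membership.Propositional.Properties as MP
import Data.Integer.Properties as ℤP
import Data.List.Relation.Unary.Unique.Propositional.Properties as UP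
import Data.List.Relation.Unary.All.Properties as AllP
import Data.List.Relation.Unary.Any.Properties as AnyP
import Data.Bool.Properties as BoolP

module FiniteSums where
 open import Algebra.Bundles using (CommutativeRing; RawRing)
 open import Algebra.Structures using (IsCommutativeRing)
 import Algebra.Solver.Ring
 import Algebra.Solver.Ring.AlmostCommutativeRing as ACR
 import Algebra.Properties.Ring
 import Algebra.Properties.Semiring.Mult
 open import Data.Integer as Z using (ℤ; +_; -[1+_]; 0ℤ; 1ℤ; -1ℤ)
 open import Data.List using ([]; _∷_; map; _++_; filter; length; allFin; cartesianProduct)
 open import Data.List.Relation.Unary.Any using (here; there)
 open import Data.List.Relation.Unary.All using ([]; _∷_)
 open import Data.List.Relation.Unary.AllPairs using ([]; _∷_)
 open import Data.List.Membership.Propositional using (_∈_)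
 open import Data.Maybe using (Maybe; just; nothing)
 open import Data.Bool using (if_then_else_)
 open import Data.Vec using ([]; _∷_)
 open import Relation.Nullary.Decidable using (map′)
 open import Relation.Unary using (Decidable)
 open import Relation.Binary.Definitions using (DecidableEquality)
 open import Function using (case_of_)

 module IntegerRingSolver (R : CommutativeRing 0ℓ 0ℓ) where
   open CommutativeRing R renaming (refl to ≈-refl; sym to ≈-sym; trans to ≈-trans)
   open Algebra.Properties.Ring ring
   open Algebra.Properties.Semiring.Mult semiring renaming (_×_ to _·_)
   open import Algebra.Properties.Monoid.Mult.TCOptimised +-monoid using (×ᵤ≈×) renaming (_×_ to _·′_)
   open import Relation.Binary.Reasoning.Setoid setoid

   fromℤ : ℤ → Carrier
   fromℤ (+ n)    = n · 1#
   fromℤ -[1+ n ] = - (suc n · 1#)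

   private
     neg-homo : ∀ i → fromℤ (Z.- i) ≈ - fromℤ i
     neg-homo (+ zero)  = ≈-sym -0#≈0#
     neg-homo (+ suc n) = ≈-refl
     neg-homo -[1+ n ]  = ≈-sym (-‿involutive _)

     ⊖-homo : ∀ m n → fromℤ (m Z.⊖ n) ≈ (m · 1#) - (n · 1#)
     ⊖-homo m zero = ≈-sym (≈-trans (+-cong ≈-refl -0#≈0#) (+-identityʳ _))
     ⊖-homo zero (suc n) = ≈-sym (+-identityˡ _)
     ⊖-homo (suc m) (suc n) = begin
       fromℤ (suc m Z.⊖ suc n)            ≡⟨ cong fromℤ (ℤP.[1+m]⊖[1+n]≡m⊖n m n) ⟩
       fromℤ (m Z.⊖ n)                    ≈⟨ ⊖-homo m n ⟩
       (m · 1#) - (n · 1#)                ≈⟨ +-cong (+-identityʳ _) ≈-refl ⟨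
       ((m · 1#) + 0#) - (n · 1#)         ≈⟨ +-cong (+-cong ≈-refl (-‿inverseʳ 1#)) ≈-refl ⟨
       ((m · 1#) + (1# - 1#)) - (n · 1#)  ≈⟨ +-cong (≈-sym (+-assoc _ _ _)) ≈-refl ⟩
       (((m · 1#) + 1#) - 1#) - (n · 1#)  ≈⟨ +-assoc _ _ _ ⟩
       ((m · 1#) + 1#) + (- 1# - (n · 1#)) ≈⟨ +-cong (+-comm _ _) (-‿+-comm 1# (n · 1#)) ⟩
       (suc m · 1#) - (suc n · 1#)        ∎

     +-homo : ∀ i j → fromℤ (i Z.+ j) ≈ fromℤ i + fromℤ j
     +-homo (+ m) (+ n) = ×-homo-+ 1# m n
     +-homo (+ m) -[1+ n ] = ⊖-homo m (suc n)
     +-homo -[1+ m ] (+ n) = ≈-trans (⊖-homo n (suc m)) (+-comm _ _)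
     +-homo -[1+ m ] -[1+ n ] = begin
       - (suc (suc (m ℕ.+ n)) · 1#)        ≡⟨ cong (λ k → - (k · 1#)) (cong suc (ℕP.+-suc m n)) ⟨
       - ((suc m ℕ.+ suc n) · 1#)          ≈⟨ -‿cong (×-homo-+ 1# (suc m) (suc n)) ⟩
       - ((suc m · 1#) + (suc n · 1#))     ≈⟨ -‿+-comm _ _ ⟨
       - (suc m · 1#) - (suc n · 1#)       ∎

     *-homo⁺ : ∀ m j → fromℤ (+ m Z.* j) ≈ fromℤ (+ m) * fromℤ j
     *-homo⁺ m (+ n) = begin
       fromℤ (+ m Z.* + n)     ≡⟨ cong fromℤ (ℤP.pos-* m n) ⟨
       fromℤ (+ (m ℕ.* n))     ≈⟨ ×1-homo-* m n ⟩
       (m · 1#) * (n · 1#)     ∎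
     *-homo⁺ m -[1+ n ] = begin
       fromℤ (+ m Z.* -[1+ n ])          ≡⟨ cong fromℤ (ℤP.neg-distribʳ-* (+ m) (+ suc n)) ⟨
       fromℤ (Z.- (+ m Z.* + suc n))     ≈⟨ neg-homo (+ m Z.* + suc n) ⟩
       - fromℤ (+ m Z.* + suc n)         ≈⟨ -‿cong (*-homo⁺ m (+ suc n)) ⟩
       - ((m · 1#) * (suc n · 1#))       ≈⟨ -‿distribʳ-* _ _ ⟩
       (m · 1#) * - (suc n · 1#)         ∎

     *-homo : ∀ i j → fromℤ (i Z.* j) ≈ fromℤ i * fromℤ j
     *-homo (+ m) j = *-homo⁺ m j
     *-homo -[1+ m ] j = begin
       fromℤ (-[1+ m ] Z.* j)            ≡⟨ cong fromℤ (ℤP.neg-distribˡ-* (+ suc m) j) ⟨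
       fromℤ (Z.- (+ suc m Z.* j))       ≈⟨ neg-homo (+ suc m Z.* j) ⟩
       - fromℤ (+ suc m Z.* j)           ≈⟨ -‿cong (*-homo⁺ (suc m) j) ⟩
       - ((suc m · 1#) * fromℤ j)        ≈⟨ -‿distribˡ-* _ _ ⟩
       - (suc m · 1#) * fromℤ j          ∎

     ℤ-raw : RawRing 0ℓ 0ℓ
     ℤ-raw = record { Carrier = ℤ ; _≈_ = _≡_ ; _+_ = Z._+_ ; _*_ = Z._*_ ; -_ = Z.-_ ; 0# = 0ℤ ; 1# = 1ℤ }

     -- With the optimised multiples, con 0ℤ, con 1ℤ and con (+ 2) denote 0#, 1# and 1# + 1# on the nose.
     coeff : ℤ → Carrier
     coeff (+ n)    = n ·′ 1#
     coeff -[1+ n ] = - (suc n ·′ 1#)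

     coeff≈ : ∀ i → coeff i ≈ fromℤ i
     coeff≈ (+ n)    = ≈-sym (×ᵤ≈× n 1#)
     coeff≈ -[1+ n ] = -‿cong (≈-sym (×ᵤ≈× (suc n) 1#))

     coeff≟ : ∀ i j → Maybe (coeff i ≈ coeff j)
     coeff≟ i j = case i Z.≟ j of λ where
       (yes refl) → just ≈-refl
       (no _)     → nothing

     coeff-homo : ℤ-raw ACR.-Raw-AlmostCommutative⟶ ACR.fromCommutativeRing R
     coeff-homo = record
       { ⟦_⟧ = coeff
       ; +-homo = λ i j → ≈-trans (coeff≈ (i Z.+ j)) (≈-trans (+-homo i j) (≈-sym (+-cong (coeff≈ i) (coeff≈ j))))
       ; *-homo = λ i j → ≈-trans (coeff≈ (i Z.* j)) (≈-trans (*-homo i j) (≈-sym (*-cong (coeff≈ i) (coeff≈ j))))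
       ; -‿homo = λ i → ≈-trans (coeff≈ (Z.- i)) (≈-trans (neg-homo i) (≈-sym (-‿cong (coeff≈ i))))
       ; 0-homo = ≈-refl ; 1-homo = ≈-refl }

   open Algebra.Solver.Ring ℤ-raw (ACR.fromCommutativeRing R) coeff-homo coeff≟ public
     using (solve; _:=_; _:+_; _:*_; :-_; con)

 record Finite (A : Set) : Set where
   field
     els      : List A
     unique   : Unique els
     complete : ∀ a → a ∈ els
     _≟_      : DecidableEquality A

   δ : A → A → ℤ
   δ x a = if does (x ≟ a) then 1ℤ else 0ℤ

   δ-≡ : ∀ {x a} → x ≡ a → δ x a ≡ 1ℤ
   δ-≡ {x} {a} e with x ≟ a
   ... | yes _ = refl
   ... | no ¬e = ⊥-elim (¬e e)

   δ-≢ : ∀ {x a} → x ≢ a → δ x a ≡ 0ℤ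
   δ-≢ {x} {a} ¬e with x ≟ a
   ... | yes e = ⊥-elim (¬e e)
   ... | no _ = refl

 module _ where
   open Z using (_+_; _*_; _≤_; -_)

   +ˡ : ∀ a {b c} → b ≡ c → a + b ≡ a + c
   +ˡ a refl = refl

   ∑ : ∀ {A : Set} → List A → (A → ℤ) → ℤ
   ∑ [] f = 0ℤ
   ∑ (x ∷ xs) f = f x + ∑ xs f

   module _ {A : Set} where
     ∑-cong : ∀ (xs : List A) {f g : A → ℤ} → (∀ x → f x ≡ g x) → ∑ xs f ≡ ∑ xs g
     ∑-cong [] e = refl
     ∑-cong (x ∷ xs) e = cong₂ _+_ (e x) (∑-cong xs e)

     ∑-zero : ∀ (xs : List A) → ∑ xs (λ _ → 0ℤ) ≡ 0ℤ
     ∑-zero [] = refl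
     ∑-zero (x ∷ xs) = trans (ℤP.+-identityˡ _) (∑-zero xs)

     ∑-+ : ∀ (xs : List A) (f g : A → ℤ) → ∑ xs (λ x → f x + g x) ≡ ∑ xs f + ∑ xs g
     ∑-+ [] f g = refl
     ∑-+ (x ∷ xs) f g = begin
       (f x + g x) + ∑ xs (λ x → f x + g x) ≡⟨ +ˡ (f x + g x) (∑-+ xs f g) ⟩
       (f x + g x) + (∑ xs f + ∑ xs g) ≡⟨ lem (f x) (g x) _ _ ⟩
       (f x + ∑ xs f) + (g x + ∑ xs g) ∎
       where
         open ≡-Reasoning
         lem : ∀ a b c d → (a + b) + (c + d) ≡ (a + c) + (b + d)
         lem a b c d = trans (ℤP.+-assoc a b _) (trans (+ˡ a (trans (sym (ℤP.+-assoc b c d))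
           (trans (cong (_+ d) (ℤP.+-comm b c)) (ℤP.+-assoc c b d)))) (sym (ℤP.+-assoc a c _)))

     ∑-*ˡ : ∀ (xs : List A) c (f : A → ℤ) → ∑ xs (λ x → c * f x) ≡ c * ∑ xs f
     ∑-*ˡ [] c f = sym (ℤP.*-zeroʳ c)
     ∑-*ˡ (x ∷ xs) c f = trans (+ˡ (c * f x) (∑-*ˡ xs c f)) (sym (ℤP.*-distribˡ-+ c (f x) (∑ xs f)))

     ∑-*ʳ : ∀ (xs : List A) c (f : A → ℤ) → ∑ xs (λ x → f x * c) ≡ ∑ xs f * c
     ∑-*ʳ xs c f = trans (∑-cong xs (λ x → ℤP.*-comm (f x) c)) (trans (∑-*ˡ xs c f) (ℤP.*-comm c _))

     ∑-neg : ∀ (xs : List A) (f : A → ℤ) → ∑ xs (λ x → - f x) ≡ - ∑ xs f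
     ∑-neg xs f = trans (∑-cong xs (λ x → sym (ℤP.-1*i≡-i (f x)))) (trans (∑-*ˡ xs -1ℤ f) (ℤP.-1*i≡-i _))

     ∑-- : ∀ (xs : List A) (f g : A → ℤ) → ∑ xs (λ x → f x Z.- g x) ≡ ∑ xs f Z.- ∑ xs g
     ∑-- xs f g = trans (∑-+ xs f (λ x → - g x)) (+ˡ (∑ xs f) (∑-neg xs g))

     ∑-mono : ∀ (xs : List A) {f g : A → ℤ} → (∀ x → f x ≤ g x) → ∑ xs f ≤ ∑ xs g
     ∑-mono [] e = ℤP.≤-refl
     ∑-mono (x ∷ xs) e = ℤP.+-mono-≤ (e x) (∑-mono xs e)

     ∑-nonneg : ∀ (xs : List A) {f : A → ℤ} → (∀ x → 0ℤ ≤ f x) → 0ℤ ≤ ∑ xs f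
     ∑-nonneg xs e = ℤP.≤-trans (ℤP.≤-reflexive (sym (∑-zero xs))) (∑-mono xs e)

     ∑-++ : ∀ (xs ys : List A) f → ∑ (xs ++ ys) f ≡ ∑ xs f + ∑ ys f
     ∑-++ [] ys f = sym (ℤP.+-identityˡ _)
     ∑-++ (x ∷ xs) ys f = trans (+ˡ (f x) (∑-++ xs ys f)) (sym (ℤP.+-assoc (f x) _ _))

     ∑-const : ∀ (xs : List A) c → ∑ xs (λ _ → c) ≡ + length xs * c
     ∑-const [] c = sym (ℤP.*-zeroˡ c)
     ∑-const (x ∷ xs) c = begin
       c + ∑ xs (λ _ → c) ≡⟨ +ˡ c (∑-const xs c) ⟩
       c + + length xs * c ≡⟨ cong (_+ (+ length xs * c)) (sym (ℤP.*-identityˡ c)) ⟩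
       1ℤ * c + + length xs * c ≡⟨ sym (ℤP.*-distribʳ-+ c 1ℤ (+ length xs)) ⟩
       + suc (length xs) * c ∎
       where open ≡-Reasoning

   ∑-map : ∀ {A B : Set} (h : A → B) xs (f : B → ℤ) → ∑ (map h xs) f ≡ ∑ xs (f ∘ h)
   ∑-map h [] f = refl
   ∑-map h (x ∷ xs) f = +ˡ (f (h x)) (∑-map h xs f)

   ∑-swap : ∀ {A B : Set} (xs : List A) (ys : List B) (f : A → B → ℤ) →
            ∑ xs (λ x → ∑ ys (f x)) ≡ ∑ ys (λ y → ∑ xs (λ x → f x y))
   ∑-swap [] ys f = sym (∑-zero ys)
   ∑-swap (x ∷ xs) ys f = trans (+ˡ (∑ ys (f x)) (∑-swap xs ys f)) (sym (∑-+ ys (f x) _))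

   ∑-cart : ∀ {A B : Set} (xs : List A) (ys : List B) (f : A × B → ℤ) →
            ∑ (cartesianProduct xs ys) f ≡ ∑ xs (λ x → ∑ ys (λ y → f (x , y)))
   ∑-cart [] ys f = refl
   ∑-cart (x ∷ xs) ys f = trans (∑-++ (map (x ,_) ys) _ f)
     (cong₂ _+_ (∑-map (x ,_) ys f) (∑-cart xs ys f))

   module _ {A : Set} (F : Finite A) where
     open Finite F

     private
       sift-∉ : ∀ xs a (g : A → ℤ) → All (λ x → x ≢ a) xs → ∑ xs (λ x → δ x a * g x) ≡ 0ℤ
       sift-∉ [] a g [] = refl
       sift-∉ (x ∷ xs) a g (p ∷ ps) = cong₂ _+_ (cong (_* g x) (δ-≢ p)) (sift-∉ xs a g ps)

       sift-list : ∀ xs a (g : A → ℤ) → Unique xs → a ∈ xs → ∑ xs (λ x → δ x a * g x) ≡ g a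
       sift-list (x ∷ xs) a g (px ∷ u) (here refl) =
         trans (cong₂ _+_ (trans (cong (_* g x) (δ-≡ refl)) (ℤP.*-identityˡ _))
           (sift-∉ xs a g (All.map (λ p e → p (sym e)) px))) (ℤP.+-identityʳ _)
       sift-list (x ∷ xs) a g (px ∷ u) (there a∈) =
         trans (cong₂ _+_ (cong (_* g x) (δ-≢ (All.lookup px a∈))) (sift-list xs a g u a∈)) (ℤP.+-identityˡ _)

     sift : ∀ a (g : A → ℤ) → ∑ els (λ x → δ x a * g x) ≡ g a
     sift a g = sift-list els a g unique (complete a)

     ∑-δ : ∀ a → ∑ els (λ x → δ x a) ≡ 1ℤ
     ∑-δ a = trans (∑-cong els (λ x → sym (ℤP.*-identityʳ _))) (sift a (λ _ → 1ℤ))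

     ∑-indicator : ∀ {P : A → Set} (P? : Decidable P) →
       ∑ els (λ x → if does (P? x) then 1ℤ else 0ℤ) ≡ + length (filter P? els)
     ∑-indicator P? = go els
       where
         go : ∀ xs → ∑ xs (λ x → if does (P? x) then 1ℤ else 0ℤ) ≡ + length (filter P? xs)
         go [] = refl
         go (x ∷ xs) with does (P? x)
         ... | true = +ˡ 1ℤ (go xs)
         ... | false = trans (ℤP.+-identityˡ _) (go xs)

   δ-cong : ∀ {A B : Set} (F : Finite A) (G : Finite B) {x y : A} {u v : B} →
            (x ≡ y → u ≡ v) → (u ≡ v → x ≡ y) → Finite.δ F x y ≡ Finite.δ G u v
   δ-cong F G {x} {y} f g with Finite._≟_ F x y
   ... | yes e = sym (Finite.δ-≡ G (f e))
   ... | no ¬e = sym (Finite.δ-≢ G (¬e ∘ g))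

   ∑-reindex : ∀ {A B : Set} (F : Finite A) (G : Finite B) (f : A → B) (g : B → A) →
               (∀ a → g (f a) ≡ a) → (∀ b → f (g b) ≡ b) → (h : B → ℤ) →
               ∑ (Finite.els F) (h ∘ f) ≡ ∑ (Finite.els G) h
   ∑-reindex F G f g gf fg h = begin
     ∑ A.els (h ∘ f) ≡⟨ ∑-cong A.els (λ a → sym (sift G (f a) h)) ⟩
     ∑ A.els (λ a → ∑ B.els (λ b → B.δ b (f a) * h b)) ≡⟨ ∑-swap A.els B.els _ ⟩
     ∑ B.els (λ b → ∑ A.els (λ a → B.δ b (f a) * h b)) ≡⟨ ∑-cong B.els (λ b →
        trans (∑-*ʳ A.els (h b) _) (trans (cong (_* h b) (trans (∑-cong A.els (λ a →
          δ-cong G F (λ e → trans (sym (gf a)) (cong g (sym e))) (λ e → trans (sym (fg b)) (cong f (sym e)))))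
          (∑-δ F (g b)))) (ℤP.*-identityˡ _))) ⟩
     ∑ B.els h ∎
     where
       open ≡-Reasoning
       module A = Finite F
       module B = Finite G

 Finite-Fin : ∀ n → Finite (Fin n)
 Finite-Fin n = record { els = allFin n ; unique = UP.allFin⁺ n ; complete = MP.∈-allFin ; _≟_ = FinP._≟_ }

 Finite-× : ∀ {A B} → Finite A → Finite B → Finite (A × B)
 Finite-× F G = record
   { els = cartesianProduct A.els B.els
   ; unique = UP.cartesianProduct⁺ A.unique B.unique
   ; complete = λ { (a , b) → MP.∈-cartesianProduct⁺ (A.complete a) (B.complete b) }
   ; _≟_ = λ { (a , b) (a′ , b′) → dec a b a′ b′ } }
   where
     module A = Finite F
     module B = Finite G
     dec : ∀ a b a′ b′ → Dec ((a , b) ≡ (a′ , b′))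
     dec a b a′ b′ with a A.≟ a′ | b B.≟ b′
     ... | yes refl | yes refl = yes refl
     ... | no ¬p | _ = no λ { refl → ¬p refl }
     ... | _ | no ¬p = no λ { refl → ¬p refl }

 Finite-map : ∀ {A B : Set} → Finite A → (f : A → B) (g : B → A) →
              (∀ a → g (f a) ≡ a) → (∀ b → f (g b) ≡ b) → Finite B
 Finite-map F f g gf fg = record
   { els = map f els
   ; unique = UP.map⁺ (λ {x} {y} e → trans (sym (gf x)) (trans (cong g e) (gf y))) unique
   ; complete = λ b → subst (_∈ map f els) (fg b) (MP.∈-map⁺ f (complete (g b)))
   ; _≟_ = λ b b′ → map′ (λ e → trans (sym (fg b)) (trans (cong f e) (fg b′))) (cong g) (g b ≟ g b′) }
   where open Finite F

 Finite-Vec : ∀ {A} → Finite A → ∀ n → Finite (Vec A n)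
 Finite-Vec F zero = record
   { els = [] ∷ [] ; unique = [] ∷ [] ; complete = λ { [] → here refl } ; _≟_ = λ { [] [] → yes refl } }
 Finite-Vec F (suc n) = Finite-map (Finite-× F (Finite-Vec F n)) (λ { (a , v) → a ∷ v }) (λ { (a ∷ v) → a , v })
   (λ _ → refl) (λ { (a ∷ v) → refl })

 record FiniteField : Set₁ where
   infixl 6 _⊕_
   infixl 7 _⊛_
   infix 8 ⊖_
   field
     C       : Set
     _⊕_ _⊛_ : C → C → C
     ⊖_ inv  : C → C
     0ᶠ 1ᶠ   : C
     isCR    : IsCommutativeRing _≡_ _⊕_ _⊛_ ⊖_ 0ᶠ 1ᶠ
     1≢0     : 1ᶠ ≢ 0ᶠ
     inv-r   : ∀ x → x ≢ 0ᶠ → x ⊛ inv x ≡ 1ᶠ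
     inv-0   : inv 0ᶠ ≡ 0ᶠ
     fin     : Finite C

   open IsCommutativeRing isCR public
     using (+-assoc; +-comm; +-identityˡ; +-identityʳ; *-assoc; *-comm; *-identityˡ; *-identityʳ;
            zeroˡ; zeroʳ; distribˡ; distribʳ; -‿inverseˡ; -‿inverseʳ)
   open Finite fin public

   commRing : CommutativeRing 0ℓ 0ℓ
   commRing = record { isCommutativeRing = isCR }

   module Solver = IntegerRingSolver commRing

   order : ℕ
   order = length els

   inv-l : ∀ x → x ≢ 0ᶠ → inv x ⊛ x ≡ 1ᶠ
   inv-l x nz = trans (*-comm _ _) (inv-r x nz)

   cancel : ∀ x y → x ⊛ y ≡ 0ᶠ → x ≢ 0ᶠ → y ≡ 0ᶠ
   cancel x y e nz = begin
     y ≡⟨ sym (*-identityˡ y) ⟩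
     1ᶠ ⊛ y ≡⟨ cong (_⊛ y) (sym (inv-l x nz)) ⟩
     inv x ⊛ x ⊛ y ≡⟨ *-assoc _ _ _ ⟩
     inv x ⊛ (x ⊛ y) ≡⟨ cong (inv x ⊛_) e ⟩
     inv x ⊛ 0ᶠ ≡⟨ zeroʳ _ ⟩
     0ᶠ ∎
     where open ≡-Reasoning

   *-nz : ∀ x y → x ≢ 0ᶠ → y ≢ 0ᶠ → x ⊛ y ≢ 0ᶠ
   *-nz x y nx ny e = ny (cancel x y e nx)

   inv-nz : ∀ x → x ≢ 0ᶠ → inv x ≢ 0ᶠ
   inv-nz x nz e = 1≢0 (trans (sym (inv-r x nz)) (trans (cong (x ⊛_) e) (zeroʳ x)))

   x-x : ∀ x y → x ⊕ ⊖ y ≡ 0ᶠ → x ≡ y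
   x-x x y e = trans (solve 2 (λ x y → x := (x :+ (:- y)) :+ y) refl x y) (trans (cong (_⊕ y) e) (+-identityˡ y))
     where open Solver

   *-cancelˡ : ∀ x y z → x ≢ 0ᶠ → x ⊛ y ≡ x ⊛ z → y ≡ z
   *-cancelˡ x y z nz e = x-x y z (cancel x _ (trans (solve 3 (λ x y z → x :* (y :+ (:- z)) := x :* y :+ (:- (x :* z))) refl x y z)
     (trans (cong (λ t → t ⊕ ⊖ (x ⊛ z)) e) (-‿inverseʳ _))) nz)
     where open Solver

   inv-unique : ∀ x y → x ⊛ y ≡ 1ᶠ → inv x ≡ y
   inv-unique x y e = *-cancelˡ x _ _ nz (trans (inv-r x nz) (sym e))
     where
       nz : x ≢ 0ᶠ
       nz refl = 1≢0 (trans (sym e) (zeroˡ y))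

   inv-inv : ∀ x → inv (inv x) ≡ x
   inv-inv x with x ≟ 0ᶠ
   ... | yes refl = trans (cong inv inv-0) inv-0
   ... | no nz = inv-unique _ _ (inv-l x nz)

   inv-* : ∀ x y → inv (x ⊛ y) ≡ inv x ⊛ inv y
   inv-* x y with x ≟ 0ᶠ | y ≟ 0ᶠ
   ... | yes refl | _ = trans (cong inv (zeroˡ y)) (trans inv-0 (trans (sym (zeroˡ _)) (cong (_⊛ inv y) (sym inv-0))))
   ... | no _ | yes refl = trans (cong inv (zeroʳ x)) (trans inv-0 (trans (sym (zeroʳ _)) (cong (inv x ⊛_) (sym inv-0))))
   ... | no nx | no ny = inv-unique _ _ (trans (solve 4 (λ x y a b → x :* y :* (a :* b) := (x :* a) :* (y :* b)) refl x y (inv x) (inv y))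
      (trans (cong₂ _⊛_ (inv-r x nx) (inv-r y ny)) (*-identityˡ 1ᶠ)))
     where open Solver

   infixr 9 _^ᶠ_
   _^ᶠ_ : C → ℕ → C
   x ^ᶠ zero = 1ᶠ
   x ^ᶠ suc n = x ⊛ x ^ᶠ n

   ^-+ : ∀ x m n → x ^ᶠ (m ℕ.+ n) ≡ x ^ᶠ m ⊛ x ^ᶠ n
   ^-+ x zero n = sym (*-identityˡ _)
   ^-+ x (suc m) n = trans (cong (x ⊛_) (^-+ x m n)) (sym (*-assoc _ _ _))

   ^-*ᵇ : ∀ x y n → (x ⊛ y) ^ᶠ n ≡ x ^ᶠ n ⊛ y ^ᶠ n
   ^-*ᵇ x y zero = sym (*-identityˡ _)
   ^-*ᵇ x y (suc n) = trans (cong (x ⊛ y ⊛_) (^-*ᵇ x y n))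
     (solve 4 (λ x y a b → x :* y :* (a :* b) := (x :* a) :* (y :* b)) refl x y (x ^ᶠ n) (y ^ᶠ n))
     where open Solver

   1^ : ∀ n → 1ᶠ ^ᶠ n ≡ 1ᶠ
   1^ zero = refl
   1^ (suc n) = trans (*-identityˡ _) (1^ n)

   ^-^ : ∀ x m n → (x ^ᶠ m) ^ᶠ n ≡ x ^ᶠ (m ℕ.* n)
   ^-^ x zero n = 1^ n
   ^-^ x (suc m) n = trans (^-*ᵇ x (x ^ᶠ m) n) (trans (cong (x ^ᶠ n ⊛_) (^-^ x m n)) (sym (^-+ x n (m ℕ.* n))))

   ^-nz : ∀ x n → x ≢ 0ᶠ → x ^ᶠ n ≢ 0ᶠ
   ^-nz x zero nz = 1≢0
   ^-nz x (suc n) nz = *-nz _ _ nz (^-nz x n nz)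

module PolynomialFunctions where
 open FiniteSums
 open import Data.Fin using (zero; suc; toℕ; inject₁; fromℕ; punchIn)
 open import Data.List using ([]; _∷_; length)
 open import Data.List.Relation.Unary.All using ([]; _∷_)
 open import Data.List.Relation.Unary.AllPairs using ([]; _∷_)
 open import Data.Vec using ([]; _∷_)
 import Data.Vec.Functional as VF
 import Data.Vec.Functional.Properties as VFP
 open import Relation.Nullary.Decidable using (¬?)
 import Algebra.Properties.Semiring.Sum as SemiringSum
 open import Algebra.Bundles using (CommutativeRing)

 module Polynomials (K : FiniteField) where
   open FiniteField K
   open Solver using (solve; _:=_; _:+_; _:*_; :-_; con)
   open SemiringSum (CommutativeRing.semiring commRing) public
     using (sum; sum-cong-≗; sum-remove; sum-init-last; ∑-distrib-+; *-distribˡ-sum; *-distribʳ-sum)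

   eval : ∀ {n} → Vec C n → C → C
   eval [] x = 0ᶠ
   eval (a ∷ v) x = a ⊕ x ⊛ eval v x

   -- Poly n f: the function f is given by a polynomial of degree < n.
   Poly : ℕ → (C → C) → Set
   Poly n f = Σ (Vec C n) λ v → ∀ x → f x ≡ eval v x

   poly-cong : ∀ {n f g} → (∀ x → g x ≡ f x) → Poly n f → Poly n g
   poly-cong e (v , p) = v , λ x → trans (e x) (p x)

   poly-∷ : ∀ {n f} a → Poly n f → Poly (suc n) (λ x → a ⊕ x ⊛ f x)
   poly-∷ a (v , p) = a ∷ v , λ x → cong (λ t → a ⊕ x ⊛ t) (p x)

   poly-X : ∀ {n f} → Poly n f → Poly (suc n) (λ x → x ⊛ f x)
   poly-X p = poly-cong (λ x → sym (+-identityˡ _)) (poly-∷ 0ᶠ p)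

   poly-0 : ∀ n → Poly n (λ _ → 0ᶠ)
   poly-0 zero = [] , λ _ → refl
   poly-0 (suc n) = poly-cong (λ x → sym (zeroʳ x)) (poly-X (poly-0 n))

   poly-weaken : ∀ {m n f} → m ℕ.≤ n → Poly m f → Poly n f
   poly-weaken {n = n} ℕ.z≤n ([] , p) = poly-cong p (poly-0 n)
   poly-weaken (ℕ.s≤s m≤n) (a ∷ v , p) = poly-cong p (poly-∷ a (poly-weaken m≤n (v , λ _ → refl)))

   poly-const : ∀ n a → Poly (suc n) (λ _ → a)
   poly-const n a = poly-cong (λ x → sym (trans (cong (a ⊕_) (zeroʳ x)) (+-identityʳ a))) (poly-∷ a (poly-0 n))

   poly-+ : ∀ {n f g} → Poly n f → Poly n g → Poly n (λ x → f x ⊕ g x)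
   poly-+ ([] , p) ([] , q) = [] , λ x → trans (cong₂ _⊕_ (p x) (q x)) (+-identityˡ 0ᶠ)
   poly-+ (a ∷ v , p) (b ∷ w , q) =
     poly-cong (λ x → trans (cong₂ _⊕_ (p x) (q x))
       (solve 5 (λ a x v b w → a :+ x :* v :+ (b :+ x :* w) := (a :+ b) :+ x :* (v :+ w)) refl a x (eval v x) b (eval w x)))
       (poly-∷ (a ⊕ b) (poly-+ (v , λ _ → refl) (w , λ _ → refl)))

   poly-* : ∀ {m n f g} → Poly (suc m) f → Poly (suc n) g → Poly (suc (m ℕ.+ n)) (λ x → f x ⊛ g x)

   poly-scale : ∀ {n f} c → Poly n f → Poly n (λ x → c ⊛ f x)
   poly-scale c ([] , p) = [] , λ x → trans (cong (c ⊛_) (p x)) (zeroʳ c)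
   poly-scale c (a ∷ v , p) =
     poly-cong (λ x → trans (cong (c ⊛_) (p x)) (solve 4 (λ c a x v → c :* (a :+ x :* v) := c :* a :+ x :* (c :* v)) refl c a x (eval v x)))
       (poly-∷ (c ⊛ a) (poly-scale c (v , λ _ → refl)))

   poly-* {zero} (a ∷ [] , p) q =
     poly-cong (λ x → cong (_⊛ _) (trans (p x) (trans (cong (a ⊕_) (zeroʳ x)) (+-identityʳ a)))) (poly-scale a q)
   poly-* {suc m} {n} {g = g} (a ∷ v , p) q =
     poly-cong (λ x → trans (cong (_⊛ g x) (p x)) (solve 4 (λ a x v g → (a :+ x :* v) :* g := a :* g :+ x :* (v :* g)) refl a x (eval v x) (g x)))
       (poly-+ (poly-weaken (ℕ.s≤s (ℕP.m≤n+m n (suc m))) (poly-scale a q)) (poly-X (poly-* {m} {n} (v , λ _ → refl) q)))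

   poly-X^ : ∀ {n f} k → Poly n f → Poly (k ℕ.+ n) (λ x → x ^ᶠ k ⊛ f x)
   poly-X^ zero p = poly-cong (λ x → *-identityˡ _) p
   poly-X^ (suc k) p = poly-cong (λ x → *-assoc _ _ _) (poly-X (poly-X^ k p))

   poly-mono : ∀ k → Poly (suc k) (λ x → x ^ᶠ k)
   poly-mono k = subst (λ t → Poly t (λ x → x ^ᶠ k)) (ℕP.+-comm k 1) (poly-cong (λ x → sym (*-identityʳ _)) (poly-X^ k (poly-const 0 1ᶠ)))

   poly-pow : ∀ {m f} j → Poly (suc m) f → Poly (suc (j ℕ.* m)) (λ x → f x ^ᶠ j)
   poly-pow zero p = poly-const 0 1ᶠ
   poly-pow (suc j) p = poly-* p (poly-pow j p)

   Monic : ℕ → (C → C) → Set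
   Monic n f = Σ (C → C) λ g → Poly n g × (∀ x → f x ≡ x ^ᶠ n ⊕ g x)

   monic-X^ : ∀ k → Monic k (λ x → x ^ᶠ k)
   monic-X^ k = (λ _ → 0ᶠ) , poly-0 k , λ x → sym (+-identityʳ _)

   poly-*-lower : ∀ {m n f g} → Poly m f → Poly (suc n) g → Poly (m ℕ.+ n) (λ x → f x ⊛ g x)
   poly-*-lower {zero} {n} ([] , p) q = poly-cong (λ x → trans (cong (_⊛ _) (p x)) (zeroˡ _)) (poly-0 n)
   poly-*-lower {suc m} p q = poly-* p q

   monic⇒poly : ∀ {n f} → Monic n f → Poly (suc n) f
   monic⇒poly {n} (g , p , e) = poly-cong e (poly-+ (poly-mono n) (poly-weaken (ℕP.n≤1+n n) p))

   monic-* : ∀ {m n f g} → Monic m f → Monic n g → Monic (m ℕ.+ n) (λ x → f x ⊛ g x)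
   monic-* {m} {n} {f} {g} (f′ , p , e) G@(g′ , p′ , e′) =
     (λ x → f′ x ⊛ g x ⊕ x ^ᶠ m ⊛ g′ x) ,
     poly-+ (poly-*-lower p (monic⇒poly G)) (poly-X^ m p′) ,
     λ x → trans (cong (_⊛ g x) (e x)) (trans (distribʳ (g x) (x ^ᶠ m) (f′ x))
       (trans (cong (λ t → x ^ᶠ m ⊛ t ⊕ f′ x ⊛ g x) (e′ x))
       (trans (solve 4 (λ a b c d → a :* (b :+ c) :+ d := (a :* b) :+ (d :+ a :* c)) refl (x ^ᶠ m) (x ^ᶠ n) (g′ x) (f′ x ⊛ g x))
         (cong (_⊕ (f′ x ⊛ g x ⊕ x ^ᶠ m ⊛ g′ x)) (sym (^-+ x m n))))))

   monic-pow : ∀ {m f} j → Monic m f → Monic (j ℕ.* m) (λ x → f x ^ᶠ j)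
   monic-pow zero p = monic-X^ 0
   monic-pow (suc j) p = monic-* p (monic-pow j p)

   -- Lead n f: f is given by a polynomial of degree exactly n.
   Lead : ℕ → (C → C) → Set
   Lead zero f = Σ C λ a → a ≢ 0ᶠ × (∀ x → f x ≡ a)
   Lead (suc n) f = Σ C λ b → Σ (C → C) λ g → Lead n g × (∀ x → f x ≡ b ⊕ x ⊛ g x)

   lead-cong : ∀ {n f g} → (∀ x → g x ≡ f x) → Lead n f → Lead n g
   lead-cong {zero} e (a , nz , p) = a , nz , λ x → trans (e x) (p x)
   lead-cong {suc n} e (b , g , l , p) = b , g , l , λ x → trans (e x) (p x)

   lead-+ : ∀ {n f g} → Lead n f → Poly n g → Lead n (λ x → f x ⊕ g x)
   lead-+ {zero} (a , nz , p) ([] , q) = a , nz , λ x → trans (cong₂ _⊕_ (p x) (q x)) (+-identityʳ a)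
   lead-+ {suc n} (b , g , l , p) (a ∷ v , q) =
     b ⊕ a , (λ x → g x ⊕ eval v x) , lead-+ l (v , λ _ → refl) ,
     λ x → trans (cong₂ _⊕_ (p x) (q x))
       (solve 5 (λ a x v b w → a :+ x :* v :+ (b :+ x :* w) := (a :+ b) :+ x :* (v :+ w)) refl b x (g x) a (eval v x))

   lead-X^ : ∀ n a → a ≢ 0ᶠ → Lead n (λ x → a ⊛ x ^ᶠ n)
   lead-X^ zero a nz = a , nz , λ x → *-identityʳ a
   lead-X^ (suc n) a nz = 0ᶠ , (λ x → a ⊛ x ^ᶠ n) , lead-X^ n a nz ,
     λ x → solve 3 (λ a x y → a :* (x :* y) := con Z.0ℤ :+ x :* (a :* y)) refl a x (x ^ᶠ n)
     where import Data.Integer as Z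

   lead⇒poly : ∀ {n f} → Lead n f → Poly (suc n) f
   lead⇒poly {zero} (a , nz , p) = poly-cong p (poly-const 0 a)
   lead⇒poly {suc n} (b , g , l , p) = poly-cong p (poly-∷ b (lead⇒poly l))

   factor : ∀ {n f} → Lead (suc n) f → ∀ ρ → Σ (C → C) λ h → Lead n h × (∀ x → f x ⊕ ⊖ f ρ ≡ (x ⊕ ⊖ ρ) ⊛ h x)
   factor {zero} {f} (b , g , (a , nz , q) , p) ρ = (λ _ → a) , (a , nz , λ _ → refl) , λ x →
     trans (cong₂ (λ s t → s ⊕ ⊖ t) (trans (p x) (cong (λ t → b ⊕ x ⊛ t) (q x))) (trans (p ρ) (cong (λ t → b ⊕ ρ ⊛ t) (q ρ))))
       (solve 4 (λ b x ρ a → b :+ x :* a :+ (:- (b :+ ρ :* a)) := (x :+ (:- ρ)) :* a) refl b x ρ a)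
   factor {suc n} {f} (b , g , l , p) ρ with factor l ρ
   ... | h , lh , e = (λ x → g x ⊕ ρ ⊛ h x) , lead-+ l (poly-scale ρ (lead⇒poly lh)) , λ x →
     trans (cong₂ (λ s t → s ⊕ ⊖ t) (p x) (p ρ))
       (trans (solve 5 (λ b x ρ g k → b :+ x :* g :+ (:- (b :+ ρ :* k)) := (x :+ (:- ρ)) :* g :+ ρ :* (g :+ (:- k))) refl b x ρ (g x) (g ρ))
       (trans (cong (λ t → (x ⊕ ⊖ ρ) ⊛ g x ⊕ ρ ⊛ t) (e x))
         (solve 4 (λ x ρ g h → (x :+ (:- ρ)) :* g :+ ρ :* ((x :+ (:- ρ)) :* h) := (x :+ (:- ρ)) :* (g :+ ρ :* h)) refl x ρ (g x) (h x))))

   roots-bound : ∀ {n f} → Lead n f → ∀ xs → Unique xs → All (λ x → f x ≡ 0ᶠ) xs → length xs ℕ.≤ n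
   roots-bound l [] u a = ℕ.z≤n
   roots-bound {zero} (a , nz , p) (x ∷ xs) u (e ∷ _) = ⊥-elim (nz (trans (sym (p x)) e))
   roots-bound {suc n} {f} l (ρ ∷ xs) (ρ∉ ∷ u) (e ∷ es) with factor l ρ
   ... | h , lh , q = ℕ.s≤s (roots-bound lh xs u (go xs ρ∉ es))
     where
       go : ∀ ys → All (λ y → ρ ≢ y) ys → All (λ x → f x ≡ 0ᶠ) ys → All (λ x → h x ≡ 0ᶠ) ys
       go [] [] [] = []
       go (y ∷ ys) (n ∷ ns) (z ∷ zs) = cancel (y ⊕ ⊖ ρ) (h y)
         (trans (sym (q y)) (trans (cong₂ (λ s t → s ⊕ ⊖ t) z e) (-‿inverseʳ 0ᶠ))) (λ d → n (sym (x-x y ρ d))) ∷ go ys ns zs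

   poly-sum : ∀ {m n} {f : Fin n → C → C} → (∀ t → Poly m (f t)) → Poly m (λ x → sum (λ t → f t x))
   poly-sum {m} {zero} p = poly-0 m
   poly-sum {m} {suc n} p = poly-+ (p zero) (poly-sum (p ∘ suc))

   monic-combination : ∀ {n} s (e : Fin n → C → C) → (∀ t → Monic (toℕ t ℕ.+ s) (e t)) →
     (d : Fin n → C) → (∃ λ t → d t ≢ 0ᶠ) →
     Σ ℕ λ D → D ℕ.< n ℕ.+ s × Lead D (λ x → sum (λ t → d t ⊛ e t x))
   monic-combination {suc n} s e mon d (t , nz) with d (fromℕ n) ≟ 0ᶠ
   ... | no top≢0 = n ℕ.+ s , ℕP.n<1+n _ ,
         lead-cong (λ x → trans (sum-init-last (λ t → d t ⊛ e t x)) (+-comm _ _))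
          (lead-+ (lead-cong (λ x → trans (cong (d (fromℕ n) ⊛_) (eₙ x)) (distribˡ _ _ _))
            (lead-+ (lead-X^ (n ℕ.+ s) (d (fromℕ n)) top≢0) (poly-scale _ pₙ)))
            (poly-sum (λ t → poly-scale (d (inject₁ t))
               (poly-weaken (ℕP.+-monoˡ-≤ s (subst (λ k → suc k ℕ.≤ n) (sym (FinP.toℕ-inject₁ t)) (FinP.toℕ<n t))) (monic⇒poly (mon (inject₁ t)))))))
     where
       M = subst (λ k → Monic (k ℕ.+ s) (e (fromℕ n))) (FinP.toℕ-fromℕ n) (mon (fromℕ n))
       pₙ = proj₁ (proj₂ M)
       eₙ = proj₂ (proj₂ M)
   ... | yes top≡0 with monic-combination s (e ∘ inject₁) (λ t → subst (λ k → Monic (k ℕ.+ s) (e (inject₁ t))) (FinP.toℕ-inject₁ t) (mon (inject₁ t)))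
                         (d ∘ inject₁) nz′
     where
       nz′ : ∃ λ t → d (inject₁ t) ≢ 0ᶠ
       nz′ with n ℕ.≟ toℕ t
       ... | yes e = ⊥-elim (nz (trans (cong d (FinP.toℕ-injective (trans (sym e) (sym (FinP.toℕ-fromℕ n))))) top≡0))
       ... | no ne = Data.Fin.lower₁ t ne , λ z → nz (trans (cong d (sym (FinP.inject₁-lower₁ t ne))) z)
         where import Data.Fin
   ... | D , D< , l = D , ℕP.m<n⇒m<1+n D< ,
         lead-cong (λ x → trans (sum-init-last (λ t → d t ⊛ e t x))
           (trans (cong (λ z → sum (λ t → d (inject₁ t) ⊛ e (inject₁ t) x) ⊕ z) (trans (cong (_⊛ e (fromℕ n) x) top≡0) (zeroˡ _))) (+-identityʳ _))) l

   linear-dependence : ∀ {m n} (f : Fin n → C → C) → (∀ t → Poly m (f t)) → m ℕ.< n →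
     Σ (Fin n → C) λ c → (∃ λ t → c t ≢ 0ᶠ) × (∀ x → sum (λ t → c t ⊛ f t x) ≡ 0ᶠ)
   linear-dependence {zero} {suc n} f p m<n = (λ _ → 1ᶠ) , (zero , 1≢0) , λ x → allzero (suc n) _ (λ t → trans (*-identityˡ _) (vanish (p t) x))
     where
       vanish : ∀ {g} → Poly 0 g → ∀ x → g x ≡ 0ᶠ
       vanish ([] , e) = e
       allzero : ∀ n (g : Fin n → C) → (∀ t → g t ≡ 0ᶠ) → sum g ≡ 0ᶠ
       allzero zero g z = refl
       allzero (suc n) g z = trans (cong₂ _⊕_ (z zero) (allzero n (g ∘ suc) (z ∘ suc))) (+-identityˡ 0ᶠ)
   linear-dependence {suc m} {suc n} f p (ℕ.s≤s m<n) = go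
     where
       a : Fin (suc n) → C
       a t with proj₁ (p t)
       ... | b ∷ _ = b
       g : Fin (suc n) → C → C
       g t x with proj₁ (p t)
       ... | _ ∷ v = eval v x
       pg : ∀ t → Poly m (g t)
       pg t with proj₁ (p t)
       ... | _ ∷ v = v , λ _ → refl
       f≡ : ∀ t x → f t x ≡ a t ⊕ x ⊛ g t x
       f≡ t x with p t
       ... | b ∷ v , e = e x
       go : Σ (Fin (suc n) → C) λ c → (∃ λ t → c t ≢ 0ᶠ) × (∀ x → sum (λ t → c t ⊛ f t x) ≡ 0ᶠ)
       go with FinP.any? (λ t → ¬? (a t ≟ 0ᶠ))
       ... | no all0 with linear-dependence {m} {suc n} g pg (ℕP.m<n⇒m<1+n m<n)
       ...   | c , nz , z = c , nz , λ x → trans (sum-cong-≗ (λ t → trans (cong (c t ⊛_) (trans (f≡ t x)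
                 (trans (cong (_⊕ x ⊛ g t x) (a0 t)) (+-identityˡ _))))
                 (solve 3 (λ c x g → c :* (x :* g) := x :* (c :* g)) refl (c t) x (g t x))))
                 (trans (sym (*-distribˡ-sum x (λ t → c t ⊛ g t x))) (trans (cong (x ⊛_) (z x)) (zeroʳ x)))
         where
           a0 : ∀ t → a t ≡ 0ᶠ
           a0 t with a t ≟ 0ᶠ
           ... | yes e = e
           ... | no ne = ⊥-elim (all0 (t , ne))
       go | yes (t₀ , a₀≢0) = elim (linear-dependence {m} {n} h ph m<n)
         where
           μ : Fin n → C
           μ j = a (punchIn t₀ j) ⊛ inv (a t₀)
           h : Fin n → C → C
           h j x = g (punchIn t₀ j) x ⊕ ⊖ (μ j) ⊛ g t₀ x
           ph : ∀ j → Poly m (h j)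
           ph j = poly-+ (pg (punchIn t₀ j)) (poly-scale (⊖ (μ j)) (pg t₀))
           elim : (Σ (Fin n → C) λ c → (∃ λ t → c t ≢ 0ᶠ) × (∀ x → sum (λ t → c t ⊛ h t x) ≡ 0ᶠ)) →
                  Σ (Fin (suc n) → C) λ c → (∃ λ t → c t ≢ 0ᶠ) × (∀ x → sum (λ t → c t ⊛ f t x) ≡ 0ᶠ)
           elim (c , (j , nz) , z) = VF.insertAt c t₀ w , (punchIn t₀ j , λ q → nz (trans (sym (VFP.insertAt-punchIn c t₀ w j)) q)) , λ x →
               trans (sum-remove {i = t₀} (λ t → VF.insertAt c t₀ w t ⊛ f t x))
               (trans (cong₂ _⊕_ (cong (_⊛ f t₀ x) (VFP.insertAt-lookup c t₀ w))
                   (sum-cong-≗ (λ j → cong (_⊛ f (punchIn t₀ j) x) (VFP.insertAt-punchIn c t₀ w j))))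
               (trans (cong (_⊕ sum (λ j → c j ⊛ f (punchIn t₀ j) x)) (*-distribʳ-sum (f t₀ x) (λ j → ⊖ (c j ⊛ μ j))))
               (trans (sym (∑-distrib-+ (λ j → ⊖ (c j ⊛ μ j) ⊛ f t₀ x) (λ j → c j ⊛ f (punchIn t₀ j) x)))
               (trans (sum-cong-≗ (λ j → step x j))
               (trans (sym (*-distribˡ-sum x (λ j → c j ⊛ h j x))) (trans (cong (x ⊛_) (z x)) (zeroʳ x)))))))
             where
               w = sum (λ j → ⊖ (c j ⊛ μ j))
               step : ∀ x j → ⊖ (c j ⊛ μ j) ⊛ f t₀ x ⊕ c j ⊛ f (punchIn t₀ j) x ≡ x ⊛ (c j ⊛ h j x)
               step x j = trans (cong₂ (λ s t → ⊖ (c j ⊛ μ j) ⊛ s ⊕ c j ⊛ t) (f≡ t₀ x) (f≡ (punchIn t₀ j) x))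
                 (trans (solve 7 (λ c μ a₀ x g₀ a g → (:- (c :* μ)) :* (a₀ :+ x :* g₀) :+ c :* (a :+ x :* g)
                          := c :* (a :+ (:- (μ :* a₀))) :+ x :* (c :* (g :+ (:- μ) :* g₀))) refl
                          (c j) (μ j) (a t₀) x (g t₀ x) (a (punchIn t₀ j)) (g (punchIn t₀ j) x))
                 (trans (cong (_⊕ x ⊛ (c j ⊛ h j x)) (trans (cong (c j ⊛_) (trans (cong (λ s → a (punchIn t₀ j) ⊕ ⊖ s)
                     (trans (*-assoc _ _ _) (trans (cong (a (punchIn t₀ j) ⊛_) (inv-l _ a₀≢0)) (*-identityʳ _)))) (-‿inverseʳ _))) (zeroʳ (c j))))
                   (+-identityˡ _)))

module FiniteFields where
 open FiniteSums
 open PolynomialFunctions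
 open import Algebra.Bundles using (CommutativeRing; CommutativeMonoid; Semiring)
 open import Data.Nat.Primality using (euclidsLemma; prime⇒nonZero; prime⇒nonTrivial)
 open import Data.Nat.Divisibility using (_∣_; divides; ∣⇒≤)
 import Data.Nat.DivMod as DivMod
 open import Data.Nat.Combinatorics using (k![n∸k]!∣n!; nCn≡1) renaming (_C_ to _choose_)
 open import Data.Nat.Combinatorics.Specification using (nCk≡n!/k![n-k]!)
 open import Data.Nat.Base using (_!)
 open import Data.Integer as Z using (ℤ; +_; 0ℤ; 1ℤ)
 import Data.Integer.Solver as ℤSolver
 open import Data.Fin using (zero; suc; toℕ; fromℕ)
 open import Data.List using ([]; _∷_; map; filter; length; foldr)
 open import Data.List.Relation.Unary.All using ([]; _∷_)
 open import Data.List.Relation.Unary.AllPairs using ([]; _∷_)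
 open import Data.List.Membership.Propositional using (_∈_)
 open import Data.List.Membership.Propositional.Properties.WithK using (unique∧set⇒bag)
 open import Data.List.Relation.Binary.BagAndSetEquality using (∼bag⇒↭)
 open import Data.List.Relation.Binary.Permutation.Propositional using (↭⇒↭ₛ)
 import Data.List.Relation.Binary.Permutation.Setoid.Properties as Permₛ
 open import Data.Bool using (if_then_else_)
 open import Relation.Nullary.Decidable using (¬?)
 import Relation.Binary.PropositionalEquality as ≡
 open import Function using (mk⇔)
 import Algebra.Properties.Semiring.Mult
 import Algebra.Properties.Semiring.Exp
 import Algebra.Properties.CommutativeSemiring.Binomial as Binomial

 ∑-zero-terms : ∀ {A : Set} (F : Finite A) (f : A → ℤ) → (∀ x → 0ℤ Z.≤ f x) → ∑ (Finite.els F) f Z.≤ 0ℤ → ∀ a → f a ≡ 0ℤ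
 ∑-zero-terms F f nn s a = ℤP.≤-antisym (ℤP.≤-trans (ℤP.≤-trans (ℤP.≤-reflexive (sym (sift F a f))) (∑-mono els {λ x → δ x a Z.* f x} {f} mono)) s) (nn a)
   where
     open Finite F
     mono : ∀ x → δ x a Z.* f x Z.≤ f x
     mono x with x ≟ a
     ... | yes _ = ℤP.≤-reflexive (ℤP.*-identityˡ _)
     ... | no _ = ℤP.≤-trans (ℤP.≤-reflexive (ℤP.*-zeroˡ (f x))) (nn x)

 fold-bijection : (M : CommutativeMonoid 0ℓ 0ℓ) → ∀ {A : Set} (h : A → CommutativeMonoid.Carrier M) xs (f : A → A) → Unique xs →
   (∀ {x y} → f x ≡ f y → x ≡ y) → (∀ x → x ∈ xs → f x ∈ xs) → (∀ x → x ∈ xs → ∃ λ y → y ∈ xs × x ≡ f y) →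
   CommutativeMonoid._≈_ M (foldr (CommutativeMonoid._∙_ M) (CommutativeMonoid.ε M) (map h (map f xs))) (foldr (CommutativeMonoid._∙_ M) (CommutativeMonoid.ε M) (map h xs))
 fold-bijection M h xs f u inj into onto = Permₛ.foldr-commMonoid (CommutativeMonoid.setoid M) (CommutativeMonoid.isCommutativeMonoid M)
    (Permₛ.map⁺ (≡.setoid _) (CommutativeMonoid.setoid M) (λ e → CommutativeMonoid.reflexive M (cong h e))
    (↭⇒↭ₛ (∼bag⇒↭ (unique∧set⇒bag (UP.map⁺ inj u) u (mk⇔ to from)))))
   where
     to : ∀ {x} → x ∈ map f xs → x ∈ xs
     to p with MP.∈-map⁻ f p
     ... | y , y∈ , refl = into y y∈
     from : ∀ {x} → x ∈ xs → x ∈ map f xs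
     from {x} p with onto x p
     ... | y , y∈ , refl = MP.∈-map⁺ f y∈

 prime∣binomial : ∀ {p} k → Prime p → 0 ℕ.< k → k ℕ.< p → p ∣ p choose k
 prime∣binomial {p} k pr 0<k k<p = case-split (euclidsLemma (p choose k) (k ! ℕ.* (p ℕ.∸ k) !) pr p∣)
   where
     instance
       _ = prime⇒nonZero pr
       _ = ℕP.m*n≢0 (k !) ((p ℕ.∸ k) !) {{ℕP._!≢0 k}} {{ℕP._!≢0 (p ℕ.∸ k)}}
     fact : (p choose k) ℕ.* (k ! ℕ.* (p ℕ.∸ k) !) ≡ p !
     fact = trans (cong (ℕ._* (k ! ℕ.* (p ℕ.∸ k) !)) (nCk≡n!/k![n-k]! (ℕP.<⇒≤ k<p)))
                  (DivMod.m/n*n≡m (k![n∸k]!∣n! (ℕP.<⇒≤ k<p)))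
     p∣p! : ∀ p → .{{ℕ.NonZero p}} → p ∣ p !
     p∣p! (suc n) = divides (n !) (ℕP.*-comm (suc n) (n !))
     p∣ : p ∣ (p choose k) ℕ.* (k ! ℕ.* (p ℕ.∸ k) !)
     p∣ = subst (p ∣_) (sym fact) (p∣p! p)
     p∤! : ∀ j → j ℕ.< p → p ∣ j ! → ⊥
     p∤! zero j<p d = ℕP.<⇒≱ (ℕ.nonTrivial⇒n>1 p {{prime⇒nonTrivial pr}}) (∣⇒≤ d)
     p∤! (suc j) j<p d with euclidsLemma (suc j) (j !) pr d
     ... | inj₁ e = ℕP.<⇒≱ j<p (∣⇒≤ e)
     ... | inj₂ e = p∤! j (ℕP.<-trans (ℕP.n<1+n j) j<p) e
     case-split : p ∣ p choose k ⊎ p ∣ k ! ℕ.* (p ℕ.∸ k) ! → p ∣ p choose k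
     case-split (inj₁ d) = d
     case-split (inj₂ d) with euclidsLemma (k !) ((p ℕ.∸ k) !) pr d
     ... | inj₁ e = ⊥-elim (p∤! k k<p e)
     ... | inj₂ e = ⊥-elim (p∤! (p ℕ.∸ k) (ℕP.∸-monoʳ-< {p} {k} {0} 0<k (ℕP.<⇒≤ k<p)) e)

 module FieldFacts (K : FiniteField) where
   open FiniteField K public
   open Polynomials K public
   open Solver public using (solve; _:=_; _:+_; _:*_; :-_; con)
   open Algebra.Properties.Semiring.Mult (CommutativeRing.semiring commRing) public using (×1-homo-*; ×-assoc-*; ×-homo-+) renaming (_×_ to _·_)

   two : C
   two = 1ᶠ ⊕ 1ᶠ

   +-cancelʳ : ∀ a x y → x ⊕ a ≡ y ⊕ a → x ≡ y
   +-cancelʳ a x y e = trans (solve 2 (λ a x → x := x :+ a :+ (:- a)) refl a x)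
     (trans (cong (_⊕ ⊖ a) e) (sym (solve 2 (λ a x → x := x :+ a :+ (:- a)) refl a y)))

   order·1≡0 : order · 1ᶠ ≡ 0ᶠ
   order·1≡0 = x-x′ (trans (sym (go els)) shift)
     where
       add = CommutativeRing.+-commutativeMonoid commRing
       S : List C → C
       S xs = foldr _⊕_ 0ᶠ (map (λ x → x) xs)
       shift : S (map (_⊕ 1ᶠ) els) ≡ S els
       shift = fold-bijection add (λ x → x) els (_⊕ 1ᶠ) unique
         (λ {x} {y} e → +-cancelʳ 1ᶠ x y e)
         (λ x _ → complete _) (λ x _ → x ⊕ ⊖ 1ᶠ , complete _ , solve 1 (λ x → x := x :+ (:- con 1ℤ) :+ con 1ℤ) refl x)
       go : ∀ xs → S (map (_⊕ 1ᶠ) xs) ≡ length xs · 1ᶠ ⊕ S xs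
       go [] = sym (+-identityˡ _)
       go (x ∷ xs) = trans (cong (x ⊕ 1ᶠ ⊕_) (go xs))
          (solve 4 (λ x o n s → x :+ o :+ (n :+ s) := (o :+ n) :+ (x :+ s)) refl x 1ᶠ (length xs · 1ᶠ) (S xs))
       x-x′ : ∀ {a b} → a ⊕ b ≡ b → a ≡ 0ᶠ
       x-x′ {a} {b} e = trans (solve 2 (λ a b → a := (a :+ b) :+ (:- b)) refl a b) (trans (cong (_⊕ ⊖ b) e) (-‿inverseʳ b))

   private
     *-monoid′ = CommutativeRing.*-commutativeMonoid commRing
     nonzeros = filter (λ x → ¬? (x ≟ 0ᶠ)) els

     length-nonzeros : suc (length nonzeros) ≡ order
     length-nonzeros = ℤP.+-injective (begin
       1ℤ Z.+ (+ length nonzeros) ≡⟨ cong₂ Z._+_ (sym (∑-δ fin 0ᶠ)) (sym (∑-indicator fin (λ x → ¬? (x ≟ 0ᶠ)))) ⟩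
       ∑ els (λ x → δ x 0ᶠ) Z.+ ∑ els (λ x → if does (¬? (x ≟ 0ᶠ)) then 1ℤ else 0ℤ) ≡⟨ sym (∑-+ els _ _) ⟩
       ∑ els (λ x → δ x 0ᶠ Z.+ (if does (¬? (x ≟ 0ᶠ)) then 1ℤ else 0ℤ)) ≡⟨ ∑-cong els one ⟩
       ∑ els (λ x → 1ℤ) ≡⟨ ∑-const els 1ℤ ⟩
       + order Z.* 1ℤ ≡⟨ ℤP.*-identityʳ _ ⟩
       + order ∎)
       where
         open ≡-Reasoning
         one : ∀ x → δ x 0ᶠ Z.+ (if does (¬? (x ≟ 0ᶠ)) then 1ℤ else 0ℤ) ≡ 1ℤ
         one x with x ≟ 0ᶠ
         ... | yes _ = refl
         ... | no _ = refl

   x^order≡x : ∀ x → x ^ᶠ order ≡ x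
   x^order≡x x with x ≟ 0ᶠ
   ... | yes refl = subst (λ n → 0ᶠ ^ᶠ n ≡ 0ᶠ) length-nonzeros (zeroˡ _)
   ... | no x≢0 = subst (λ n → x ^ᶠ n ≡ x) length-nonzeros (trans (cong (x ⊛_) one) (*-identityʳ x))
     where
       P : List C → C
       P xs = foldr _⊛_ 1ᶠ (map (λ x → x) xs)
       P-map : ∀ xs → P (map (x ⊛_) xs) ≡ x ^ᶠ length xs ⊛ P xs
       P-map [] = sym (*-identityˡ _)
       P-map (y ∷ ys) = trans (cong (x ⊛ y ⊛_) (P-map ys)) (solve 4 (λ x o n s → x :* o :* (n :* s) := (x :* n) :* (o :* s)) refl x y (x ^ᶠ length ys) (P ys))
       P-nz : ∀ xs → All (_≢ 0ᶠ) xs → P xs ≢ 0ᶠ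
       P-nz [] [] = 1≢0
       P-nz (y ∷ ys) (n ∷ ns) = *-nz y _ n (P-nz ys ns)
       nz∈ : ∀ {y} → y ≢ 0ᶠ → y ∈ nonzeros
       nz∈ {y} n = MP.∈-filter⁺ (λ x → ¬? (x ≟ 0ᶠ)) (complete y) n
       ∈nz : ∀ {y} → y ∈ nonzeros → y ≢ 0ᶠ
       ∈nz p = proj₂ (MP.∈-filter⁻ (λ x → ¬? (x ≟ 0ᶠ)) {xs = els} p)
       perm : P (map (x ⊛_) nonzeros) ≡ P nonzeros
       perm = fold-bijection *-monoid′ (λ x → x) nonzeros (x ⊛_) (UP.filter⁺ (λ x → ¬? (x ≟ 0ᶠ)) unique)
         (λ {y} {z} → *-cancelˡ x y z x≢0) (λ y p → nz∈ (*-nz x y x≢0 (∈nz p)))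
         (λ y p → inv x ⊛ y , nz∈ (*-nz _ y (inv-nz x x≢0) (∈nz p)) ,
           trans (sym (*-identityˡ y)) (trans (cong (_⊛ y) (sym (inv-r x x≢0))) (*-assoc _ _ _)))
       one : x ^ᶠ length nonzeros ≡ 1ᶠ
       one = *-cancelˡ (P nonzeros) _ _ (P-nz nonzeros (All.tabulate ∈nz))
         (trans (*-comm _ _) (trans (sym (P-map nonzeros)) (trans perm (sym (*-identityʳ _)))))

   ^≡^ : ∀ x n → Algebra.Properties.Semiring.Exp._^_ (CommutativeRing.semiring commRing) x n ≡ x ^ᶠ n
   ^≡^ x zero = refl
   ^≡^ x (suc n) = cong (x ⊛_) (^≡^ x n)

   module OddChar (p m h : ℕ) (p-prime : Prime p) (p-odd : p ≡ suc (2 ℕ.* h)) (order≡ : order ≡ p ℕ.^ m) where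

     ·1-^ : ∀ a k → (a ℕ.^ k) · 1ᶠ ≡ (a · 1ᶠ) ^ᶠ k
     ·1-^ a zero = +-identityʳ _
     ·1-^ a (suc k) = trans (×1-homo-* a (a ℕ.^ k)) (cong ((a · 1ᶠ) ⊛_) (·1-^ a k))

     p·1≡0 : p · 1ᶠ ≡ 0ᶠ
     p·1≡0 with (p · 1ᶠ) ≟ 0ᶠ
     ... | yes e = e
     ... | no ne = ⊥-elim (^-nz _ m ne (trans (sym (·1-^ p m)) (trans (cong (_· 1ᶠ) (sym order≡)) order·1≡0)))

     two≢0 : two ≢ 0ᶠ
     two≢0 e = 1≢0 (trans (sym (+-identityʳ 1ᶠ)) (trans (cong (1ᶠ ⊕_) (sym (trans (×1-homo-* 2 h)
        (trans (cong (_⊛ (h · 1ᶠ)) (trans (cong (1ᶠ ⊕_) (+-identityʳ 1ᶠ)) e)) (zeroˡ _))))) (trans (cong (_· 1ᶠ) (sym p-odd)) p·1≡0)))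

     p∣⇒·≡0 : ∀ {n} x → p ∣ n → n · x ≡ 0ᶠ
     p∣⇒·≡0 x (divides k refl) = begin
       (k ℕ.* p) · x ≡⟨ cong ((k ℕ.* p) ·_) (sym (*-identityˡ x)) ⟩
       (k ℕ.* p) · (1ᶠ ⊛ x) ≡⟨ ×-assoc-* (k ℕ.* p) 1ᶠ x ⟨
       ((k ℕ.* p) · 1ᶠ) ⊛ x ≡⟨ cong (_⊛ x) (trans (×1-homo-* k p) (trans (cong ((k · 1ᶠ) ⊛_) p·1≡0) (zeroʳ _))) ⟩
       0ᶠ ⊛ x ≡⟨ zeroˡ x ⟩
       0ᶠ ∎
       where open ≡-Reasoning

     frobenius-p : ∀ x y → (x ⊕ y) ^ᶠ p ≡ x ^ᶠ p ⊕ y ^ᶠ p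
     frobenius-p x y = trans (sym (^≡^ (x ⊕ y) p)) (trans (B.theorem p x y) (trans (expand p (prime⇒nonZero p-prime) middle)
       (cong₂ _⊕_ (^≡^ x p) (^≡^ y p))))
       where
         module B = Binomial (CommutativeRing.commutativeSemiring commRing)
         open import Algebra.Properties.Semiring.Exp (CommutativeRing.semiring commRing) using (_^_)
         middle : ∀ (k : Fin (suc p)) → 0 ℕ.< toℕ k → toℕ k ℕ.< p → B.binomialTerm x y p k ≡ 0ᶠ
         middle k 0<k k<p = p∣⇒·≡0 _ (prime∣binomial (toℕ k) p-prime 0<k k<p)
         expand : ∀ n → ℕ.NonZero n → (∀ (k : Fin (suc n)) → 0 ℕ.< toℕ k → toℕ k ℕ.< n → B.binomialTerm x y n k ≡ 0ᶠ) →
           B.binomialExpansion x y n ≡ x ^ n ⊕ y ^ n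
         expand (suc n) _ mid = begin
           B.binomialTerm x y (suc n) zero ⊕ sum (λ k → B.binomialTerm x y (suc n) (suc k))
             ≡⟨ cong₂ _⊕_ (trans (+-identityʳ _) (*-identityˡ _))
                  (trans (sum-init-last (λ k → B.binomialTerm x y (suc n) (suc k))) (cong₂ _⊕_ (zeros n _ (λ k → mid _ (ℕ.s≤s ℕ.z≤n)
                      (ℕ.s≤s (subst (ℕ._< n) (sym (FinP.toℕ-inject₁ k)) (FinP.toℕ<n k)))))
                    (last-term (toℕ (fromℕ n)) (FinP.toℕ-fromℕ n)))) ⟩
           y ^ suc n ⊕ (0ᶠ ⊕ x ^ suc n) ≡⟨ trans (cong (y ^ suc n ⊕_) (+-identityˡ _)) (+-comm _ _) ⟩
           x ^ suc n ⊕ y ^ suc n ∎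
           where
             open ≡-Reasoning
             last-term : ∀ t → t ≡ n → (suc n choose suc t) · (x ^ suc t ⊛ y ^ (suc n ℕ.∸ suc t)) ≡ x ^ suc n
             last-term t refl = trans (cong₂ (λ c e → c · (x ^ suc t ⊛ y ^ e)) (nCn≡1 (suc t)) (ℕP.n∸n≡0 t))
               (trans (+-identityʳ _) (*-identityʳ _))
             zeros : ∀ n (g : Fin n → C) → (∀ t → g t ≡ 0ᶠ) → sum g ≡ 0ᶠ
             zeros zero g z = refl
             zeros (suc n) g z = trans (cong₂ _⊕_ (z zero) (zeros n (g ∘ suc) (z ∘ suc))) (+-identityˡ 0ᶠ)

     frobenius : ∀ j x y → (x ⊕ y) ^ᶠ (p ℕ.^ j) ≡ x ^ᶠ (p ℕ.^ j) ⊕ y ^ᶠ (p ℕ.^ j)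
     frobenius zero x y = trans (*-identityʳ _) (sym (cong₂ _⊕_ (*-identityʳ x) (*-identityʳ y)))
     frobenius (suc j) x y = trans (sym (^-^ (x ⊕ y) p (p ℕ.^ j))) (trans (cong (_^ᶠ (p ℕ.^ j)) (frobenius-p x y))
       (trans (frobenius j _ _) (cong₂ _⊕_ (^-^ x p (p ℕ.^ j)) (^-^ y p (p ℕ.^ j)))))

   module Squares (two≢0 : two ≢ 0ᶠ) where

     sq-eq : ∀ x y → x ⊛ x ≡ y ⊛ y → (x ≡ y) ⊎ (x ≡ ⊖ y)
     sq-eq x y e with x ≟ y
     ... | yes eq = inj₁ eq
     ... | no ne = inj₂ (x-x x (⊖ y) (cancel (x ⊕ ⊖ y) _ (trans (solve 2 (λ x y → (x :+ (:- y)) :* (x :+ (:- (:- y))) := x :* x :+ (:- (y :* y))) refl x y)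
        (trans (cong (λ t → t ⊕ ⊖ (y ⊛ y)) e) (-‿inverseʳ _))) (λ d → ne (x-x x y d))))

     neg≢ : ∀ x → x ≢ 0ᶠ → x ≢ ⊖ x
     neg≢ x nz e = nz (cancel two x (trans (solve 1 (λ x → con (+ 2) :* x := x :+ x) refl x) (trans (cong (x ⊕_) e) (-‿inverseʳ x))) two≢0)

     roots : C → ℤ
     roots D = ∑ els (λ w → δ (w ⊛ w) D)

     ∑-roots : (h : C → ℤ) → ∑ els (λ w → h (w ⊛ w)) ≡ ∑ els (λ D → roots D Z.* h D)
     ∑-roots h = begin
       ∑ els (λ w → h (w ⊛ w)) ≡⟨ ∑-cong els (λ w → sym (sift fin (w ⊛ w) h)) ⟩
       ∑ els (λ w → ∑ els (λ D → δ D (w ⊛ w) Z.* h D)) ≡⟨ ∑-swap els els _ ⟩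
       ∑ els (λ D → ∑ els (λ w → δ D (w ⊛ w) Z.* h D)) ≡⟨ ∑-cong els (λ D → trans (∑-*ʳ els (h D) _)
           (cong (Z._* h D) (∑-cong els (λ w → δ-cong fin fin {D} {w ⊛ w} {w ⊛ w} {D} sym sym)))) ⟩
       ∑ els (λ D → roots D Z.* h D) ∎
       where open ≡-Reasoning

     ∑-roots-total : ∑ els roots ≡ + order
     ∑-roots-total = trans (∑-cong els (λ D → sym (ℤP.*-identityʳ _))) (trans (sym (∑-roots (λ _ → 1ℤ)))
       (trans (∑-const els 1ℤ) (ℤP.*-identityʳ _)))

     roots-square : ∀ a → a ≢ 0ᶠ → roots (a ⊛ a) ≡ + 2
     roots-square a nz = trans (∑-cong els pointwise) (trans (∑-+ els _ _) (cong₂ Z._+_ (∑-δ fin a) (∑-δ fin (⊖ a))))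
       where
         pointwise : ∀ w → δ (w ⊛ w) (a ⊛ a) ≡ δ w a Z.+ δ w (⊖ a)
         pointwise w with w ≟ a | w ≟ (⊖ a)
         ... | yes refl | yes e = ⊥-elim (neg≢ a nz e)
         ... | yes refl | no _ = δ-≡ refl
         ... | no _ | yes refl = δ-≡ (solve 1 (λ a → (:- a) :* (:- a) := a :* a) refl a)
         ... | no n₁ | no n₂ = δ-≢ (λ e → go (sq-eq w a e))
           where
             go : (w ≡ a) ⊎ (w ≡ ⊖ a) → ⊥
             go (inj₁ e) = n₁ e
             go (inj₂ e) = n₂ e

     roots-nonsquare : ∀ D → (∀ w → w ⊛ w ≢ D) → roots D ≡ 0ℤ
     roots-nonsquare D ns = trans (∑-cong els (λ w → δ-≢ (ns w))) (∑-zero els)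

     square? : ∀ D → (∃ λ w → w ⊛ w ≡ D) ⊎ (∀ w → w ⊛ w ≢ D)
     square? D = go els complete
       where
         go′ : ∀ xs → (∃ λ w → w ⊛ w ≡ D) ⊎ All (λ w → w ⊛ w ≢ D) xs
         go′ [] = inj₂ []
         go′ (x ∷ xs) with (x ⊛ x) ≟ D | go′ xs
         ... | yes e | _ = inj₁ (x , e)
         ... | no _ | inj₁ r = inj₁ r
         ... | no n | inj₂ a = inj₂ (n ∷ a)
         go : ∀ xs → (∀ x → x ∈ xs) → (∃ λ w → w ⊛ w ≡ D) ⊎ (∀ w → w ⊛ w ≢ D)
         go xs c with go′ xs
         ... | inj₁ r = inj₁ r
         ... | inj₂ a = inj₂ (λ w → All.lookup a (c w))

     0≢sq : ∀ w → w ⊛ w ≡ 0ᶠ → w ≡ 0ᶠ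
     0≢sq w e with w ≟ 0ᶠ
     ... | yes r = r
     ... | no n = cancel w w e n

     roots-0 : roots 0ᶠ ≡ 1ℤ
     roots-0 = trans (∑-cong els (λ w → δ-cong fin fin (0≢sq w) (λ { refl → zeroˡ 0ᶠ }))) (∑-δ fin 0ᶠ)

     -- Otherwise every D has at least one root, and 1 has two: too many in total.
     nonsquare : ∃ λ D → ∀ w → w ⊛ w ≢ D
     nonsquare = go els complete
       where
         all-squares : (∀ D → ∃ λ w → w ⊛ w ≡ D) → ⊥
         all-squares sq = bad (trans (sym (cong (Z._- 1ℤ) (trans (cong roots (sym (*-identityˡ 1ᶠ))) (roots-square 1ᶠ 1≢0))))
             (∑-zero-terms fin (λ D → roots D Z.- 1ℤ) (λ D → ℤP.i≤j⇒0≤j-i (1≤ D)) (ℤP.≤-reflexive tot) 1ᶠ))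
           where
             bad : 1ℤ ≡ 0ℤ → ⊥
             bad ()
             1≤ : ∀ D → 1ℤ Z.≤ roots D
             1≤ D with sq D
             ... | w , refl with w ≟ 0ᶠ
             ...   | yes refl = ℤP.≤-reflexive (sym (trans (cong roots (zeroˡ 0ᶠ)) roots-0))
             ...   | no n = ℤP.≤-trans (Z.+≤+ (ℕ.s≤s ℕ.z≤n)) (ℤP.≤-reflexive (sym (roots-square w n)))
             tot : ∑ els (λ D → roots D Z.- 1ℤ) ≡ 0ℤ
             tot = trans (∑-- els roots (λ _ → 1ℤ)) (trans (cong₂ Z._-_ ∑-roots-total (trans (∑-const els 1ℤ) (ℤP.*-identityʳ (+ order)))) (ℤP.+-inverseʳ (+ order)))
         go : ∀ xs → (∀ x → x ∈ xs) → ∃ λ D → ∀ w → w ⊛ w ≢ D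
         go xs c with go′ xs
           where
             go′ : ∀ xs → (∃ λ D → ∀ w → w ⊛ w ≢ D) ⊎ All (λ D → ∃ λ w → w ⊛ w ≡ D) xs
             go′ [] = inj₂ []
             go′ (x ∷ xs) with square? x | go′ xs
             ... | inj₂ n | _ = inj₁ (x , n)
             ... | inj₁ _ | inj₁ r = inj₁ r
             ... | inj₁ s | inj₂ a = inj₂ (s ∷ a)
         ... | inj₁ r = r
         ... | inj₂ a = ⊥-elim (all-squares (λ D → All.lookup a (c D)))

     ∑-pairs : ∀ (f : C → C → ℤ) → ∑ els (λ x → ∑ els (f x)) ≡ ∑ els (λ x → ∑ els (λ y → f (x ⊕ y) (x ⊕ ⊖ y)))
     ∑-pairs f = trans (sym (∑-cart els els (λ { (x , y) → f x y })))
       (trans (sym (∑-reindex (Finite-× fin fin) (Finite-× fin fin) (λ { (x , y) → x ⊕ y , x ⊕ ⊖ y })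
         (λ { (s , t) → inv two ⊛ (s ⊕ t) , inv two ⊛ (s ⊕ ⊖ t) })
         (λ { (x , y) → cong₂ _,_
           (trans (solve 3 (λ i x y → i :* (x :+ y :+ (x :+ (:- y))) := i :* con (+ 2) :* x) refl (inv two) x y) (half x))
           (trans (solve 3 (λ i x y → i :* (x :+ y :+ (:- (x :+ (:- y)))) := i :* con (+ 2) :* y) refl (inv two) x y) (half y)) })
         (λ { (s , t) → cong₂ _,_
           (trans (solve 3 (λ i s t → i :* (s :+ t) :+ i :* (s :+ (:- t)) := i :* con (+ 2) :* s) refl (inv two) s t) (half s))
           (trans (solve 3 (λ i s t → i :* (s :+ t) :+ (:- (i :* (s :+ (:- t)))) := i :* con (+ 2) :* t) refl (inv two) s t) (half t)) })
         (λ { (x , y) → f x y })))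
       (∑-cart els els _))
       where
         half : ∀ x → inv two ⊛ two ⊛ x ≡ x
         half x = trans (cong (_⊛ x) (inv-l two two≢0)) (*-identityˡ x)

     module _ (d : C) (d-nonsq : ∀ w → w ⊛ w ≢ d) where
       d≢0 : d ≢ 0ᶠ
       d≢0 e = d-nonsq 0ᶠ (trans (zeroˡ 0ᶠ) (sym e))

       private
         twisted : C → ℤ
         twisted D = roots (inv d ⊛ D)

         total≤2 : ∀ D → roots D Z.+ twisted D Z.≤ + 2
         total≤2 D with square? D | square? (inv d ⊛ D)
         ... | inj₂ n | inj₂ n′ = ℤP.≤-trans (ℤP.≤-reflexive (cong₂ Z._+_ (roots-nonsquare D n) (roots-nonsquare _ n′))) (Z.+≤+ ℕ.z≤n)
         ... | inj₂ n | inj₁ (w , e) = ℤP.≤-trans (ℤP.≤-reflexive (cong₂ Z._+_ (roots-nonsquare D n) (cong roots (sym e))))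
                 (ℤP.≤-trans (ℤP.≤-reflexive (ℤP.+-identityˡ _)) (≤2 w))
           where
             ≤2 : ∀ w → roots (w ⊛ w) Z.≤ + 2
             ≤2 w with w ≟ 0ᶠ
             ... | yes refl = ℤP.≤-trans (ℤP.≤-reflexive (trans (cong roots (zeroˡ 0ᶠ)) roots-0)) (Z.+≤+ (ℕ.s≤s ℕ.z≤n))
             ... | no nz = ℤP.≤-reflexive (roots-square w nz)
         ... | inj₁ (w , refl) | r with w ≟ 0ᶠ
         ...   | yes refl = ℤP.≤-reflexive (cong₂ Z._+_ (trans (cong roots (zeroˡ 0ᶠ)) roots-0)
                     (trans (cong roots (trans (cong (inv d ⊛_) (zeroˡ 0ᶠ)) (zeroʳ _))) roots-0))
         ...   | no nz = ℤP.≤-reflexive (cong₂ Z._+_ (roots-square w nz) (roots-nonsquare _ contra))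
           where
             contra : ∀ v → v ⊛ v ≢ inv d ⊛ (w ⊛ w)
             contra v e = d-nonsq (w ⊛ inv v) (begin
                 w ⊛ inv v ⊛ (w ⊛ inv v) ≡⟨ solve 2 (λ w i → w :* i :* (w :* i) := (w :* w) :* (i :* i)) refl w (inv v) ⟩
                 w ⊛ w ⊛ (inv v ⊛ inv v) ≡⟨ cong (_⊛ (inv v ⊛ inv v)) w² ⟩
                 d ⊛ (v ⊛ v) ⊛ (inv v ⊛ inv v) ≡⟨ solve 3 (λ d v i → d :* (v :* v) :* (i :* i) := d :* ((v :* i) :* (v :* i))) refl d v (inv v) ⟩
                 d ⊛ ((v ⊛ inv v) ⊛ (v ⊛ inv v)) ≡⟨ cong (λ t → d ⊛ (t ⊛ t)) (inv-r v v≢0) ⟩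
                 d ⊛ (1ᶠ ⊛ 1ᶠ) ≡⟨ trans (cong (d ⊛_) (*-identityˡ 1ᶠ)) (*-identityʳ d) ⟩
                 d ∎)
               where
                 open ≡-Reasoning
                 w² : w ⊛ w ≡ d ⊛ (v ⊛ v)
                 w² = sym (trans (cong (d ⊛_) e) (trans (sym (*-assoc _ _ _)) (trans (cong (_⊛ (w ⊛ w)) (inv-r d d≢0)) (*-identityˡ _))))
                 v≢0 : v ≢ 0ᶠ
                 v≢0 refl = *-nz w w nz nz (trans w² (trans (cong (d ⊛_) (zeroˡ 0ᶠ)) (zeroʳ d)))

         scale-d : ∀ (h : C → ℤ) → ∑ els (λ D → h (inv d ⊛ D)) ≡ ∑ els h
         scale-d = ∑-reindex fin fin (inv d ⊛_) (d ⊛_)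
           (λ a → trans (sym (*-assoc _ _ _)) (trans (cong (_⊛ a) (inv-r d d≢0)) (*-identityˡ a)))
           (λ a → trans (sym (*-assoc _ _ _)) (trans (cong (_⊛ a) (inv-l d d≢0)) (*-identityˡ a)))

         total≡2 : ∀ D → roots D Z.+ twisted D ≡ + 2
         total≡2 D = sym (ℤP.i-j≡0⇒i≡j (+ 2) _ (∑-zero-terms fin (λ D → + 2 Z.- (roots D Z.+ twisted D)) (λ D → ℤP.i≤j⇒0≤j-i (total≤2 D))
           (ℤP.≤-reflexive (trans (∑-- els (λ _ → + 2) _) (trans (cong₂ Z._-_ (∑-const els (+ 2))
              (trans (∑-+ els roots twisted) (cong₂ Z._+_ ∑-roots-total (trans (scale-d roots) ∑-roots-total))))
              (ℤSolver.+-*-Solver.solve 1 (λ n → n ℤSolver.+-*-Solver.:* ℤSolver.+-*-Solver.con (+ 2) ℤSolver.+-*-Solver.:- (n ℤSolver.+-*-Solver.:+ n) ℤSolver.+-*-Solver.:= ℤSolver.+-*-Solver.con 0ℤ) refl (+ order))))) D))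

       ∑-squares : (h : C → ℤ) → ∑ els (λ w → h (w ⊛ w) Z.+ h (d ⊛ (w ⊛ w))) ≡ + 2 Z.* ∑ els h
       ∑-squares h = begin
         ∑ els (λ w → h (w ⊛ w) Z.+ h (d ⊛ (w ⊛ w))) ≡⟨ ∑-+ els _ _ ⟩
         ∑ els (λ w → h (w ⊛ w)) Z.+ ∑ els (λ w → h (d ⊛ (w ⊛ w))) ≡⟨ cong₂ Z._+_ (∑-roots h) (∑-roots (λ D → h (d ⊛ D))) ⟩
         ∑ els (λ D → roots D Z.* h D) Z.+ ∑ els (λ D → roots D Z.* h (d ⊛ D))
           ≡⟨ cong (λ t → ∑ els (λ D → roots D Z.* h D) Z.+ t) (sym (trans (∑-cong els (λ D → cong (λ t → twisted D Z.* h t)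
                (trans (sym (*-identityˡ D)) (trans (cong (_⊛ D) (sym (inv-r d d≢0))) (*-assoc _ _ _))))) (scale-d (λ D → roots D Z.* h (d ⊛ D))))) ⟩
         ∑ els (λ D → roots D Z.* h D) Z.+ ∑ els (λ D → twisted D Z.* h D) ≡⟨ sym (∑-+ els _ _) ⟩
         ∑ els (λ D → roots D Z.* h D Z.+ twisted D Z.* h D) ≡⟨ ∑-cong els (λ D → trans (sym (ℤP.*-distribʳ-+ (h D) (roots D) (twisted D))) (cong (Z._* h D) (total≡2 D))) ⟩
         ∑ els (λ D → + 2 Z.* h D) ≡⟨ ∑-*ˡ els (+ 2) h ⟩
         + 2 Z.* ∑ els h ∎
         where open ≡-Reasoning

module QuadraticTower where
 open FiniteSums
 open PolynomialFunctions
 open FiniteFields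
 open import Algebra.Structures using (IsCommutativeRing)
 open import Data.Integer using (+_; 0ℤ; 1ℤ)
 open import Data.List using ([]; _∷_; map; length; cartesianProduct)
 open import Data.List.Relation.Unary.All using ([]; _∷_)
 open import Data.List.Relation.Unary.AllPairs using ([]; _∷_)
 import Relation.Binary.PropositionalEquality as ≡

 module QuadraticExtension (K : FiniteField) (d : FiniteField.C K) (d-nonsq : ∀ w → FiniteField._⊛_ K w w ≢ d) where
   open FieldFacts K

   norm : C × C → C
   norm (a , b) = a ⊛ a ⊕ ⊖ (d ⊛ (b ⊛ b))

   norm-nz : ∀ a b → (a , b) ≢ (0ᶠ , 0ᶠ) → norm (a , b) ≢ 0ᶠ
   norm-nz a b nz e with b ≟ 0ᶠ
   ... | yes refl with a ≟ 0ᶠ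
   ...   | yes refl = nz refl
   ...   | no n = *-nz a a n n (trans (solve 2 (λ a d → a :* a := a :* a :+ (:- (d :* (con 0ℤ :* con 0ℤ)))) refl a d) e)
   norm-nz a b nz e | no b≢0 = d-nonsq (a ⊛ inv b) (begin
       a ⊛ inv b ⊛ (a ⊛ inv b) ≡⟨ solve 2 (λ w i → w :* i :* (w :* i) := (w :* w) :* (i :* i)) refl a (inv b) ⟩
       a ⊛ a ⊛ (inv b ⊛ inv b) ≡⟨ cong (_⊛ (inv b ⊛ inv b)) (x-x _ _ e) ⟩
       d ⊛ (b ⊛ b) ⊛ (inv b ⊛ inv b) ≡⟨ solve 3 (λ d v i → d :* (v :* v) :* (i :* i) := d :* ((v :* i) :* (v :* i))) refl d b (inv b) ⟩
       d ⊛ ((b ⊛ inv b) ⊛ (b ⊛ inv b)) ≡⟨ cong (λ t → d ⊛ (t ⊛ t)) (inv-r b b≢0) ⟩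
       d ⊛ (1ᶠ ⊛ 1ᶠ) ≡⟨ trans (cong (d ⊛_) (*-identityˡ 1ᶠ)) (*-identityʳ d) ⟩
       d ∎)
     where open ≡-Reasoning

   private
     _⊕²_ _⊛²_ : C × C → C × C → C × C
     (a , b) ⊕² (a′ , b′) = a ⊕ a′ , b ⊕ b′
     (a , b) ⊛² (a′ , b′) = a ⊛ a′ ⊕ d ⊛ (b ⊛ b′) , a ⊛ b′ ⊕ b ⊛ a′
     ⊖²_ inv² : C × C → C × C
     ⊖² (a , b) = ⊖ a , ⊖ b
     inv² (a , b) = a ⊛ inv (norm (a , b)) , ⊖ b ⊛ inv (norm (a , b))

     isCR² : IsCommutativeRing _≡_ _⊕²_ _⊛²_ ⊖²_ (0ᶠ , 0ᶠ) (1ᶠ , 0ᶠ)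
     isCR² = record
       { isRing = record
         { +-isAbelianGroup = record
           { isGroup = record
             { isMonoid = record
               { isSemigroup = record
                 { isMagma = record { isEquivalence = ≡.isEquivalence ; ∙-cong = cong₂ _⊕²_ }
                 ; assoc = λ _ _ _ → cong₂ _,_ (+-assoc _ _ _) (+-assoc _ _ _) }
               ; identity = (λ _ → cong₂ _,_ (+-identityˡ _) (+-identityˡ _)) , (λ _ → cong₂ _,_ (+-identityʳ _) (+-identityʳ _)) }
             ; inverse = (λ _ → cong₂ _,_ (-‿inverseˡ _) (-‿inverseˡ _)) , (λ _ → cong₂ _,_ (-‿inverseʳ _) (-‿inverseʳ _))
             ; ⁻¹-cong = cong ⊖²_ }
           ; comm = λ _ _ → cong₂ _,_ (+-comm _ _) (+-comm _ _) }
         ; *-cong = cong₂ _⊛²_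
         ; *-assoc = λ { (a , b) (a′ , b′) (a″ , b″) → cong₂ _,_
             (solve 7 (λ d a b a′ b′ a″ b″ → (a :* a′ :+ d :* (b :* b′)) :* a″ :+ d :* ((a :* b′ :+ b :* a′) :* b″)
                := a :* (a′ :* a″ :+ d :* (b′ :* b″)) :+ d :* (b :* (a′ :* b″ :+ b′ :* a″))) refl d a b a′ b′ a″ b″)
             (solve 7 (λ d a b a′ b′ a″ b″ → (a :* a′ :+ d :* (b :* b′)) :* b″ :+ (a :* b′ :+ b :* a′) :* a″
                := a :* (a′ :* b″ :+ b′ :* a″) :+ b :* (a′ :* a″ :+ d :* (b′ :* b″))) refl d a b a′ b′ a″ b″) }
         ; *-identity = (λ { (a , b) → cong₂ _,_ (solve 3 (λ d a b → con 1ℤ :* a :+ d :* (con 0ℤ :* b) := a) refl d a b)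
                                                 (solve 2 (λ a b → con 1ℤ :* b :+ con 0ℤ :* a := b) refl a b) })
                      , (λ { (a , b) → cong₂ _,_ (solve 3 (λ d a b → a :* con 1ℤ :+ d :* (b :* con 0ℤ) := a) refl d a b)
                                                 (solve 2 (λ a b → a :* con 0ℤ :+ b :* con 1ℤ := b) refl a b) })
         ; distrib = (λ { (a , b) (a′ , b′) (a″ , b″) → cong₂ _,_
                        (solve 7 (λ d a b a′ b′ a″ b″ → a :* (a′ :+ a″) :+ d :* (b :* (b′ :+ b″))
                          := (a :* a′ :+ d :* (b :* b′)) :+ (a :* a″ :+ d :* (b :* b″))) refl d a b a′ b′ a″ b″)
                        (solve 6 (λ a b a′ b′ a″ b″ → a :* (b′ :+ b″) :+ b :* (a′ :+ a″)
                          := (a :* b′ :+ b :* a′) :+ (a :* b″ :+ b :* a″)) refl a b a′ b′ a″ b″) })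
                   , (λ { (a , b) (a′ , b′) (a″ , b″) → cong₂ _,_
                        (solve 7 (λ d a b a′ b′ a″ b″ → (a′ :+ a″) :* a :+ d :* ((b′ :+ b″) :* b)
                          := (a′ :* a :+ d :* (b′ :* b)) :+ (a″ :* a :+ d :* (b″ :* b))) refl d a b a′ b′ a″ b″)
                        (solve 6 (λ a b a′ b′ a″ b″ → (a′ :+ a″) :* b :+ (b′ :+ b″) :* a
                          := (a′ :* b :+ b′ :* a) :+ (a″ :* b :+ b″ :* a)) refl a b a′ b′ a″ b″) }) }
       ; *-comm = λ { (a , b) (a′ , b′) → cong₂ _,_
             (solve 5 (λ d a b a′ b′ → a :* a′ :+ d :* (b :* b′) := a′ :* a :+ d :* (b′ :* b)) refl d a b a′ b′)
             (solve 4 (λ a b a′ b′ → a :* b′ :+ b :* a′ := a′ :* b :+ b′ :* a) refl a b a′ b′) } }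

   L : FiniteField
   L = record
     { C = C × C ; _⊕_ = _⊕²_ ; _⊛_ = _⊛²_ ; ⊖_ = ⊖²_ ; inv = inv² ; 0ᶠ = 0ᶠ , 0ᶠ ; 1ᶠ = 1ᶠ , 0ᶠ
     ; isCR = isCR²
     ; 1≢0 = λ e → 1≢0 (cong proj₁ e)
     ; inv-r = λ { (a , b) nz → cong₂ _,_
         (trans (solve 4 (λ a b d i → a :* (a :* i) :+ d :* (b :* ((:- b) :* i)) := (a :* a :+ (:- (d :* (b :* b)))) :* i) refl a b d (inv (norm (a , b))))
           (inv-r _ (norm-nz a b nz)))
         (solve 3 (λ a b i → a :* ((:- b) :* i) :+ b :* (a :* i) := con 0ℤ) refl a b (inv (norm (a , b)))) }
     ; inv-0 = cong₂ _,_ (zeroˡ _) (solve 1 (λ i → (:- con 0ℤ) :* i := con 0ℤ) refl (inv (norm (0ᶠ , 0ᶠ))))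
     ; fin = Finite-× fin fin }

   private module L = FiniteField L

   order-L : L.order ≡ order ℕ.* order
   order-L = go els
     where
       go : ∀ xs → length (cartesianProduct xs els) ≡ length xs ℕ.* order
       go [] = refl
       go (x ∷ xs) = trans (ListP.length-++ (map (x ,_) els)) (cong₂ ℕ._+_ (ListP.length-map _ els) (go xs))

   embed : C → C × C
   embed a = a , 0ᶠ

   embed-^ : ∀ a n → embed a L.^ᶠ n ≡ embed (a ^ᶠ n)
   embed-^ a zero = refl
   embed-^ a (suc n) = trans (cong (embed a L.⊛_) (embed-^ a n)) (cong₂ _,_
     (solve 3 (λ a b d → a :* b :+ d :* (con 0ℤ :* con 0ℤ) := a :* b) refl a (a ^ᶠ n) d)
     (solve 2 (λ a b → a :* con 0ℤ :+ con 0ℤ :* b := con 0ℤ) refl a (a ^ᶠ n)))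

   √d : C × C
   √d = 0ᶠ , 1ᶠ

   private
     -- X^Q - X has degree Q and vanishes on K, so √d is not a further root
     √d^order≢√d : 2 ℕ.≤ order → √d L.^ᶠ order ≢ √d
     √d^order≢√d 2≤ e = ℕP.<-irrefl refl (subst (ℕ._≤ order) (cong suc (ListP.length-map embed els))
       (roots-bound-L lead (√d ∷ map embed els)
         (AllP.map⁺ (All.tabulate (λ _ p → 1≢0 (cong proj₂ p))) ∷ UP.map⁺ (λ q → cong proj₁ q) unique)
         (zero-at √d e ∷ AllP.map⁺ (All.tabulate (λ {a} _ → zero-at (embed a) (trans (embed-^ a order) (cong embed (x^order≡x a))))))))
       where
         open Polynomials L renaming (roots-bound to roots-bound-L) hiding (eval)
         f : L.C → L.C
         f x = L.1ᶠ L.⊛ x L.^ᶠ order L.⊕ L.⊖ L.1ᶠ L.⊛ x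
         zero-at : ∀ x → x L.^ᶠ order ≡ x → f x ≡ L.0ᶠ
         zero-at x e = trans (cong (λ t → L.1ᶠ L.⊛ t L.⊕ L.⊖ L.1ᶠ L.⊛ x) e)
           (L.Solver.solve 1 (λ x → L.Solver.con 1ℤ L.Solver.:* x L.Solver.:+ (L.Solver.:- L.Solver.con 1ℤ) L.Solver.:* x L.Solver.:= L.Solver.con 0ℤ) refl x)
         lead : Polynomials.Lead L order f
         lead = Polynomials.lead-+ L (Polynomials.lead-X^ L order L.1ᶠ L.1≢0)
           (Polynomials.poly-scale L (L.⊖ L.1ᶠ) (Polynomials.poly-weaken L 2≤
             (Polynomials.poly-cong L (λ x → sym (L.*-identityʳ x)) (Polynomials.poly-X L (Polynomials.poly-const L 0 L.1ᶠ)))))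

     √d² : √d L.⊛ √d ≡ embed d
     √d² = cong₂ _,_ (solve 1 (λ d → con 0ℤ :* con 0ℤ :+ d :* (con 1ℤ :* con 1ℤ) := d) refl d)
                     (solve 0 (con 0ℤ :* con 1ℤ :+ con 1ℤ :* con 0ℤ := con 0ℤ) refl)

     √d^order : 2 ℕ.≤ order → √d L.^ᶠ order ≡ L.⊖ √d
     √d^order 2≤ with sq-eq-L (√d L.^ᶠ order) √d same
       where
         sq-eq-L : ∀ x y → x L.⊛ x ≡ y L.⊛ y → (x ≡ y) ⊎ (x ≡ L.⊖ y)
         sq-eq-L x y e with x L.≟ y
         ... | yes eq = inj₁ eq
         ... | no ne = inj₂ (L.x-x x (L.⊖ y) (L.cancel (x L.⊕ L.⊖ y) _ (trans (L.Solver.solve 2 (λ x y → (x L.Solver.:+ (L.Solver.:- y)) L.Solver.:* (x L.Solver.:+ (L.Solver.:- (L.Solver.:- y))) L.Solver.:= x L.Solver.:* x L.Solver.:+ (L.Solver.:- (y L.Solver.:* y))) refl x y)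
            (trans (cong (λ t → t L.⊕ L.⊖ (y L.⊛ y)) e) (L.-‿inverseʳ _))) (λ d → ne (L.x-x x y d))))
         same : (√d L.^ᶠ order) L.⊛ (√d L.^ᶠ order) ≡ √d L.⊛ √d
         same = trans (sym (L.^-*ᵇ √d √d order)) (trans (cong (L._^ᶠ order) √d²) (trans (embed-^ d order) (trans (cong embed (x^order≡x d)) (sym √d²))))
     ... | inj₁ e = ⊥-elim (√d^order≢√d 2≤ e)
     ... | inj₂ e = e

   conjugate : 2 ℕ.≤ order → (∀ x y → (x L.⊕ y) L.^ᶠ order ≡ x L.^ᶠ order L.⊕ y L.^ᶠ order) →
               ∀ a b → (a , b) L.^ᶠ order ≡ (a , ⊖ b)
   conjugate 2≤ frob a b = begin
     (a , b) L.^ᶠ order ≡⟨ cong (L._^ᶠ order) split ⟩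
     (embed a L.⊕ embed b L.⊛ √d) L.^ᶠ order ≡⟨ frob _ _ ⟩
     embed a L.^ᶠ order L.⊕ (embed b L.⊛ √d) L.^ᶠ order ≡⟨ cong₂ L._⊕_ (trans (embed-^ a order) (cong embed (x^order≡x a)))
        (trans (L.^-*ᵇ (embed b) √d order) (cong₂ L._⊛_ (trans (embed-^ b order) (cong embed (x^order≡x b))) (√d^order 2≤))) ⟩
     embed a L.⊕ embed b L.⊛ (L.⊖ √d) ≡⟨ cong₂ _,_
         (solve 3 (λ a b d → a :+ (b :* (:- con 0ℤ) :+ d :* (con 0ℤ :* (:- con 1ℤ))) := a) refl a b d)
         (solve 1 (λ b → con 0ℤ :+ (b :* (:- con 1ℤ) :+ con 0ℤ :* (:- con 0ℤ)) := :- b) refl b) ⟩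
     (a , ⊖ b) ∎
     where
       open ≡-Reasoning
       split : (a , b) ≡ embed a L.⊕ embed b L.⊛ √d
       split = cong₂ _,_ (solve 3 (λ a b d → a := a :+ (b :* con 0ℤ :+ d :* (con 0ℤ :* con 1ℤ))) refl a b d)
                         (solve 1 (λ b → b := con 0ℤ :+ (b :* con 1ℤ :+ con 0ℤ :* con 0ℤ)) refl b)

 module PowerSum (K : FiniteField) where
   open FiniteField K
   psum : ℕ → (ℕ → C) → C
   psum zero f = 0ᶠ
   psum (suc n) f = psum n f ⊕ f n

   psum-cong : ∀ n {f g : ℕ → C} → (∀ i → f i ≡ g i) → psum n f ≡ psum n g
   psum-cong zero e = refl
   psum-cong (suc n) e = cong₂ _⊕_ (psum-cong n e) (e n)

   psum-⊕ : ∀ n (f g : ℕ → C) → psum n (λ i → f i ⊕ g i) ≡ psum n f ⊕ psum n g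
   psum-⊕ zero f g = sym (+-identityˡ 0ᶠ)
   psum-⊕ (suc n) f g = trans (cong (_⊕ (f n ⊕ g n)) (psum-⊕ n f g))
     (Solver.solve 4 (λ a b c d → a Solver.:+ b Solver.:+ (c Solver.:+ d) Solver.:= (a Solver.:+ c) Solver.:+ (b Solver.:+ d)) refl (psum n f) (psum n g) (f n) (g n))

   psum-⊛ : ∀ n c (f : ℕ → C) → psum n (λ i → c ⊛ f i) ≡ c ⊛ psum n f
   psum-⊛ zero c f = sym (zeroʳ c)
   psum-⊛ (suc n) c f = trans (cong (_⊕ (c ⊛ f n)) (psum-⊛ n c f)) (sym (distribˡ c _ _))

   psum-split : ∀ m n (f : ℕ → C) → psum (m ℕ.+ n) f ≡ psum m f ⊕ psum n (λ i → f (m ℕ.+ i))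
   psum-split m zero f = trans (cong (λ t → psum t f) (ℕP.+-identityʳ m)) (sym (+-identityʳ _))
   psum-split m (suc n) f = trans (cong (λ t → psum t f) (ℕP.+-suc m n)) (trans (cong (_⊕ f (m ℕ.+ n)) (psum-split m n f)) (+-assoc _ _ _))

 module FieldTower (F : FiniteField) (p m h : ℕ) (p-prime : Prime p) (p-odd : p ≡ suc (2 ℕ.* h))
                   (orderF : FiniteField.order F ≡ p ℕ.^ m) where
   open FiniteField F using () renaming (C to CF; order to q)

   q^≡p^ : ∀ i → q ℕ.^ i ≡ p ℕ.^ (m ℕ.* i)
   q^≡p^ i = trans (cong (ℕ._^ i) orderF) (ℕP.^-*-assoc p m i)

   record TowerLevel (k : ℕ) : Set₁ where
     field
       K : FiniteField
     open FieldFacts K public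
     open PowerSum K public
     field
       order≡ : order ≡ q ℕ.^ (2 ℕ.^ k)
       ι      : CF → C
       ι-inj  : ∀ a b → ι a ≡ ι b → a ≡ b
       ι-⊕    : ∀ a b → ι (FiniteField._⊕_ F a b) ≡ ι a ⊕ ι b
       ι-⊛    : ∀ a b → ι (FiniteField._⊛_ F a b) ≡ ι a ⊛ ι b
       ι-1    : ι (FiniteField.1ᶠ F) ≡ 1ᶠ
       Tr     : C → CF
       Tr-⊕   : ∀ x y → Tr (x ⊕ y) ≡ FiniteField._⊕_ F (Tr x) (Tr y)
       ι-Tr   : ∀ x → ι (Tr x) ≡ psum (2 ℕ.^ k) (λ i → x ^ᶠ (q ℕ.^ i))
     open OddChar p (m ℕ.* 2 ℕ.^ k) h p-prime p-odd (trans order≡ (q^≡p^ (2 ℕ.^ k))) public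
     open Squares two≢0 public

     frobenius-q : ∀ i x y → (x ⊕ y) ^ᶠ (q ℕ.^ i) ≡ x ^ᶠ (q ℕ.^ i) ⊕ y ^ᶠ (q ℕ.^ i)
     frobenius-q i x y = subst (λ e → (x ⊕ y) ^ᶠ e ≡ x ^ᶠ e ⊕ y ^ᶠ e) (sym (q^≡p^ i)) (frobenius (m ℕ.* i) x y)

     2≤order : 2 ℕ.≤ order
     2≤order = two-elements els (complete 0ᶠ) (complete 1ᶠ)
       where
         open import Data.List.Membership.Propositional using (_∈_)
         open import Data.List.Relation.Unary.Any using (here; there)
         two-elements : ∀ xs → 0ᶠ ∈ xs → 1ᶠ ∈ xs → 2 ℕ.≤ length xs
         two-elements (x ∷ []) (here refl) (here e) = ⊥-elim (1≢0 e)
         two-elements (x ∷ y ∷ xs) _ _ = ℕ.s≤s (ℕ.s≤s ℕ.z≤n)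

   base : TowerLevel 0
   base = record
     { K = F ; order≡ = sym (ℕP.*-identityʳ q) ; ι = λ a → a ; ι-inj = λ _ _ e → e ; ι-⊕ = λ _ _ → refl ; ι-⊛ = λ _ _ → refl ; ι-1 = refl
     ; Tr = λ a → a ; Tr-⊕ = λ _ _ → refl
     ; ι-Tr = λ x → sym (trans (FiniteField.+-identityˡ F _) (FiniteField.*-identityʳ F x)) }

   next : ∀ {k} → TowerLevel k → TowerLevel (suc k)
   next {k} ℓ = record
     { K = L
     ; order≡ = trans order-L (trans (cong₂ ℕ._*_ order≡ order≡) (trans (sym (ℕP.^-distribˡ-+-* q (2 ℕ.^ k) (2 ℕ.^ k)))
           (cong (λ t → q ℕ.^ (2 ℕ.^ k ℕ.+ t)) (sym (ℕP.+-identityʳ _)))))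
     ; ι = embed ∘ ι ; ι-inj = λ a b e → ι-inj a b (cong proj₁ e)
     ; ι-⊕ = λ a b → cong₂ _,_ (ι-⊕ a b) (sym (+-identityˡ 0ᶠ))
     ; ι-⊛ = λ a b → cong₂ _,_ (trans (ι-⊛ a b) (solve 3 (λ a b d → a :* b := a :* b :+ d :* (con 0ℤ :* con 0ℤ)) refl (ι a) (ι b) d))
                               (solve 2 (λ a b → con 0ℤ := a :* con 0ℤ :+ con 0ℤ :* b) refl (ι a) (ι b))
     ; ι-1 = cong embed ι-1
     ; Tr = λ z → Tr (proj₁ z ⊕ proj₁ z)
     ; Tr-⊕ = λ z w → trans (cong Tr (solve 2 (λ a b → a :+ b :+ (a :+ b) := (a :+ a) :+ (b :+ b)) refl (proj₁ z) (proj₁ w))) (Tr-⊕ _ _)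
     ; ι-Tr = λ z → sym (trans (cong (λ t → L.psum (2 ℕ.^ k ℕ.+ t) (λ i → z L.^ᶠ (q ℕ.^ i))) (ℕP.+-identityʳ _)) (trans (L.psum-split (2 ℕ.^ k) (2 ℕ.^ k) _)
         (trans (sym (L.psum-⊕ (2 ℕ.^ k) _ _)) (trans (L.psum-cong (2 ℕ.^ k) (term z)) (trans (embed-psum (2 ℕ.^ k) _) (cong embed (sym (ι-Tr _))))))))
     }
     where
       open TowerLevel ℓ
       d = proj₁ nonsquare
       open QuadraticExtension K d (proj₂ nonsquare)
       module L where
         open FieldFacts L public
         open PowerSum L public
       embed-psum : ∀ n (f : ℕ → C) → L.psum n (embed ∘ f) ≡ embed (psum n f)
       embed-psum zero f = refl
       embed-psum (suc n) f = trans (cong (L._⊕ embed (f n)) (embed-psum n f)) (cong₂ _,_ refl (+-identityˡ 0ᶠ))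
       Q≡ : order ≡ p ℕ.^ (m ℕ.* 2 ℕ.^ k)
       Q≡ = trans order≡ (q^≡p^ (2 ℕ.^ k))
       orderL≡ : L.order ≡ p ℕ.^ (m ℕ.* 2 ℕ.^ k ℕ.+ m ℕ.* 2 ℕ.^ k)
       orderL≡ = trans order-L (trans (cong₂ ℕ._*_ Q≡ Q≡) (sym (ℕP.^-distribˡ-+-* p (m ℕ.* 2 ℕ.^ k) (m ℕ.* 2 ℕ.^ k))))
       frobL : ∀ j x y → (x L.⊕ y) L.^ᶠ (p ℕ.^ j) ≡ x L.^ᶠ (p ℕ.^ j) L.⊕ y L.^ᶠ (p ℕ.^ j)
       frobL = L.OddChar.frobenius p (m ℕ.* 2 ℕ.^ k ℕ.+ m ℕ.* 2 ℕ.^ k) h p-prime p-odd orderL≡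
       frobQ : ∀ x y → (x L.⊕ y) L.^ᶠ order ≡ x L.^ᶠ order L.⊕ y L.^ᶠ order
       frobQ x y = subst (λ e → (x L.⊕ y) L.^ᶠ e ≡ x L.^ᶠ e L.⊕ y L.^ᶠ e) (sym Q≡) (frobL (m ℕ.* 2 ℕ.^ k) x y)
       term : ∀ z i → z L.^ᶠ (q ℕ.^ i) L.⊕ z L.^ᶠ (q ℕ.^ (2 ℕ.^ k ℕ.+ i)) ≡ embed ((proj₁ z ⊕ proj₁ z) ^ᶠ (q ℕ.^ i))
       term z@(a , b) i = begin
         z L.^ᶠ (q ℕ.^ i) L.⊕ z L.^ᶠ (q ℕ.^ (2 ℕ.^ k ℕ.+ i)) ≡⟨ cong (z L.^ᶠ (q ℕ.^ i) L.⊕_) (trans (cong (z L.^ᶠ_) (trans (ℕP.^-distribˡ-+-* q (2 ℕ.^ k) i)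
              (cong (ℕ._* q ℕ.^ i) (sym order≡)))) (sym (L.^-^ z order (q ℕ.^ i)))) ⟩
         z L.^ᶠ (q ℕ.^ i) L.⊕ (z L.^ᶠ order) L.^ᶠ (q ℕ.^ i) ≡⟨ sym (subst (λ e → (z L.⊕ z L.^ᶠ order) L.^ᶠ e ≡ z L.^ᶠ e L.⊕ (z L.^ᶠ order) L.^ᶠ e) (sym (q^≡p^ i)) (frobL (m ℕ.* i) z (z L.^ᶠ order))) ⟩
         (z L.⊕ z L.^ᶠ order) L.^ᶠ (q ℕ.^ i) ≡⟨ cong (L._^ᶠ (q ℕ.^ i)) (trans (cong (z L.⊕_) (conjugate 2≤order frobQ a b)) (cong₂ _,_ refl (-‿inverseʳ b))) ⟩
         embed (a ⊕ a) L.^ᶠ (q ℕ.^ i) ≡⟨ embed-^ (a ⊕ a) (q ℕ.^ i) ⟩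
         embed ((a ⊕ a) ^ᶠ (q ℕ.^ i)) ∎
         where open ≡-Reasoning

module StepanovMethod where
 open FiniteSums
 open PolynomialFunctions
 open FiniteFields
 open QuadraticTower
 import Data.Nat.Solver as ℕSolver
 open import Data.Fin using (zero; suc; toℕ; remQuot)
 open import Data.List using (length)

 open ℕSolver.+-*-Solver using () renaming (solve to solveℕ; con to conℕ; _:=_ to _≔_; _:+_ to _⟨+⟩_; _:*_ to _⟨*⟩_)

 -- Stepanov's method. With r = √Q and l = r / q put u = Σ_{i < N/2} (x^{q^i} + β x^{-q^i}), so that the condition
 -- Tr x + β Tr x⁻¹ = c reads u^r = c - u. A combination Θ of the monic polynomials x^{κ + r i} (x^l u)^j x^{(q-1-j) l},
 -- whose degrees are distinct, satisfies Θ^r = Σ c_t x^{κ r + i} (c - u)^j ⋯ at solutions x because x^{r²} = x; the right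
 -- side has small degree, so by counting parameters Θ ≠ 0 can be chosen to vanish at every solution.
 module StepanovBound (F : FiniteField) (p m h : ℕ) (p-prime : Prime p) (p-odd : p ≡ suc (2 ℕ.* h))
                      (orderF : FiniteField.order F ≡ p ℕ.^ m)
                      {k : ℕ} (ℓ : FieldTower.TowerLevel F p m h p-prime p-odd orderF (suc k)) (β c : FiniteField.C F) where
   open FiniteField F using () renaming (C to CF; order to q)
   open FieldTower F p m h p-prime p-odd orderF
   open TowerLevel ℓ

   private
     n′ : ℕ
     n′ = ℕ.pred (2 ℕ.^ k)
     n≡ : suc n′ ≡ 2 ℕ.^ k
     n≡ = ℕP.suc-pred (2 ℕ.^ k) {{ℕP.m^n≢0 2 k}}

     l r I : ℕ
     l = q ℕ.^ n′
     r = q ℕ.* l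
     I = l ℕ.+ 3

     r≡ : r ≡ q ℕ.^ (2 ℕ.^ k)
     r≡ = cong (q ℕ.^_) n≡

     2≤q : 2 ℕ.≤ q
     2≤q = TowerLevel.2≤order base

     q⁻ : ℕ
     q⁻ = ℕ.pred q
     q≡ : suc q⁻ ≡ q
     q≡ = ℕP.suc-pred q {{ℕ.>-nonZero (ℕP.<-trans (ℕ.s≤s ℕ.z≤n) 2≤q)}}

     1≤l : 1 ℕ.≤ l
     1≤l = ℕP.m^n>0 q {{ℕ.>-nonZero (ℕP.<-trans (ℕ.s≤s ℕ.z≤n) 2≤q)}} n′

     2≤r : 2 ℕ.≤ r
     2≤r = ℕP.*-mono-≤ 2≤q 1≤l

     Q≡rr : order ≡ r ℕ.* r
     Q≡rr = trans order≡ (trans (cong (λ t → q ℕ.^ (2 ℕ.^ k ℕ.+ t)) (ℕP.+-identityʳ _))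
       (trans (ℕP.^-distribˡ-+-* q (2 ℕ.^ k) (2 ℕ.^ k)) (sym (cong₂ ℕ._*_ r≡ r≡))))

     frobenius-r : ∀ x y → (x ⊕ y) ^ᶠ r ≡ x ^ᶠ r ⊕ y ^ᶠ r
     frobenius-r x y = frobenius-q (suc n′) x y

     ι-^ : ∀ a j → ι (FiniteField._^ᶠ_ F a j) ≡ ι a ^ᶠ j
     ι-^ a zero = ι-1
     ι-^ a (suc j) = trans (ι-⊛ a _) (cong (ι a ⊛_) (ι-^ a j))

     F-fixed : ∀ a j → FiniteField._^ᶠ_ F a (q ℕ.^ j) ≡ a
     F-fixed a zero = FiniteField.*-identityʳ F a
     F-fixed a (suc j) = trans (sym (FiniteField.^-^ F a q (q ℕ.^ j))) (trans (cong (λ t → FiniteField._^ᶠ_ F t (q ℕ.^ j)) (TowerLevel.x^order≡x base a)) (F-fixed a j))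

     ι-fixed : ∀ a → ι a ^ᶠ r ≡ ι a
     ι-fixed a = trans (sym (ι-^ a r)) (cong ι (F-fixed a (suc n′)))

     0^r : 0ᶠ ^ᶠ r ≡ 0ᶠ
     0^r = subst (λ t → 0ᶠ ^ᶠ t ≡ 0ᶠ) (ℕP.suc-pred r {{ℕ.>-nonZero (ℕP.<-trans (ℕ.s≤s ℕ.z≤n) 2≤r)}}) (zeroˡ _)

     psum-^r : ∀ n f → psum n f ^ᶠ r ≡ psum n (λ i → f i ^ᶠ r)
     psum-^r zero f = 0^r
     psum-^r (suc n) f = trans (frobenius-r _ _) (cong (_⊕ f n ^ᶠ r) (psum-^r n f))

     sum-^r : ∀ {n} (f : Fin n → C) → sum f ^ᶠ r ≡ sum (λ t → f t ^ᶠ r)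
     sum-^r {zero} f = 0^r
     sum-^r {suc n} f = trans (frobenius-r _ _) (cong (f zero ^ᶠ r ⊕_) (sum-^r (f ∘ suc)))

     b = ι β

     u w : C → C
     u x = psum (suc n′) (λ i → x ^ᶠ (q ℕ.^ i) ⊕ b ⊛ inv x ^ᶠ (q ℕ.^ i))
     w x = psum (suc n′) (λ i → x ^ᶠ (l ℕ.+ q ℕ.^ i) ⊕ b ⊛ x ^ᶠ (l ℕ.∸ q ℕ.^ i))

     psum-cong-< : ∀ n {f g : ℕ → C} → (∀ i → i ℕ.< n → f i ≡ g i) → psum n f ≡ psum n g
     psum-cong-< zero e = refl
     psum-cong-< (suc n) e = cong₂ _⊕_ (psum-cong-< n (λ i i<n → e i (ℕP.m<n⇒m<1+n i<n))) (e n ℕP.≤-refl)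

     q^-mono : ∀ {i j} → i ℕ.≤ j → q ℕ.^ i ℕ.≤ q ℕ.^ j
     q^-mono = ℕP.^-monoʳ-≤ q {{ℕ.>-nonZero (ℕP.<-trans (ℕ.s≤s ℕ.z≤n) 2≤q)}}

     w≡ : ∀ x → x ≢ 0ᶠ → w x ≡ x ^ᶠ l ⊛ u x
     w≡ x nz = trans (psum-cong-< (suc n′) (λ i i< → term i (q^-mono (ℕ.s≤s⁻¹ i<)))) (psum-⊛ (suc n′) (x ^ᶠ l) _)
       where
         shift : ∀ a → a ℕ.≤ l → x ^ᶠ (l ℕ.∸ a) ≡ x ^ᶠ l ⊛ inv x ^ᶠ a
         shift a a≤l = begin
           x ^ᶠ (l ℕ.∸ a) ≡⟨ sym (*-identityʳ _) ⟩
           x ^ᶠ (l ℕ.∸ a) ⊛ 1ᶠ ≡⟨ cong (x ^ᶠ (l ℕ.∸ a) ⊛_) (sym (trans (sym (^-*ᵇ x (inv x) a)) (trans (cong (_^ᶠ a) (inv-r x nz)) (1^ a)))) ⟩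
           x ^ᶠ (l ℕ.∸ a) ⊛ (x ^ᶠ a ⊛ inv x ^ᶠ a) ≡⟨ sym (*-assoc _ _ _) ⟩
           x ^ᶠ (l ℕ.∸ a) ⊛ x ^ᶠ a ⊛ inv x ^ᶠ a ≡⟨ cong (_⊛ inv x ^ᶠ a) (trans (sym (^-+ x (l ℕ.∸ a) a)) (cong (x ^ᶠ_) (ℕP.m∸n+n≡m a≤l))) ⟩
           x ^ᶠ l ⊛ inv x ^ᶠ a ∎
           where open ≡-Reasoning
         term : ∀ i → q ℕ.^ i ℕ.≤ l → x ^ᶠ (l ℕ.+ q ℕ.^ i) ⊕ b ⊛ x ^ᶠ (l ℕ.∸ q ℕ.^ i) ≡ x ^ᶠ l ⊛ (x ^ᶠ (q ℕ.^ i) ⊕ b ⊛ inv x ^ᶠ (q ℕ.^ i))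
         term i le = trans (cong₂ (λ s t → s ⊕ b ⊛ t) (^-+ x l (q ℕ.^ i)) (shift (q ℕ.^ i) le))
           (solve 4 (λ a b c d → a :* c :+ b :* (a :* d) := a :* (c :+ b :* d)) refl (x ^ᶠ l) b (x ^ᶠ (q ℕ.^ i)) (inv x ^ᶠ (q ℕ.^ i)))

     poly-psum : ∀ {n} j {f : ℕ → C → C} → (∀ i → i ℕ.< j → Poly n (f i)) → Poly n (λ x → psum j (λ i → f i x))
     poly-psum {n} zero p = poly-0 n
     poly-psum (suc j) p = poly-+ (poly-psum j (λ i i<j → p i (ℕP.m<n⇒m<1+n i<j))) (p j ℕP.≤-refl)

     w-monic : Monic (l ℕ.+ l) w
     w-monic = (λ x → b ⊛ x ^ᶠ (l ℕ.∸ l) ⊕ psum n′ (λ i → x ^ᶠ (l ℕ.+ q ℕ.^ i) ⊕ b ⊛ x ^ᶠ (l ℕ.∸ q ℕ.^ i))) ,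
       poly-+ (low l) (poly-psum n′ (λ i i<n′ → poly-+
           (poly-weaken (ℕP.≤-trans (ℕP.≤-reflexive (sym (ℕP.+-suc l _))) (ℕP.+-monoʳ-≤ l (ℕP.^-monoʳ-< q 2≤q i<n′))) (poly-mono (l ℕ.+ q ℕ.^ i)))
           (low (q ℕ.^ i)))) ,
       λ x → solve 3 (λ a b c → a :+ (b :+ c) := b :+ (c :+ a)) refl (psum n′ (λ i → x ^ᶠ (l ℕ.+ q ℕ.^ i) ⊕ b ⊛ x ^ᶠ (l ℕ.∸ q ℕ.^ i))) (x ^ᶠ (l ℕ.+ l)) (b ⊛ x ^ᶠ (l ℕ.∸ l))
       where
         low : ∀ a → Poly (l ℕ.+ l) (λ x → b ⊛ x ^ᶠ (l ℕ.∸ a))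
         low a = poly-scale b (poly-weaken (ℕP.≤-trans (ℕ.s≤s (ℕP.m∸n≤m l a)) (ℕP.+-monoˡ-≤ l 1≤l)) (poly-mono (l ℕ.∸ a)))

     M : ℕ
     M = I ℕ.* (q ℕ.* l)

     i# j# κ# g# : Fin M → ℕ
     i# t = toℕ (proj₁ (remQuot {I} (q ℕ.* l) t))
     j# t = toℕ (proj₁ (remQuot {q} l (proj₂ (remQuot {I} (q ℕ.* l) t))))
     κ# t = toℕ (proj₂ (remQuot {q} l (proj₂ (remQuot {I} (q ℕ.* l) t))))
     g# t = q⁻ ℕ.∸ j# t

     i<I : ∀ t → i# t ℕ.< I
     i<I t = FinP.toℕ<n (proj₁ (remQuot {I} (q ℕ.* l) t))
     κ<l : ∀ t → κ# t ℕ.< l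
     κ<l t = FinP.toℕ<n (proj₂ (remQuot {q} l (proj₂ (remQuot {I} (q ℕ.* l) t))))
     j+g : ∀ t → j# t ℕ.+ g# t ≡ q⁻
     j+g t = ℕP.m+[n∸m]≡n (ℕ.s≤s⁻¹ (subst (j# t ℕ.<_) (sym q≡) (FinP.toℕ<n (proj₁ (remQuot {q} l (proj₂ (remQuot {I} (q ℕ.* l) t)))))))

     t≡ : ∀ t → toℕ t ≡ (q ℕ.* l) ℕ.* i# t ℕ.+ (l ℕ.* j# t ℕ.+ κ# t)
     t≡ t = trans (cong toℕ (sym (FinP.combine-remQuot {I} (q ℕ.* l) t)))
       (trans (FinP.toℕ-combine (proj₁ (remQuot {I} (q ℕ.* l) t)) s)
         (cong ((q ℕ.* l) ℕ.* i# t ℕ.+_) (trans (cong toℕ (sym (FinP.combine-remQuot {q} l s))) (FinP.toℕ-combine (proj₁ (remQuot {q} l s)) (proj₂ (remQuot {q} l s))))))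
       where s = proj₂ (remQuot {I} (q ℕ.* l) t)

     e Ψ : Fin M → C → C
     e t x = x ^ᶠ (κ# t ℕ.+ r ℕ.* i# t) ⊛ w x ^ᶠ j# t ⊛ x ^ᶠ (g# t ℕ.* l)
     Ψ t x = x ^ᶠ (κ# t ℕ.* r ℕ.+ i# t ℕ.+ g# t ℕ.* l) ⊛ (ι c ⊛ x ^ᶠ l ⊕ ⊖ 1ᶠ ⊛ w x) ^ᶠ j# t

     e-monic : ∀ t → Monic (toℕ t ℕ.+ q⁻ ℕ.* l) (e t)
     e-monic t = subst (λ n → Monic n (e t)) deg (monic-* (monic-* (monic-X^ (κ# t ℕ.+ r ℕ.* i# t)) (monic-pow (j# t) w-monic)) (monic-X^ (g# t ℕ.* l)))
       where
         deg : κ# t ℕ.+ r ℕ.* i# t ℕ.+ j# t ℕ.* (l ℕ.+ l) ℕ.+ g# t ℕ.* l ≡ toℕ t ℕ.+ q⁻ ℕ.* l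
         deg = trans (solveℕ 6 (λ κ i j g l r → κ ⟨+⟩ r ⟨*⟩ i ⟨+⟩ j ⟨*⟩ (l ⟨+⟩ l) ⟨+⟩ g ⟨*⟩ l ≔ (r ⟨*⟩ i ⟨+⟩ (l ⟨*⟩ j ⟨+⟩ κ)) ⟨+⟩ (j ⟨+⟩ g) ⟨*⟩ l) refl
             (κ# t) (i# t) (j# t) (g# t) l r)
           (cong₂ (λ s t → s ℕ.+ t ℕ.* l) (sym (t≡ t)) (j+g t))

     Ψ-degree : ℕ
     Ψ-degree = l ℕ.* r ℕ.+ r ℕ.+ 3

     Ψ-poly : ∀ t → Poly Ψ-degree (Ψ t)
     Ψ-poly t = poly-weaken bound (poly-X^ (κ# t ℕ.* r ℕ.+ i# t ℕ.+ g# t ℕ.* l) (poly-pow (j# t)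
         (poly-+ (poly-scale (ι c) (poly-weaken (ℕ.s≤s (ℕP.m≤m+n l l)) (poly-mono l))) (poly-scale (⊖ 1ᶠ) (monic⇒poly w-monic)))))
       where
         bound : κ# t ℕ.* r ℕ.+ i# t ℕ.+ g# t ℕ.* l ℕ.+ suc (j# t ℕ.* (l ℕ.+ l)) ℕ.≤ Ψ-degree
         bound = ℕP.+-cancelʳ-≤ (r ℕ.+ (l ℕ.+ l)) _ _ (begin
           κ# t ℕ.* r ℕ.+ i# t ℕ.+ g# t ℕ.* l ℕ.+ suc (j# t ℕ.* (l ℕ.+ l)) ℕ.+ (r ℕ.+ (l ℕ.+ l))
             ≤⟨ ℕP.m≤m+n _ (g# t ℕ.* l) ⟩
           κ# t ℕ.* r ℕ.+ i# t ℕ.+ g# t ℕ.* l ℕ.+ suc (j# t ℕ.* (l ℕ.+ l)) ℕ.+ (r ℕ.+ (l ℕ.+ l)) ℕ.+ g# t ℕ.* l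
             ≡⟨ solveℕ 6 (λ κ i j g l r → κ ⟨*⟩ r ⟨+⟩ i ⟨+⟩ g ⟨*⟩ l ⟨+⟩ (conℕ 1 ⟨+⟩ j ⟨*⟩ (l ⟨+⟩ l)) ⟨+⟩ (r ⟨+⟩ (l ⟨+⟩ l)) ⟨+⟩ g ⟨*⟩ l
                  ≔ (conℕ 1 ⟨+⟩ κ) ⟨*⟩ r ⟨+⟩ (conℕ 1 ⟨+⟩ i) ⟨+⟩ ((conℕ 1 ⟨+⟩ (j ⟨+⟩ g)) ⟨*⟩ l ⟨+⟩ (conℕ 1 ⟨+⟩ (j ⟨+⟩ g)) ⟨*⟩ l)) refl (κ# t) (i# t) (j# t) (g# t) l r ⟩
           suc (κ# t) ℕ.* r ℕ.+ suc (i# t) ℕ.+ (suc (j# t ℕ.+ g# t) ℕ.* l ℕ.+ suc (j# t ℕ.+ g# t) ℕ.* l)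
             ≡⟨ cong (λ s → suc (κ# t) ℕ.* r ℕ.+ suc (i# t) ℕ.+ (s ℕ.* l ℕ.+ s ℕ.* l)) (trans (cong suc (j+g t)) q≡) ⟩
           suc (κ# t) ℕ.* r ℕ.+ suc (i# t) ℕ.+ (r ℕ.+ r)
             ≤⟨ ℕP.+-monoˡ-≤ (r ℕ.+ r) (ℕP.+-mono-≤ (ℕP.*-monoˡ-≤ r (κ<l t)) (i<I t)) ⟩
           l ℕ.* r ℕ.+ (l ℕ.+ 3) ℕ.+ (r ℕ.+ r) ≤⟨ ℕP.m≤m+n _ l ⟩
           l ℕ.* r ℕ.+ (l ℕ.+ 3) ℕ.+ (r ℕ.+ r) ℕ.+ l
             ≡⟨ solveℕ 2 (λ l r → l ⟨*⟩ r ⟨+⟩ (l ⟨+⟩ conℕ 3) ⟨+⟩ (r ⟨+⟩ r) ⟨+⟩ l ≔ l ⟨*⟩ r ⟨+⟩ r ⟨+⟩ conℕ 3 ⟨+⟩ (r ⟨+⟩ (l ⟨+⟩ l))) refl l r ⟩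
           Ψ-degree ℕ.+ (r ℕ.+ (l ℕ.+ l)) ∎)
           where open ℕP.≤-Reasoning

     Ψ-degree<M : Ψ-degree ℕ.< M
     Ψ-degree<M = begin
       suc (l ℕ.* r ℕ.+ r ℕ.+ 3) ≡⟨ solveℕ 2 (λ lr r → conℕ 1 ⟨+⟩ (lr ⟨+⟩ r ⟨+⟩ conℕ 3) ≔ lr ⟨+⟩ r ⟨+⟩ (conℕ 2 ⟨+⟩ conℕ 2)) refl (l ℕ.* r) r ⟩
       l ℕ.* r ℕ.+ r ℕ.+ (2 ℕ.+ 2) ≤⟨ ℕP.+-monoʳ-≤ (l ℕ.* r ℕ.+ r) (ℕP.+-mono-≤ 2≤r 2≤r) ⟩
       l ℕ.* r ℕ.+ r ℕ.+ (r ℕ.+ r) ≡⟨ solveℕ 2 (λ l r → l ⟨*⟩ r ⟨+⟩ r ⟨+⟩ (r ⟨+⟩ r) ≔ (l ⟨+⟩ conℕ 3) ⟨*⟩ r) refl l r ⟩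
       M ∎
       where
         open ℕP.≤-Reasoning

     module Solution (x : C) (nz : x ≢ 0ᶠ) (sol : FiniteField._⊕_ F (Tr x) (FiniteField._⊛_ F β (Tr (inv x))) ≡ c) where
       u^r : u x ^ᶠ r ≡ ι c ⊕ ⊖ u x
       u^r = begin
         u x ^ᶠ r ≡⟨ solve 2 (λ a b → b := (a :+ b) :+ (:- a)) refl (u x) (u x ^ᶠ r) ⟩
         (u x ⊕ u x ^ᶠ r) ⊕ ⊖ u x ≡⟨ cong (_⊕ ⊖ u x) total ⟩
         ι c ⊕ ⊖ u x ∎
         where
           open ≡-Reasoning
           f : ℕ → C
           f i = x ^ᶠ (q ℕ.^ i) ⊕ b ⊛ inv x ^ᶠ (q ℕ.^ i)
           powers : ∀ y i → (y ^ᶠ (q ℕ.^ i)) ^ᶠ r ≡ y ^ᶠ (q ℕ.^ (suc n′ ℕ.+ i))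
           powers y i = trans (^-^ y (q ℕ.^ i) r) (cong (y ^ᶠ_) (trans (sym (ℕP.^-distribˡ-+-* q i (suc n′))) (cong (q ℕ.^_) (ℕP.+-comm i (suc n′)))))
           total : u x ⊕ u x ^ᶠ r ≡ ι c
           total = begin
             u x ⊕ u x ^ᶠ r ≡⟨ cong (u x ⊕_) (trans (psum-^r (suc n′) f) (psum-cong (suc n′) (λ i →
                  trans (frobenius-r _ _) (cong₂ _⊕_ (powers x i) (trans (^-*ᵇ b _ r) (cong₂ _⊛_ (ι-fixed β) (powers (inv x) i))))))) ⟩
             psum (suc n′) f ⊕ psum (suc n′) (λ i → f (suc n′ ℕ.+ i)) ≡⟨ sym (psum-split (suc n′) (suc n′) f) ⟩
             psum (suc n′ ℕ.+ suc n′) f ≡⟨ cong (λ t → psum t f) (trans (cong₂ ℕ._+_ n≡ n≡) (cong (2 ℕ.^ k ℕ.+_) (sym (ℕP.+-identityʳ _)))) ⟩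
             psum (2 ℕ.^ suc k) f ≡⟨ psum-⊕ (2 ℕ.^ suc k) _ _ ⟩
             psum (2 ℕ.^ suc k) (λ i → x ^ᶠ (q ℕ.^ i)) ⊕ psum (2 ℕ.^ suc k) (λ i → b ⊛ inv x ^ᶠ (q ℕ.^ i))
               ≡⟨ cong₂ _⊕_ (sym (ι-Tr x)) (trans (psum-⊛ (2 ℕ.^ suc k) b _) (cong (b ⊛_) (sym (ι-Tr (inv x))))) ⟩
             ι (Tr x) ⊕ b ⊛ ι (Tr (inv x)) ≡⟨ trans (cong (ι (Tr x) ⊕_) (sym (ι-⊛ β _))) (trans (sym (ι-⊕ _ _)) (cong ι sol)) ⟩
             ι c ∎

       A : C
       A = x ^ᶠ (q⁻ ℕ.* l)

       e-form : ∀ t → e t x ≡ x ^ᶠ (κ# t ℕ.+ r ℕ.* i# t) ⊛ u x ^ᶠ j# t ⊛ A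
       e-form t = begin
         x ^ᶠ (κ# t ℕ.+ r ℕ.* i# t) ⊛ w x ^ᶠ j# t ⊛ x ^ᶠ (g# t ℕ.* l)
           ≡⟨ cong (λ y → x ^ᶠ (κ# t ℕ.+ r ℕ.* i# t) ⊛ y ⊛ x ^ᶠ (g# t ℕ.* l)) (trans (cong (_^ᶠ j# t) (w≡ x nz)) (^-*ᵇ _ (u x) (j# t))) ⟩
         x ^ᶠ (κ# t ℕ.+ r ℕ.* i# t) ⊛ ((x ^ᶠ l) ^ᶠ j# t ⊛ u x ^ᶠ j# t) ⊛ x ^ᶠ (g# t ℕ.* l)
           ≡⟨ solve 4 (λ a b c d → a :* (b :* c) :* d := a :* c :* (b :* d)) refl (x ^ᶠ (κ# t ℕ.+ r ℕ.* i# t)) ((x ^ᶠ l) ^ᶠ j# t) (u x ^ᶠ j# t) (x ^ᶠ (g# t ℕ.* l)) ⟩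
         x ^ᶠ (κ# t ℕ.+ r ℕ.* i# t) ⊛ u x ^ᶠ j# t ⊛ ((x ^ᶠ l) ^ᶠ j# t ⊛ x ^ᶠ (g# t ℕ.* l)) ≡⟨ cong (λ y → x ^ᶠ (κ# t ℕ.+ r ℕ.* i# t) ⊛ u x ^ᶠ j# t ⊛ y) (collect t) ⟩
         x ^ᶠ (κ# t ℕ.+ r ℕ.* i# t) ⊛ u x ^ᶠ j# t ⊛ A ∎
         where
           open ≡-Reasoning
           collect : ∀ t → (x ^ᶠ l) ^ᶠ j# t ⊛ x ^ᶠ (g# t ℕ.* l) ≡ A
           collect t = trans (cong (_⊛ x ^ᶠ (g# t ℕ.* l)) (trans (^-^ x l (j# t)) (cong (x ^ᶠ_) (ℕP.*-comm l (j# t)))))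
             (trans (sym (^-+ x (j# t ℕ.* l) (g# t ℕ.* l))) (cong (x ^ᶠ_) (trans (sym (ℕP.*-distribʳ-+ l (j# t) (g# t))) (cong (ℕ._* l) (j+g t)))))

       Ψ-form : ∀ t → Ψ t x ≡ x ^ᶠ (κ# t ℕ.* r ℕ.+ i# t) ⊛ (u x ^ᶠ r) ^ᶠ j# t ⊛ A
       Ψ-form t = begin
         x ^ᶠ (κ# t ℕ.* r ℕ.+ i# t ℕ.+ g# t ℕ.* l) ⊛ (ι c ⊛ x ^ᶠ l ⊕ ⊖ 1ᶠ ⊛ w x) ^ᶠ j# t
           ≡⟨ cong₂ _⊛_ (^-+ x (κ# t ℕ.* r ℕ.+ i# t) (g# t ℕ.* l)) (trans (cong (_^ᶠ j# t) inner) (^-*ᵇ _ _ (j# t))) ⟩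
         x ^ᶠ (κ# t ℕ.* r ℕ.+ i# t) ⊛ x ^ᶠ (g# t ℕ.* l) ⊛ ((x ^ᶠ l) ^ᶠ j# t ⊛ (u x ^ᶠ r) ^ᶠ j# t)
           ≡⟨ solve 4 (λ a b c d → a :* b :* (c :* d) := a :* d :* (c :* b)) refl (x ^ᶠ (κ# t ℕ.* r ℕ.+ i# t)) (x ^ᶠ (g# t ℕ.* l)) ((x ^ᶠ l) ^ᶠ j# t) ((u x ^ᶠ r) ^ᶠ j# t) ⟩
         x ^ᶠ (κ# t ℕ.* r ℕ.+ i# t) ⊛ (u x ^ᶠ r) ^ᶠ j# t ⊛ ((x ^ᶠ l) ^ᶠ j# t ⊛ x ^ᶠ (g# t ℕ.* l)) ≡⟨ cong (λ y → x ^ᶠ (κ# t ℕ.* r ℕ.+ i# t) ⊛ (u x ^ᶠ r) ^ᶠ j# t ⊛ y) collect ⟩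
         x ^ᶠ (κ# t ℕ.* r ℕ.+ i# t) ⊛ (u x ^ᶠ r) ^ᶠ j# t ⊛ A ∎
         where
           open ≡-Reasoning
           collect : (x ^ᶠ l) ^ᶠ j# t ⊛ x ^ᶠ (g# t ℕ.* l) ≡ A
           collect = trans (cong (_⊛ x ^ᶠ (g# t ℕ.* l)) (trans (^-^ x l (j# t)) (cong (x ^ᶠ_) (ℕP.*-comm l (j# t)))))
             (trans (sym (^-+ x (j# t ℕ.* l) (g# t ℕ.* l))) (cong (x ^ᶠ_) (trans (sym (ℕP.*-distribʳ-+ l (j# t) (g# t))) (cong (ℕ._* l) (j+g t)))))
           inner : ι c ⊛ x ^ᶠ l ⊕ ⊖ 1ᶠ ⊛ w x ≡ x ^ᶠ l ⊛ u x ^ᶠ r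
           inner = trans (cong (λ y → ι c ⊛ x ^ᶠ l ⊕ ⊖ 1ᶠ ⊛ y) (w≡ x nz)) (trans (solve 3 (λ c a u → c :* a :+ (:- con Z.1ℤ) :* (a :* u) := a :* (c :+ (:- u))) refl (ι c) (x ^ᶠ l) (u x))
             (cong (x ^ᶠ l ⊛_) (sym u^r)))
             where import Data.Integer as Z

       e^r : ∀ t → A ⊛ e t x ^ᶠ r ≡ A ^ᶠ r ⊛ Ψ t x
       e^r t = begin
         A ⊛ e t x ^ᶠ r ≡⟨ cong (λ y → A ⊛ y ^ᶠ r) (e-form t) ⟩
         A ⊛ (x ^ᶠ (κ# t ℕ.+ r ℕ.* i# t) ⊛ u x ^ᶠ j# t ⊛ A) ^ᶠ r ≡⟨ cong (A ⊛_) (trans (^-*ᵇ _ A r) (cong (_⊛ A ^ᶠ r) (^-*ᵇ _ _ r))) ⟩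
         A ⊛ ((x ^ᶠ (κ# t ℕ.+ r ℕ.* i# t)) ^ᶠ r ⊛ (u x ^ᶠ j# t) ^ᶠ r ⊛ A ^ᶠ r) ≡⟨ cong₂ (λ y z → A ⊛ (y ⊛ z ⊛ A ^ᶠ r)) x-part (trans (^-^ _ (j# t) r) (trans (cong (u x ^ᶠ_) (ℕP.*-comm (j# t) r)) (sym (^-^ _ r (j# t))))) ⟩
         A ⊛ (x ^ᶠ (κ# t ℕ.* r ℕ.+ i# t) ⊛ (u x ^ᶠ r) ^ᶠ j# t ⊛ A ^ᶠ r) ≡⟨ solve 4 (λ a b c d → a :* (b :* c :* d) := d :* (b :* c :* a)) refl A (x ^ᶠ (κ# t ℕ.* r ℕ.+ i# t)) ((u x ^ᶠ r) ^ᶠ j# t) (A ^ᶠ r) ⟩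
         A ^ᶠ r ⊛ (x ^ᶠ (κ# t ℕ.* r ℕ.+ i# t) ⊛ (u x ^ᶠ r) ^ᶠ j# t ⊛ A) ≡⟨ cong (A ^ᶠ r ⊛_) (sym (Ψ-form t)) ⟩
         A ^ᶠ r ⊛ Ψ t x ∎
         where
           open ≡-Reasoning
           x-part : (x ^ᶠ (κ# t ℕ.+ r ℕ.* i# t)) ^ᶠ r ≡ x ^ᶠ (κ# t ℕ.* r ℕ.+ i# t)
           x-part = begin
             (x ^ᶠ (κ# t ℕ.+ r ℕ.* i# t)) ^ᶠ r ≡⟨ ^-^ x (κ# t ℕ.+ r ℕ.* i# t) r ⟩
             x ^ᶠ ((κ# t ℕ.+ r ℕ.* i# t) ℕ.* r) ≡⟨ cong (x ^ᶠ_) (solveℕ 3 (λ κ r i → (κ ⟨+⟩ r ⟨*⟩ i) ⟨*⟩ r ≔ κ ⟨*⟩ r ⟨+⟩ (r ⟨*⟩ r) ⟨*⟩ i) refl (κ# t) r (i# t)) ⟩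
             x ^ᶠ (κ# t ℕ.* r ℕ.+ (r ℕ.* r) ℕ.* i# t) ≡⟨ ^-+ x (κ# t ℕ.* r) _ ⟩
             x ^ᶠ (κ# t ℕ.* r) ⊛ x ^ᶠ ((r ℕ.* r) ℕ.* i# t) ≡⟨ cong (x ^ᶠ (κ# t ℕ.* r) ⊛_) (trans (sym (^-^ x (r ℕ.* r) (i# t)))
                   (cong (_^ᶠ i# t) (trans (cong (x ^ᶠ_) (sym Q≡rr)) (x^order≡x x)))) ⟩
             x ^ᶠ (κ# t ℕ.* r) ⊛ x ^ᶠ i# t ≡⟨ sym (^-+ x (κ# t ℕ.* r) (i# t)) ⟩
             x ^ᶠ (κ# t ℕ.* r ℕ.+ i# t) ∎

       Θ-zero : (cs : Fin M → C) → sum (λ t → cs t ⊛ Ψ t x) ≡ 0ᶠ → sum (λ t → cs t ^ᶠ r ⊛ e t x) ≡ 0ᶠ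
       Θ-zero cs z with sum (λ t → cs t ^ᶠ r ⊛ e t x) ≟ 0ᶠ
       ... | yes y = y
       ... | no Θ≢0 = ⊥-elim (^-nz _ r Θ≢0 (cancel A _ (begin
             A ⊛ sum (λ t → cs t ^ᶠ r ⊛ e t x) ^ᶠ r ≡⟨ cong (A ⊛_) (sum-^r (λ t → cs t ^ᶠ r ⊛ e t x)) ⟩
             A ⊛ sum (λ t → (cs t ^ᶠ r ⊛ e t x) ^ᶠ r) ≡⟨ *-distribˡ-sum A (λ t → (cs t ^ᶠ r ⊛ e t x) ^ᶠ r) ⟩
             sum (λ t → A ⊛ (cs t ^ᶠ r ⊛ e t x) ^ᶠ r) ≡⟨ sum-cong-≗ (λ t → trans (cong (A ⊛_) (trans (^-*ᵇ (cs t ^ᶠ r) (e t x) r)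
                   (cong (_⊛ e t x ^ᶠ r) (trans (^-^ (cs t) r r) (trans (cong (cs t ^ᶠ_) (sym Q≡rr)) (x^order≡x (cs t)))))))
                 (trans (solve 3 (λ a b c → a :* (b :* c) := b :* (a :* c)) refl A (cs t) (e t x ^ᶠ r)) (trans (cong (cs t ⊛_) (e^r t))
                   (solve 3 (λ a b c → b :* (a :* c) := a :* (b :* c)) refl (A ^ᶠ r) (cs t) (Ψ t x))))) ⟩
             sum (λ t → A ^ᶠ r ⊛ (cs t ⊛ Ψ t x)) ≡⟨ sym (*-distribˡ-sum (A ^ᶠ r) (λ t → cs t ⊛ Ψ t x)) ⟩
             A ^ᶠ r ⊛ sum (λ t → cs t ⊛ Ψ t x) ≡⟨ trans (cong (A ^ᶠ r ⊛_) z) (zeroʳ _) ⟩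
             0ᶠ ∎) (^-nz x (q⁻ ℕ.* l) nz)))
         where open ≡-Reasoning

     degree-bound : ∀ n D → n ℕ.≤ D → D ℕ.< M ℕ.+ q⁻ ℕ.* l → q ℕ.* n ℕ.≤ order ℕ.+ 4 ℕ.* q ℕ.* q ℕ.^ (2 ℕ.^ k)
     degree-bound n D n≤D D< = begin
       q ℕ.* n ≤⟨ ℕP.*-monoʳ-≤ q (ℕP.≤-trans n≤D (ℕP.<⇒≤ D<)) ⟩
       q ℕ.* (M ℕ.+ q⁻ ℕ.* l) ≤⟨ ℕP.*-monoʳ-≤ q (ℕP.+-monoʳ-≤ M (ℕP.*-monoˡ-≤ l (subst (q⁻ ℕ.≤_) q≡ (ℕP.n≤1+n q⁻)))) ⟩
       q ℕ.* (M ℕ.+ r) ≡⟨ solveℕ 2 (λ q l → q ⟨*⟩ ((l ⟨+⟩ conℕ 3) ⟨*⟩ (q ⟨*⟩ l) ⟨+⟩ q ⟨*⟩ l) ≔ (q ⟨*⟩ l) ⟨*⟩ (q ⟨*⟩ l) ⟨+⟩ conℕ 4 ⟨*⟩ q ⟨*⟩ (q ⟨*⟩ l)) refl q l ⟩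
       r ℕ.* r ℕ.+ 4 ℕ.* q ℕ.* r ≡⟨ cong₂ (λ s t → s ℕ.+ 4 ℕ.* q ℕ.* t) (sym Q≡rr) r≡ ⟩
       order ℕ.+ 4 ℕ.* q ℕ.* q ℕ.^ (2 ℕ.^ k) ∎
       where open ℕP.≤-Reasoning

     Solves : C → Set
     Solves x = x ≢ 0ᶠ × FiniteField._⊕_ F (Tr x) (FiniteField._⊛_ F β (Tr (inv x))) ≡ c

   stepanov : ∀ xs → Unique xs → All Solves xs → q ℕ.* length xs ℕ.≤ order ℕ.+ 4 ℕ.* q ℕ.* q ℕ.^ (2 ℕ.^ k)
   stepanov xs uniq sols = finish (linear-dependence Ψ Ψ-poly Ψ-degree<M)
     where
       finish : (Σ (Fin M → C) λ cs → (∃ λ t → cs t ≢ 0ᶠ) × (∀ x → sum (λ t → cs t ⊛ Ψ t x) ≡ 0ᶠ)) →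
                q ℕ.* length xs ℕ.≤ order ℕ.+ 4 ℕ.* q ℕ.* q ℕ.^ (2 ℕ.^ k)
       finish (cs , (t , nz) , z) = conclude (monic-combination (q⁻ ℕ.* l) e e-monic (λ t → cs t ^ᶠ r) (t , ^-nz (cs t) r nz))
         where
           conclude : (Σ ℕ λ D → D ℕ.< M ℕ.+ q⁻ ℕ.* l × Lead D (λ x → sum (λ t → cs t ^ᶠ r ⊛ e t x))) →
                      q ℕ.* length xs ℕ.≤ order ℕ.+ 4 ℕ.* q ℕ.* q ℕ.^ (2 ℕ.^ k)
           conclude (D , D< , lead) = degree-bound (length xs) D
             (roots-bound lead xs uniq (All.map (λ {x} s → Solution.Θ-zero x (proj₁ s) (proj₂ s) cs (z x)) sols)) D<

module KloostermanSums where
 open FiniteSums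
 open PolynomialFunctions
 open FiniteFields
 open QuadraticTower
 open StepanovMethod
 open import Data.Integer as Z using (ℤ; +_; -[1+_]; 0ℤ; 1ℤ; _+_; _*_; -_; _-_; _≤_; _<_)
 open import Data.Integer.Tactic.RingSolver using (solve-∀)
 open import Data.List using ([]; _∷_; length; filter)
 open import Data.List.Relation.Unary.All using ([]; _∷_)
 open import Data.Bool using (if_then_else_)
 open import Relation.Nullary.Decidable using (¬?; _×-dec_)

 module _ where
   *-nonneg : ∀ {a b} → 0ℤ ≤ a → 0ℤ ≤ b → 0ℤ ≤ a * b
   *-nonneg {+ m} {+ n} _ _ = subst (0ℤ ≤_) (ℤP.pos-* m n) (Z.+≤+ ℕ.z≤n)

   +-nonneg : ∀ {a b} → 0ℤ ≤ a → 0ℤ ≤ b → 0ℤ ≤ a + b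
   +-nonneg = ℤP.+-mono-≤

   ≤-by : ∀ {a b c} → 0ℤ ≤ c → b - a ≡ c → a ≤ b
   ≤-by p e = ℤP.0≤i-j⇒j≤i (subst (0ℤ ≤_) (sym e) p)

   0≤- : ∀ {a b} → a ≤ b → 0ℤ ≤ b - a
   0≤- = ℤP.i≤j⇒0≤j-i

   0≤sq : ∀ a → 0ℤ ≤ a * a
   0≤sq (+ n) = *-nonneg {+ n} {+ n} (Z.+≤+ ℕ.z≤n) (Z.+≤+ ℕ.z≤n)
   0≤sq -[1+ n ] = Z.+≤+ ℕ.z≤n

   0≤+ : ∀ n → 0ℤ ≤ + n
   0≤+ n = Z.+≤+ ℕ.z≤n

   *-cancel-≤ : ∀ {a b c} → 0ℤ < c → c * a ≤ c * b → a ≤ b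
   *-cancel-≤ {a} {b} {c} 0<c p = ℤP.*-cancelˡ-≤-pos a b c {{Z.positive 0<c}} p

   sq-≤ : ∀ {x y} → 0ℤ ≤ y → x * x ≤ y * y → x ≤ y
   sq-≤ {x} {y} 0≤y p with ℤP._≤?_ x y
   ... | yes q = q
   ... | no q = ⊥-elim (ℤP.<⇒≱ (ℤP.≤-<-trans (ℤP.*-monoˡ-≤-nonNeg y {{Z.nonNegative 0≤y}} (ℤP.<⇒≤ y<x))
       (subst (_< x * x) (ℤP.*-comm x y) (ℤP.*-monoˡ-<-pos x {{Z.positive (ℤP.≤-<-trans 0≤y y<x)}} y<x))) p)
     where y<x = ℤP.≰⇒> q

 and-indicator : ∀ {A B : Set} (a : Dec A) (b : Dec B) → (if does a then 0ℤ else 1ℤ) Z.* (if does b then 1ℤ else 0ℤ) ≡ (if does (¬? a ×-dec b) then 1ℤ else 0ℤ)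
 and-indicator (yes _) (yes _) = refl
 and-indicator (yes _) (no _) = refl
 and-indicator (no _) (yes _) = refl
 and-indicator (no _) (no _) = refl

 not-indicator : ∀ {A B : Set} (a : Dec A) (b : Dec B) → (A → B) → (¬ A → ¬ B) → (if does a then 0ℤ else 1ℤ) ≡ (if does b then 0ℤ else 1ℤ)
 not-indicator (yes _) (yes _) f g = refl
 not-indicator (no _) (no _) f g = refl
 not-indicator (yes x) (no ¬y) f g = ⊥-elim (¬y (f x))
 not-indicator (no ¬x) (yes y) f g = ⊥-elim (g ¬x y)

 module NonzeroSums (K : FiniteField) where
   open FiniteField K

   nz : C → ℤ
   nz x = if does (x ≟ 0ᶠ) then 0ℤ else 1ℤ

   nz≡ : ∀ x → nz x ≡ 1ℤ - δ x 0ᶠ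
   nz≡ x with x ≟ 0ᶠ
   ... | yes _ = refl
   ... | no _ = refl

   nz-0 : nz 0ᶠ ≡ 0ℤ
   nz-0 with 0ᶠ ≟ 0ᶠ
   ... | yes _ = refl
   ... | no n = ⊥-elim (n refl)

   nz-1 : ∀ {x} → x ≢ 0ᶠ → nz x ≡ 1ℤ
   nz-1 {x} n with x ≟ 0ᶠ
   ... | yes e = ⊥-elim (n e)
   ... | no _ = refl

   nz-cong : ∀ {x} {f g : ℤ} → (x ≢ 0ᶠ → f ≡ g) → nz x * f ≡ nz x * g
   nz-cong {x} {f} {g} e with x ≟ 0ᶠ
   ... | yes _ = refl
   ... | no n = cong (1ℤ *_) (e n)

   ∑-nz : ∀ f → ∑ els (λ x → nz x * f x) ≡ ∑ els f - f 0ᶠ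
   ∑-nz f = trans (∑-cong els (λ x → trans (cong (_* f x) (nz≡ x)) (lem (δ x 0ᶠ) (f x))))
     (trans (∑-- els f (λ x → δ x 0ᶠ * f x)) (cong (λ t → ∑ els f - t) (sift fin 0ᶠ f)))
     where
       lem : ∀ a b → (1ℤ - a) * b ≡ b - a * b
       lem = solve-∀

   nz-⊛ : ∀ x y → nz (x ⊛ y) ≡ nz x * nz y
   nz-⊛ x y with x ≟ 0ᶠ | y ≟ 0ᶠ
   ... | yes refl | _ = trans (cong nz (zeroˡ y)) nz-0
   ... | no _ | yes refl = trans (cong nz (zeroʳ x)) nz-0
   ... | no a | no b = nz-1 (*-nz x y a b)

   nz-inv : ∀ x → nz (inv x) ≡ nz x
   nz-inv x with x ≟ 0ᶠ
   ... | yes refl = trans (cong nz inv-0) nz-0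
   ... | no n = nz-1 (inv-nz x n)

   neg-nz : ∀ {x} → x ≢ 0ᶠ → ⊖ x ≢ 0ᶠ
   neg-nz {x} n e = n (trans (Solver.solve 1 (λ x → x Solver.:= Solver.:- (Solver.:- x)) refl x)
     (trans (cong ⊖_ e) (Solver.solve 0 (Solver.:- Solver.con 0ℤ Solver.:= Solver.con 0ℤ) refl)))

   nz-neg : ∀ x → nz (⊖ x) ≡ nz x
   nz-neg x with x ≟ 0ᶠ
   ... | yes refl = trans (cong nz (Solver.solve 0 (Solver.:- Solver.con 0ℤ Solver.:= Solver.con 0ℤ) refl)) nz-0
   ... | no n = nz-1 (neg-nz n)

   inv-neg : ∀ x → inv (⊖ x) ≡ ⊖ inv x
   inv-neg x with x ≟ 0ᶠ
   ... | yes refl = trans (cong inv neg-0) (trans inv-0 (trans (sym neg-0) (cong ⊖_ (sym inv-0))))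
     where
       neg-0 : ⊖ 0ᶠ ≡ 0ᶠ
       neg-0 = Solver.solve 0 (Solver.:- Solver.con 0ℤ Solver.:= Solver.con 0ℤ) refl
   ... | no n = inv-unique _ _ (trans (Solver.solve 2 (λ x i → (Solver.:- x) Solver.:* (Solver.:- i) Solver.:= x Solver.:* i) refl x (inv x)) (inv-r x n))

   ∑-inv : ∀ h → ∑ els (h ∘ inv) ≡ ∑ els h
   ∑-inv = ∑-reindex fin fin inv inv inv-inv inv-inv

   neg-neg : ∀ x → ⊖ (⊖ x) ≡ x
   neg-neg = Solver.solve 1 (λ x → Solver.:- (Solver.:- x) Solver.:= x) refl

   ∑-negate : ∀ h → ∑ els (h ∘ ⊖_) ≡ ∑ els h
   ∑-negate = ∑-reindex fin fin ⊖_ ⊖_ neg-neg neg-neg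

   ∑-scale : ∀ c → c ≢ 0ᶠ → ∀ h → ∑ els (λ x → h (c ⊛ x)) ≡ ∑ els h
   ∑-scale c n = ∑-reindex fin fin (c ⊛_) (inv c ⊛_)
     (λ a → trans (sym (*-assoc _ _ _)) (trans (cong (_⊛ a) (inv-l c n)) (*-identityˡ a)))
     (λ a → trans (sym (*-assoc _ _ _)) (trans (cong (_⊛ a) (inv-r c n)) (*-identityˡ a)))

   ∑-shift : ∀ c h → ∑ els (λ x → h (x ⊕ c)) ≡ ∑ els h
   ∑-shift c = ∑-reindex fin fin (_⊕ c) (_⊕ ⊖ c)
     (λ a → Solver.solve 2 (λ a c → a Solver.:+ c Solver.:+ (Solver.:- c) Solver.:= a) refl a c)
     (λ a → Solver.solve 2 (λ a c → a Solver.:+ (Solver.:- c) Solver.:+ c Solver.:= a) refl a c)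

   ∑-reflect : ∀ c h → ∑ els (λ x → h (c ⊕ ⊖ x)) ≡ ∑ els h
   ∑-reflect c = ∑-reindex fin fin (λ x → c ⊕ ⊖ x) (λ x → c ⊕ ⊖ x)
     (λ a → Solver.solve 2 (λ a c → c Solver.:+ (Solver.:- (c Solver.:+ (Solver.:- a))) Solver.:= a) refl a c)
     (λ a → Solver.solve 2 (λ a c → c Solver.:+ (Solver.:- (c Solver.:+ (Solver.:- a))) Solver.:= a) refl a c)

 record PositiveDefinite (F : FiniteField) : Set₁ where
   open FiniteField F
   field
     ψ     : C → C → ℤ
     B     : ℤ
     0≤B   : 0ℤ ≤ B
     ψ-0   : ψ 0ᶠ 0ᶠ ≡ B
     line  : ∀ a → ∑ els (λ c → ψ c a) ≡ 0ℤ
     psd   : ∀ {I : Set} (is : List I) (n : I → ℤ) (z w : I → C) →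
             0ℤ ≤ ∑ is (λ i → ∑ is (λ j → n i * n j * ψ (z j ⊕ ⊖ z i) (w j ⊕ ⊖ w i)))
     cauchy : ∀ {I : Set} (is : List I) (n : I → ℤ) (z w : I → C) →
             ∑ is (λ i → n i * ψ (z i) (w i)) * ∑ is (λ i → n i * ψ (z i) (w i))
               ≤ B * ∑ is (λ i → ∑ is (λ j → n i * n j * ψ (z j ⊕ ⊖ z i) (w j ⊕ ⊖ w i)))

 -- Weil's bound in operator form. T k is the sum over the field with Q = q^(2^k) elements. Each monic quadratic with
 -- nonzero constant term has exactly two roots in K counted with multiplicity or two in the quadratic extension, whence
 -- E k + T (k + 1) ≤ 2 Q B; with T² ≤ B E this makes - T (k + 1) / √Q grow under iteration once it is too large,
 -- while the point count of Stepanov's method bounds it uniformly in k.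
 module KloostermanBound (F : FiniteField) (p m h : ℕ) (p-prime : Prime p) (p-odd : p ≡ suc (2 ℕ.* h))
                         (orderF : FiniteField.order F ≡ p ℕ.^ m) (P : PositiveDefinite F) where
   open FieldTower F p m h p-prime p-odd orderF
   open PositiveDefinite P
   private module F = FiniteField F
   open F using () renaming (order to q)

   level : ∀ k → TowerLevel k
   level zero = base
   level (suc k) = next (level k)

   module At (k : ℕ) where
     open TowerLevel (level k) public
     open NonzeroSums K public

     Q : ℤ
     Q = + order

     Tr-0 : Tr 0ᶠ ≡ F.0ᶠ
     Tr-0 = F.x-x _ _ (trans (cong (λ t → t F.⊕ F.⊖ F.0ᶠ) (F.Solver.solve 1 (λ a → a F.Solver.:= a F.Solver.:+ a F.Solver.:+ (F.Solver.:- a)) refl (Tr 0ᶠ)))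
       (trans (cong (λ t → t F.⊕ F.⊖ Tr 0ᶠ F.⊕ F.⊖ F.0ᶠ) (trans (sym (Tr-⊕ 0ᶠ 0ᶠ)) (cong Tr (+-identityˡ 0ᶠ))))
         (F.Solver.solve 1 (λ a → a F.Solver.:+ (F.Solver.:- a) F.Solver.:+ (F.Solver.:- F.Solver.con 0ℤ) F.Solver.:= F.Solver.con 0ℤ) refl (Tr 0ᶠ))))

     Tr-neg : ∀ x → Tr (⊖ x) ≡ F.⊖ Tr x
     Tr-neg x = trans (F.Solver.solve 2 (λ a b → b F.Solver.:= a F.Solver.:+ b F.Solver.:+ (F.Solver.:- a)) refl (Tr x) (Tr (⊖ x)))
       (trans (cong (F._⊕ F.⊖ Tr x) (trans (sym (Tr-⊕ x (⊖ x))) (trans (cong Tr (-‿inverseʳ x)) Tr-0))) (F.+-identityˡ _))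

     Tr-diff : ∀ x y → Tr (x ⊕ ⊖ y) ≡ Tr x F.⊕ F.⊖ Tr y
     Tr-diff x y = trans (Tr-⊕ x (⊖ y)) (cong (Tr x F.⊕_) (Tr-neg y))

     T E S : ℤ
     T = ∑ els (λ s → nz s * ψ (Tr s) (Tr (inv s)))
     E = ∑ els (λ s → ∑ els (λ t → nz s * nz t * ψ (Tr s F.⊕ Tr t) (Tr (inv s) F.⊕ Tr (inv t))))
     S = ∑ els (λ w → ψ F.0ᶠ (Tr w))

     1≤Q : 1ℤ ≤ Q
     1≤Q = Z.+≤+ (ℕP.<⇒≤ 2≤order)

     T²≤BE : T * T ≤ B * E
     T²≤BE = subst (λ t → T * T ≤ B * t) reflect (cauchy els nz Tr (Tr ∘ inv))
       where
         reflect : ∑ els (λ s → ∑ els (λ t → nz s * nz t * ψ (Tr t F.⊕ F.⊖ Tr s) (Tr (inv t) F.⊕ F.⊖ Tr (inv s)))) ≡ E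
         reflect = trans (sym (∑-negate (λ s → ∑ els (λ t → nz s * nz t * ψ (Tr t F.⊕ F.⊖ Tr s) (Tr (inv t) F.⊕ F.⊖ Tr (inv s))))))
           (∑-cong els (λ s → ∑-cong els (λ t → cong₂ _*_ (cong (_* nz t) (nz-neg s)) (cong₂ ψ
             (trans (cong (λ y → Tr t F.⊕ F.⊖ y) (Tr-neg s)) (swap (Tr t) (Tr s)))
             (trans (cong (λ y → Tr (inv t) F.⊕ F.⊖ y) (trans (cong Tr (inv-neg s)) (Tr-neg (inv s)))) (swap (Tr (inv t)) (Tr (inv s))))))))
           where
             swap : ∀ a b → a F.⊕ F.⊖ (F.⊖ b) ≡ b F.⊕ a
             swap = F.Solver.solve 2 (λ a b → a F.Solver.:+ (F.Solver.:- (F.Solver.:- b)) F.Solver.:= b F.Solver.:+ a) refl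

     0≤S : 0ℤ ≤ S
     0≤S = *-cancel-≤ {0ℤ} {S} {Q} (ℤP.<-≤-trans (Z.+<+ (ℕ.s≤s ℕ.z≤n)) 1≤Q)
       (ℤP.≤-trans (ℤP.≤-reflexive (ℤP.*-zeroʳ Q)) (ℤP.≤-trans (psd els (λ _ → 1ℤ) (λ _ → F.0ᶠ) Tr) (ℤP.≤-reflexive
         (trans (∑-cong els (λ i → trans (∑-cong els (λ j → trans (ℤP.*-identityˡ _) (cong₂ ψ (F.-‿inverseʳ _) (sym (Tr-diff j i)))))
             (∑-shift (⊖ i) (λ j → ψ F.0ᶠ (Tr j))))) (∑-const els S)))))

     G : C → C → ℤ
     G u v = nz v * ψ (Tr u) (Tr (u ⊛ inv v))

     R : ℤ
     R = ∑ els (λ u → ∑ els (λ v → G u v))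

     E≡ : E ≡ ∑ els (λ s → ∑ els (λ t → G (s ⊕ t) (s ⊛ t)))
     E≡ = ∑-cong els (λ s → ∑-cong els (λ t → trans (cong (_* ψ (Tr s F.⊕ Tr t) (Tr (inv s) F.⊕ Tr (inv t))) (sym (nz-⊛ s t)))
         (nz-cong {s ⊛ t} (λ n → cong₂ ψ (sym (Tr-⊕ s t)) (trans (sym (Tr-⊕ (inv s) (inv t))) (cong Tr (sums s t n)))))))
       where
         sums : ∀ s t → s ⊛ t ≢ 0ᶠ → inv s ⊕ inv t ≡ (s ⊕ t) ⊛ inv (s ⊛ t)
         sums s t n = sym (trans (cong ((s ⊕ t) ⊛_) (inv-* s t)) (trans
           (solve 4 (λ s t i j → (s :+ t) :* (i :* j) := (t :* j) :* i :+ (s :* i) :* j) refl s t (inv s) (inv t))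
           (cong₂ _⊕_ (trans (cong (_⊛ inv s) (inv-r t (λ e → n (trans (cong (s ⊛_) e) (zeroʳ s))))) (*-identityˡ _))
                      (trans (cong (_⊛ inv t) (inv-r s (λ e → n (trans (cong (_⊛ t) e) (zeroˡ t))))) (*-identityˡ _)))))

   open At using (T; E; S; Q)

   line-K : ∀ k a → ∑ (At.els k) (λ s → ψ (At.Tr k s) a) ≡ 0ℤ
   line-K zero a = line a
   line-K (suc k) a = trans (∑-cart els els _) (trans (∑-cong els (λ x → ∑-const els _))
       (trans (∑-*ˡ els (+ order) _) (trans (cong ((+ order) *_) scaled) (ℤP.*-zeroʳ (+ order)))))
     where
       open At k
       scaled : ∑ els (λ x → ψ (Tr (x ⊕ x)) a) ≡ 0ℤ
       scaled = trans (∑-cong els (λ x → cong (λ y → ψ (Tr y) a) (solve 1 (λ x → x :+ x := con (+ 2) :* x) refl x)))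
         (trans (∑-scale two two≢0 (λ x → ψ (Tr x) a)) (line-K k a))

   R≡ : ∀ k → At.R k ≡ Q k * B - S k
   R≡ k = begin
     R ≡⟨ ∑-swap els els G ⟩
     ∑ els (λ v → ∑ els (λ u → nz v * ψ (Tr u) (Tr (u ⊛ inv v)))) ≡⟨ ∑-cong els (λ v → ∑-cong els (λ u → cong (_* ψ (Tr u) (Tr (u ⊛ inv v))) (sym (nz-inv v)))) ⟩
     ∑ els (λ v → ∑ els (λ u → nz (inv v) * ψ (Tr u) (Tr (u ⊛ inv v)))) ≡⟨ ∑-inv (λ w → ∑ els (λ u → nz w * ψ (Tr u) (Tr (u ⊛ w)))) ⟩
     ∑ els (λ w → ∑ els (λ u → nz w * ψ (Tr u) (Tr (u ⊛ w)))) ≡⟨ ∑-swap els els _ ⟩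
     ∑ els f ≡⟨ lem₁ (∑ els f) (f 0ᶠ) ⟩
     f 0ᶠ + (∑ els f - f 0ᶠ) ≡⟨ +ˡ (f 0ᶠ) (trans (sym (∑-nz f)) (trans (∑-cong els (λ u → nz-cong {u} (f≡f′ u))) (∑-nz f′))) ⟩
     f 0ᶠ + (∑ els f′ - f′ 0ᶠ) ≡⟨ cong₂ _+_ f0 (cong₂ _-_ ∑f′ f′0) ⟩
     (Q k * B - B) + (0ℤ - (S k - B)) ≡⟨ lem₂ (Q k * B) B (S k) ⟩
     Q k * B - S k ∎
     where
       open ≡-Reasoning
       open At k hiding (T; E; S; Q)
       f f′ : C → ℤ
       f u = ∑ els (λ w → nz w * ψ (Tr u) (Tr (u ⊛ w)))
       f′ u = ∑ els (λ w → nz w * ψ (Tr u) (Tr w))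
       lem₁ : ∀ a b → a ≡ b + (a - b)
       lem₁ = solve-∀
       lem₂ : ∀ a b s → (a - b) + (0ℤ - (s - b)) ≡ a - s
       lem₂ = solve-∀
       f≡f′ : ∀ u → u ≢ 0ᶠ → f u ≡ f′ u
       f≡f′ u n = trans (∑-cong els (λ w → cong (_* ψ (Tr u) (Tr (u ⊛ w))) (sym (trans (nz-⊛ u w) (trans (cong (_* nz w) (nz-1 n)) (ℤP.*-identityˡ _))))))
         (∑-scale u n (λ w → nz w * ψ (Tr u) (Tr w)))
       ψ00 : ψ (Tr 0ᶠ) (Tr 0ᶠ) ≡ B
       ψ00 = trans (cong₂ ψ Tr-0 Tr-0) ψ-0
       f0 : f 0ᶠ ≡ Q k * B - B
       f0 = trans (∑-nz _) (cong₂ _-_ (trans (∑-cong els (λ w → trans (cong (λ y → ψ (Tr 0ᶠ) (Tr y)) (zeroˡ w)) ψ00)) (∑-const els B))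
          (trans (cong (λ y → ψ (Tr 0ᶠ) (Tr y)) (zeroˡ 0ᶠ)) ψ00))
       f′0 : f′ 0ᶠ ≡ S k - B
       f′0 = trans (∑-nz _) (cong₂ _-_ (∑-cong els (λ w → cong (λ y → ψ y (Tr w)) Tr-0)) ψ00)
       ∑f′ : ∑ els f′ ≡ 0ℤ
       ∑f′ = trans (∑-swap els els _) (trans (∑-cong els (λ w → trans (∑-*ˡ els (nz w) _) (trans (cong (nz w *_) (line-K k (Tr w))) (ℤP.*-zeroʳ (nz w))))) (∑-zero els))

   E+T : ∀ k → E k + T (suc k) ≡ + 2 * At.R k
   E+T k = begin
     E k + T (suc k) ≡⟨ cong₂ _+_ (trans E≡ (trans (∑-pairs _) (∑-cong els (λ x → ∑-cong els (λ y → cong₂ G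
         (solve 2 (λ x y → x :+ y :+ (x :+ (:- y)) := x :+ x) refl x y)
         (solve 2 (λ x y → (x :+ y) :* (x :+ (:- y)) := x :* x :+ (:- (y :* y))) refl x y)))))) T≡ ⟩
     ∑ els (λ x → ∑ els (λ y → G (x ⊕ x) (x ⊛ x ⊕ ⊖ (y ⊛ y)))) + ∑ els (λ x → ∑ els (λ y → G (x ⊕ x) (x ⊛ x ⊕ ⊖ (d ⊛ (y ⊛ y)))))
       ≡⟨ trans (sym (∑-+ els _ _)) (∑-cong els (λ x → trans (sym (∑-+ els _ _))
            (trans (∑-squares d (proj₂ nonsquare) (λ D → G (x ⊕ x) (x ⊛ x ⊕ ⊖ D))) (cong (+ 2 *_) (∑-reflect (x ⊛ x) (G (x ⊕ x))))))) ⟩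
     ∑ els (λ x → + 2 * ∑ els (G (x ⊕ x))) ≡⟨ ∑-*ˡ els (+ 2) _ ⟩
     + 2 * ∑ els (λ x → ∑ els (G (x ⊕ x))) ≡⟨ cong (+ 2 *_) (trans (∑-cong els (λ x → cong (λ y → ∑ els (G y))
          (solve 1 (λ x → x :+ x := con (+ 2) :* x) refl x))) (∑-scale two two≢0 (λ u → ∑ els (G u)))) ⟩
     + 2 * R ∎
     where
       open ≡-Reasoning
       open At k hiding (T; E; S; Q)
       d = proj₁ nonsquare
       open QuadraticExtension K d (proj₂ nonsquare) using (norm; norm-nz)
       nz-L : ∀ x y → NonzeroSums.nz (TowerLevel.K (level (suc k))) (x , y) ≡ nz (norm (x , y))
       nz-L x y = not-indicator (TowerLevel._≟_ (level (suc k)) (x , y) (0ᶠ , 0ᶠ)) (norm (x , y) ≟ 0ᶠ) norm-0 (norm-nz x y)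
         where
           norm-0 : (x , y) ≡ (0ᶠ , 0ᶠ) → norm (x , y) ≡ 0ᶠ
           norm-0 refl = solve 1 (λ d → con 0ℤ :* con 0ℤ :+ (:- (d :* (con 0ℤ :* con 0ℤ))) := con 0ℤ) refl d
       T≡ : T (suc k) ≡ ∑ els (λ x → ∑ els (λ y → G (x ⊕ x) (x ⊛ x ⊕ ⊖ (d ⊛ (y ⊛ y)))))
       T≡ = trans (∑-cart els els _) (∑-cong els (λ x → ∑-cong els (λ y → cong₂ _*_ (nz-L x y)
         (cong (λ t → ψ (Tr (x ⊕ x)) (Tr t)) (sym (distribʳ (inv (norm (x , y))) x x))))))

   E≤ : ∀ k → E k ≤ + 2 * (Q k * B) - T (suc k)
   E≤ k = ≤-by (*-nonneg {+ 2} (0≤+ 2) (At.0≤S k)) (trans (cong (λ e → + 2 * (Q k * B) - T (suc k) - e) E≡′) (lem (Q k * B) (T (suc k)) (S k)))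
     where
       E≡′ : E k ≡ + 2 * (Q k * B - S k) - T (suc k)
       E≡′ = trans (lem′ (E k) (T (suc k))) (cong (_- T (suc k)) (trans (E+T k) (cong (+ 2 *_) (R≡ k))))
         where
           lem′ : ∀ e t → e ≡ (e + t) - t
           lem′ = solve-∀
       lem : ∀ a t s → + 2 * a - t - (+ 2 * (a - s) - t) ≡ + 2 * s
       lem = solve-∀

   ψ≤B : ∀ c a → ψ c a ≤ B
   ψ≤B c a = sq-≤ 0≤B (ℤP.≤-trans (ℤP.≤-reflexive (lem (ψ c a)))
       (ℤP.≤-trans (cauchy (F.0ᶠ ∷ []) (λ _ → 1ℤ) (λ _ → c) (λ _ → a))
         (ℤP.≤-reflexive (cong (B *_) (trans (lem′ _) (trans (cong₂ ψ (F.-‿inverseʳ c) (F.-‿inverseʳ a)) ψ-0))))))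
     where
       lem : ∀ x → x * x ≡ (1ℤ * x + 0ℤ) * (1ℤ * x + 0ℤ)
       lem = solve-∀
       lem′ : ∀ x → (1ℤ * 1ℤ * x + 0ℤ) + 0ℤ ≡ x
       lem′ = solve-∀

   √Q : ℕ → ℤ
   √Q k = + (q ℕ.^ (2 ℕ.^ k))

   -- The solution counts on the q + 1 lines through (c , a) determine the number of s with (Tr s , Tr s⁻¹) = (c , a).
   module PointCount (k : ℕ) where
     open At (suc k) hiding (T; E; S; Q)
     open F using () renaming (δ to δF; els to elsF; fin to finF)

     Y Z : ℤ
     Y = + order + + 4 * + q * √Q k
     Z = (+ q + 1ℤ) * Y - + q * (+ order - 1ℤ)

     N : F.C → F.C → ℤ
     N β γ = ∑ els (λ s → nz s * δF (Tr s F.⊕ β F.⊛ Tr (inv s)) γ)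

     N≤ : ∀ β γ → + q * N β γ ≤ Y
     N≤ β γ = subst (λ t → + q * t ≤ Y) (sym N≡) (subst₂ _≤_ (ℤP.pos-* q _) cast (Z.+≤+ count))
       where
         P? : ∀ s → Dec (s ≢ 0ᶠ × Tr s F.⊕ β F.⊛ Tr (inv s) ≡ γ)
         P? s = ¬? (s ≟ 0ᶠ) ×-dec ((Tr s F.⊕ β F.⊛ Tr (inv s)) F.≟ γ)
         count : q ℕ.* length (filter P? els) ℕ.≤ order ℕ.+ 4 ℕ.* q ℕ.* q ℕ.^ (2 ℕ.^ k)
         count = StepanovBound.stepanov F p m h p-prime p-odd orderF (level (suc k)) β γ (filter P? els)
                   (UP.filter⁺ P? unique) (AllP.all-filter P? els)
         indicator : ∀ s → nz s * δF (Tr s F.⊕ β F.⊛ Tr (inv s)) γ ≡ (if does (P? s) then 1ℤ else 0ℤ)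
         indicator s = and-indicator (s ≟ 0ᶠ) ((Tr s F.⊕ β F.⊛ Tr (inv s)) F.≟ γ)
         N≡ : N β γ ≡ + length (filter P? els)
         N≡ = trans (∑-cong els indicator) (∑-indicator fin P?)
         cast : + (order ℕ.+ 4 ℕ.* q ℕ.* q ℕ.^ (2 ℕ.^ k)) ≡ Y
         cast = trans (ℤP.pos-+ order _) (+ˡ (+ order) (trans (ℤP.pos-* (4 ℕ.* q) _) (cong (_* √Q k) (ℤP.pos-* 4 q))))

     n e : F.C → F.C → ℤ
     n c a = ∑ els (λ s → nz s * (δF c (Tr s) * δF a (Tr (inv s))))
     e c a = Z - + q * + q * n c a

     lines : ∀ c a → ∑ elsF (λ β → N β (c F.⊕ β F.⊛ a)) + N F.0ᶠ a ≡ + q * n c a + (+ order - 1ℤ)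
     lines c a = begin
       ∑ elsF (λ β → N β (c F.⊕ β F.⊛ a)) + N F.0ᶠ a ≡⟨ cong₂ _+_ (∑-swap elsF els _) vertical ⟩
       ∑ els (λ s → ∑ elsF (λ β → nz s * δF (Tr s F.⊕ β F.⊛ Tr (inv s)) (c F.⊕ β F.⊛ a))) + ∑ els (λ s → nz s * δF (Tr (inv s)) a) ≡⟨ sym (∑-+ els _ _) ⟩
       ∑ els (λ s → ∑ elsF (λ β → nz s * δF (Tr s F.⊕ β F.⊛ Tr (inv s)) (c F.⊕ β F.⊛ a)) + nz s * δF (Tr (inv s)) a)
         ≡⟨ ∑-cong els (λ s → trans (cong (_+ nz s * δF (Tr (inv s)) a) (∑-*ˡ elsF (nz s) _)) (trans (sym (ℤP.*-distribˡ-+ (nz s) _ (δF (Tr (inv s)) a)))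
              (trans (cong (nz s *_) (pointwise (Tr s) (Tr (inv s)))) (lem (nz s) (+ q) _)))) ⟩
       ∑ els (λ s → + q * (nz s * (δF c (Tr s) * δF a (Tr (inv s)))) + nz s * 1ℤ) ≡⟨ trans (∑-+ els _ _) (cong₂ _+_ (∑-*ˡ els (+ q) _) (trans (∑-nz (λ _ → 1ℤ)) (cong (_- 1ℤ) (trans (∑-const els 1ℤ) (ℤP.*-identityʳ (+ order)))))) ⟩
       + q * n c a + (+ order - 1ℤ) ∎
       where
         open ≡-Reasoning
         lem : ∀ a b c → a * (b * c + 1ℤ) ≡ b * (a * c) + a * 1ℤ
         lem = solve-∀
         vertical : N F.0ᶠ a ≡ ∑ els (λ s → nz s * δF (Tr (inv s)) a)
         vertical = trans (sym (∑-inv (λ s → nz s * δF (Tr s F.⊕ F.0ᶠ F.⊛ Tr (inv s)) a)))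
           (∑-cong els (λ s → cong₂ _*_ (nz-inv s) (cong (λ t → δF t a) (trans (cong (Tr (inv s) F.⊕_) (F.zeroˡ _)) (F.+-identityʳ _)))))
         pointwise : ∀ t v → ∑ elsF (λ β → δF (t F.⊕ β F.⊛ v) (c F.⊕ β F.⊛ a)) + δF v a ≡ + q * (δF c t * δF a v) + 1ℤ
         pointwise t v = go (v F.≟ a)
           where
             go : Dec (v ≡ a) → ∑ elsF (λ β → δF (t F.⊕ β F.⊛ v) (c F.⊕ β F.⊛ a)) + δF v a ≡ + q * (δF c t * δF a v) + 1ℤ
             go (yes refl) = cong₂ _+_ (trans (∑-cong elsF (λ β → δ-cong finF finF {t F.⊕ β F.⊛ v} {c F.⊕ β F.⊛ v} {c} {t}
                  (λ e → sym (cancelʳ _ t c e)) (λ e → cong (F._⊕ β F.⊛ v) (sym e))))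
                (trans (∑-const elsF (δF c t)) (cong (+ q *_) (sym (trans (cong (δF c t *_) (F.δ-≡ refl)) (ℤP.*-identityʳ _)))))) (F.δ-≡ refl)
               where
                 cancelʳ : ∀ b x y → x F.⊕ b ≡ y F.⊕ b → x ≡ y
                 cancelʳ b x y e = trans (F.Solver.solve 2 (λ x b → x F.Solver.:= x F.Solver.:+ b F.Solver.:+ (F.Solver.:- b)) refl x b)
                   (trans (cong (F._⊕ F.⊖ b) e) (F.Solver.solve 2 (λ x b → x F.Solver.:+ b F.Solver.:+ (F.Solver.:- b) F.Solver.:= x) refl y b))
             go (no v≢a) = trans (cong₂ _+_ (trans (∑-cong elsF (λ β → δ-cong finF finF {t F.⊕ β F.⊛ v} {c F.⊕ β F.⊛ a} {β} {β₀} (to β) (from β))) (∑-δ finF β₀)) (F.δ-≢ v≢a))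
                (sym (trans (cong (λ y → + q * (δF c t * y) + 1ℤ) (F.δ-≢ (v≢a ∘ sym))) (lem₀ (+ q) (δF c t))))
               where
                 lem₀ : ∀ a b → a * (b * 0ℤ) + 1ℤ ≡ 1ℤ + 0ℤ
                 lem₀ = solve-∀
                 w = v F.⊕ F.⊖ a
                 w≢0 : w ≢ F.0ᶠ
                 w≢0 e = v≢a (F.x-x v a e)
                 β₀ = (c F.⊕ F.⊖ t) F.⊛ F.inv w
                 open F.Solver using () renaming (solve to solveF; _:=_ to _≔_; _:+_ to _∔_; _:*_ to _∙_; :-_ to ∸_)
                 to : ∀ β → t F.⊕ β F.⊛ v ≡ c F.⊕ β F.⊛ a → β ≡ β₀
                 to β e = F.*-cancelˡ w β β₀ w≢0 (begin
                   w F.⊛ β ≡⟨ solveF 4 (λ v a t β → (v ∔ (∸ a)) ∙ β ≔ (t ∔ β ∙ v) ∔ (∸ (t ∔ β ∙ a))) refl v a t β ⟩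
                   (t F.⊕ β F.⊛ v) F.⊕ F.⊖ (t F.⊕ β F.⊛ a) ≡⟨ cong (F._⊕ F.⊖ (t F.⊕ β F.⊛ a)) e ⟩
                   (c F.⊕ β F.⊛ a) F.⊕ F.⊖ (t F.⊕ β F.⊛ a) ≡⟨ solveF 4 (λ c a t β → (c ∔ β ∙ a) ∔ (∸ (t ∔ β ∙ a)) ≔ c ∔ (∸ t)) refl c a t β ⟩
                   c F.⊕ F.⊖ t ≡⟨ sym (trans (cong ((c F.⊕ F.⊖ t) F.⊛_) (F.inv-r w w≢0)) (F.*-identityʳ _)) ⟩
                   (c F.⊕ F.⊖ t) F.⊛ (w F.⊛ F.inv w) ≡⟨ solveF 3 (λ x w i → x ∙ (w ∙ i) ≔ w ∙ (x ∙ i)) refl (c F.⊕ F.⊖ t) w (F.inv w) ⟩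
                   w F.⊛ β₀ ∎)
                 from : ∀ β → β ≡ β₀ → t F.⊕ β F.⊛ v ≡ c F.⊕ β F.⊛ a
                 from β refl = begin
                   t F.⊕ β₀ F.⊛ v ≡⟨ solveF 4 (λ v a t β → t ∔ β ∙ v ≔ β ∙ (v ∔ (∸ a)) ∔ (t ∔ β ∙ a)) refl v a t β₀ ⟩
                   β₀ F.⊛ w F.⊕ (t F.⊕ β₀ F.⊛ a) ≡⟨ cong (F._⊕ (t F.⊕ β₀ F.⊛ a)) (trans (F.*-assoc _ _ _) (trans (cong ((c F.⊕ F.⊖ t) F.⊛_) (F.inv-l w w≢0)) (F.*-identityʳ _))) ⟩
                   (c F.⊕ F.⊖ t) F.⊕ (t F.⊕ β₀ F.⊛ a) ≡⟨ solveF 3 (λ c t x → (c ∔ (∸ t)) ∔ (t ∔ x) ≔ c ∔ x) refl c t (β₀ F.⊛ a) ⟩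
                   c F.⊕ β₀ F.⊛ a ∎

     0≤e : ∀ c a → 0ℤ ≤ e c a
     0≤e c a = subst (0ℤ ≤_) eq (0≤- (ℤP.+-mono-≤ (∑-mono elsF {λ β → + q * N β (c F.⊕ β F.⊛ a)} {λ _ → Y} (λ β → N≤ β (c F.⊕ β F.⊛ a))) (N≤ F.0ᶠ a)))
       where
         eq : ∑ elsF (λ _ → Y) + Y - (∑ elsF (λ β → + q * N β (c F.⊕ β F.⊛ a)) + + q * N F.0ᶠ a) ≡ e c a
         eq = trans (cong₂ (λ s t → s + Y - t) (∑-const elsF Y) (trans (cong (_+ + q * N F.0ᶠ a) (∑-*ˡ elsF (+ q) _))
             (trans (sym (ℤP.*-distribˡ-+ (+ q) _ (N F.0ᶠ a))) (cong (+ q *_) (lines c a))))) (lem (+ q) Y (n c a) (+ order))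
           where
             lem : ∀ q Y n Q → q * Y + Y - q * (q * n + (Q - 1ℤ)) ≡ ((q + 1ℤ) * Y - q * (Q - 1ℤ)) - q * q * n
             lem = solve-∀

     ∑∑n : (g : F.C → F.C → ℤ) → ∑ elsF (λ c → ∑ elsF (λ a → n c a * g c a)) ≡ ∑ els (λ s → nz s * g (Tr s) (Tr (inv s)))
     ∑∑n g = begin
       ∑ elsF (λ c → ∑ elsF (λ a → n c a * g c a)) ≡⟨ ∑-cong elsF (λ c → ∑-cong elsF (λ a → trans (sym (∑-*ʳ els (g c a) _)) (∑-cong els (λ s → lem (nz s) (δF c (Tr s)) (δF a (Tr (inv s))) (g c a))))) ⟩
       ∑ elsF (λ c → ∑ elsF (λ a → ∑ els (λ s → nz s * (δF c (Tr s) * (δF a (Tr (inv s)) * g c a))))) ≡⟨ trans (∑-cong elsF (λ c → ∑-swap elsF els _)) (∑-swap elsF els _) ⟩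
       ∑ els (λ s → ∑ elsF (λ c → ∑ elsF (λ a → nz s * (δF c (Tr s) * (δF a (Tr (inv s)) * g c a)))))
         ≡⟨ ∑-cong els (λ s → trans (∑-cong elsF (λ c → trans (∑-*ˡ elsF (nz s) _) (cong (nz s *_) (trans (∑-*ˡ elsF (δF c (Tr s)) _) (cong (δF c (Tr s) *_) (sift finF (Tr (inv s)) (g c)))))))
              (trans (∑-*ˡ elsF (nz s) _) (cong (nz s *_) (sift finF (Tr s) (λ c → g c (Tr (inv s))))))) ⟩
       ∑ els (λ s → nz s * g (Tr s) (Tr (inv s))) ∎
       where
         open ≡-Reasoning
         lem : ∀ a b c d → a * (b * c) * d ≡ a * (b * (c * d))
         lem = solve-∀

     ∑∑-linear : ∀ z y (f g : F.C → F.C → ℤ) → ∑ elsF (λ c → ∑ elsF (λ a → (z - y * f c a) * g c a))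
                 ≡ z * ∑ elsF (λ c → ∑ elsF (λ a → g c a)) - y * ∑ elsF (λ c → ∑ elsF (λ a → f c a * g c a))
     ∑∑-linear z y f g = trans (∑-cong elsF (λ c → trans (∑-cong elsF (λ a → lem z y (f c a) (g c a))) (trans (∑-- elsF _ _) (cong₂ _-_ (∑-*ˡ elsF z _) (∑-*ˡ elsF y _)))))
       (trans (∑-- elsF _ _) (cong₂ _-_ (∑-*ˡ elsF z _) (∑-*ˡ elsF y _)))
       where
         lem : ∀ z y f g → (z - y * f) * g ≡ z * g - y * (f * g)
         lem = solve-∀

     0<q : 0ℤ < + q
     0<q = Z.+<+ (ℕP.<-≤-trans (ℕ.s≤s ℕ.z≤n) (TowerLevel.2≤order base))

     -T≤ : - T (suc k) ≤ B * ((+ q + 1ℤ) * (+ 4 * + q * √Q k + 1ℤ))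
     -T≤ = *-cancel-≤ {c = + q * + q} (subst (_< + q * + q) (ℤP.*-zeroʳ (+ q)) (ℤP.*-monoˡ-<-pos (+ q) {{Z.positive 0<q}} 0<q))
       (subst₂ _≤_ lhs rhs (∑-mono elsF {λ c → ∑ elsF (λ a → e c a * ψ c a)} {λ c → ∑ elsF (λ a → e c a * B)}
          (λ c → ∑-mono elsF {λ a → e c a * ψ c a} {λ a → e c a * B} (λ a → ℤP.*-monoˡ-≤-nonNeg (e c a) {{Z.nonNegative (0≤e c a)}} (ψ≤B c a)))))
       where
         lhs : ∑ elsF (λ c → ∑ elsF (λ a → e c a * ψ c a)) ≡ + q * + q * - T (suc k)
         lhs = trans (∑∑-linear Z (+ q * + q) n ψ) (trans (cong₂ (λ s t → Z * s - + q * + q * t) (trans (∑-swap elsF elsF ψ) (trans (∑-cong elsF line) (∑-zero elsF))) (∑∑n ψ))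
            (lem Z (+ q * + q) (T (suc k))))
           where
             lem : ∀ z y t → z * 0ℤ - y * t ≡ y * - t
             lem = solve-∀
         rhs : ∑ elsF (λ c → ∑ elsF (λ a → e c a * B)) ≡ + q * + q * (B * ((+ q + 1ℤ) * (+ 4 * + q * √Q k + 1ℤ)))
         rhs = trans (∑∑-linear Z (+ q * + q) n (λ _ _ → B)) (trans (cong₂ (λ s t → Z * s - + q * + q * t)
             (trans (∑-cong elsF (λ _ → ∑-const elsF B)) (∑-const elsF (+ q * B)))
             (trans (∑∑n (λ _ _ → B)) (trans (∑-nz (λ _ → B)) (cong (_- B) (∑-const els B)))))
           (lem (+ q) (+ order) (√Q k) B))
           where
             lem : ∀ q Q r B → ((q + 1ℤ) * (Q + + 4 * q * r) - q * (Q - 1ℤ)) * (q * (q * B)) - q * q * (Q * B - B)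
                    ≡ q * q * (B * ((q + 1ℤ) * (+ 4 * q * r + 1ℤ)))
             lem = solve-∀

   0<√Q : ∀ k → 0ℤ < √Q k
   0<√Q k = Z.+<+ (ℕP.m^n>0 q {{ℕ.>-nonZero (ℕP.<-trans (ℕ.s≤s ℕ.z≤n) (TowerLevel.2≤order base))}} (2 ℕ.^ k))

   √Q² : ∀ k → √Q (suc k) ≡ √Q k * √Q k
   √Q² k = trans (cong +_ (trans (cong (λ t → q ℕ.^ (2 ℕ.^ k ℕ.+ t)) (ℕP.+-identityʳ _)) (ℕP.^-distribˡ-+-* q (2 ℕ.^ k) (2 ℕ.^ k)))) (ℤP.pos-* (q ℕ.^ (2 ℕ.^ k)) (q ℕ.^ (2 ℕ.^ k)))

   Q≡ : ∀ k → Q (suc k) ≡ √Q k * √Q k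
   Q≡ k = trans (cong +_ (TowerLevel.order≡ (level (suc k)))) (√Q² k)

   module _ (0<B : 0ℤ < B) (large : + 3 * + q * B ≤ - T 1) where
     growth : ∀ k → (+ k + + 3) * √Q k * B ≤ - T (suc k)
     growth zero = ℤP.≤-trans (ℤP.≤-reflexive (cong (λ t → + 3 * + t * B) (ℕP.*-identityʳ q))) large
     growth (suc k) = ≤-by (+-nonneg step (*-nonneg {poly k} (0≤+ _) (*-nonneg (ℤP.<⇒≤ (0<√Q (suc k))) 0≤B)))
         (trans (cong (λ t → - T (suc (suc k)) - (+ suc k + + 3) * t * B) (√Q² k))
           (trans (lem (T (suc (suc k))) (+ k) (√Q k) B) (cong₂ (λ w t → (+ 2 * (√Q k * √Q k * B) - T (suc (suc k)) - x * (x * B)) + w * (t * B)) (sym poly≡) (sym (√Q² k)))))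
       where
         x = (+ k + + 3) * √Q k
         poly : ℕ → ℤ
         poly k = + (k ℕ.* k ℕ.+ 5 ℕ.* k ℕ.+ 3)
         poly≡ : poly k ≡ + k * + k + + 5 * + k + + 3
         poly≡ = cong₂ (λ a b → a + b + + 3) (ℤP.pos-* k k) (ℤP.pos-* 5 k)
         lem : ∀ T k′ r B → - T - (1ℤ + k′ + + 3) * (r * r) * B ≡ (+ 2 * (r * r * B) - T - (k′ + + 3) * r * ((k′ + + 3) * r * B)) + (k′ * k′ + + 5 * k′ + + 3) * (r * r * B)
         lem = solve-∀
         step : 0ℤ ≤ + 2 * (√Q k * √Q k * B) - T (suc (suc k)) - x * (x * B)
         step = 0≤- (*-cancel-≤ 0<B (begin
           B * (x * (x * B)) ≡⟨ lem₁ B x ⟩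
           (x * B) * (x * B) ≤⟨ ℤP.*-monoˡ-≤-nonNeg (x * B) {{Z.nonNegative 0≤xB}} (growth k) ⟩
           (x * B) * - T (suc k) ≡⟨ ℤP.*-comm (x * B) (- T (suc k)) ⟩
           - T (suc k) * (x * B) ≤⟨ ℤP.*-monoˡ-≤-nonNeg (- T (suc k)) {{Z.nonNegative (ℤP.≤-trans 0≤xB (growth k))}} (growth k) ⟩
           - T (suc k) * - T (suc k) ≡⟨ lem₂ (T (suc k)) ⟩
           T (suc k) * T (suc k) ≤⟨ At.T²≤BE (suc k) ⟩
           B * E (suc k) ≤⟨ ℤP.*-monoˡ-≤-nonNeg B {{Z.nonNegative 0≤B}} (E≤ (suc k)) ⟩
           B * (+ 2 * (Q (suc k) * B) - T (suc (suc k))) ≡⟨ cong (λ t → B * (+ 2 * (t * B) - T (suc (suc k)))) (Q≡ k) ⟩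
           B * (+ 2 * (√Q k * √Q k * B) - T (suc (suc k))) ∎))
           where
             open ℤP.≤-Reasoning
             0≤xB : 0ℤ ≤ x * B
             0≤xB = *-nonneg (*-nonneg (+-nonneg (0≤+ k) (0≤+ 3)) (ℤP.<⇒≤ (0<√Q k))) 0≤B
             lem₁ : ∀ B x → B * (x * (x * B)) ≡ (x * B) * (x * B)
             lem₁ = solve-∀
             lem₂ : ∀ t → - t * - t ≡ t * t
             lem₂ = solve-∀

     large-absurd : ⊥
     large-absurd = ℤP.<⇒≱ (begin-strict
       c * x ≡⟨ lem₁ c x ⟩
       c * x + 0ℤ <⟨ ℤP.+-monoʳ-< (c * x) (*-pos {+ 3} {x} (Z.+<+ (ℕ.s≤s ℕ.z≤n)) 0<x) ⟩
       c * x + + 3 * x ≡⟨ lem₂ c (√Q k) B ⟩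
       (c + + 3) * √Q k * B ≤⟨ growth k ⟩
       - T (suc k) ∎) (begin
       - T (suc k) ≤⟨ PointCount.-T≤ k ⟩
       B * ((+ q + 1ℤ) * (+ 4 * + q * √Q k + 1ℤ)) ≤⟨ ≤-by (*-nonneg 0≤B (*-nonneg (+-nonneg (0≤+ q) (0≤+ 1)) (0≤- (ℤP.i<j⇒suc[i]≤j (0<√Q k))))) (lem₃ B (+ q) (√Q k)) ⟩
       (+ q + 1ℤ) * (+ 4 * + q + 1ℤ) * (√Q k * B) ≡⟨ cong (_* (√Q k * B)) (sym c≡) ⟩
       c * x ∎)
       where
         open ℤP.≤-Reasoning
         k = (q ℕ.+ 1) ℕ.* (4 ℕ.* q ℕ.+ 1)
         c = + k
         x = √Q k * B
         c≡ : c ≡ (+ q + 1ℤ) * (+ 4 * + q + 1ℤ)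
         c≡ = trans (ℤP.pos-* (q ℕ.+ 1) _) (cong (λ t → (+ q + 1ℤ) * (t + 1ℤ)) (ℤP.pos-* 4 q))
         *-pos : ∀ {a b} → 0ℤ < a → 0ℤ < b → 0ℤ < a * b
         *-pos {a} {b} pa pb = subst (_< a * b) (ℤP.*-zeroʳ a) (ℤP.*-monoˡ-<-pos a {{Z.positive pa}} pb)
         0<x : 0ℤ < x
         0<x = *-pos (0<√Q k) 0<B
         lem₁ : ∀ c x → c * x ≡ c * x + 0ℤ
         lem₁ = solve-∀
         lem₂ : ∀ c r B → c * (r * B) + + 3 * (r * B) ≡ (c + + 3) * r * B
         lem₂ = solve-∀
         lem₃ : ∀ B q r → (q + 1ℤ) * (+ 4 * q + 1ℤ) * (r * B) - B * ((q + 1ℤ) * (+ 4 * q * r + 1ℤ)) ≡ B * ((q + 1ℤ) * (r - (1ℤ + 0ℤ)))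
         lem₃ = solve-∀

   -T₁≤ : - T 1 ≤ + 3 * + q * B
   -T₁≤ = go (ℤP._≤?_ (- T 1) (+ 3 * + q * B)) (ℤP._≤?_ B 0ℤ)
     where
       go : Dec (- T 1 ≤ + 3 * + q * B) → Dec (B ≤ 0ℤ) → - T 1 ≤ + 3 * + q * B
       go (yes p) _ = p
       go (no p) (no B>0) = ⊥-elim (large-absurd (ℤP.≰⇒> B>0) (ℤP.<⇒≤ (ℤP.≰⇒> p)))
       go (no p) (yes B≤0) = ℤP.≤-trans (sq-≤ {y = 0ℤ} ℤP.≤-refl (ℤP.≤-trans (ℤP.≤-reflexive (lem (T 1))) (ℤP.≤-trans (At.T²≤BE 1)
           (ℤP.≤-reflexive (trans (cong (_* E 1) B≡0) (ℤP.*-zeroˡ (E 1))))))) (*-nonneg (*-nonneg {+ 3} {+ q} (0≤+ 3) (0≤+ q)) 0≤B)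
         where
           B≡0 = ℤP.≤-antisym B≤0 0≤B
           lem : ∀ t → - t * - t ≡ t * t
           lem = solve-∀

   kloosterman : E 0 ≤ + 5 * (+ q * B)
   kloosterman = ℤP.≤-trans (E≤ 0) (≤-by (0≤- -T₁≤) (lem (+ q) B (T 1)))
     where
       lem : ∀ q B T → + 5 * (q * B) - (+ 2 * (q * B) - T) ≡ + 3 * q * B - - T
       lem = solve-∀

module SphereSums where
 open FiniteSums
 open FiniteFields
 open QuadraticTower
 open KloostermanSums
 open import Data.Integer as Z using (ℤ; +_; 0ℤ; 1ℤ; _+_; _*_; -_; _-_; _≤_)
 open import Data.Integer.Tactic.RingSolver using (solve-∀)
 open import Data.List using ([]; _∷_; map; cartesianProduct)
 open import Data.Vec using ([]; _∷_; zipWith)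

 ∑∑-cong : ∀ {A B : Set} (xs : List A) (ys : List B) {f g : A → B → ℤ} → (∀ x y → f x y ≡ g x y) →
           ∑ xs (λ x → ∑ ys (f x)) ≡ ∑ xs (λ x → ∑ ys (g x))
 ∑∑-cong xs ys e = ∑-cong xs (λ x → ∑-cong ys (e x))

 ∑-product : ∀ {A B : Set} (xs : List A) (ys : List B) (f : A → ℤ) (g : B → ℤ) → ∑ xs f * ∑ ys g ≡ ∑ xs (λ x → ∑ ys (λ y → f x * g y))
 ∑-product xs ys f g = trans (sym (∑-*ʳ xs (∑ ys g) f)) (∑-cong xs (λ x → sym (∑-*ˡ ys (f x) g)))

 cauchy-schwarz : ∀ {A : Set} (xs : List A) (f g : A → ℤ) → ∑ xs (λ x → f x * g x) * ∑ xs (λ x → f x * g x) ≤ ∑ xs (λ x → f x * f x) * ∑ xs (λ x → g x * g x)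
 cauchy-schwarz xs f g = *-cancel-≤ {c = + 2} (Z.+<+ (ℕ.s≤s ℕ.z≤n)) (≤-by (∑-nonneg xs (λ x → ∑-nonneg xs (λ y → 0≤sq (f x * g y - f y * g x)))) (sym (begin
     ∑ xs (λ x → ∑ xs (λ y → (f x * g y - f y * g x) * (f x * g y - f y * g x)))
       ≡⟨ ∑∑-cong xs xs (λ x y → expand (f x) (g x) (f y) (g y)) ⟩
     ∑ xs (λ x → ∑ xs (λ y → ((f x * f x) * (g y * g y) + (g x * g x) * (f y * f y)) - (+ 2 * (f x * g x)) * (f y * g y)))
       ≡⟨ trans (∑-cong xs (λ x → ∑-- xs _ _)) (∑-- xs _ _) ⟩
     ∑ xs (λ x → ∑ xs (λ y → (f x * f x) * (g y * g y) + (g x * g x) * (f y * f y))) - ∑ xs (λ x → ∑ xs (λ y → (+ 2 * (f x * g x)) * (f y * g y)))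
       ≡⟨ cong₂ _-_ (trans (trans (∑-cong xs (λ x → ∑-+ xs _ _)) (∑-+ xs _ _)) (cong₂ _+_ (sym (∑-product xs xs _ _)) (sym (∑-product xs xs _ _))))
            (trans (sym (∑-product xs xs _ _)) (cong (_* ∑ xs (λ y → f y * g y)) (∑-*ˡ xs (+ 2) _))) ⟩
     (ff * gg + gg * ff) - + 2 * fg * fg ≡⟨ collect ff gg fg ⟩
     + 2 * (ff * gg) - + 2 * (fg * fg) ∎)))
   where
     open ≡-Reasoning
     ff = ∑ xs (λ x → f x * f x)
     gg = ∑ xs (λ x → g x * g x)
     fg = ∑ xs (λ x → f x * g x)
     expand : ∀ a b c d → (a * d - c * b) * (a * d - c * b) ≡ ((a * a) * (d * d) + (b * b) * (c * c)) - (+ 2 * (a * b)) * (c * d)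
     expand = solve-∀
     collect : ∀ a b c → (a * b + b * a) - + 2 * c * c ≡ + 2 * (a * b) - + 2 * (c * c)
     collect = solve-∀

 double : ℕ → ℕ
 double zero = zero
 double (suc e) = suc (suc (double e))

 module Sphere (F : FiniteField) (two≢0 : FieldFacts.two F ≢ FiniteField.0ᶠ F) where
   open FieldFacts F
   open Squares two≢0
   open NonzeroSums F

   q : ℤ
   q = + order

   Zero : (C → ℤ) → Set
   Zero h = ∑ els h ≡ 0ℤ

   ∑-translate : ∀ τ h → ∑ els (λ a → h (τ ⊕ a)) ≡ ∑ els h
   ∑-translate τ h = trans (∑-cong els (λ a → cong h (+-comm τ a))) (∑-shift τ h)

   ∑-affine : ∀ τ c h → c ≢ 0ᶠ → ∑ els (λ a → h (τ ⊕ c ⊛ a)) ≡ ∑ els h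
   ∑-affine τ c h n = trans (∑-scale c n (λ a → h (τ ⊕ a))) (∑-translate τ h)

   ∑-line : ∀ τ c h → Zero h → ∑ els (λ a → h (τ ⊕ a ⊛ c)) ≡ q * δ c 0ᶠ * h τ
   ∑-line τ c h z with c ≟ 0ᶠ
   ... | yes refl = trans (∑-cong els (λ a → cong h (trans (cong (τ ⊕_) (zeroʳ a)) (+-identityʳ τ)))) (trans (∑-const els (h τ)) (cong (_* h τ) (sym (ℤP.*-identityʳ q))))
   ... | no n = trans (∑-cong els (λ a → cong (λ t → h (τ ⊕ t)) (*-comm a c))) (trans (∑-affine τ c h n) (trans z (sym (trans (cong (_* h τ) (ℤP.*-zeroʳ q)) (ℤP.*-zeroˡ (h τ))))))

   ∑-line-nz : ∀ τ c h → Zero h → ∑ els (λ a → nz a * h (τ ⊕ a ⊛ c)) ≡ q * δ c 0ᶠ * h τ - h τ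
   ∑-line-nz τ c h z = trans (∑-nz _) (cong₂ _-_ (∑-line τ c h z) (cong h (trans (cong (τ ⊕_) (zeroˡ c)) (+-identityʳ τ))))

   four : C
   four = two ⊛ two

   four≢0 : four ≢ 0ᶠ
   four≢0 = *-nz two two two≢0 two≢0

   infixl 6 _⊕ᵛ_
   _⊕ᵛ_ : ∀ {d} → Vec C d → Vec C d → Vec C d
   _⊕ᵛ_ = zipWith _⊕_

   ⊖ᵛ_ : ∀ {d} → Vec C d → Vec C d
   ⊖ᵛ_ = Vec.map ⊖_

   0ᵛ : ∀ {d} → Vec C d
   0ᵛ = Vec.replicate _ 0ᶠ

   N : ∀ {d} → Vec C d → C
   N [] = 0ᶠ
   N (x ∷ v) = x ⊛ x ⊕ N v

   finᵛ : ∀ d → Finite (Vec C d)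
   finᵛ d = Finite-Vec fin d

   elsᵛ : ∀ d → List (Vec C d)
   elsᵛ d = Finite.els (finᵛ d)

   ∑ᵛ-∷ : ∀ d (f : Vec C (suc d) → ℤ) → ∑ (elsᵛ (suc d)) f ≡ ∑ els (λ a → ∑ (elsᵛ d) (λ v → f (a ∷ v)))
   ∑ᵛ-∷ d f = trans (∑-map _ (cartesianProduct els (elsᵛ d)) f) (∑-cart els (elsᵛ d) _)

   ⊕ᵛ-⊖ : ∀ {d} (x v : Vec C d) → (x ⊕ᵛ v) ⊕ᵛ (⊖ᵛ v) ≡ x
   ⊕ᵛ-⊖ [] [] = refl
   ⊕ᵛ-⊖ (a ∷ x) (b ∷ v) = cong₂ _∷_ (solve 2 (λ a b → a :+ b :+ (:- b) := a) refl a b) (⊕ᵛ-⊖ x v)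

   ⊖-⊕ᵛ : ∀ {d} (x v : Vec C d) → (x ⊕ᵛ (⊖ᵛ v)) ⊕ᵛ v ≡ x
   ⊖-⊕ᵛ [] [] = refl
   ⊖-⊕ᵛ (a ∷ x) (b ∷ v) = cong₂ _∷_ (solve 2 (λ a b → a :+ (:- b) :+ b := a) refl a b) (⊖-⊕ᵛ x v)

   ⊖ᵛ-⊖ᵛ : ∀ {d} (v : Vec C d) → ⊖ᵛ (⊖ᵛ v) ≡ v
   ⊖ᵛ-⊖ᵛ [] = refl
   ⊖ᵛ-⊖ᵛ (a ∷ v) = cong₂ _∷_ (neg-neg a) (⊖ᵛ-⊖ᵛ v)

   ⊕ᵛ-comm : ∀ {d} (x v : Vec C d) → x ⊕ᵛ v ≡ v ⊕ᵛ x
   ⊕ᵛ-comm [] [] = refl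
   ⊕ᵛ-comm (a ∷ x) (b ∷ v) = cong₂ _∷_ (+-comm a b) (⊕ᵛ-comm x v)

   ⊕ᵛ-assoc : ∀ {d} (x v w : Vec C d) → (x ⊕ᵛ v) ⊕ᵛ w ≡ x ⊕ᵛ (v ⊕ᵛ w)
   ⊕ᵛ-assoc [] [] [] = refl
   ⊕ᵛ-assoc (a ∷ x) (b ∷ v) (c ∷ w) = cong₂ _∷_ (+-assoc a b c) (⊕ᵛ-assoc x v w)

   ⊕ᵛ-0 : ∀ {d} (x : Vec C d) → x ⊕ᵛ 0ᵛ ≡ x
   ⊕ᵛ-0 [] = refl
   ⊕ᵛ-0 (a ∷ x) = cong₂ _∷_ (+-identityʳ a) (⊕ᵛ-0 x)

   N-neg : ∀ {d} (v : Vec C d) → N (⊖ᵛ v) ≡ N v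
   N-neg [] = refl
   N-neg (a ∷ v) = cong₂ _⊕_ (solve 1 (λ a → (:- a) :* (:- a) := a :* a) refl a) (N-neg v)

   ∑ᵛ-shift : ∀ {d} (v : Vec C d) h → ∑ (elsᵛ d) (λ x → h (x ⊕ᵛ v)) ≡ ∑ (elsᵛ d) h
   ∑ᵛ-shift {d} v = ∑-reindex (finᵛ d) (finᵛ d) (_⊕ᵛ v) (_⊕ᵛ (⊖ᵛ v)) (λ x → ⊕ᵛ-⊖ x v) (λ x → ⊖-⊕ᵛ x v)

   ∑ᵛ-neg : ∀ {d} h → ∑ (elsᵛ d) (λ v → h (⊖ᵛ v)) ≡ ∑ (elsᵛ d) h
   ∑ᵛ-neg {d} = ∑-reindex (finᵛ d) (finᵛ d) ⊖ᵛ_ ⊖ᵛ_ ⊖ᵛ-⊖ᵛ ⊖ᵛ-⊖ᵛ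

   -- In dimension one, with (a , b) = (x + y , x - y): a² - b² = 4 x y.
   isotropic : ∀ u τ (k : C → C → ℤ) → u ≢ 0ᶠ → (∀ w → Zero (k w)) → ∑ els (λ a → ∑ els (λ b → k (a ⊕ b) (τ ⊕ u ⊛ (a ⊛ a ⊕ ⊖ (b ⊛ b))))) ≡ q * k 0ᶠ τ
   isotropic u τ k n z = begin
     ∑ els (λ a → ∑ els (λ b → k (a ⊕ b) (τ ⊕ u ⊛ (a ⊛ a ⊕ ⊖ (b ⊛ b))))) ≡⟨ ∑-pairs _ ⟩
     ∑ els (λ x → ∑ els (λ y → k (x ⊕ y ⊕ (x ⊕ ⊖ y)) (τ ⊕ u ⊛ ((x ⊕ y) ⊛ (x ⊕ y) ⊕ ⊖ ((x ⊕ ⊖ y) ⊛ (x ⊕ ⊖ y))))))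
       ≡⟨ ∑∑-cong els els (λ x y → cong₂ k (solve 2 (λ x y → x :+ y :+ (x :+ (:- y)) := con (+ 2) :* x) refl x y)
            (cong (τ ⊕_) (solve 3 (λ u x y → u :* ((x :+ y) :* (x :+ y) :+ (:- ((x :+ (:- y)) :* (x :+ (:- y))))) := y :* (con (+ 2) :* con (+ 2) :* u :* x)) refl u x y))) ⟩
     ∑ els (λ x → ∑ els (λ y → k (two ⊛ x) (τ ⊕ y ⊛ (four ⊛ u ⊛ x)))) ≡⟨ ∑-cong els (λ x → trans (∑-line τ (four ⊛ u ⊛ x) (k (two ⊛ x)) (z _))
          (trans (cong (λ t → q * t * k (two ⊛ x) τ) (δ-cong fin fin {four ⊛ u ⊛ x} {0ᶠ} {x} {0ᶠ}
            (λ e → cancel (four ⊛ u) x e (*-nz four u four≢0 n)) (λ { refl → zeroʳ _ }))) (lem q (δ x 0ᶠ) (k (two ⊛ x) τ)))) ⟩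
     ∑ els (λ x → q * (δ x 0ᶠ * k (two ⊛ x) τ)) ≡⟨ trans (∑-*ˡ els q _) (cong (q *_) (trans (sift fin 0ᶠ _) (cong (λ t → k t τ) (zeroʳ two)))) ⟩
     q * k 0ᶠ τ ∎
     where
       open ≡-Reasoning
       lem : ∀ a b c → a * b * c ≡ a * (b * c)
       lem = solve-∀

   isotropicᵛ : ∀ d u τ (k : Vec C d → C → ℤ) → u ≢ 0ᶠ → (∀ w → Zero (k w)) →
     ∑ (elsᵛ d) (λ v → ∑ (elsᵛ d) (λ w → k (v ⊕ᵛ w) (τ ⊕ u ⊛ (N v ⊕ ⊖ N w)))) ≡ + (order ℕ.^ d) * k 0ᵛ τ
   isotropicᵛ zero u τ k n z = trans (ℤP.+-identityʳ _) (trans (ℤP.+-identityʳ _) (trans (cong (k []) (solve 2 (λ τ u → τ :+ u :* (con 0ℤ :+ (:- con 0ℤ)) := τ) refl τ u)) (sym (ℤP.*-identityˡ _))))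
   isotropicᵛ (suc d) u τ k n z = begin
     ∑ (elsᵛ (suc d)) (λ v → ∑ (elsᵛ (suc d)) (λ w → k (v ⊕ᵛ w) (τ ⊕ u ⊛ (N v ⊕ ⊖ N w)))) ≡⟨ trans (∑ᵛ-∷ d _) (∑∑-cong els (elsᵛ d) (λ a v → ∑ᵛ-∷ d _)) ⟩
     ∑ els (λ a → ∑ (elsᵛ d) (λ v → ∑ els (λ b → ∑ (elsᵛ d) (λ w → k ((a ⊕ b) ∷ (v ⊕ᵛ w)) (τ ⊕ u ⊛ (a ⊛ a ⊕ N v ⊕ ⊖ (b ⊛ b ⊕ N w)))))))
       ≡⟨ ∑-cong els (λ a → trans (∑-swap (elsᵛ d) els _) (∑-cong els (λ b → ∑∑-cong (elsᵛ d) (elsᵛ d) (λ v w → cong (k ((a ⊕ b) ∷ (v ⊕ᵛ w)))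
            (solve 6 (λ τ u a b v w → τ :+ u :* (a :* a :+ v :+ (:- (b :* b :+ w))) := (τ :+ u :* (a :* a :+ (:- (b :* b)))) :+ u :* (v :+ (:- w))) refl τ u a b (N v) (N w)))))) ⟩
     ∑ els (λ a → ∑ els (λ b → ∑ (elsᵛ d) (λ v → ∑ (elsᵛ d) (λ w → k ((a ⊕ b) ∷ (v ⊕ᵛ w)) ((τ ⊕ u ⊛ (a ⊛ a ⊕ ⊖ (b ⊛ b))) ⊕ u ⊛ (N v ⊕ ⊖ N w))))))
       ≡⟨ ∑∑-cong els els (λ a b → isotropicᵛ d u _ (λ v → k ((a ⊕ b) ∷ v)) n (λ w → z _)) ⟩
     ∑ els (λ a → ∑ els (λ b → + (order ℕ.^ d) * k ((a ⊕ b) ∷ 0ᵛ) (τ ⊕ u ⊛ (a ⊛ a ⊕ ⊖ (b ⊛ b)))))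
       ≡⟨ trans (∑-cong els (λ a → ∑-*ˡ els (+ (order ℕ.^ d)) _)) (∑-*ˡ els (+ (order ℕ.^ d)) _) ⟩
     + (order ℕ.^ d) * ∑ els (λ a → ∑ els (λ b → k ((a ⊕ b) ∷ 0ᵛ) (τ ⊕ u ⊛ (a ⊛ a ⊕ ⊖ (b ⊛ b))))) ≡⟨ cong (+ (order ℕ.^ d) *_) (isotropic u τ (λ a → k (a ∷ 0ᵛ)) n (λ w → z _)) ⟩
     + (order ℕ.^ d) * (q * k 0ᵛ τ) ≡⟨ trans (lem (+ (order ℕ.^ d)) q (k 0ᵛ τ)) (cong (_* k 0ᵛ τ) (sym (ℤP.pos-* order (order ℕ.^ d)))) ⟩
     + (order ℕ.* order ℕ.^ d) * k 0ᵛ τ ∎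
     where
       open ≡-Reasoning
       lem : ∀ a b c → a * (b * c) ≡ b * a * c
       lem = solve-∀

   -- Gauss sums, as operators on functions on the line
   Γ₁ : C → (C → ℤ) → C → ℤ
   Γ₁ u h τ = ∑ els (λ a → h (τ ⊕ u ⊛ (a ⊛ a)))

   Γ : ∀ d → C → (C → ℤ) → C → ℤ
   Γ d u h τ = ∑ (elsᵛ d) (λ v → h (τ ⊕ u ⊛ N v))

   Γ-suc : ∀ d u h τ → Γ (suc d) u h τ ≡ Γ₁ u (Γ d u h) τ
   Γ-suc d u h τ = trans (∑ᵛ-∷ d _) (∑∑-cong els (elsᵛ d) (λ a v → cong h
     (solve 4 (λ τ u a v → τ :+ u :* (a :* a :+ v) := τ :+ u :* (a :* a) :+ u :* v) refl τ u a (N v))))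

   Γ₁-cong : ∀ u {h h′} → (∀ τ → h τ ≡ h′ τ) → ∀ τ → Γ₁ u h τ ≡ Γ₁ u h′ τ
   Γ₁-cong u e τ = ∑-cong els (λ a → e _)

   Γ₁-scale : ∀ u c h τ → Γ₁ u (λ σ → c * h σ) τ ≡ c * Γ₁ u h τ
   Γ₁-scale u c h τ = ∑-*ˡ els c _

   Γ₁-square : ∀ u w h τ → w ≢ 0ᶠ → Γ₁ (u ⊛ (w ⊛ w)) h τ ≡ Γ₁ u h τ
   Γ₁-square u w h τ n = trans (∑-cong els (λ a → cong (λ t → h (τ ⊕ t)) (solve 3 (λ u w a → u :* (w :* w) :* (a :* a) := u :* ((w :* a) :* (w :* a))) refl u w a)))
     (∑-scale w n (λ a → h (τ ⊕ u ⊛ (a ⊛ a))))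

   Γ₁-nonsquare : ∀ u z h τ → u ≢ 0ᶠ → (∀ w → w ⊛ w ≢ z) → Zero h → Γ₁ (u ⊛ z) h τ ≡ - Γ₁ u h τ
   Γ₁-nonsquare u z h τ n ns zero-h = minus (trans (sym (∑-+ els _ _)) (trans (∑-cong els (λ w → cong (λ t → h (τ ⊕ u ⊛ (w ⊛ w)) + h (τ ⊕ t)) (*-assoc u z (w ⊛ w))))
     (trans (∑-squares z ns (λ D → h (τ ⊕ u ⊛ D))) (trans (cong (+ 2 *_) (trans (∑-affine τ u h n) zero-h)) refl))))
     where
       minus : ∀ {a b} → a + b ≡ 0ℤ → b ≡ - a
       minus {a} {b} e = trans (lem a b) (trans (cong (λ t → - a + t) e) (ℤP.+-identityʳ (- a)))
         where
           lem : ∀ a b → b ≡ - a + (a + b)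
           lem = solve-∀

   -1ᶠ : C
   -1ᶠ = ⊖ 1ᶠ

   χ₁-exists : Σ ℤ λ χ → χ * χ ≡ 1ℤ × (∀ u h τ → u ≢ 0ᶠ → Zero h → Γ₁ (⊖ u) h τ ≡ χ * Γ₁ u h τ)
   χ₁-exists = go (square? -1ᶠ)
     where
       -u : ∀ u → ⊖ u ≡ u ⊛ -1ᶠ
       -u u = solve 1 (λ u → :- u := u :* (:- con 1ℤ)) refl u
       w≢0 : ∀ w → w ⊛ w ≡ -1ᶠ → w ≢ 0ᶠ
       w≢0 w e refl = neg-nz 1≢0 (trans (sym e) (zeroˡ 0ᶠ))
       go : (∃ λ w → w ⊛ w ≡ -1ᶠ) ⊎ (∀ w → w ⊛ w ≢ -1ᶠ) → _
       go (inj₁ (w , e)) = 1ℤ , refl , λ u h τ n z → trans (cong (λ t → Γ₁ t h τ) (trans (-u u) (cong (u ⊛_) (sym e)))) (trans (Γ₁-square u w h τ (w≢0 w e)) (sym (ℤP.*-identityˡ _)))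
       go (inj₂ ns) = Z.-1ℤ , refl , λ u h τ n z → trans (cong (λ t → Γ₁ t h τ) (-u u)) (trans (Γ₁-nonsquare u -1ᶠ h τ n ns z) (sym (ℤP.-1*i≡-i _)))

   χ₁ : ℤ
   χ₁ = proj₁ χ₁-exists
   χ₁² : χ₁ * χ₁ ≡ 1ℤ
   χ₁² = proj₁ (proj₂ χ₁-exists)

   Γ₁Γ₁⁻ : ∀ u h τ → u ≢ 0ᶠ → Zero h → Γ₁ u (Γ₁ (⊖ u) h) τ ≡ q * h τ
   Γ₁Γ₁⁻ u h τ n z = trans (∑∑-cong els els (λ a b → cong h (solve 4 (λ τ u a b → τ :+ u :* (a :* a) :+ (:- u) :* (b :* b) := τ :+ u :* (a :* a :+ (:- (b :* b)))) refl τ u a b)))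
     (isotropic u τ (λ _ → h) n (λ _ → z))

   Γ₁Γ₁ : ∀ u h τ → u ≢ 0ᶠ → Zero h → Γ₁ u (Γ₁ u h) τ ≡ χ₁ * q * h τ
   Γ₁Γ₁ u h τ n z = begin
     Γ₁ u (Γ₁ u h) τ ≡⟨ sym (ℤP.*-identityˡ _) ⟩
     1ℤ * Γ₁ u (Γ₁ u h) τ ≡⟨ cong (_* Γ₁ u (Γ₁ u h) τ) (sym χ₁²) ⟩
     χ₁ * χ₁ * Γ₁ u (Γ₁ u h) τ ≡⟨ ℤP.*-assoc χ₁ χ₁ _ ⟩
     χ₁ * (χ₁ * Γ₁ u (Γ₁ u h) τ) ≡⟨ cong (χ₁ *_) (trans (sym (Γ₁-scale u χ₁ (Γ₁ u h) τ)) (trans (Γ₁-cong u (λ σ → sym (proj₂ (proj₂ χ₁-exists) u h σ n z)) τ) (Γ₁Γ₁⁻ u h τ n z))) ⟩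
     χ₁ * (q * h τ) ≡⟨ sym (ℤP.*-assoc χ₁ q _) ⟩
     χ₁ * q * h τ ∎
     where open ≡-Reasoning

   κ χ D : ℕ → ℤ
   χ zero = 1ℤ
   χ (suc e) = χ₁ * χ e
   D e = + (order ℕ.^ e)
   κ e = χ e * D e

   D-suc : ∀ e → D (suc e) ≡ q * D e
   D-suc e = ℤP.pos-* order (order ℕ.^ e)

   χ² : ∀ e → χ e * χ e ≡ 1ℤ
   χ² zero = refl
   χ² (suc e) = trans (lem χ₁ (χ e)) (cong₂ _*_ χ₁² (χ² e))
     where
       lem : ∀ a b → a * b * (a * b) ≡ (a * a) * (b * b)
       lem = solve-∀

   D² : ∀ e → D e * D e ≡ D (double e)
   D² zero = refl
   D² (suc e) = trans (cong₂ _*_ (D-suc e) (D-suc e)) (trans (lem q (D e)) (trans (cong (λ t → q * (q * t)) (D² e)) (trans (cong (q *_) (sym (D-suc (double e)))) (sym (D-suc (suc (double e)))))))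
     where
       lem : ∀ a b → a * b * (a * b) ≡ a * (a * (b * b))
       lem = solve-∀

   κ² : ∀ e → κ e * κ e ≡ D (double e)
   κ² e = trans (lem (χ e) (D e)) (trans (cong (_* (D e * D e)) (χ² e)) (trans (ℤP.*-identityˡ _) (D² e)))
     where
       lem : ∀ a b → a * b * (a * b) ≡ (a * a) * (b * b)
       lem = solve-∀

   Γ-even : ∀ e u h τ → u ≢ 0ᶠ → Zero h → Γ (double e) u h τ ≡ κ e * h τ
   Γ-even zero u h τ n z = trans (ℤP.+-identityʳ _) (trans (cong h (trans (cong (τ ⊕_) (zeroʳ u)) (+-identityʳ τ))) (sym (ℤP.*-identityˡ _)))
   Γ-even (suc e) u h τ n z = begin
     Γ (suc (suc (double e))) u h τ ≡⟨ trans (Γ-suc (suc (double e)) u h τ) (Γ₁-cong u (Γ-suc (double e) u h) τ) ⟩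
     Γ₁ u (Γ₁ u (Γ (double e) u h)) τ ≡⟨ Γ₁-cong u (λ σ → trans (Γ₁-cong u (λ ρ → Γ-even e u h ρ n z) σ) (Γ₁-scale u (κ e) h σ)) τ ⟩
     Γ₁ u (λ σ → κ e * Γ₁ u h σ) τ ≡⟨ trans (Γ₁-scale u (κ e) (Γ₁ u h) τ) (cong (κ e *_) (Γ₁Γ₁ u h τ n z)) ⟩
     κ e * (χ₁ * q * h τ) ≡⟨ trans (lem (χ e) (D e) χ₁ q (h τ)) (cong (λ t → χ₁ * χ e * t * h τ) (sym (D-suc e))) ⟩
     κ (suc e) * h τ ∎
     where
       open ≡-Reasoning
       lem : ∀ c d x q h → c * d * (x * q * h) ≡ x * c * (q * d) * h
       lem = solve-∀

   Γ-odd : ∀ e u h τ → u ≢ 0ᶠ → Zero h → Γ (suc (double e)) u h τ ≡ κ e * Γ₁ u h τ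
   Γ-odd e u h τ n z = trans (Γ-suc (double e) u h τ) (trans (Γ₁-cong u (λ σ → Γ-even e u h σ n z) τ) (Γ₁-scale u (κ e) h τ))

module SphereOperatorAlgebra where
 open FiniteSums
 open FiniteFields
 open QuadraticTower
 open KloostermanSums
 open SphereSums
 open import Data.Integer using (ℤ; +_; 0ℤ; 1ℤ; _+_; _*_; -_; _-_; _≤_)
 open import Data.Integer.Tactic.RingSolver using (solve-∀)
 open import Data.List using ([]; _∷_; cartesianProduct)
 open import Data.Vec using ([]; _∷_; zipWith)

 module SphereOperators (F : FiniteField) (two≢0 : FieldFacts.two F ≢ FiniteField.0ᶠ F) (d : ℕ) where
   open FieldFacts F
   open Squares two≢0
   open NonzeroSums F
   open Sphere F two≢0

   V : List (Vec C d)
   V = elsᵛ d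

   𝔾 : Set
   𝔾 = Vec C d → C → ℤ

   ZeroG : 𝔾 → Set
   ZeroG g = ∀ x → Zero (g x)

   U : C → 𝔾 → 𝔾
   U s g x τ = ∑ V (λ v → g (x ⊕ᵛ v) (τ ⊕ s ⊛ N v))

   Sh : C → 𝔾 → 𝔾
   Sh c g x τ = g x (τ ⊕ c)

   ΓG : C → 𝔾 → 𝔾
   ΓG u g x = Γ d u (g x)

   combine : ∀ {I : Set} → List I → (I → ℤ) → (I → 𝔾) → 𝔾
   combine is n G x τ = ∑ is (λ i → n i * G i x τ)

   abstract
     ⟨_,_⟩ : 𝔾 → 𝔾 → ℤ
     ⟨ f , g ⟩ = ∑ V (λ x → ∑ els (λ τ → f x τ * g x τ))

   ‖_‖² : 𝔾 → ℤ
   ‖ g ‖² = ⟨ g , g ⟩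

   abstract
     ip-congʳ : ∀ {f g g′ : 𝔾} → (∀ x τ → g x τ ≡ g′ x τ) → ⟨ f , g ⟩ ≡ ⟨ f , g′ ⟩
     ip-congʳ {f} r = ∑∑-cong V els (λ x τ → cong (f x τ *_) (r x τ))

     ip-comm : ∀ f g → ⟨ f , g ⟩ ≡ ⟨ g , f ⟩
     ip-comm f g = ∑∑-cong V els (λ x τ → ℤP.*-comm (f x τ) (g x τ))

     ip-scaleʳ : ∀ c f g → ⟨ f , (λ x τ → c * g x τ) ⟩ ≡ c * ⟨ f , g ⟩
     ip-scaleʳ c f g = trans (∑-cong V (λ x → trans (∑-cong els (λ τ → lem c (f x τ) (g x τ))) (∑-*ˡ els c _))) (∑-*ˡ V c _)
       where
         lem : ∀ c a b → a * (c * b) ≡ c * (a * b)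
         lem = solve-∀

     ip-addʳ : ∀ f g h → ⟨ f , (λ x τ → g x τ + h x τ) ⟩ ≡ ⟨ f , g ⟩ + ⟨ f , h ⟩
     ip-addʳ f g h = trans (∑-cong V (λ x → trans (∑-cong els (λ τ → ℤP.*-distribˡ-+ (f x τ) (g x τ) (h x τ))) (∑-+ els _ _))) (∑-+ V _ _)

     ip-tensor : ∀ (f k : Vec C d → ℤ) (h : C → ℤ) → ⟨ (λ x τ → f x * h τ) , (λ x τ → k x * h τ) ⟩ ≡ ∑ V (λ x → f x * k x) * ∑ els (λ τ → h τ * h τ)
     ip-tensor f k h = trans (∑-cong V (λ x → trans (∑-cong els (λ τ → lem (f x) (h τ) (k x))) (∑-*ˡ els (f x * k x) _))) (∑-*ʳ V (∑ els (λ τ → h τ * h τ)) _)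
       where
         lem : ∀ a b c → a * b * (c * b) ≡ a * c * (b * b)
         lem = solve-∀

     ip-combineʳ : ∀ {I : Set} (is : List I) n G f → ⟨ f , combine is n G ⟩ ≡ ∑ is (λ i → n i * ⟨ f , G i ⟩)
     ip-combineʳ [] n G f = trans (∑∑-cong V els (λ x τ → ℤP.*-zeroʳ (f x τ))) (trans (∑-cong V (λ _ → ∑-zero els)) (∑-zero V))
     ip-combineʳ (i ∷ is) n G f = trans (∑∑-cong V els (λ x τ → ℤP.*-distribˡ-+ (f x τ) (n i * G i x τ) (combine is n G x τ)))
       (trans (∑-cong V (λ x → ∑-+ els _ _)) (trans (∑-+ V _ _) (cong₂ _+_ (ip-scaleʳ (n i) f (G i)) (ip-combineʳ is n G f))))

     ‖‖²-combine : ∀ {I : Set} (is : List I) n G → ‖ combine is n G ‖² ≡ ∑ is (λ i → ∑ is (λ j → n i * n j * ⟨ G i , G j ⟩))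
     ‖‖²-combine is n G = trans (ip-combineʳ is n G (combine is n G)) (∑-cong is (λ i → trans (cong (n i *_) (trans (ip-comm (combine is n G) (G i)) (ip-combineʳ is n G (G i))))
       (trans (sym (∑-*ˡ is (n i) _)) (∑-cong is (λ j → sym (ℤP.*-assoc (n i) (n j) _))))))

     0≤‖‖² : ∀ g → 0ℤ ≤ ‖ g ‖²
     0≤‖‖² g = ∑-nonneg V (λ x → ∑-nonneg els (λ τ → 0≤sq (g x τ)))

     ip-cauchy : ∀ f g → ⟨ f , g ⟩ * ⟨ f , g ⟩ ≤ ‖ f ‖² * ‖ g ‖²
     ip-cauchy f g = subst₂ _≤_ (cong₂ _*_ (∑-cart V els _) (∑-cart V els _)) (cong₂ _*_ (∑-cart V els _) (∑-cart V els _))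
       (cauchy-schwarz (cartesianProduct V els) (λ { (x , τ) → f x τ }) (λ { (x , τ) → g x τ }))

     am-gm : ∀ a b f g → + 2 * (a * b) * ⟨ f , g ⟩ ≤ a * a * ‖ f ‖² + b * b * ‖ g ‖²
     am-gm a b f g = ≤-by (0≤‖‖² (λ x τ → a * f x τ - b * g x τ)) (sym (trans (∑-cong V (λ x → trans (∑-cong els (λ τ → lem a b (f x τ) (g x τ)))
         (trans (∑-- els _ _) (cong₂ _-_ (trans (∑-+ els _ _) (cong₂ _+_ (∑-*ˡ els (a * a) _) (∑-*ˡ els (b * b) _))) (∑-*ˡ els (+ 2 * (a * b)) _)))))
       (trans (∑-- V _ _) (cong₂ _-_ (trans (∑-+ V _ _) (cong₂ _+_ (∑-*ˡ V (a * a) _) (∑-*ˡ V (b * b) _))) (∑-*ˡ V (+ 2 * (a * b)) _)))))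
       where
         lem : ∀ a b x y → (a * x - b * y) * (a * x - b * y) ≡ (a * a * (x * x) + b * b * (y * y)) - + 2 * (a * b) * (x * y)
         lem = solve-∀

     Sh-adjoint : ∀ c f g → ⟨ Sh c f , g ⟩ ≡ ⟨ f , Sh (⊖ c) g ⟩
     Sh-adjoint c f g = ∑-cong V (λ x → trans (∑-cong els (λ τ → cong (λ t → f x (τ ⊕ c) * g x t) (solve 2 (λ τ c → τ := τ :+ c :+ (:- c)) refl τ c)))
       (∑-shift c (λ τ → f x τ * g x (τ ⊕ ⊖ c))))

     shift-adjoint : ∀ v c f g → ⟨ (λ x τ → f (x ⊕ᵛ v) (τ ⊕ c)) , g ⟩ ≡ ⟨ f , (λ x τ → g (x ⊕ᵛ (⊖ᵛ v)) (τ ⊕ ⊖ c)) ⟩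
     shift-adjoint v c f g = trans (Sh-adjoint c (λ x → f (x ⊕ᵛ v)) g)
       (trans (∑∑-cong V els (λ x τ → cong (λ y → f (x ⊕ᵛ v) τ * g y (τ ⊕ ⊖ c)) (sym (⊕ᵛ-⊖ x v))))
         (∑ᵛ-shift v (λ x → ∑ els (λ τ → f x τ * g (x ⊕ᵛ (⊖ᵛ v)) (τ ⊕ ⊖ c)))))

   ∑-one : ∀ {I : Set} (is : List I) (h : I → ℤ) → ∑ is h ≡ ∑ is (λ i → 1ℤ * h i)
   ∑-one is h = ∑-cong is (λ i → sym (ℤP.*-identityˡ (h i)))

   U-adjoint : ∀ s f g → ⟨ U s f , g ⟩ ≡ ⟨ f , U (⊖ s) g ⟩
   U-adjoint s f g = begin
     ⟨ U s f , g ⟩ ≡⟨ trans (ip-comm _ g) (trans (ip-congʳ (λ x τ → ∑-one V _)) (ip-combineʳ V (λ _ → 1ℤ) _ g)) ⟩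
     ∑ V (λ v → 1ℤ * ⟨ g , (λ x τ → f (x ⊕ᵛ v) (τ ⊕ s ⊛ N v)) ⟩) ≡⟨ ∑-cong V (λ v → cong (1ℤ *_) (trans (ip-comm g _) (shift-adjoint v (s ⊛ N v) f g))) ⟩
     ∑ V (λ v → 1ℤ * ⟨ f , (λ x τ → g (x ⊕ᵛ (⊖ᵛ v)) (τ ⊕ ⊖ (s ⊛ N v))) ⟩) ≡⟨ sym (∑ᵛ-neg {d} (λ v → 1ℤ * ⟨ f , (λ x τ → g (x ⊕ᵛ (⊖ᵛ v)) (τ ⊕ ⊖ (s ⊛ N v))) ⟩)) ⟩
     ∑ V (λ v → 1ℤ * ⟨ f , (λ x τ → g (x ⊕ᵛ (⊖ᵛ (⊖ᵛ v))) (τ ⊕ ⊖ (s ⊛ N (⊖ᵛ v)))) ⟩)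
       ≡⟨ ∑-cong V (λ v → cong (1ℤ *_) (ip-congʳ (λ x τ → cong₂ (λ y t → g (x ⊕ᵛ y) (τ ⊕ t)) (⊖ᵛ-⊖ᵛ v)
            (trans (cong (λ t → ⊖ (s ⊛ t)) (N-neg v)) (solve 2 (λ s n → :- (s :* n) := (:- s) :* n) refl s (N v)))))) ⟩
     ∑ V (λ v → 1ℤ * ⟨ f , (λ x τ → g (x ⊕ᵛ v) (τ ⊕ (⊖ s) ⊛ N v)) ⟩) ≡⟨ trans (sym (ip-combineʳ V (λ _ → 1ℤ) _ f)) (ip-congʳ (λ x τ → sym (∑-one V _))) ⟩
     ⟨ f , U (⊖ s) g ⟩ ∎
     where open ≡-Reasoning

   ΓG-adjoint : ∀ u f g → ⟨ ΓG u f , g ⟩ ≡ ⟨ f , ΓG (⊖ u) g ⟩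
   ΓG-adjoint u f g = begin
     ⟨ ΓG u f , g ⟩ ≡⟨ trans (ip-comm _ g) (trans (ip-congʳ (λ x τ → ∑-one V _)) (ip-combineʳ V (λ _ → 1ℤ) _ g)) ⟩
     ∑ V (λ v → 1ℤ * ⟨ g , Sh (u ⊛ N v) f ⟩) ≡⟨ ∑-cong V (λ v → cong (1ℤ *_) (trans (ip-comm g _) (trans (Sh-adjoint (u ⊛ N v) f g)
          (ip-congʳ (λ x τ → cong (λ t → g x (τ ⊕ t)) (solve 2 (λ s n → :- (s :* n) := (:- s) :* n) refl u (N v))))))) ⟩
     ∑ V (λ v → 1ℤ * ⟨ f , Sh ((⊖ u) ⊛ N v) g ⟩) ≡⟨ trans (sym (ip-combineʳ V (λ _ → 1ℤ) _ f)) (ip-congʳ (λ x τ → sym (∑-one V _))) ⟩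
     ⟨ f , ΓG (⊖ u) g ⟩ ∎
     where open ≡-Reasoning

   U-zero : ∀ s g → ZeroG g → ZeroG (U s g)
   U-zero s g z x = trans (∑-swap els V _) (trans (∑-cong V (λ v → trans (∑-shift (s ⊛ N v) (g (x ⊕ᵛ v))) (z _))) (∑-zero V))

   qᵈ : ℤ
   qᵈ = + (order ℕ.^ d)

   U-unitary : ∀ s g → s ≢ 0ᶠ → ZeroG g → ∀ x τ → U s (U (⊖ s) g) x τ ≡ qᵈ * g x τ
   U-unitary s g n z x τ = trans (∑∑-cong V V (λ v w → cong₂ g (⊕ᵛ-assoc x v w)
        (solve 4 (λ τ s a b → τ :+ s :* a :+ (:- s) :* b := τ :+ s :* (a :+ (:- b))) refl τ s (N v) (N w))))
     (trans (isotropicᵛ d s τ (λ w → g (x ⊕ᵛ w)) n (λ w → z _)) (cong (λ y → qᵈ * g y τ) (⊕ᵛ-0 x)))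

   Γ-unitary : ∀ s h → s ≢ 0ᶠ → Zero h → ∀ τ → Γ d s (Γ d (⊖ s) h) τ ≡ qᵈ * h τ
   Γ-unitary s h n z τ = trans (∑∑-cong V V (λ v w → cong h
        (solve 4 (λ τ s a b → τ :+ s :* a :+ (:- s) :* b := τ :+ s :* (a :+ (:- b))) refl τ s (N v) (N w))))
     (isotropicᵛ d s τ (λ _ → h) n (λ _ → z))

   private
     op₁ op₂ inv₁ : ∀ {n} → C → Vec C n → Vec C n → Vec C n
     op₁ α = zipWith (λ v w → v ⊕ (1ᶠ ⊕ ⊖ α) ⊛ w)
     op₂ α = zipWith (λ v w → α ⊛ w ⊕ ⊖ v)
     inv₁ α = zipWith (λ a b → α ⊛ a ⊕ ⊖ ((1ᶠ ⊕ ⊖ α) ⊛ b))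

     inv-op₁ : ∀ {n} α (v w : Vec C n) → inv₁ α (op₁ α v w) (op₂ α v w) ≡ v
     inv-op₁ α [] [] = refl
     inv-op₁ α (v ∷ vs) (w ∷ ws) = cong₂ _∷_ (solve 3 (λ α v w → α :* (v :+ (con 1ℤ :+ (:- α)) :* w) :+ (:- ((con 1ℤ :+ (:- α)) :* (α :* w :+ (:- v)))) := v) refl α v w) (inv-op₁ α vs ws)

     op₁+op₂ : ∀ {n} α (v w : Vec C n) → op₁ α v w ⊕ᵛ op₂ α v w ≡ w
     op₁+op₂ α [] [] = refl
     op₁+op₂ α (v ∷ vs) (w ∷ ws) = cong₂ _∷_ (solve 3 (λ α v w → v :+ (con 1ℤ :+ (:- α)) :* w :+ (α :* w :+ (:- v)) := w) refl α v w) (op₁+op₂ α vs ws)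

     op₁-inv : ∀ {n} α (a b : Vec C n) → op₁ α (inv₁ α a b) (a ⊕ᵛ b) ≡ a
     op₁-inv α [] [] = refl
     op₁-inv α (a ∷ as) (b ∷ bs) = cong₂ _∷_ (solve 3 (λ α a b → α :* a :+ (:- ((con 1ℤ :+ (:- α)) :* b)) :+ (con 1ℤ :+ (:- α)) :* (a :+ b) := a) refl α a b) (op₁-inv α as bs)

     op₂-inv : ∀ {n} α (a b : Vec C n) → op₂ α (inv₁ α a b) (a ⊕ᵛ b) ≡ b
     op₂-inv α [] [] = refl
     op₂-inv α (a ∷ as) (b ∷ bs) = cong₂ _∷_ (solve 3 (λ α a b → α :* (a :+ b) :+ (:- (α :* a :+ (:- ((con 1ℤ :+ (:- α)) :* b)))) := b) refl α a b) (op₂-inv α as bs)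

     N-op : ∀ {n} u α (v w : Vec C n) → u ⊛ α ⊛ N (op₁ α v w) ⊕ u ⊛ (1ᶠ ⊕ ⊖ α) ⊛ N (op₂ α v w) ≡ u ⊛ N v ⊕ u ⊛ α ⊛ (1ᶠ ⊕ ⊖ α) ⊛ N w
     N-op u α [] [] = solve 2 (λ u α → u :* α :* con 0ℤ :+ u :* (con 1ℤ :+ (:- α)) :* con 0ℤ := u :* con 0ℤ :+ u :* α :* (con 1ℤ :+ (:- α)) :* con 0ℤ) refl u α
     N-op u α (v ∷ vs) (w ∷ ws) = trans (solve 6 (λ u α v w A B → u :* α :* ((v :+ (con 1ℤ :+ (:- α)) :* w) :* (v :+ (con 1ℤ :+ (:- α)) :* w) :+ A)
           :+ u :* (con 1ℤ :+ (:- α)) :* ((α :* w :+ (:- v)) :* (α :* w :+ (:- v)) :+ B)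
           := (u :* (v :* v) :+ u :* α :* (con 1ℤ :+ (:- α)) :* (w :* w)) :+ (u :* α :* A :+ u :* (con 1ℤ :+ (:- α)) :* B)) refl u α v w (N (op₁ α vs ws)) (N (op₂ α vs ws)))
       (trans (cong (λ t → u ⊛ (v ⊛ v) ⊕ u ⊛ α ⊛ (1ᶠ ⊕ ⊖ α) ⊛ (w ⊛ w) ⊕ t) (N-op u α vs ws))
         (solve 6 (λ u p v w A B → u :* v :+ p :* w :+ (u :* A :+ p :* B) := u :* (v :+ A) :+ p :* (w :+ B)) refl u (u ⊛ α ⊛ (1ᶠ ⊕ ⊖ α)) (v ⊛ v) (w ⊛ w) (N vs) (N ws)))

   -- Completing the square: s ‖v‖ + t ‖w - v‖ = (s + t) ‖v′‖ + (s t / (s + t)) ‖w‖, with s = u α and t = u (1 - α).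
   U-compose : ∀ u α g x τ → U (u ⊛ α) (U (u ⊛ (1ᶠ ⊕ ⊖ α)) g) x τ ≡ ΓG u (U (u ⊛ α ⊛ (1ᶠ ⊕ ⊖ α)) g) x τ
   U-compose u α g x τ = begin
     ∑ V (λ v → ∑ V (λ w → g ((x ⊕ᵛ v) ⊕ᵛ w) (τ ⊕ u ⊛ α ⊛ N v ⊕ u ⊛ (1ᶠ ⊕ ⊖ α) ⊛ N w))) ≡⟨ sym (∑-cart V V _) ⟩
     ∑ (cartesianProduct V V) k ≡⟨ sym (∑-reindex (Finite-× (finᵛ d) (finᵛ d)) (Finite-× (finᵛ d) (finᵛ d))
         (λ { (v , w) → op₁ α v w , op₂ α v w }) (λ { (a , b) → inv₁ α a b , a ⊕ᵛ b })
         (λ { (v , w) → cong₂ _,_ (inv-op₁ α v w) (op₁+op₂ α v w) }) (λ { (a , b) → cong₂ _,_ (op₁-inv α a b) (op₂-inv α a b) }) k) ⟩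
     ∑ (cartesianProduct V V) (λ { (v , w) → k (op₁ α v w , op₂ α v w) }) ≡⟨ ∑-cart V V _ ⟩
     ∑ V (λ v → ∑ V (λ w → k (op₁ α v w , op₂ α v w))) ≡⟨ ∑∑-cong V V (λ v w → cong₂ g (trans (⊕ᵛ-assoc x _ _) (cong (x ⊕ᵛ_) (op₁+op₂ α v w)))
         (trans (+-assoc τ _ _) (trans (cong (τ ⊕_) (N-op u α v w)) (sym (+-assoc τ _ _))))) ⟩
     ∑ V (λ v → ∑ V (λ w → g (x ⊕ᵛ w) (τ ⊕ u ⊛ N v ⊕ u ⊛ α ⊛ (1ᶠ ⊕ ⊖ α) ⊛ N w))) ∎
     where
       open ≡-Reasoning
       k : Vec C d × Vec C d → ℤ
       k (v , w) = g ((x ⊕ᵛ v) ⊕ᵛ w) (τ ⊕ u ⊛ α ⊛ N v ⊕ u ⊛ (1ᶠ ⊕ ⊖ α) ⊛ N w)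

   R : C → C → 𝔾 → 𝔾
   R r s g = Sh ((⊖ r) ⊛ s) (U s g)

   M : C → 𝔾 → 𝔾
   M r g = combine els nz (λ s → R r s g)

module EvenDimensions where
 open FiniteSums
 open FiniteFields
 open QuadraticTower
 open KloostermanSums
 open SphereSums
 open SphereOperatorAlgebra
 open import Data.Integer as Z using (ℤ; +_; 0ℤ; 1ℤ; _+_; _*_; _≤_; _<_)
 open import Data.Integer.Tactic.RingSolver using (solve-∀)
 open import Data.List using (_∷_; length)
 open import Data.Vec using (_∷_)

 -- In even dimension the operators W a = U (a⁻¹) satisfy W a W b = κ W (a + b), so shifts and W form, up to scaling,
 -- a unitary representation of F × F whose matrix coefficients are positive definite.
 module EvenDimension (F : FiniteField) (p m h : ℕ) (p-prime : Prime p) (p-odd : p ≡ suc (2 ℕ.* h))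
                      (orderF : FiniteField.order F ≡ p ℕ.^ m) (two≢0 : FieldFacts.two F ≢ FiniteField.0ᶠ F) (e : ℕ) where
   open FieldFacts F
   open Squares two≢0
   open NonzeroSums F
   open Sphere F two≢0
   open SphereOperators F two≢0 (double e)

   W : C → 𝔾 → 𝔾
   W a g x τ = [ a ≟ 0ᶠ ]W
     where
       [_]W : Dec (a ≡ 0ᶠ) → ℤ
       [ yes _ ]W = κ e * g x τ
       [ no _ ]W = U (inv a) g x τ

   W-0 : ∀ g x τ → W 0ᶠ g x τ ≡ κ e * g x τ
   W-0 g x τ with 0ᶠ ≟ 0ᶠ
   ... | yes _ = refl
   ... | no n = ⊥-elim (n refl)

   W-nz : ∀ a g x τ → a ≢ 0ᶠ → W a g x τ ≡ U (inv a) g x τ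
   W-nz a g x τ n with a ≟ 0ᶠ
   ... | yes e = ⊥-elim (n e)
   ... | no _ = refl

   W-cong : ∀ a {f g : 𝔾} → (∀ x τ → f x τ ≡ g x τ) → ∀ x τ → W a f x τ ≡ W a g x τ
   W-cong a r x τ with a ≟ 0ᶠ
   ... | yes _ = cong (κ e *_) (r x τ)
   ... | no _ = ∑-cong V (λ v → r _ _)

   W-zero : ∀ a g → ZeroG g → ZeroG (W a g)
   W-zero a g z x with a ≟ 0ᶠ
   ... | yes _ = trans (∑-*ˡ els (κ e) _) (trans (cong (κ e *_) (z x)) (ℤP.*-zeroʳ (κ e)))
   ... | no _ = U-zero (inv a) g z x

   W-shift : ∀ a c g x τ → W a (Sh c g) x τ ≡ Sh c (W a g) x τ
   W-shift a c g x τ with a ≟ 0ᶠ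
   ... | yes _ = refl
   ... | no _ = ∑-cong V (λ v → cong (g (x ⊕ᵛ v)) (solve 3 (λ τ s c → τ :+ s :+ c := τ :+ c :+ s) refl τ (inv a ⊛ N v) c))

   ⊖0 : ⊖ 0ᶠ ≡ 0ᶠ
   ⊖0 = solve 0 (:- con 0ℤ := con 0ℤ) refl

   W-adjoint : ∀ a f g → ⟨ W a f , g ⟩ ≡ ⟨ f , W (⊖ a) g ⟩
   W-adjoint a f g = go (a ≟ 0ᶠ)
     where
       go : Dec (a ≡ 0ᶠ) → ⟨ W a f , g ⟩ ≡ ⟨ f , W (⊖ a) g ⟩
       go (yes refl) = trans (ip-comm (W 0ᶠ f) g) (trans (ip-congʳ (W-0 f)) (trans (ip-scaleʳ (κ e) g f) (trans (cong (κ e *_) (ip-comm g f))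
          (trans (sym (ip-scaleʳ (κ e) f g)) (ip-congʳ (λ x τ → sym (trans (cong (λ b → W b g x τ) ⊖0) (W-0 g x τ))))))))
       go (no n) = trans (ip-comm (W a f) g) (trans (ip-congʳ (λ x τ → W-nz a f x τ n)) (trans (ip-comm g (U (inv a) f)) (trans (U-adjoint (inv a) f g)
          (ip-congʳ (λ x τ → sym (trans (W-nz (⊖ a) g x τ (neg-nz n)) (cong (λ s → U s g x τ) (inv-neg a))))))))

   U-scale : ∀ s c g x τ → U s (λ x τ → c * g x τ) x τ ≡ c * U s g x τ
   U-scale s c g x τ = ∑-*ˡ V c _

   W-compose : ∀ a b g → ZeroG g → ∀ x τ → W a (W b g) x τ ≡ κ e * W (a ⊕ b) g x τ
   W-compose a b g z x τ = go (a ≟ 0ᶠ) (b ≟ 0ᶠ) ((a ⊕ b) ≟ 0ᶠ)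
     where
       open ≡-Reasoning
       go : Dec (a ≡ 0ᶠ) → Dec (b ≡ 0ᶠ) → Dec (a ⊕ b ≡ 0ᶠ) → W a (W b g) x τ ≡ κ e * W (a ⊕ b) g x τ
       go (yes refl) _ _ = trans (W-0 (W b g) x τ) (cong (λ c → κ e * W c g x τ) (sym (+-identityˡ b)))
       go (no na) (yes refl) _ = begin
         W a (W 0ᶠ g) x τ ≡⟨ W-cong a (W-0 g) x τ ⟩
         W a (λ x τ → κ e * g x τ) x τ ≡⟨ W-nz a _ x τ na ⟩
         U (inv a) (λ x τ → κ e * g x τ) x τ ≡⟨ U-scale (inv a) (κ e) g x τ ⟩
         κ e * U (inv a) g x τ ≡⟨ cong (κ e *_) (sym (trans (cong (λ c → W c g x τ) (+-identityʳ a)) (W-nz a g x τ na))) ⟩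
         κ e * W (a ⊕ 0ᶠ) g x τ ∎
       go (no na) (no nb) (yes a+b) = begin
         W a (W b g) x τ ≡⟨ trans (W-cong a (λ x τ → trans (cong (λ c → W c g x τ) b≡) (trans (W-nz (⊖ a) g x τ (neg-nz na)) (cong (λ c → U c g x τ) (inv-neg a)))) x τ)
               (W-nz a _ x τ na) ⟩
         U (inv a) (U (⊖ inv a) g) x τ ≡⟨ U-unitary (inv a) g (inv-nz a na) z x τ ⟩
         D (double e) * g x τ ≡⟨ cong (_* g x τ) (sym (κ² e)) ⟩
         κ e * κ e * g x τ ≡⟨ ℤP.*-assoc (κ e) (κ e) (g x τ) ⟩
         κ e * (κ e * g x τ) ≡⟨ cong (κ e *_) (sym (trans (cong (λ c → W c g x τ) a+b) (W-0 g x τ))) ⟩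
         κ e * W (a ⊕ b) g x τ ∎
         where
           b≡ : b ≡ ⊖ a
           b≡ = trans (solve 2 (λ a b → b := a :+ b :+ (:- a)) refl a b) (trans (cong (_⊕ ⊖ a) a+b) (+-identityˡ _))
       go (no na) (no nb) (no n) = begin
         W a (W b g) x τ ≡⟨ trans (W-cong a (λ x τ → W-nz b g x τ nb) x τ) (W-nz a _ x τ na) ⟩
         U s (U t g) x τ ≡⟨ cong₂ (λ y z → U y (U z g) x τ) (sym uα) (sym u1-α) ⟩
         U (u ⊛ α) (U (u ⊛ (1ᶠ ⊕ ⊖ α)) g) x τ ≡⟨ U-compose u α g x τ ⟩
         Γ (double e) u (U (u ⊛ α ⊛ (1ᶠ ⊕ ⊖ α)) g x) τ ≡⟨ Γ-even e u (U (u ⊛ α ⊛ (1ᶠ ⊕ ⊖ α)) g x) τ u≢0 (U-zero _ g z x) ⟩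
         κ e * U (u ⊛ α ⊛ (1ᶠ ⊕ ⊖ α)) g x τ ≡⟨ cong (λ y → κ e * U y g x τ) (sym p≡) ⟩
         κ e * U (inv (a ⊕ b)) g x τ ≡⟨ cong (κ e *_) (sym (W-nz (a ⊕ b) g x τ n)) ⟩
         κ e * W (a ⊕ b) g x τ ∎
         where
           s = inv a
           t = inv b
           u = s ⊕ t
           α = s ⊛ inv u
           [a+b]st : (a ⊕ b) ⊛ (s ⊛ t) ≡ u
           [a+b]st = trans (solve 4 (λ a b s t → (a :+ b) :* (s :* t) := t :* (a :* s) :+ s :* (b :* t)) refl a b s t)
             (trans (cong₂ (λ y z → t ⊛ y ⊕ s ⊛ z) (inv-r a na) (inv-r b nb)) (solve 2 (λ s t → t :* con 1ℤ :+ s :* con 1ℤ := s :+ t) refl s t))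
           u≢0 : u ≢ 0ᶠ
           u≢0 e′ = *-nz (a ⊕ b) (s ⊛ t) n (*-nz s t (inv-nz a na) (inv-nz b nb)) (trans [a+b]st e′)
           uα : u ⊛ α ≡ s
           uα = trans (solve 3 (λ u s i → u :* (s :* i) := s :* (u :* i)) refl u s (inv u)) (trans (cong (s ⊛_) (inv-r u u≢0)) (*-identityʳ s))
           u1-α : u ⊛ (1ᶠ ⊕ ⊖ α) ≡ t
           u1-α = trans (solve 2 (λ u α → u :* (con 1ℤ :+ (:- α)) := u :+ (:- (u :* α))) refl u α) (trans (cong (λ y → u ⊕ ⊖ y) uα)
             (solve 2 (λ s t → s :+ t :+ (:- s) := t) refl s t))
           p≡ : inv (a ⊕ b) ≡ u ⊛ α ⊛ (1ᶠ ⊕ ⊖ α)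
           p≡ = inv-unique (a ⊕ b) _ (begin
             (a ⊕ b) ⊛ (u ⊛ α ⊛ (1ᶠ ⊕ ⊖ α)) ≡⟨ cong ((a ⊕ b) ⊛_) (solve 2 (λ u α → u :* α :* (con 1ℤ :+ (:- α)) := α :* (u :* (con 1ℤ :+ (:- α)))) refl u α) ⟩
             (a ⊕ b) ⊛ (α ⊛ (u ⊛ (1ᶠ ⊕ ⊖ α))) ≡⟨ cong (λ y → (a ⊕ b) ⊛ (α ⊛ y)) u1-α ⟩
             (a ⊕ b) ⊛ (s ⊛ inv u ⊛ t) ≡⟨ solve 4 (λ c s i t → c :* (s :* i :* t) := c :* (s :* t) :* i) refl (a ⊕ b) s (inv u) t ⟩
             (a ⊕ b) ⊛ (s ⊛ t) ⊛ inv u ≡⟨ trans (cong (_⊛ inv u) [a+b]st) (inv-r u u≢0) ⟩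
             1ᶠ ∎)

   ρ : C → C → 𝔾 → 𝔾
   ρ c a g = Sh c (W a g)

   module _ (g : 𝔾) (z : ZeroG g) (r : C) (r≢0 : r ≢ 0ᶠ) where

     φ : C → C → ℤ
     φ c a = ⟨ g , ρ ((⊖ r) ⊛ c) a g ⟩

     gram : ∀ c a c′ a′ → ⟨ ρ ((⊖ r) ⊛ c) a g , ρ ((⊖ r) ⊛ c′) a′ g ⟩ ≡ D e * (χ e * φ (c′ ⊕ ⊖ c) (a′ ⊕ ⊖ a))
     gram c a c′ a′ = begin
       ⟨ Sh ((⊖ r) ⊛ c) (W a g) , ρ ((⊖ r) ⊛ c′) a′ g ⟩ ≡⟨ Sh-adjoint _ (W a g) _ ⟩
       ⟨ W a g , Sh (⊖ ((⊖ r) ⊛ c)) (ρ ((⊖ r) ⊛ c′) a′ g) ⟩ ≡⟨ W-adjoint a g _ ⟩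
       ⟨ g , W (⊖ a) (Sh (⊖ ((⊖ r) ⊛ c)) (ρ ((⊖ r) ⊛ c′) a′ g)) ⟩ ≡⟨ ip-congʳ (λ x τ → trans (W-shift (⊖ a) _ (ρ ((⊖ r) ⊛ c′) a′ g) x τ) (trans (W-shift (⊖ a) _ (W a′ g) x _)
           (trans (W-compose (⊖ a) a′ g z x _) (cong₂ (λ b t → κ e * W b g x t) (+-comm (⊖ a) a′)
             (solve 4 (λ τ r c c′ → τ :+ (:- ((:- r) :* c)) :+ (:- r) :* c′ := τ :+ (:- r) :* (c′ :+ (:- c))) refl τ r c c′))))) ⟩
       ⟨ g , (λ x τ → κ e * ρ ((⊖ r) ⊛ (c′ ⊕ ⊖ c)) (a′ ⊕ ⊖ a) g x τ) ⟩ ≡⟨ ip-scaleʳ (κ e) g _ ⟩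
       κ e * φ (c′ ⊕ ⊖ c) (a′ ⊕ ⊖ a) ≡⟨ lem (χ e) (D e) (φ (c′ ⊕ ⊖ c) (a′ ⊕ ⊖ a)) ⟩
       D e * (χ e * φ (c′ ⊕ ⊖ c) (a′ ⊕ ⊖ a)) ∎
       where
         open ≡-Reasoning
         lem : ∀ x d f → x * d * f ≡ d * (x * f)
         lem = solve-∀

     Ψ : C → C → ℤ
     Ψ c a = χ e * φ c a

     G : ∀ {I : Set} → (I → C) → (I → C) → I → 𝔾
     G c a i = ρ ((⊖ r) ⊛ c i) (a i) g

     norm-combine : ∀ {I : Set} (is : List I) (n : I → ℤ) (c a : I → C) →
       ‖ combine is n (G c a) ‖² ≡ D e * ∑ is (λ i → ∑ is (λ j → n i * n j * Ψ (c j ⊕ ⊖ c i) (a j ⊕ ⊖ a i)))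
     norm-combine is n c a = trans (‖‖²-combine is n (G c a)) (trans (∑∑-cong is is (λ i j → trans (cong (n i * n j *_) (gram (c i) (a i) (c j) (a j))) (lem (n i * n j) (D e) _)))
       (trans (∑-cong is (λ i → ∑-*ˡ is (D e) _)) (∑-*ˡ is (D e) _)))
       where
         lem : ∀ a b c → a * (b * c) ≡ b * (a * c)
         lem = solve-∀

     0<D : 0ℤ < D e
     0<D = Z.+<+ (ℕP.m^n>0 order {{ℕ.>-nonZero (Data.Nat.Properties.≤-trans (ℕ.s≤s ℕ.z≤n) (Mem.2≤length))}} e)
       where
         import Data.Nat.Properties
         open import Data.List.Membership.Propositional using (_∈_)
         open import Data.List.Relation.Unary.Any using (here; there)
         module Mem where
           2≤length : 1 ℕ.≤ order
           2≤length = go els (complete 0ᶠ)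
             where
               go : ∀ xs → 0ᶠ ∈ xs → 1 ℕ.≤ length xs
               go (x ∷ xs) _ = ℕ.s≤s ℕ.z≤n

     positiveDefinite : PositiveDefinite F
     positiveDefinite = record
       { ψ = Ψ
       ; B = D e * ‖ g ‖²
       ; 0≤B = *-nonneg (ℤP.<⇒≤ 0<D) (0≤‖‖² g)
       ; ψ-0 = trans (cong (χ e *_) (trans (ip-congʳ (λ x τ → trans (cong (λ t → W 0ᶠ g x t) (trans (cong (τ ⊕_) (zeroʳ (⊖ r))) (+-identityʳ τ))) (W-0 g x τ))) (ip-scaleʳ (κ e) g g)))
                (trans (lem (χ e) (D e) ‖ g ‖²) (trans (cong (_* (D e * ‖ g ‖²)) (χ² e)) (ℤP.*-identityˡ (D e * ‖ g ‖²))))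
       ; line = λ a → trans (∑-*ˡ els (χ e) _) (trans (cong (χ e *_) (trans (∑-one els _) (trans (sym (ip-combineʳ els (λ _ → 1ℤ) (λ c → ρ ((⊖ r) ⊛ c) a g) g))
                (trans (ip-congʳ {g′ = λ x τ → 0ℤ * g x τ} (λ x τ → trans (sym (∑-one els _)) (trans (∑-affine τ (⊖ r) (W a g x) (neg-nz r≢0)) (trans (W-zero a g z x) (sym (ℤP.*-zeroˡ (g x τ)))))))
                  (trans (ip-scaleʳ 0ℤ g g) (ℤP.*-zeroˡ ‖ g ‖²)))))) (ℤP.*-zeroʳ (χ e)))
       ; psd = λ is n c a → *-cancel-≤ {0ℤ} {_} {D e} 0<D (ℤP.≤-trans (ℤP.≤-reflexive (ℤP.*-zeroʳ (D e))) (ℤP.≤-trans (0≤‖‖² (combine is n (G c a))) (ℤP.≤-reflexive (norm-combine is n c a))))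
       ; cauchy = cauchy′ }
       where
         lem : ∀ x d n → x * (x * d * n) ≡ x * x * (d * n)
         lem = solve-∀
         cauchy′ : ∀ {I : Set} (is : List I) (n : I → ℤ) (c a : I → C) →
             ∑ is (λ i → n i * Ψ (c i) (a i)) * ∑ is (λ i → n i * Ψ (c i) (a i))
               ≤ D e * ‖ g ‖² * ∑ is (λ i → ∑ is (λ j → n i * n j * Ψ (c j ⊕ ⊖ c i) (a j ⊕ ⊖ a i)))
         cauchy′ is n c a = ℤP.≤-trans (ℤP.≤-reflexive (trans (cong₂ _*_ T≡ T≡) (trans (lem₁ (χ e) X) (trans (cong (_* (X * X)) (χ² e)) (ℤP.*-identityˡ _)))))
           (ℤP.≤-trans (ip-cauchy g (combine is n (G c a))) (ℤP.≤-reflexive (trans (cong (‖ g ‖² *_) (norm-combine is n c a)) (lem₂ ‖ g ‖² (D e) _))))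
           where
             X = ⟨ g , combine is n (G c a) ⟩
             T≡ : ∑ is (λ i → n i * Ψ (c i) (a i)) ≡ χ e * X
             T≡ = trans (∑-cong is (λ i → lem₃ (n i) (χ e) (φ (c i) (a i)))) (trans (∑-*ˡ is (χ e) _) (cong (χ e *_) (sym (ip-combineʳ is n (G c a) g))))
               where
                 lem₃ : ∀ a b c → a * (b * c) ≡ b * (a * c)
                 lem₃ = solve-∀
             lem₁ : ∀ c x → c * x * (c * x) ≡ c * c * (x * x)
             lem₁ = solve-∀
             lem₂ : ∀ a b c → a * (b * c) ≡ b * a * c
             lem₂ = solve-∀

     even-bound : ‖ M r g ‖² ≤ + 5 * (+ (order ℕ.^ suc (double e)) * ‖ g ‖²)
     even-bound = ℤP.≤-trans (ℤP.≤-reflexive norm≡) (ℤP.≤-trans (ℤP.*-monoˡ-≤-nonNeg (D e) {{Z.nonNegative (ℤP.<⇒≤ 0<D)}} K.kloosterman)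
         (ℤP.≤-reflexive (trans (lem₂ q (D e) ‖ g ‖²) (cong (λ t → + 5 * (t * ‖ g ‖²)) (trans (cong (q *_) (D² e)) (sym (D-suc (double e))))))))
       where
         module K = KloostermanBound F p m h p-prime p-odd orderF positiveDefinite
         lem₂ : ∀ q d n → d * (+ 5 * (q * (d * n))) ≡ + 5 * (q * (d * d) * n)
         lem₂ = solve-∀
         M≡ : ∀ x τ → M r g x τ ≡ combine els nz (G (λ s → s) inv) x τ
         M≡ x τ = ∑-cong els (λ s → nz-cong {s} (λ n → sym (trans (W-nz (inv s) g x _ (inv-nz s n)) (cong (λ t → U t g x (τ ⊕ (⊖ r) ⊛ s)) (inv-inv s)))))
         norm≡ : ‖ M r g ‖² ≡ D e * K.At.E 0
         norm≡ = trans (trans (ip-congʳ M≡) (trans (ip-comm _ _) (ip-congʳ M≡))) (trans (norm-combine els nz (λ s → s) inv) (cong (D e *_)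
           (trans (sym (∑-negate (λ s → ∑ els (λ t → nz s * nz t * Ψ (t ⊕ ⊖ s) (inv t ⊕ ⊖ inv s)))))
             (∑∑-cong els els (λ s t → cong₂ _*_ (cong (_* nz t) (nz-neg s)) (cong₂ Ψ (solve 2 (λ s t → t :+ (:- (:- s)) := s :+ t) refl s t)
               (trans (cong (λ y → inv t ⊕ ⊖ y) (inv-neg s)) (solve 2 (λ s t → t :+ (:- (:- s)) := s :+ t) refl (inv s) (inv t)))))))))

module OddDimensions where
 open FiniteSums
 open FiniteFields
 open QuadraticTower
 open KloostermanSums
 open SphereSums
 open SphereOperatorAlgebra
 open import Data.Integer as Z using (ℤ; +_; 0ℤ; 1ℤ; _+_; _*_; -_; _-_; _≤_)
 open import Data.Integer.Tactic.RingSolver using (solve-∀)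

 -- In odd dimension M r M r = (q - 1) q^d + c r M 0 + c (4 r) M (4 r) - Σ Γ(-p) U p, where c r² ≤ q^(d+1) and c 0 = 0.
 -- A common bound B q^(d+1) for all ‖M r g‖² / ‖g‖² therefore improves to (5 + B/6) q^(d+1).
 module OddDimension (F : FiniteField) (two≢0 : FieldFacts.two F ≢ FiniteField.0ᶠ F) (e : ℕ) where
   open FieldFacts F
   open Squares two≢0
   open NonzeroSums F
   open Sphere F two≢0
   open SphereOperators F two≢0 (suc (double e))

   Γ-roots : ∀ u z h τ → u ≢ 0ᶠ → Zero h → roots z * Γ (suc (double e)) u h τ ≡ Γ (suc (double e)) u h τ + nz z * Γ (suc (double e)) (u ⊛ z) h τ
   Γ-roots u z h τ n zero-h = go (z ≟ 0ᶠ) (square? z)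
     where
       Γu = Γ (suc (double e)) u h τ
       lem₁ : ∀ a b → 1ℤ * a ≡ a + 0ℤ * b
       lem₁ = solve-∀
       lem₂ : ∀ a → + 2 * a ≡ a + 1ℤ * a
       lem₂ = solve-∀
       lem₃ : ∀ k a → 0ℤ * (k * a) ≡ k * a + 1ℤ * (k * - a)
       lem₃ = solve-∀
       go : Dec (z ≡ 0ᶠ) → (∃ λ w → w ⊛ w ≡ z) ⊎ (∀ w → w ⊛ w ≢ z) → roots z * Γu ≡ Γu + nz z * Γ (suc (double e)) (u ⊛ z) h τ
       go (yes refl) _ = trans (cong (_* Γu) roots-0) (trans (lem₁ Γu (Γ (suc (double e)) (u ⊛ z) h τ)) (cong (λ t → Γu + t * Γ (suc (double e)) (u ⊛ z) h τ) (sym nz-0)))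
       go (no nz₀) (inj₁ (w , refl)) = trans (cong (_* Γu) (roots-square w w≢0)) (trans (lem₂ Γu) (cong₂ (λ s t → Γu + s * t) (sym (nz-1 nz₀))
           (sym (trans (Γ-odd e (u ⊛ (w ⊛ w)) h τ (*-nz u _ n nz₀) zero-h) (trans (cong (κ e *_) (Γ₁-square u w h τ w≢0)) (sym (Γ-odd e u h τ n zero-h)))))))
         where
           w≢0 : w ≢ 0ᶠ
           w≢0 w≡0 = nz₀ (trans (cong (_⊛ w) w≡0) (zeroˡ w))
       go (no nz₀) (inj₂ ns) = trans (cong₂ _*_ (roots-nonsquare z ns) (Γ-odd e u h τ n zero-h)) (trans (lem₃ (κ e) (Γ₁ u h τ))
           (cong₂ _+_ (sym (Γ-odd e u h τ n zero-h)) (cong₂ _*_ (sym (nz-1 nz₀)) (sym (trans (Γ-odd e (u ⊛ z) h τ (*-nz u z n nz₀) zero-h) (cong (κ e *_) (Γ₁-nonsquare u z h τ n ns zero-h)))))))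

   c : C → ℤ
   c r = κ e * (q * roots r - q)

   c-0 : c 0ᶠ ≡ 0ℤ
   c-0 = trans (cong (λ t → κ e * (q * t - q)) roots-0) (lem (κ e) q)
     where
       lem : ∀ k q → k * (q * 1ℤ - q) ≡ 0ℤ
       lem = solve-∀

   Q₁ : ℤ
   Q₁ = + (order ℕ.^ suc (suc (double e)))

   Q₁≡ : Q₁ ≡ q * qᵈ
   Q₁≡ = D-suc (suc (double e))

   0≤qᵈ : 0ℤ ≤ qᵈ
   0≤qᵈ = 0≤+ _

   0≤Q₁ : 0ℤ ≤ Q₁
   0≤Q₁ = 0≤+ _

   c² : ∀ r → r ≢ 0ᶠ → c r * c r ≡ Q₁
   c² r n = trans (expand (κ e) q (roots r)) (trans (cong₂ (λ s t → s * (q * q) * t) (κ² e) (unit (square? r)))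
      (trans (lem (D (double e)) q) (trans (cong (q *_) (sym (D-suc (double e)))) (sym Q₁≡))))
     where
       expand : ∀ k q x → k * (q * x - q) * (k * (q * x - q)) ≡ k * k * (q * q) * ((x - 1ℤ) * (x - 1ℤ))
       expand = solve-∀
       lem : ∀ d q → d * (q * q) * 1ℤ ≡ q * (q * d)
       lem = solve-∀
       unit : (∃ λ w → w ⊛ w ≡ r) ⊎ (∀ w → w ⊛ w ≢ r) → (roots r - 1ℤ) * (roots r - 1ℤ) ≡ 1ℤ
       unit (inj₁ (w , refl)) = cong (λ t → (t - 1ℤ) * (t - 1ℤ)) (roots-square w (λ w≡0 → n (trans (cong (_⊛ w) w≡0) (zeroˡ w))))
       unit (inj₂ ns) = cong (λ t → (t - 1ℤ) * (t - 1ℤ)) (roots-nonsquare r ns)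

   -- Σ_{u ≠ 0} Γ u, shifted by - r u, is multiplication by c r
   Γ-average : ∀ r h τ → Zero h → ∑ els (λ u → nz u * Γ (suc (double e)) u h (τ ⊕ (⊖ r) ⊛ u)) ≡ c r * h τ
   Γ-average r h τ z = begin
     ∑ els (λ u → nz u * Γ (suc (double e)) u h (τ ⊕ (⊖ r) ⊛ u)) ≡⟨ ∑-cong els (λ u → trans (nz-cong {u} (λ n → Γ-odd e u h _ n z))
         (trans (lem₁ (nz u) (κ e) _) (cong (κ e *_) (sym (∑-*ˡ els (nz u) _))))) ⟩
     ∑ els (λ u → κ e * ∑ els (λ a → nz u * h (τ ⊕ (⊖ r) ⊛ u ⊕ u ⊛ (a ⊛ a)))) ≡⟨ trans (∑-*ˡ els (κ e) _) (cong (κ e *_) (trans (∑-swap els els _)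
         (∑-cong els (λ a → trans (∑-cong els (λ u → cong (λ t → nz u * h t) (solve 4 (λ τ r u a → τ :+ (:- r) :* u :+ u :* (a :* a) := τ :+ u :* (a :* a :+ (:- r))) refl τ r u a)))
           (∑-line-nz τ (a ⊛ a ⊕ ⊖ r) h z))))) ⟩
     κ e * ∑ els (λ a → q * δ (a ⊛ a ⊕ ⊖ r) 0ᶠ * h τ - h τ) ≡⟨ cong (κ e *_) (trans (∑-- els _ _) (cong₂ _-_
         (trans (∑-cong els (λ a → cong (λ t → q * t * h τ) (δ-cong fin fin {a ⊛ a ⊕ ⊖ r} {0ᶠ} {a ⊛ a} {r} (x-x _ _) (λ eq → trans (cong (_⊕ ⊖ r) eq) (-‿inverseʳ r)))))
           (trans (∑-*ʳ els (h τ) _) (cong (_* h τ) (∑-*ˡ els q _)))) (∑-const els (h τ)))) ⟩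
     κ e * (q * roots r * h τ - q * h τ) ≡⟨ lem₂ (κ e) q (roots r) (h τ) ⟩
     c r * h τ ∎
     where
       open ≡-Reasoning
       lem₁ : ∀ a b c → a * (b * c) ≡ b * (a * c)
       lem₁ = solve-∀
       lem₂ : ∀ k q x h → k * (q * x * h - q * h) ≡ k * (q * x - q) * h
       lem₂ = solve-∀

   module _ (g : 𝔾) (z : ZeroG g) where

     X : ℤ
     X = ‖ g ‖²

     0≤X : 0ℤ ≤ X
     0≤X = 0≤‖‖² g

     T : ℤ
     T = ∑ els (λ p → nz p * ⟨ g , ΓG (⊖ p) (U p g) ⟩)

     ‖U‖² : ∀ s → s ≢ 0ᶠ → ‖ U s g ‖² ≡ qᵈ * X
     ‖U‖² s n = trans (U-adjoint s g (U s g)) (trans (ip-congʳ (λ x τ → trans (cong (λ t → U (⊖ s) (U t g) x τ) (sym (neg-neg s))) (U-unitary (⊖ s) g (neg-nz n) z x τ))) (ip-scaleʳ qᵈ g g))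

     ‖Γ‖² : ∀ s → s ≢ 0ᶠ → ‖ ΓG s g ‖² ≡ qᵈ * X
     ‖Γ‖² s n = trans (ΓG-adjoint s g (ΓG s g)) (trans (ip-congʳ (λ x τ → trans (cong (λ t → Γ (suc (double e)) (⊖ s) (Γ (suc (double e)) t (g x)) τ) (sym (neg-neg s))) (Γ-unitary (⊖ s) (g x) (neg-nz n) (z x) τ))) (ip-scaleʳ qᵈ g g))

     -T≤ : - T ≤ Q₁ * X
     -T≤ = ℤP.≤-trans (ℤP.≤-reflexive (sym (∑-neg els _))) (ℤP.≤-trans (∑-mono els {λ p → - (nz p * ⟨ g , ΓG (⊖ p) (U p g) ⟩)} {λ _ → qᵈ * X} term)
         (ℤP.≤-reflexive (trans (∑-const els (qᵈ * X)) (trans (sym (ℤP.*-assoc q qᵈ X)) (cong (_* X) (sym Q₁≡))))))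
       where
         bound : ∀ p → p ≢ 0ᶠ → - ⟨ g , ΓG (⊖ p) (U p g) ⟩ ≤ qᵈ * X
         bound p n = *-cancel-≤ {c = + 2} (Z.+<+ (ℕ.s≤s ℕ.z≤n)) (subst₂ _≤_ lhs rhs (am-gm 1ℤ Z.-1ℤ (ΓG p g) (U p g)))
           where
             lem₁ : ∀ t → + 2 * (1ℤ * Z.-1ℤ) * t ≡ + 2 * - t
             lem₁ = solve-∀
             lem₂ : ∀ a → 1ℤ * 1ℤ * a + Z.-1ℤ * Z.-1ℤ * a ≡ + 2 * a
             lem₂ = solve-∀
             lhs : + 2 * (1ℤ * Z.-1ℤ) * ⟨ ΓG p g , U p g ⟩ ≡ + 2 * - ⟨ g , ΓG (⊖ p) (U p g) ⟩
             lhs = trans (lem₁ _) (cong (λ t → + 2 * - t) (ΓG-adjoint p g (U p g)))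
             rhs : 1ℤ * 1ℤ * ‖ ΓG p g ‖² + Z.-1ℤ * Z.-1ℤ * ‖ U p g ‖² ≡ + 2 * (qᵈ * X)
             rhs = trans (cong₂ (λ s t → 1ℤ * 1ℤ * s + Z.-1ℤ * Z.-1ℤ * t) (‖Γ‖² p n) (‖U‖² p n)) (lem₂ (qᵈ * X))
         term : ∀ p → - (nz p * ⟨ g , ΓG (⊖ p) (U p g) ⟩) ≤ qᵈ * X
         term p = go (p ≟ 0ᶠ)
           where
             go : Dec (p ≡ 0ᶠ) → - (nz p * ⟨ g , ΓG (⊖ p) (U p g) ⟩) ≤ qᵈ * X
             go (yes refl) = ℤP.≤-trans (ℤP.≤-reflexive (cong -_ (trans (cong (_* ⟨ g , ΓG (⊖ p) (U p g) ⟩) nz-0) (ℤP.*-zeroˡ ⟨ g , ΓG (⊖ p) (U p g) ⟩)))) (*-nonneg 0≤qᵈ 0≤X)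
             go (no n) = ℤP.≤-trans (ℤP.≤-reflexive (cong -_ (trans (cong (_* ⟨ g , ΓG (⊖ p) (U p g) ⟩) (nz-1 n)) (ℤP.*-identityˡ _)))) (bound p n)

     module _ (r : C) where
       J : C → C → ℤ
       J s t = ⟨ g , Sh ((⊖ r) ⊛ (s ⊕ t)) (U s (U t g)) ⟩

       norm≡ : ‖ M r g ‖² ≡ ∑ els (λ s → ∑ els (λ t → nz s * nz t * J s t))
       norm≡ = trans (‖‖²-combine els nz (λ s → R r s g)) (trans (sym (∑-negate (λ s → ∑ els (λ t → nz s * nz t * ⟨ R r s g , R r t g ⟩))))
         (∑∑-cong els els (λ s t → cong₂ _*_ (cong (_* nz t) (nz-neg s)) (trans (Sh-adjoint _ (U (⊖ s) g) (R r t g)) (trans (U-adjoint (⊖ s) g _)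
           (ip-congʳ (λ x τ → trans (cong (λ w → U w (Sh (⊖ ((⊖ r) ⊛ (⊖ s))) (R r t g)) x τ) (neg-neg s))
              (∑∑-cong V V (λ v w → cong (g _) (solve 6 (λ τ r s t v w → τ :+ v :+ (:- ((:- r) :* (:- s))) :+ (:- r) :* t :+ w := τ :+ (:- r) :* (s :+ t) :+ v :+ w) refl τ r s t (s ⊛ N v) (t ⊛ N w)))))))))))

       inv4 : C
       inv4 = inv two ⊛ inv two

       four·inv4 : four ⊛ inv4 ≡ 1ᶠ
       four·inv4 = trans (solve 2 (λ t i → t :* t :* (i :* i) := (t :* i) :* (t :* i)) refl two (inv two)) (trans (cong₂ _⊛_ (inv-r two two≢0) (inv-r two two≢0)) (*-identityˡ 1ᶠ))

       H : C → C → ℤ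
       H u y = ⟨ g , Sh ((⊖ r) ⊛ u) (ΓG u (U (u ⊛ y) g)) ⟩

       K : C → C → C → ℤ
       K u v p = ⟨ g , Sh ((⊖ r) ⊛ u) (ΓG v (U p g)) ⟩

       -- substitute s = u (½ + β), t = u (½ - β)
       slice : ∀ u → u ≢ 0ᶠ → ∑ els (λ s → nz s * nz (u ⊕ ⊖ s) * J s (u ⊕ ⊖ s)) ≡ ∑ els (λ y → nz y * (roots (inv4 ⊕ ⊖ y) * H u y))
       slice u n = begin
         ∑ els (λ s → nz s * nz (u ⊕ ⊖ s) * J s (u ⊕ ⊖ s)) ≡⟨ sym (∑-scale u n (λ s → nz s * nz (u ⊕ ⊖ s) * J s (u ⊕ ⊖ s))) ⟩
         ∑ els (λ α → nz (u ⊛ α) * nz (u ⊕ ⊖ (u ⊛ α)) * J (u ⊛ α) (u ⊕ ⊖ (u ⊛ α))) ≡⟨ ∑-cong els step ⟩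
         ∑ els (λ α → nz (α ⊛ (1ᶠ ⊕ ⊖ α)) * H u (α ⊛ (1ᶠ ⊕ ⊖ α))) ≡⟨ sym (∑-shift (inv two) (λ α → nz (α ⊛ (1ᶠ ⊕ ⊖ α)) * H u (α ⊛ (1ᶠ ⊕ ⊖ α)))) ⟩
         ∑ els (λ β → nz ((β ⊕ inv two) ⊛ (1ᶠ ⊕ ⊖ (β ⊕ inv two))) * H u ((β ⊕ inv two) ⊛ (1ᶠ ⊕ ⊖ (β ⊕ inv two)))) ≡⟨ ∑-cong els (λ β → cong (λ y → nz y * H u y) (complete-square β)) ⟩
         ∑ els (λ β → nz (inv4 ⊕ ⊖ (β ⊛ β)) * H u (inv4 ⊕ ⊖ (β ⊛ β))) ≡⟨ ∑-roots (λ D → nz (inv4 ⊕ ⊖ D) * H u (inv4 ⊕ ⊖ D)) ⟩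
         ∑ els (λ D → roots D * (nz (inv4 ⊕ ⊖ D) * H u (inv4 ⊕ ⊖ D))) ≡⟨ sym (∑-reflect inv4 (λ D → roots D * (nz (inv4 ⊕ ⊖ D) * H u (inv4 ⊕ ⊖ D)))) ⟩
         ∑ els (λ y → roots (inv4 ⊕ ⊖ y) * (nz (inv4 ⊕ ⊖ (inv4 ⊕ ⊖ y)) * H u (inv4 ⊕ ⊖ (inv4 ⊕ ⊖ y)))) ≡⟨ ∑-cong els (λ y → trans (cong (λ w → roots (inv4 ⊕ ⊖ y) * (nz w * H u w)) (solve 2 (λ i y → i :+ (:- (i :+ (:- y))) := y) refl inv4 y))
              (lem (roots (inv4 ⊕ ⊖ y)) (nz y) (H u y))) ⟩
         ∑ els (λ y → nz y * (roots (inv4 ⊕ ⊖ y) * H u y)) ∎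
         where
           open ≡-Reasoning
           lem : ∀ a b c → a * (b * c) ≡ b * (a * c)
           lem = solve-∀
           u-uα : ∀ α → u ⊕ ⊖ (u ⊛ α) ≡ u ⊛ (1ᶠ ⊕ ⊖ α)
           u-uα α = solve 2 (λ u α → u :+ (:- (u :* α)) := u :* (con 1ℤ :+ (:- α))) refl u α
           step : ∀ α → nz (u ⊛ α) * nz (u ⊕ ⊖ (u ⊛ α)) * J (u ⊛ α) (u ⊕ ⊖ (u ⊛ α)) ≡ nz (α ⊛ (1ᶠ ⊕ ⊖ α)) * H u (α ⊛ (1ᶠ ⊕ ⊖ α))
           step α = trans (cong (λ w → nz (u ⊛ α) * nz w * J (u ⊛ α) w) (u-uα α)) (cong₂ _*_
             (trans (cong₂ _*_ (nz-⊛ u α) (nz-⊛ u (1ᶠ ⊕ ⊖ α))) (trans (cong₂ (λ s t → s * nz α * (t * nz (1ᶠ ⊕ ⊖ α))) (nz-1 n) (nz-1 n))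
               (trans (cong₂ _*_ (ℤP.*-identityˡ (nz α)) (ℤP.*-identityˡ (nz (1ᶠ ⊕ ⊖ α)))) (sym (nz-⊛ α _)))))
             (ip-congʳ (λ x τ → trans (cong (λ w → U (u ⊛ α) (U (u ⊛ (1ᶠ ⊕ ⊖ α)) g) x (τ ⊕ (⊖ r) ⊛ w)) (solve 2 (λ u α → u :* α :+ u :* (con 1ℤ :+ (:- α)) := u) refl u α))
               (trans (U-compose u α g x _) (cong (λ w → Γ (suc (double e)) u (U w g x) (τ ⊕ (⊖ r) ⊛ u)) (*-assoc u α _))))))
           complete-square : ∀ β → (β ⊕ inv two) ⊛ (1ᶠ ⊕ ⊖ (β ⊕ inv two)) ≡ inv4 ⊕ ⊖ (β ⊛ β)
           complete-square β = trans (cong (λ o → (β ⊕ inv two) ⊛ (o ⊕ ⊖ (β ⊕ inv two))) (sym (inv-l two two≢0)))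
             (solve 2 (λ β i → (β :+ i) :* (i :* con (+ 2) :+ (:- (β :+ i))) := i :* i :+ (:- (β :* β))) refl β (inv two))

       decompose : ‖ M r g ‖² ≡ (q - 1ℤ) * (qᵈ * X) + ∑ els (λ u → nz u * ∑ els (λ y → nz y * (roots (inv4 ⊕ ⊖ y) * H u y)))
       decompose = begin
         ‖ M r g ‖² ≡⟨ norm≡ ⟩
         ∑ els (λ s → ∑ els (λ t → nz s * nz t * J s t)) ≡⟨ ∑-cong els (λ s → trans (sym (∑-shift (⊖ s) (λ t → nz s * nz t * J s t)))  refl) ⟩
         ∑ els (λ s → ∑ els (λ u → nz s * nz (u ⊕ ⊖ s) * J s (u ⊕ ⊖ s))) ≡⟨ ∑-swap els els _ ⟩
         ∑ els f ≡⟨ lem₁ (∑ els f) (f 0ᶠ) ⟩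
         f 0ᶠ + (∑ els f - f 0ᶠ) ≡⟨ cong₂ _+_ f0 (trans (sym (∑-nz f)) (∑-cong els (λ u → nz-cong {u} (slice u)))) ⟩
         (q - 1ℤ) * (qᵈ * X) + ∑ els (λ u → nz u * ∑ els (λ y → nz y * (roots (inv4 ⊕ ⊖ y) * H u y))) ∎
         where
           open ≡-Reasoning
           f : C → ℤ
           f u = ∑ els (λ s → nz s * nz (u ⊕ ⊖ s) * J s (u ⊕ ⊖ s))
           lem₁ : ∀ a b → a ≡ b + (a - b)
           lem₁ = solve-∀
           nz² : ∀ s → nz s * nz s ≡ nz s
           nz² s with s ≟ 0ᶠ
           ... | yes _ = refl
           ... | no _ = refl
           f0 : f 0ᶠ ≡ (q - 1ℤ) * (qᵈ * X)
           f0 = trans (∑-cong els (λ s → trans (cong₂ _*_ (trans (cong (nz s *_) (trans (cong nz (+-identityˡ (⊖ s))) (nz-neg s))) (nz² s)) refl)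
               (nz-cong {s} {_} {qᵈ * X} (λ n → trans (ip-congʳ (λ x τ → trans (cong₂ (λ w t → U s (U w g) x t) (+-identityˡ (⊖ s))
                  (trans (cong (λ y → τ ⊕ (⊖ r) ⊛ y) (solve 1 (λ s → s :+ (con 0ℤ :+ (:- s)) := con 0ℤ) refl s)) (trans (cong (τ ⊕_) (zeroʳ _)) (+-identityʳ τ))))
                  (U-unitary s g n z x τ))) (ip-scaleʳ qᵈ g g)))))
             (trans (∑-nz (λ _ → qᵈ * X)) (trans (cong (_- (qᵈ * X)) (∑-const els (qᵈ * X))) (lem₂ q (qᵈ * X))))
             where
               lem₂ : ∀ q x → q * x - x ≡ (q - 1ℤ) * x
               lem₂ = solve-∀

       H-roots : ∀ u y → u ≢ 0ᶠ → roots (inv4 ⊕ ⊖ y) * H u y ≡ K u u (u ⊛ y) + nz (inv4 ⊕ ⊖ y) * K u (u ⊛ (inv4 ⊕ ⊖ y)) (u ⊛ y)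
       H-roots u y n = begin
         roots w * H u y ≡⟨ sym (ip-scaleʳ (roots w) g (Sh ((⊖ r) ⊛ u) (ΓG u (U (u ⊛ y) g)))) ⟩
         ⟨ g , (λ x τ → roots w * Γ (suc (double e)) u (U (u ⊛ y) g x) (τ ⊕ (⊖ r) ⊛ u)) ⟩ ≡⟨ ip-congʳ (λ x τ → Γ-roots u w (U (u ⊛ y) g x) (τ ⊕ (⊖ r) ⊛ u) n (U-zero _ g z x)) ⟩
         ⟨ g , (λ x τ → Sh ((⊖ r) ⊛ u) (ΓG u (U (u ⊛ y) g)) x τ + nz w * Sh ((⊖ r) ⊛ u) (ΓG (u ⊛ w) (U (u ⊛ y) g)) x τ) ⟩ ≡⟨ trans (ip-addʳ g _ _) (+ˡ (K u u (u ⊛ y)) (ip-scaleʳ (nz w) g _)) ⟩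
         K u u (u ⊛ y) + nz w * K u (u ⊛ w) (u ⊛ y) ∎
         where
           open ≡-Reasoning
           w = inv4 ⊕ ⊖ y

       first : ∑ els (λ u → nz u * ∑ els (λ y → nz y * K u u (u ⊛ y))) ≡ c r * ⟨ g , M 0ᶠ g ⟩
       first = begin
         ∑ els (λ u → nz u * ∑ els (λ y → nz y * K u u (u ⊛ y))) ≡⟨ ∑-cong els (λ u → nz-cong {u} (λ n → trans (∑-cong els (λ y → cong (_* K u u (u ⊛ y)) (sym (trans (nz-⊛ u y) (trans (cong (_* nz y) (nz-1 n)) (ℤP.*-identityˡ _))))))
              (∑-scale u n (λ p → nz p * K u u p)))) ⟩
         ∑ els (λ u → nz u * ∑ els (λ p → nz p * K u u p)) ≡⟨ trans (∑-cong els (λ u → sym (∑-*ˡ els (nz u) _))) (∑-swap els els _) ⟩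
         ∑ els (λ p → ∑ els (λ u → nz u * (nz p * K u u p))) ≡⟨ ∑-cong els (λ p → trans (∑-cong els (λ u → lem (nz u) (nz p) (K u u p))) (trans (∑-*ˡ els (nz p) _) (cong (nz p *_)
              (trans (sym (ip-combineʳ els nz (λ u → Sh ((⊖ r) ⊛ u) (ΓG u (U p g))) g)) (trans (ip-congʳ (λ x τ → Γ-average r (U p g x) τ (U-zero p g z x))) (ip-scaleʳ (c r) g (U p g))))))) ⟩
         ∑ els (λ p → nz p * (c r * ⟨ g , U p g ⟩)) ≡⟨ trans (∑-cong els (λ p → lem (nz p) (c r) _)) (∑-*ˡ els (c r) _) ⟩
         c r * ∑ els (λ p → nz p * ⟨ g , U p g ⟩) ≡⟨ cong (c r *_) (trans (∑-cong els (λ p → cong (nz p *_) (ip-congʳ (λ x τ → cong (U p g x) (solve 2 (λ τ p → τ := τ :+ (:- con 0ℤ) :* p) refl τ p)))))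
              (sym (ip-combineʳ els nz (λ p → R 0ᶠ p g) g))) ⟩
         c r * ⟨ g , M 0ᶠ g ⟩ ∎
         where
           open ≡-Reasoning
           lem : ∀ a b c → a * (b * c) ≡ b * (a * c)
           lem = solve-∀

       -- substitute p = u y and v = u (¼ - y), so that u = 4 (v + p)
       second : ∑ els (λ u → nz u * ∑ els (λ y → nz y * (nz (inv4 ⊕ ⊖ y) * K u (u ⊛ (inv4 ⊕ ⊖ y)) (u ⊛ y)))) ≡ c (four ⊛ r) * ⟨ g , M (four ⊛ r) g ⟩ - T
       second = begin
         ∑ els (λ u → nz u * ∑ els (λ y → nz y * (nz (inv4 ⊕ ⊖ y) * K u (u ⊛ (inv4 ⊕ ⊖ y)) (u ⊛ y)))) ≡⟨ ∑-cong els (λ u → nz-cong {u} (λ n → trans (∑-cong els (λ y → cong₂ _*_ (nz-u u n y)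
               (cong₂ _*_ (nz-u u n (inv4 ⊕ ⊖ y)) refl))) (trans (∑-cong els (λ y → cong (λ w → nz (u ⊛ y) * (nz w * K u w (u ⊛ y))) (solve 3 (λ u i y → u :* (i :+ (:- y)) := u :* i :+ (:- (u :* y))) refl u inv4 y)))
               (∑-scale u n (λ p → nz p * (nz (u ⊛ inv4 ⊕ ⊖ p) * K u (u ⊛ inv4 ⊕ ⊖ p) p)))))) ⟩
         ∑ els (λ u → nz u * ∑ els (λ p → nz p * (nz (u ⊛ inv4 ⊕ ⊖ p) * K u (u ⊛ inv4 ⊕ ⊖ p) p))) ≡⟨ trans (∑-cong els (λ u → sym (∑-*ˡ els (nz u) _))) (∑-swap els els _) ⟩
         ∑ els (λ p → ∑ els (λ u → nz u * (nz p * (nz (u ⊛ inv4 ⊕ ⊖ p) * K u (u ⊛ inv4 ⊕ ⊖ p) p)))) ≡⟨ ∑-cong els (λ p → trans (∑-cong els (λ u → lem (nz u) (nz p) _)) (trans (∑-*ˡ els (nz p) _) (nz-cong {p} (inner p)))) ⟩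
         ∑ els (λ p → nz p * (c (four ⊛ r) * ⟨ g , R (four ⊛ r) p g ⟩ - ⟨ g , ΓG (⊖ p) (U p g) ⟩)) ≡⟨ trans (∑-cong els (λ p → lem₃ (nz p) (c (four ⊛ r)) ⟨ g , R (four ⊛ r) p g ⟩ ⟨ g , ΓG (⊖ p) (U p g) ⟩)) (trans (∑-- els _ _) (cong (_- T) (∑-*ˡ els (c (four ⊛ r)) _))) ⟩
         c (four ⊛ r) * ∑ els (λ p → nz p * ⟨ g , R (four ⊛ r) p g ⟩) - T ≡⟨ cong (λ t → c (four ⊛ r) * t - T) (sym (ip-combineʳ els nz (λ p → R (four ⊛ r) p g) g)) ⟩
         c (four ⊛ r) * ⟨ g , M (four ⊛ r) g ⟩ - T ∎
         where
           open ≡-Reasoning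
           lem : ∀ a b c → a * (b * c) ≡ b * (a * c)
           lem = solve-∀
           lem₃ : ∀ n c a b → n * (c * a - b) ≡ c * (n * a) - n * b
           lem₃ = solve-∀
           nz-u : ∀ u → u ≢ 0ᶠ → ∀ y → nz y ≡ nz (u ⊛ y)
           nz-u u n y = sym (trans (nz-⊛ u y) (trans (cong (_* nz y) (nz-1 n)) (ℤP.*-identityˡ _)))
           inner : ∀ p → p ≢ 0ᶠ → ∑ els (λ u → nz u * (nz (u ⊛ inv4 ⊕ ⊖ p) * K u (u ⊛ inv4 ⊕ ⊖ p) p)) ≡ c (four ⊛ r) * ⟨ g , R (four ⊛ r) p g ⟩ - ⟨ g , ΓG (⊖ p) (U p g) ⟩
           inner p n = begin
             ∑ els (λ u → nz u * (nz (u ⊛ inv4 ⊕ ⊖ p) * K u (u ⊛ inv4 ⊕ ⊖ p) p)) ≡⟨ sym (∑-scale four four≢0 (λ u → nz u * (nz (u ⊛ inv4 ⊕ ⊖ p) * K u (u ⊛ inv4 ⊕ ⊖ p) p))) ⟩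
             ∑ els (λ w → nz (four ⊛ w) * (nz (four ⊛ w ⊛ inv4 ⊕ ⊖ p) * K (four ⊛ w) (four ⊛ w ⊛ inv4 ⊕ ⊖ p) p)) ≡⟨ ∑-cong els (λ w → cong₂ (λ a b → a * (nz (b ⊕ ⊖ p) * K (four ⊛ w) (b ⊕ ⊖ p) p)) (sym (nz-u four four≢0 w))
                  (trans (solve 3 (λ f w i → f :* w :* i := (f :* i) :* w) refl four w inv4) (trans (cong (_⊛ w) four·inv4) (*-identityˡ w)))) ⟩
             ∑ els (λ w → nz w * (nz (w ⊕ ⊖ p) * K (four ⊛ w) (w ⊕ ⊖ p) p)) ≡⟨ ∑-nz (λ w → nz (w ⊕ ⊖ p) * K (four ⊛ w) (w ⊕ ⊖ p) p) ⟩
             ∑ els (λ w → nz (w ⊕ ⊖ p) * K (four ⊛ w) (w ⊕ ⊖ p) p) - nz (0ᶠ ⊕ ⊖ p) * K (four ⊛ 0ᶠ) (0ᶠ ⊕ ⊖ p) p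
               ≡⟨ cong₂ _-_ (trans (sym (∑-shift p (λ w → nz (w ⊕ ⊖ p) * K (four ⊛ w) (w ⊕ ⊖ p) p))) (trans (∑-cong els (λ v → cong (λ w → nz w * K (four ⊛ (v ⊕ p)) w p) (solve 2 (λ v p → v :+ p :+ (:- p) := v) refl v p))) average)) last ⟩
             c (four ⊛ r) * ⟨ g , R (four ⊛ r) p g ⟩ - ⟨ g , ΓG (⊖ p) (U p g) ⟩ ∎
             where
               average : ∑ els (λ v → nz v * K (four ⊛ (v ⊕ p)) v p) ≡ c (four ⊛ r) * ⟨ g , R (four ⊛ r) p g ⟩
               average = trans (∑-cong els (λ v → cong (nz v *_) (ip-congʳ (λ x τ → cong (Γ (suc (double e)) v (U p g x)) (solve 5 (λ τ r f v p → τ :+ (:- r) :* (f :* (v :+ p)) := τ :+ (:- (f :* r)) :* p :+ (:- (f :* r)) :* v) refl τ r four v p)))))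
                 (trans (sym (ip-combineʳ els nz (λ v x τ → Γ (suc (double e)) v (U p g x) (τ ⊕ (⊖ (four ⊛ r)) ⊛ p ⊕ (⊖ (four ⊛ r)) ⊛ v)) g))
                   (trans (ip-congʳ (λ x τ → Γ-average (four ⊛ r) (U p g x) (τ ⊕ (⊖ (four ⊛ r)) ⊛ p) (U-zero p g z x))) (ip-scaleʳ (c (four ⊛ r)) g (R (four ⊛ r) p g))))
               last : nz (0ᶠ ⊕ ⊖ p) * K (four ⊛ 0ᶠ) (0ᶠ ⊕ ⊖ p) p ≡ ⟨ g , ΓG (⊖ p) (U p g) ⟩
               last = trans (cong₂ _*_ (trans (cong nz (+-identityˡ (⊖ p))) (nz-1 (neg-nz n))) (ip-congʳ (λ x τ → cong₂ (λ v t → Γ (suc (double e)) v (U p g x) t) (+-identityˡ (⊖ p)) (solve 3 (λ τ r f → τ :+ (:- r) :* (f :* con 0ℤ) := τ) refl τ r four)))) (ℤP.*-identityˡ _)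

       identity : ‖ M r g ‖² ≡ (q - 1ℤ) * (qᵈ * X) + (c r * ⟨ g , M 0ᶠ g ⟩ + (c (four ⊛ r) * ⟨ g , M (four ⊛ r) g ⟩ - T))
       identity = trans decompose (+ˡ ((q - 1ℤ) * (qᵈ * X)) (trans (∑-cong els (λ u → nz-cong {u} (λ n → trans (∑-cong els (λ y → trans (cong (nz y *_) (H-roots u y n)) (ℤP.*-distribˡ-+ (nz y) _ _))) (∑-+ els _ _))))
         (trans (trans (∑-cong els (λ u → ℤP.*-distribˡ-+ (nz u) _ _)) (∑-+ els _ _)) (cong₂ _+_ first second))))

     ‖M0‖² : ‖ M 0ᶠ g ‖² ≤ + 2 * (Q₁ * X)
     ‖M0‖² = ℤP.≤-trans (ℤP.≤-reflexive (trans (identity 0ᶠ) (cong₂ (λ s t → (q - 1ℤ) * (qᵈ * X) + (s * ⟨ g , M 0ᶠ g ⟩ + (t * ⟨ g , M (four ⊛ 0ᶠ) g ⟩ - T))) c-0 (trans (cong c (zeroʳ four)) c-0))))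
       (≤-by (+-nonneg (0≤- -T≤) (*-nonneg 0≤qᵈ 0≤X)) (trans (cong (λ t → + 2 * (t * X) - ((q - 1ℤ) * (qᵈ * X) + (0ℤ * ⟨ g , M 0ᶠ g ⟩ + (0ℤ * ⟨ g , M (four ⊛ 0ᶠ) g ⟩ - T)))) Q₁≡)
          (trans (lem q qᵈ X T ⟨ g , M 0ᶠ g ⟩ ⟨ g , M (four ⊛ 0ᶠ) g ⟩) (cong (λ t → (t * X - - T) + qᵈ * X) (sym Q₁≡)))))
       where
         lem : ∀ q d X T a b → + 2 * (q * d * X) - ((q - 1ℤ) * (d * X) + (0ℤ * a + (0ℤ * b - T))) ≡ (q * d * X - - T) + d * X
         lem = solve-∀

   Bounded : ℤ → Set
   Bounded B = ∀ g → ZeroG g → ∀ r → r ≢ 0ᶠ → ‖ M r g ‖² ≤ B * (Q₁ * ‖ g ‖²)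

   improve : ∀ B → Bounded B → ∀ g → ZeroG g → ∀ r → r ≢ 0ᶠ → + 6 * ‖ M r g ‖² ≤ (+ 30 + B) * (Q₁ * ‖ g ‖²)
   improve B bd g z r n = ≤-by
       (+-nonneg (+-nonneg (+-nonneg (*-nonneg {+ 3} (0≤+ 3) s₁) s₂) (+-nonneg (*-nonneg {+ 6} (0≤+ 6) (0≤- (-T≤ g z))) (*-nonneg {+ 6} (0≤+ 6) (*-nonneg 0≤qᵈ (0≤‖‖² g)))))
                 (+-nonneg (*-nonneg {+ 3} (0≤+ 3) (0≤- (‖M0‖² g z))) (0≤- (bd g z (four ⊛ r) four·r≢0))))
       (trans (cong₂ (λ s t → (+ 30 + B) * (s * X₀) - + 6 * t) Q₁≡ (identity g z r))
         (trans (lem B q qᵈ X₀ (c r) (c (four ⊛ r)) a b (T g z) A′ B′)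
           (cong (λ t → + 3 * (t * X₀ + A′ - + 2 * c r * a) + (+ 9 * t * X₀ + B′ - + 6 * c (four ⊛ r) * b)
               + (+ 6 * (t * X₀ - - T g z) + + 6 * (qᵈ * X₀)) + (+ 3 * (+ 2 * (t * X₀) - A′) + (B * (t * X₀) - B′))) (sym Q₁≡))))
     where
       X₀ = ‖ g ‖²
       a = ⟨ g , M 0ᶠ g ⟩
       b = ⟨ g , M (four ⊛ r) g ⟩
       A′ = ‖ M 0ᶠ g ‖²
       B′ = ‖ M (four ⊛ r) g ‖²
       four·r≢0 = *-nz four r four≢0 n
       s₁ : 0ℤ ≤ Q₁ * X₀ + A′ - + 2 * c r * a
       s₁ = subst (0ℤ ≤_) (trans (lem₁ (c r) X₀ A′ a) (cong (λ t → t * X₀ + A′ - + 2 * c r * a) (c² r n))) (0≤- (am-gm (c r) 1ℤ g (M 0ᶠ g)))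
         where
           lem₁ : ∀ c X A a → c * c * X + 1ℤ * 1ℤ * A - + 2 * (c * 1ℤ) * a ≡ c * c * X + A - + 2 * c * a
           lem₁ = solve-∀
       s₂ : 0ℤ ≤ + 9 * Q₁ * X₀ + B′ - + 6 * c (four ⊛ r) * b
       s₂ = subst (0ℤ ≤_) (trans (lem₂ (c (four ⊛ r)) X₀ B′ b) (cong (λ t → + 9 * t * X₀ + B′ - + 6 * c (four ⊛ r) * b) (c² (four ⊛ r) four·r≢0))) (0≤- (am-gm (+ 3 * c (four ⊛ r)) 1ℤ g (M (four ⊛ r) g)))
         where
           lem₂ : ∀ c X A a → + 3 * c * (+ 3 * c) * X + 1ℤ * 1ℤ * A - + 2 * (+ 3 * c * 1ℤ) * a ≡ + 9 * (c * c) * X + A - + 6 * c * a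
           lem₂ = solve-∀
       lem : ∀ B q d X c₁ c₂ a b T A′ B′ → (+ 30 + B) * (q * d * X) - + 6 * ((q - 1ℤ) * (d * X) + (c₁ * a + (c₂ * b - T)))
         ≡ + 3 * (q * d * X + A′ - + 2 * c₁ * a) + (+ 9 * (q * d) * X + B′ - + 6 * c₂ * b)
               + (+ 6 * (q * d * X - - T) + + 6 * (d * X)) + (+ 3 * (+ 2 * (q * d * X) - A′) + (B * (q * d * X) - B′))
       lem = solve-∀

   trivial-bound : Bounded q
   trivial-bound g z r n = ℤP.≤-trans (ℤP.≤-reflexive (‖‖²-combine els nz (λ s → R r s g))) (ℤP.≤-trans (∑-mono els {g = λ _ → q * (qᵈ * ‖ g ‖²)} (λ s →
       ℤP.≤-trans (∑-mono els {g = λ _ → qᵈ * ‖ g ‖²} (term s)) (ℤP.≤-reflexive (∑-const els _))))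
       (ℤP.≤-reflexive (trans (∑-const els _) (cong (q *_) (trans (sym (ℤP.*-assoc q qᵈ _)) (cong (_* ‖ g ‖²) (sym Q₁≡)))))))
     where
       ‖R‖² : ∀ s → s ≢ 0ᶠ → ‖ R r s g ‖² ≡ qᵈ * ‖ g ‖²
       ‖R‖² s n = trans (Sh-adjoint ((⊖ r) ⊛ s) (U s g) (R r s g)) (trans (ip-congʳ (λ x τ → cong (U s g x) (solve 2 (λ τ c → τ :+ (:- c) :+ c := τ) refl τ ((⊖ r) ⊛ s)))) (‖U‖² g z s n))
       0≤b : 0ℤ ≤ qᵈ * ‖ g ‖²
       0≤b = *-nonneg 0≤qᵈ (0≤‖‖² g)
       term : ∀ s t → nz s * nz t * ⟨ R r s g , R r t g ⟩ ≤ qᵈ * ‖ g ‖²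
       term s t = go (s ≟ 0ᶠ) (t ≟ 0ᶠ)
         where
           ip = ⟨ R r s g , R r t g ⟩
           go : Dec (s ≡ 0ᶠ) → Dec (t ≡ 0ᶠ) → nz s * nz t * ip ≤ qᵈ * ‖ g ‖²
           go (yes e) _ = ℤP.≤-trans (ℤP.≤-reflexive (trans (cong (λ w → w * nz t * ip) (trans (cong nz e) nz-0)) (lem₀ (nz t) ip))) 0≤b
             where
               lem₀ : ∀ a b → 0ℤ * a * b ≡ 0ℤ
               lem₀ = solve-∀
           go _ (yes e) = ℤP.≤-trans (ℤP.≤-reflexive (trans (cong (λ w → nz s * w * ip) (trans (cong nz e) nz-0)) (lem₀ (nz s) ip))) 0≤b
             where
               lem₀ : ∀ a b → a * 0ℤ * b ≡ 0ℤ
               lem₀ = solve-∀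
           go (no a) (no b) = ℤP.≤-trans (ℤP.≤-reflexive (trans (cong₂ (λ v w → v * w * ip) (nz-1 a) (nz-1 b)) (ℤP.*-identityˡ ip)))
             (*-cancel-≤ {c = + 2} (Z.+<+ (ℕ.s≤s ℕ.z≤n)) (subst₂ _≤_ (lem₁ ip) (trans (cong₂ (λ v w → 1ℤ * 1ℤ * v + 1ℤ * 1ℤ * w) (‖R‖² s a) (‖R‖² t b)) (lem₂ (qᵈ * ‖ g ‖²)))
               (am-gm 1ℤ 1ℤ (R r s g) (R r t g))))
             where
               lem₁ : ∀ t → + 2 * (1ℤ * 1ℤ) * t ≡ + 2 * t
               lem₁ = solve-∀
               lem₂ : ∀ a → 1ℤ * 1ℤ * a + 1ℤ * 1ℤ * a ≡ + 2 * a
               lem₂ = solve-∀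

   descend : ∀ k → Bounded (+ (9 ℕ.+ k)) → Bounded (+ 9)
   descend zero b = b
   descend (suc k) b = descend k (λ g z r n → *-cancel-≤ {c = + 6} (Z.+<+ (ℕ.s≤s ℕ.z≤n)) (ℤP.≤-trans (improve (+ (10 ℕ.+ k)) (subst (λ t → Bounded (+ t)) (ℕP.+-suc 9 k) b) g z r n)
       (≤-by (*-nonneg (+-nonneg (0≤+ 14) (*-nonneg {+ 5} (0≤+ 5) (0≤+ k))) (*-nonneg 0≤Q₁ (0≤‖‖² g))) (lem (+ k) (Q₁ * ‖ g ‖²)))))
     where
       lem : ∀ k Y → + 6 * ((+ 9 + k) * Y) - (+ 30 + (+ 10 + k)) * Y ≡ (+ 14 + + 5 * k) * Y
       lem = solve-∀

   odd-bound : Bounded (+ 9)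
   odd-bound = descend order (λ g z r n → ℤP.≤-trans (trivial-bound g z r n) (ℤP.*-monoʳ-≤-nonNeg (Q₁ * ‖ g ‖²) {{Z.nonNegative (*-nonneg 0≤Q₁ (0≤‖‖² g))}} (Z.+≤+ (ℕP.m≤n+m order 9))))

module SphereMixing where
 open FiniteSums
 open FiniteFields
 open QuadraticTower
 open KloostermanSums
 open SphereSums
 open SphereOperatorAlgebra
 open EvenDimensions
 open OddDimensions
 open import Data.Integer as Z using (ℤ; +_; 1ℤ; _+_; _*_; -_; _-_; _≤_)
 open import Data.Integer.Tactic.RingSolver using (solve-∀)

 parity : ∀ d → Σ ℕ λ e → (d ≡ double e) ⊎ (d ≡ suc (double e))
 parity zero = zero , inj₁ refl
 parity (suc d) with parity d
 ... | e , inj₁ refl = e , inj₂ refl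
 ... | e , inj₂ refl = suc e , inj₁ refl

 module ExpanderMixing (F : FiniteField) (p m h : ℕ) (p-prime : Prime p) (p-odd : p ≡ suc (2 ℕ.* h))
                       (orderF : FiniteField.order F ≡ p ℕ.^ m) where
   open FieldFacts F
   private
     two≢0 : two ≢ 0ᶠ
     two≢0 = OddChar.two≢0 p m h p-prime p-odd orderF
   open NonzeroSums F
   open Sphere F two≢0

   M-bound : ∀ d g → SphereOperators.ZeroG F two≢0 d g → ∀ r → r ≢ 0ᶠ →
             SphereOperators.‖_‖² F two≢0 d (SphereOperators.M F two≢0 d r g) ≤ + 9 * (+ (order ℕ.^ suc d) * SphereOperators.‖_‖² F two≢0 d g)
   M-bound d = go (parity d)
     where
       go : (Σ ℕ λ e → (d ≡ double e) ⊎ (d ≡ suc (double e))) → ∀ g → SphereOperators.ZeroG F two≢0 d g → ∀ r → r ≢ 0ᶠ →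
             SphereOperators.‖_‖² F two≢0 d (SphereOperators.M F two≢0 d r g) ≤ + 9 * (+ (order ℕ.^ suc d) * SphereOperators.‖_‖² F two≢0 d g)
       go (e , inj₂ refl) = OddDimension.odd-bound F two≢0 e
       go (e , inj₁ refl) g z r n = ℤP.≤-trans (EvenDimension.even-bound F p m h p-prime p-odd orderF two≢0 e g z r n)
         (ℤP.*-monoʳ-≤-nonNeg (+ (order ℕ.^ suc (double e)) * SphereOperators.‖_‖² F two≢0 (double e) g)
            {{Z.nonNegative (*-nonneg {+ (order ℕ.^ suc (double e))} {SphereOperators.‖_‖² F two≢0 (double e) g} (0≤+ (order ℕ.^ suc (double e))) (SphereOperators.0≤‖‖² F two≢0 (double e) g))}} (Z.+≤+ (ℕP.m≤m+n 5 4)))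

   module _ (d : ℕ) where
     open SphereOperators F two≢0 d

     private
       h₀ : C → ℤ
       h₀ τ = δ τ 0ᶠ - δ τ 1ᶠ

       h₀-zero : Zero h₀
       h₀-zero = trans (∑-- els _ _) (cong₂ _-_ (∑-δ fin 0ᶠ) (∑-δ fin 1ᶠ))

       h₀² : ∑ els (λ τ → h₀ τ * h₀ τ) ≡ + 2
       h₀² = trans (∑-cong els pointwise) (trans (∑-+ els _ _) (cong₂ _+_ (∑-δ fin 0ᶠ) (∑-δ fin 1ᶠ)))
         where
           pointwise : ∀ τ → h₀ τ * h₀ τ ≡ δ τ 0ᶠ + δ τ 1ᶠ
           pointwise τ with τ ≟ 0ᶠ | τ ≟ 1ᶠ
           ... | yes refl | yes e = ⊥-elim (1≢0 (sym e))
           ... | yes _ | no _ = refl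
           ... | no _ | yes _ = refl
           ... | no _ | no _ = refl

       _⊗h₀ : (Vec C d → ℤ) → 𝔾
       (f ⊗h₀) x τ = f x * h₀ τ

       ⊗-zero : ∀ f → ZeroG (f ⊗h₀)
       ⊗-zero f x = trans (∑-*ˡ els (f x) h₀) (trans (cong (f x *_) h₀-zero) (ℤP.*-zeroʳ (f x)))

     module _ (f₁ f₂ : Vec C d → ℤ) (r : C) (r≢0 : r ≢ 0ᶠ) where
       nbr : Vec C d → ℤ
       nbr x = ∑ V (λ v → δ (N v) r * f₂ (x ⊕ᵛ v))

       private
         M⊗ : ∀ x τ → M r (f₂ ⊗h₀) x τ ≡ (q * nbr x - ∑ V f₂) * h₀ τ
         M⊗ x τ = begin
           ∑ els (λ s → nz s * ∑ V (λ v → f₂ (x ⊕ᵛ v) * h₀ (τ ⊕ (⊖ r) ⊛ s ⊕ s ⊛ N v))) ≡⟨ trans (∑-cong els (λ s → sym (∑-*ˡ V (nz s) _))) (∑-swap els V _) ⟩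
           ∑ V (λ v → ∑ els (λ s → nz s * (f₂ (x ⊕ᵛ v) * h₀ (τ ⊕ (⊖ r) ⊛ s ⊕ s ⊛ N v)))) ≡⟨ ∑-cong V (λ v → trans (∑-cong els (λ s → trans (lem (nz s) (f₂ (x ⊕ᵛ v)) _)
                (cong (λ t → f₂ (x ⊕ᵛ v) * (nz s * h₀ t)) (solve 4 (λ τ r s n → τ :+ (:- r) :* s :+ s :* n := τ :+ s :* (n :+ (:- r))) refl τ r s (N v)))))
                (trans (∑-*ˡ els (f₂ (x ⊕ᵛ v)) _) (cong (f₂ (x ⊕ᵛ v) *_) (trans (∑-line-nz τ (N v ⊕ ⊖ r) h₀ h₀-zero)
                  (cong (λ t → q * t * h₀ τ - h₀ τ) (δ-cong fin fin {N v ⊕ ⊖ r} {0ᶠ} {N v} {r} (x-x (N v) r) (λ e → trans (cong (_⊕ ⊖ r) e) (-‿inverseʳ r)))))))) ⟩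
           ∑ V (λ v → f₂ (x ⊕ᵛ v) * (q * δ (N v) r * h₀ τ - h₀ τ)) ≡⟨ ∑-cong V (λ v → lem′ (f₂ (x ⊕ᵛ v)) q (δ (N v) r) (h₀ τ)) ⟩
           ∑ V (λ v → (q * (δ (N v) r * f₂ (x ⊕ᵛ v)) - f₂ (x ⊕ᵛ v)) * h₀ τ) ≡⟨ trans (∑-*ʳ V (h₀ τ) _) (cong (_* h₀ τ) (trans (∑-- V _ _) (cong₂ _-_ (∑-*ˡ V q _)
                (trans (∑-cong V (λ v → cong f₂ (⊕ᵛ-comm x v))) (∑ᵛ-shift x f₂))))) ⟩
           (q * nbr x - ∑ V f₂) * h₀ τ ∎
           where
             open ≡-Reasoning
             lem : ∀ a b c → a * (b * c) ≡ b * (a * c)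
             lem = solve-∀
             lem′ : ∀ f q d h → f * (q * d * h - h) ≡ (q * (d * f) - f) * h
             lem′ = solve-∀

       e : ℤ
       e = ∑ V (λ x → f₁ x * nbr x)

       mixing : (q * e - ∑ V f₁ * ∑ V f₂) * (q * e - ∑ V f₁ * ∑ V f₂) ≤ + 9 * + (order ℕ.^ suc d) * (∑ V (λ x → f₁ x * f₁ x) * ∑ V (λ x → f₂ x * f₂ x))
       mixing = *-cancel-≤ {c = + 4} (Z.+<+ (ℕ.s≤s ℕ.z≤n)) (ℤP.≤-trans (ℤP.≤-reflexive (sym (trans (cong₂ _*_ inner inner) (lem₁ (q * e - ∑ V f₁ * ∑ V f₂)))))
          (ℤP.≤-trans (ip-cauchy (f₁ ⊗h₀) (M r (f₂ ⊗h₀))) (ℤP.≤-trans (ℤP.*-monoˡ-≤-nonNeg ‖ f₁ ⊗h₀ ‖² {{Z.nonNegative (0≤‖‖² (f₁ ⊗h₀))}} (M-bound d (f₂ ⊗h₀) (⊗-zero f₂) r r≢0))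
            (ℤP.≤-reflexive (trans (cong₂ (λ s t → s * (+ 9 * (+ (order ℕ.^ suc d) * t))) (norm f₁) (norm f₂)) (lem₂ (∑ V (λ x → f₁ x * f₁ x)) (+ (order ℕ.^ suc d)) (∑ V (λ x → f₂ x * f₂ x))))))))
         where
           lem₁ : ∀ y → y * + 2 * (y * + 2) ≡ + 4 * (y * y)
           lem₁ = solve-∀
           lem₂ : ∀ a Q b → a * + 2 * (+ 9 * (Q * (b * + 2))) ≡ + 4 * (+ 9 * Q * (a * b))
           lem₂ = solve-∀
           norm : ∀ f → ‖ f ⊗h₀ ‖² ≡ ∑ V (λ x → f x * f x) * + 2
           norm f = trans (ip-tensor f f h₀) (cong (∑ V (λ x → f x * f x) *_) h₀²)
           inner : ⟨ f₁ ⊗h₀ , M r (f₂ ⊗h₀) ⟩ ≡ (q * e - ∑ V f₁ * ∑ V f₂) * + 2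
           inner = trans (ip-congʳ M⊗) (trans (ip-tensor f₁ (λ x → q * nbr x - ∑ V f₂) h₀) (cong₂ _*_ (trans (∑-cong V (λ x → lem₃ (f₁ x) q (nbr x) (∑ V f₂)))
             (trans (∑-- V _ _) (cong₂ _-_ (∑-*ˡ V q _) (∑-*ʳ V (∑ V f₂) f₁)))) h₀²))
             where
               lem₃ : ∀ a q b c → a * (q * b - c) ≡ q * (a * b) - a * c
               lem₃ = solve-∀

     module Points {n : ℕ} (pt : Fin n → Vec C d) (pt-inj : ∀ i j → pt i ≡ pt j → i ≡ j) (r : C) (r≢0 : r ≢ 0ᶠ) (a b : Fin n → ℤ) where
       private
         I = Finite.els (Finite-Fin n)
         δᵛ = Finite.δ (finᵛ d)
         spread : (Fin n → ℤ) → Vec C d → ℤ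
         spread w x = ∑ I (λ i → δᵛ x (pt i) * w i)

         against : ∀ w (g : Vec C d → ℤ) → ∑ V (λ x → spread w x * g x) ≡ ∑ I (λ i → w i * g (pt i))
         against w g = trans (∑-cong V (λ x → sym (∑-*ʳ I (g x) _))) (trans (∑-swap V I _) (∑-cong I (λ i →
           trans (∑-cong V (λ x → lem (δᵛ x (pt i)) (w i) (g x))) (sift (finᵛ d) (pt i) (λ x → w i * g x)))))
           where
             lem : ∀ a b c → a * b * c ≡ a * (b * c)
             lem = solve-∀

         at-pt : ∀ w i → spread w (pt i) ≡ w i
         at-pt w i = trans (∑-cong I (λ j → cong (_* w j) (δ-cong (finᵛ d) (Finite-Fin n) {pt i} {pt j} {j} {i} (λ e → sym (pt-inj i j e)) (λ e → cong pt (sym e))))) (sift (Finite-Fin n) i w)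

         total : ∀ w → ∑ V (spread w) ≡ ∑ I w
         total w = trans (∑-cong V (λ x → sym (ℤP.*-identityʳ _))) (trans (against w (λ _ → 1ℤ)) (∑-cong I (λ i → ℤP.*-identityʳ _)))

         squares : ∀ w → ∑ V (λ x → spread w x * spread w x) ≡ ∑ I (λ i → w i * w i)
         squares w = trans (against w (spread w)) (∑-cong I (λ i → cong (w i *_) (at-pt w i)))

       edges : ℤ
       edges = ∑ I (λ i → a i * ∑ I (λ j → b j * δ (N (pt j ⊕ᵛ (⊖ᵛ (pt i)))) r))

       private
         e≡ : e (spread a) (spread b) r r≢0 ≡ edges
         e≡ = trans (against a _) (∑-cong I (λ i → cong (a i *_) (trans (sym (trans (∑-cong V (λ y → cong₂ (λ s t → δ (N s) r * spread b t) (refl {x = y ⊕ᵛ (⊖ᵛ (pt i))}) (sym (trans (⊕ᵛ-comm (pt i) _) (⊖-⊕ᵛ y (pt i))))))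
             (∑ᵛ-shift (⊖ᵛ (pt i)) (λ v → δ (N v) r * spread b (pt i ⊕ᵛ v))))) (trans (∑-cong V (λ y → ℤP.*-comm _ (spread b y))) (against b (λ y → δ (N (y ⊕ᵛ (⊖ᵛ (pt i)))) r))))))

       mixing-points : (q * edges - ∑ I a * ∑ I b) * (q * edges - ∑ I a * ∑ I b) ≤ + 9 * + (order ℕ.^ suc d) * (∑ I (λ i → a i * a i) * ∑ I (λ i → b i * b i))
       mixing-points = subst₂ _≤_ (cong₂ (λ s t → (q * s - t) * (q * s - t)) e≡ (cong₂ _*_ (total a) (total b))) (cong (+ 9 * + (order ℕ.^ suc d) *_) (cong₂ _*_ (squares a) (squares b)))
         (mixing (spread a) (spread b) r r≢0)

module ExtendabilityMethod where
 open import Data.Nat using (_+_; _*_; _≤_; _<_; z≤n; s≤s)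
 open import Data.Nat.Properties
 open import Data.Nat.Tactic.RingSolver using (solve-∀)
 open import Data.Fin using (zero; suc; combine; _↑ˡ_; _↑ʳ_)
 open import Data.Fin.Subset using (Subset)
 open import Data.Fin.Subset.Properties using (anySubset?)
 open import Data.Vec using ([]; _∷_; lookup; tabulate)
 import Data.Vec.Properties as VecP
 open import Data.Bool using (_∧_; _∨_; not)
 open import Data.List using ([]; _∷_; length; map)
 open import Data.List.Relation.Binary.Sublist.Propositional using (_⊆_; []; _∷_; _∷ʳ_)
 open import Data.List.Relation.Unary.All using ([]; _∷_)
 open import Relation.Nullary.Decidable using (_×-dec_; _→-dec_)

 ⟦_⟧ : Bool → ℕ
 ⟦ true ⟧ = 1
 ⟦ false ⟧ = 0

 ⟦⟧≤1 : ∀ b → ⟦ b ⟧ ≤ 1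
 ⟦⟧≤1 true = ≤-refl
 ⟦⟧≤1 false = z≤n

 ⟦⟧-mono : ∀ a b → (a ≡ true → b ≡ true) → ⟦ a ⟧ ≤ ⟦ b ⟧
 ⟦⟧-mono false b h = z≤n
 ⟦⟧-mono true b h = ≤-reflexive (cong ⟦_⟧ (sym (h refl)))

 abstract
   ∑ᶠ : ∀ {n} → (Fin n → ℕ) → ℕ
   ∑ᶠ {zero} f = 0
   ∑ᶠ {suc n} f = f zero + ∑ᶠ (f ∘ suc)

 # : ∀ {n} → (Fin n → Bool) → ℕ
 # U = ∑ᶠ (λ i → ⟦ U i ⟧)

 abstract
   ∑ᶠ-cong : ∀ {n} {f g : Fin n → ℕ} → (∀ i → f i ≡ g i) → ∑ᶠ f ≡ ∑ᶠ g
   ∑ᶠ-cong {zero} e = refl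
   ∑ᶠ-cong {suc n} e = cong₂ _+_ (e zero) (∑ᶠ-cong (e ∘ suc))

   ∑ᶠ-mono : ∀ {n} {f g : Fin n → ℕ} → (∀ i → f i ≤ g i) → ∑ᶠ f ≤ ∑ᶠ g
   ∑ᶠ-mono {zero} e = z≤n
   ∑ᶠ-mono {suc n} e = +-mono-≤ (e zero) (∑ᶠ-mono (e ∘ suc))

   ∑ᶠ-+ : ∀ {n} (f g : Fin n → ℕ) → ∑ᶠ (λ i → f i + g i) ≡ ∑ᶠ f + ∑ᶠ g
   ∑ᶠ-+ {zero} f g = refl
   ∑ᶠ-+ {suc n} f g = trans (cong (f zero + g zero +_) (∑ᶠ-+ (f ∘ suc) (g ∘ suc))) (lem (f zero) (g zero) _ _)
     where
       lem : ∀ a b c d → a + b + (c + d) ≡ a + c + (b + d)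
       lem = solve-∀

   ∑ᶠ-*ʳ : ∀ {n} c (f : Fin n → ℕ) → ∑ᶠ (λ i → f i * c) ≡ ∑ᶠ f * c
   ∑ᶠ-*ʳ {zero} c f = refl
   ∑ᶠ-*ʳ {suc n} c f = trans (cong (f zero * c +_) (∑ᶠ-*ʳ c (f ∘ suc))) (sym (*-distribʳ-+ c (f zero) _))

   ∑ᶠ-const : ∀ n c → ∑ᶠ {n} (λ _ → c) ≡ n * c
   ∑ᶠ-const zero c = refl
   ∑ᶠ-const (suc n) c = cong (c +_) (∑ᶠ-const n c)

   ∑ᶠ-zero : ∀ n → ∑ᶠ {n} (λ _ → 0) ≡ 0
   ∑ᶠ-zero n = trans (∑ᶠ-const n 0) (*-zeroʳ n)

   ∑ᶠ-swap : ∀ {m n} (f : Fin m → Fin n → ℕ) → ∑ᶠ (λ i → ∑ᶠ (f i)) ≡ ∑ᶠ (λ j → ∑ᶠ (λ i → f i j))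
   ∑ᶠ-swap {zero} {n} f = sym (∑ᶠ-zero n)
   ∑ᶠ-swap {suc m} f = trans (cong (∑ᶠ (f zero) +_) (∑ᶠ-swap (f ∘ suc))) (sym (∑ᶠ-+ (f zero) _))

   ∑ᶠ-++ : ∀ m {n} (f : Fin (m + n) → ℕ) → ∑ᶠ f ≡ ∑ᶠ (λ i → f (i ↑ˡ n)) + ∑ᶠ (λ j → f (m ↑ʳ j))
   ∑ᶠ-++ zero f = refl
   ∑ᶠ-++ (suc m) f = trans (cong (f zero +_) (∑ᶠ-++ m (f ∘ suc))) (sym (+-assoc (f zero) _ _))

   ∑ᶠ-combine : ∀ m n (f : Fin (m * n) → ℕ) → ∑ᶠ f ≡ ∑ᶠ (λ i → ∑ᶠ (λ j → f (combine {m} {n} i j)))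
   ∑ᶠ-combine zero n f = refl
   ∑ᶠ-combine (suc m) n f = trans (∑ᶠ-++ n f) (cong (∑ᶠ (λ j → f (j ↑ˡ (m * n))) +_) (∑ᶠ-combine m n (λ k → f (n ↑ʳ k))))

   ∑ᶠ-0 : ∀ (f : Fin 0 → ℕ) → ∑ᶠ f ≡ 0
   ∑ᶠ-0 f = refl

   ∑ᶠ-suc : ∀ {n} (f : Fin (suc n) → ℕ) → ∑ᶠ f ≡ f zero + ∑ᶠ (f ∘ suc)
   ∑ᶠ-suc f = refl

 _==_ : ∀ {n} → Fin n → Fin n → Bool
 i == j = does (i FinP.≟ j)

 ==-refl : ∀ {n} (i : Fin n) → (i == i) ≡ true
 ==-refl i with i FinP.≟ i
 ... | yes _ = refl
 ... | no n = ⊥-elim (n refl)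

 ==-≢ : ∀ {n} {i j : Fin n} → i ≢ j → (i == j) ≡ false
 ==-≢ {i = i} {j} ne with i FinP.≟ j
 ... | yes e = ⊥-elim (ne e)
 ... | no _ = refl

 ==-≡ : ∀ {n} {i j : Fin n} → (i == j) ≡ true → i ≡ j
 ==-≡ {i = i} {j} e with i FinP.≟ j
 ... | yes p = p

 abstract
   ∑ᶠ-δ : ∀ {n} (f : Fin n → ℕ) j → ∑ᶠ (λ i → ⟦ i == j ⟧ * f i) ≡ f j
   ∑ᶠ-δ {suc n} f zero = trans (cong (f zero + 0 +_) (trans (∑ᶠ-cong {n} {λ i → ⟦ suc i == zero ⟧ * f (suc i)} {λ _ → 0} (λ i → refl)) (∑ᶠ-zero n))) (trans (+-identityʳ _) (+-identityʳ _))
   ∑ᶠ-δ {suc n} f (suc j) = trans (∑ᶠ-cong (λ i → cong (λ b → ⟦ b ⟧ * f (suc i)) (suc== i j))) (∑ᶠ-δ (f ∘ suc) j)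
     where
       suc== : ∀ {n} (i j : Fin n) → (suc i == suc j) ≡ (i == j)
       suc== i j with i FinP.≟ j
       ... | yes _ = refl
       ... | no _ = refl

 anyᵇ : ∀ {n} → (Fin n → Bool) → Bool
 anyᵇ {zero} f = false
 anyᵇ {suc n} f = f zero ∨ anyᵇ (f ∘ suc)

 anyᵇ-intro : ∀ {n} (f : Fin n → Bool) i → f i ≡ true → anyᵇ f ≡ true
 anyᵇ-intro f zero e = cong (_∨ anyᵇ (f ∘ suc)) e
 anyᵇ-intro f (suc i) e = trans (cong (f zero ∨_) (anyᵇ-intro (f ∘ suc) i e)) (BoolP.∨-zeroʳ (f zero))

 anyᵇ-elim : ∀ {n} (f : Fin n → Bool) → anyᵇ f ≡ true → ∃ λ i → f i ≡ true
 anyᵇ-elim {suc n} f e with f zero in eq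
 ... | true = zero , eq
 ... | false with anyᵇ-elim (f ∘ suc) e
 ...   | i , p = suc i , p

 abstract
   anyᵇ-≤ : ∀ {n} (f : Fin n → Bool) → ⟦ anyᵇ f ⟧ ≤ # f
   anyᵇ-≤ {zero} f = z≤n
   anyᵇ-≤ {suc n} f with f zero
   ... | true = s≤s z≤n
   ... | false = anyᵇ-≤ (f ∘ suc)

 ∧-true : ∀ {a b} → a ∧ b ≡ true → a ≡ true × b ≡ true
 ∧-true {true} {true} _ = refl , refl

 _─_ : ∀ {n} → (Fin n → Bool) → Fin n → Fin n → Bool
 (U ─ y) i = U i ∧ not (i == y)

 ─-split : ∀ {n} (U H : Fin n → Bool) y → U y ≡ true → # (λ i → H i ∧ U i) ≡ # (λ i → H i ∧ (U ─ y) i) + ⟦ H y ⟧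
 ─-split U H y Uy = trans (∑ᶠ-cong pointwise) (trans (∑ᶠ-+ (λ i → ⟦ H i ∧ (U ─ y) i ⟧) (λ i → ⟦ i == y ⟧ * ⟦ H i ⟧)) (cong (# (λ i → H i ∧ (U ─ y) i) +_) (∑ᶠ-δ (λ i → ⟦ H i ⟧) y)))
   where
     pointwise : ∀ i → ⟦ H i ∧ U i ⟧ ≡ ⟦ H i ∧ (U ─ y) i ⟧ + ⟦ i == y ⟧ * ⟦ H i ⟧
     pointwise i with i FinP.≟ y
     ... | yes refl rewrite Uy = lem (H i)
       where
         lem : ∀ b → ⟦ b ∧ true ⟧ ≡ ⟦ b ∧ false ⟧ + (⟦ b ⟧ + 0)
         lem true = refl
         lem false = refl
     ... | no _ = lem (H i) (U i)
       where
         lem : ∀ b c → ⟦ b ∧ c ⟧ ≡ ⟦ b ∧ (c ∧ true) ⟧ + 0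
         lem true true = refl
         lem true false = refl
         lem false c = refl

 -- The extendability method (Friedman–Pippenger, Draganić–Krivelevich–Nenadov): p runs over demanders, each of which
 -- may acquire up to D private neighbours; cnt p of them have been assigned, U is the set of unused vertices.
 module Extendability {np n : ℕ} (nb : Fin np → Fin n → Bool) (active : Fin np → Bool) (D M : ℕ) (1≤M : 1 ≤ M) where

   χ : Subset np → Fin np → Bool
   χ A p = lookup A p

   size : Subset np → ℕ
   size A = # (χ A)

   weight : Subset np → (Fin np → ℕ) → ℕ
   weight A c = ∑ᶠ (λ p → ⟦ χ A p ⟧ * c p)

   hit : Subset np → Fin n → Bool
   hit A y = anyᵇ (λ p → χ A p ∧ nb p y)

   Γ# : Subset np → (Fin n → Bool) → ℕ
   Γ# A U = # (λ y → hit A y ∧ U y)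

   Active : Subset np → Set
   Active A = ∀ p → χ A p ≡ true → active p ≡ true

   Active? : ∀ A → Dec (Active A)
   Active? A = FinP.all? (λ p → (χ A p BoolP.≟ true) →-dec (active p BoolP.≟ true))

   supply : Subset np → (Fin n → Bool) → (Fin np → ℕ) → ℕ
   supply A U c = Γ# A U + weight A c

   Ext : (Fin n → Bool) → (Fin np → ℕ) → Set
   Ext U c = ∀ A → Active A → size A ≤ M + M → D * size A ≤ supply A U c

   Violates : (Fin n → Bool) → (Fin np → ℕ) → Subset np → Set
   Violates U c A = Active A × size A ≤ M + M × supply A U c < D * size A

   ext? : ∀ U c → (∃ λ A → Violates U c A) ⊎ Ext U c
   ext? U c with anySubset? (λ A → Active? A ×-dec ((size A ≤? M + M) ×-dec (supply A U c <? D * size A)))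
   ... | yes v = inj₁ v
   ... | no nv = inj₂ (λ A act sz → ≮⇒≥ (λ lt → nv (A , act , sz , lt)))

   hit-intro : ∀ A p y → χ A p ≡ true → nb p y ≡ true → hit A y ≡ true
   hit-intro A p y a b = anyᵇ-intro _ p (cong₂ _∧_ a b)

   hit-elim : ∀ A y → hit A y ≡ true → ∃ λ p → χ A p ≡ true × nb p y ≡ true
   hit-elim A y h with anyᵇ-elim _ h
   ... | p , e = p , ∧-true e

   bump : (Fin np → ℕ) → Fin np → Fin np → ℕ
   bump c p p′ = c p′ + ⟦ p′ == p ⟧

   weight-bump : ∀ A c p → weight A (bump c p) ≡ weight A c + ⟦ χ A p ⟧
   weight-bump A c p = trans (∑ᶠ-cong (λ p′ → lem ⟦ χ A p′ ⟧ (c p′) ⟦ p′ == p ⟧)) (trans (∑ᶠ-+ (λ p′ → ⟦ χ A p′ ⟧ * c p′) (λ p′ → ⟦ p′ == p ⟧ * ⟦ χ A p′ ⟧)) (cong (weight A c +_) (∑ᶠ-δ (λ p′ → ⟦ χ A p′ ⟧) p)))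
     where
       lem : ∀ a b c → a * (b + c) ≡ a * b + c * a
       lem = solve-∀

   supply-step : ∀ A U c p y → U y ≡ true → supply A (U ─ y) (bump c p) + ⟦ hit A y ⟧ ≡ supply A U c + ⟦ χ A p ⟧
   supply-step A U c p y Uy = begin
     Γ# A (U ─ y) + weight A (bump c p) + ⟦ hit A y ⟧ ≡⟨ cong (λ t → Γ# A (U ─ y) + t + ⟦ hit A y ⟧) (weight-bump A c p) ⟩
     Γ# A (U ─ y) + (weight A c + ⟦ χ A p ⟧) + ⟦ hit A y ⟧ ≡⟨ lem (Γ# A (U ─ y)) (weight A c) ⟦ χ A p ⟧ ⟦ hit A y ⟧ ⟩
     Γ# A (U ─ y) + ⟦ hit A y ⟧ + weight A c + ⟦ χ A p ⟧ ≡⟨ cong (λ t → t + weight A c + ⟦ χ A p ⟧) (sym (─-split U (hit A) y Uy)) ⟩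
     supply A U c + ⟦ χ A p ⟧ ∎
     where
       open ≡-Reasoning
       lem : ∀ a b c d → a + (b + c) + d ≡ a + d + b + c
       lem = solve-∀

   _∪_ _∩_ : Subset np → Subset np → Subset np
   _∪_ = Vec.zipWith _∨_
   _∩_ = Vec.zipWith _∧_

   χ-∪ : ∀ A B p → χ (A ∪ B) p ≡ χ A p ∨ χ B p
   χ-∪ A B p = VecP.lookup-zipWith _∨_ p A B
   χ-∩ : ∀ A B p → χ (A ∩ B) p ≡ χ A p ∧ χ B p
   χ-∩ A B p = VecP.lookup-zipWith _∧_ p A B

   modular : ∀ A B c → weight (A ∪ B) c + weight (A ∩ B) c ≡ weight A c + weight B c
   modular A B c = trans (sym (∑ᶠ-+ _ _)) (trans (∑ᶠ-cong pointwise) (∑ᶠ-+ _ _))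
     where
       lem : ∀ a b x → ⟦ a ∨ b ⟧ * x + ⟦ a ∧ b ⟧ * x ≡ ⟦ a ⟧ * x + ⟦ b ⟧ * x
       lem true true x = refl
       lem true false x = refl
       lem false true x = +-comm (1 * x) 0
       lem false false x = refl
       pointwise : ∀ p → ⟦ χ (A ∪ B) p ⟧ * c p + ⟦ χ (A ∩ B) p ⟧ * c p ≡ ⟦ χ A p ⟧ * c p + ⟦ χ B p ⟧ * c p
       pointwise p = trans (cong₂ (λ s t → ⟦ s ⟧ * c p + ⟦ t ⟧ * c p) (χ-∪ A B p) (χ-∩ A B p)) (lem (χ A p) (χ B p) (c p))

   size-weight : ∀ A → size A ≡ weight A (λ _ → 1)
   size-weight A = ∑ᶠ-cong (λ p → sym (*-identityʳ _))

   size-modular : ∀ A B → size (A ∪ B) + size (A ∩ B) ≡ size A + size B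
   size-modular A B = trans (cong₂ _+_ (size-weight (A ∪ B)) (size-weight (A ∩ B))) (trans (modular A B (λ _ → 1)) (sym (cong₂ _+_ (size-weight A) (size-weight B))))

   hit-∪ˡ : ∀ A B y → hit A y ≡ true → hit (A ∪ B) y ≡ true
   hit-∪ˡ A B y h with hit-elim A y h
   ... | p , a , b = hit-intro (A ∪ B) p y (trans (χ-∪ A B p) (cong (_∨ χ B p) a)) b

   hit-∪ʳ : ∀ A B y → hit B y ≡ true → hit (A ∪ B) y ≡ true
   hit-∪ʳ A B y h with hit-elim B y h
   ... | p , a , b = hit-intro (A ∪ B) p y (trans (χ-∪ A B p) (trans (cong (χ A p ∨_) a) (BoolP.∨-zeroʳ _))) b

   hit-∪⁻ : ∀ A B y → hit (A ∪ B) y ≡ true → hit A y ≡ true ⊎ hit B y ≡ true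
   hit-∪⁻ A B y h with hit-elim (A ∪ B) y h
   ... | p , a , b with χ A p in eq
   ...   | true = inj₁ (hit-intro A p y eq b)
   ...   | false = inj₂ (hit-intro B p y (trans (sym (cong (_∨ χ B p) eq)) (trans (sym (χ-∪ A B p)) a)) b)

   hit-∩⁻ : ∀ A B y → hit (A ∩ B) y ≡ true → hit A y ≡ true × hit B y ≡ true
   hit-∩⁻ A B y h with hit-elim (A ∩ B) y h
   ... | p , a , b with ∧-true (trans (sym (χ-∩ A B p)) a)
   ...   | c , d = hit-intro A p y c b , hit-intro B p y d b

   submodular : ∀ A B U → Γ# (A ∪ B) U + Γ# (A ∩ B) U ≤ Γ# A U + Γ# B U
   submodular A B U = subst₂ _≤_ (∑ᶠ-+ _ _) (∑ᶠ-+ _ _) (∑ᶠ-mono pointwise)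
     where
       lem : ∀ h∪ h∩ a b u → (h∪ ≡ true → a ≡ true ⊎ b ≡ true) → (h∩ ≡ true → a ≡ true × b ≡ true) → ⟦ h∪ ∧ u ⟧ + ⟦ h∩ ∧ u ⟧ ≤ ⟦ a ∧ u ⟧ + ⟦ b ∧ u ⟧
       lem h∪ true a b u f g with g refl
       ... | refl , refl = +-monoˡ-≤ ⟦ u ⟧ (⟦⟧-mono (h∪ ∧ u) u (λ e → proj₂ (∧-true {h∪} e)))
       lem true false a b u f g with f refl
       ... | inj₁ refl = +-monoʳ-≤ ⟦ u ⟧ z≤n
       ... | inj₂ refl = ≤-trans (≤-reflexive (+-identityʳ _)) (m≤n+m _ _)
       lem false false a b u f g = z≤n
       pointwise : ∀ y → ⟦ hit (A ∪ B) y ∧ U y ⟧ + ⟦ hit (A ∩ B) y ∧ U y ⟧ ≤ ⟦ hit A y ∧ U y ⟧ + ⟦ hit B y ∧ U y ⟧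
       pointwise y = lem _ _ _ _ (U y) (hit-∪⁻ A B y) (hit-∩⁻ A B y)

   Active-∪ : ∀ A B → Active A → Active B → Active (A ∪ B)
   Active-∪ A B f g p e with χ A p in eq
   ... | true = f p eq
   ... | false = g p (trans (sym (cong (_∨ χ B p) eq)) (trans (sym (χ-∪ A B p)) e))

   Active-∩ : ∀ A B → Active A → Active (A ∩ B)
   Active-∩ A B f p e = f p (proj₁ (∧-true (trans (sym (χ-∩ A B p)) e)))

   ∅ : Subset np
   ∅ = Vec.replicate np false

   χ-∅ : ∀ p → χ ∅ p ≡ false
   χ-∅ p = VecP.lookup-replicate p false

   size-∅ : size ∅ ≡ 0
   size-∅ = trans (∑ᶠ-cong (λ p → cong ⟦_⟧ (χ-∅ p))) (∑ᶠ-zero np)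

   hit-∅ : ∀ y → hit ∅ y ≡ false
   hit-∅ y with hit ∅ y in eq
   ... | false = refl
   ... | true with hit-elim ∅ y eq
   ...   | p , e , _ with trans (sym e) (χ-∅ p)
   ...     | ()

   ⁅_⁆ : Fin np → Subset np
   ⁅ p ⁆ = tabulate (_== p)

   χ-⁅⁆ : ∀ p p′ → χ ⁅ p ⁆ p′ ≡ (p′ == p)
   χ-⁅⁆ p p′ = VecP.lookup∘tabulate (_== p) p′

   -- Adding one assignment: the failing neighbours of p have tight witnesses, whose union is tight and small.
   module Extend (large : ∀ A U → M ≤ size A → # U ≤ Γ# A U + M)
                 (U : Fin n → Bool) (c : Fin np → ℕ) (ext : Ext U c) (many : (D + D) * M + M < # U)
                 (p : Fin np) (p-active : active p ≡ true) (c<D : c p < D) where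

     Tight : Subset np → Set
     Tight A = Active A × size A < M × χ A p ≡ false × supply A U c ≤ D * size A

     small : ∀ A → size A ≤ M + M → supply A U c ≤ D * size A → size A < M
     small A sz t = ≰⇒> (λ M≤ → <⇒≱ many (begin
       # U ≤⟨ large A U M≤ ⟩
       Γ# A U + M ≤⟨ +-monoˡ-≤ M (≤-trans (m≤m+n _ (weight A c)) t) ⟩
       D * size A + M ≤⟨ +-monoˡ-≤ M (*-monoʳ-≤ D sz) ⟩
       D * (M + M) + M ≡⟨ lem D M ⟩
       (D + D) * M + M ∎))
       where
         open ≤-Reasoning
         lem : ∀ D M → D * (M + M) + M ≡ (D + D) * M + M
         lem = solve-∀

     union : ∀ A B → Tight A → Tight B → Tight (A ∪ B)
     union A B (actA , szA , pA , tA) (actB , szB , pB , tB) = act , small (A ∪ B) sz t , trans (χ-∪ A B p) (cong₂ _∨_ pA pB) , t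
       where
         act = Active-∪ A B actA actB
         sz : size (A ∪ B) ≤ M + M
         sz = ≤-trans (m≤m+n _ (size (A ∩ B))) (≤-trans (≤-reflexive (size-modular A B)) (+-mono-≤ (<⇒≤ szA) (<⇒≤ szB)))
         sz∩ : size (A ∩ B) ≤ M + M
         sz∩ = ≤-trans (m≤n+m _ (size (A ∪ B))) (≤-trans (≤-reflexive (size-modular A B)) (+-mono-≤ (<⇒≤ szA) (<⇒≤ szB)))
         t : supply (A ∪ B) U c ≤ D * size (A ∪ B)
         t = +-cancelʳ-≤ (D * size (A ∩ B)) _ _ (begin
           supply (A ∪ B) U c + D * size (A ∩ B) ≤⟨ +-monoʳ-≤ (supply (A ∪ B) U c) (ext (A ∩ B) (Active-∩ A B actA) sz∩) ⟩
           supply (A ∪ B) U c + supply (A ∩ B) U c ≡⟨ lem (Γ# (A ∪ B) U) (weight (A ∪ B) c) (Γ# (A ∩ B) U) (weight (A ∩ B) c) ⟩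
           (Γ# (A ∪ B) U + Γ# (A ∩ B) U) + (weight (A ∪ B) c + weight (A ∩ B) c) ≤⟨ +-mono-≤ (submodular A B U) (≤-reflexive (modular A B c)) ⟩
           (Γ# A U + Γ# B U) + (weight A c + weight B c) ≡⟨ lem (Γ# A U) (Γ# B U) (weight A c) (weight B c) ⟩
           supply A U c + supply B U c ≤⟨ +-mono-≤ tA tB ⟩
           D * size A + D * size B ≡⟨ sym (*-distribˡ-+ D _ _) ⟩
           D * (size A + size B) ≡⟨ cong (D *_) (sym (size-modular A B)) ⟩
           D * (size (A ∪ B) + size (A ∩ B)) ≡⟨ *-distribˡ-+ D _ _ ⟩
           D * size (A ∪ B) + D * size (A ∩ B) ∎)
           where
             open ≤-Reasoning
             lem : ∀ a b c d → a + b + (c + d) ≡ a + c + (b + d)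
             lem = solve-∀

     witness : ∀ y → U y ≡ true → ∀ A → Violates (U ─ y) (bump c p) A → Tight A × hit A y ≡ true
     witness y Uy A (act , sz , viol) = go (χ A p) refl (hit A y) refl
       where
         step : supply A (U ─ y) (bump c p) + ⟦ hit A y ⟧ ≡ supply A U c + ⟦ χ A p ⟧
         step = supply-step A U c p y Uy
         ext-A : D * size A ≤ supply A U c
         ext-A = ext A act sz
         s = supply A (U ─ y) (bump c p)
         contra : ⟦ hit A y ⟧ ≤ ⟦ χ A p ⟧ → ⊥
         contra le = <⇒≱ viol (≤-trans ext-A (+-cancelʳ-≤ ⟦ χ A p ⟧ _ _ (≤-trans (≤-reflexive (sym step)) (+-monoʳ-≤ s le))))
         go : ∀ b → χ A p ≡ b → ∀ b′ → hit A y ≡ b′ → Tight A × hit A y ≡ true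
         go true e b′ e′ = ⊥-elim (contra (≤-trans (⟦⟧≤1 (hit A y)) (≤-reflexive (cong ⟦_⟧ (sym e)))))
         go false e false e′ = ⊥-elim (contra (≤-reflexive (trans (cong ⟦_⟧ e′) (sym (cong ⟦_⟧ e)))))
         go false e true e′ = (act , small A sz t , e , t) , e′
           where
             t : supply A U c ≤ D * size A
             t = begin
               supply A U c ≡⟨ sym (+-identityʳ _) ⟩
               supply A U c + 0 ≡⟨ cong (supply A U c +_) (sym (cong ⟦_⟧ e)) ⟩
               supply A U c + ⟦ χ A p ⟧ ≡⟨ sym step ⟩
               s + ⟦ hit A y ⟧ ≡⟨ cong (s +_) (cong ⟦_⟧ e′) ⟩
               s + 1 ≡⟨ +-comm s 1 ⟩
               suc s ≤⟨ viol ⟩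
               D * size A ∎
               where open ≤-Reasoning

     Good : Fin n → Set
     Good y = nb p y ≡ true × U y ≡ true × Ext (U ─ y) (bump c p)

     search : ∀ (ys : List (Fin n)) → (∃ Good) ⊎ (∃ λ A → Tight A × All (λ y → nb p y ≡ true → U y ≡ true → hit A y ≡ true) ys)
     search [] = inj₂ (∅ , ((λ q e → ⊥-elim (absurd (trans (sym e) (χ-∅ q)))) , subst (_< M) (sym size-∅) 1≤M , χ-∅ p , t) , [])
       where
         absurd : true ≡ false → ⊥
         absurd ()
         t : supply ∅ U c ≤ D * size ∅
         t = ≤-reflexive (trans (cong₂ _+_ (trans (∑ᶠ-cong (λ y → cong (λ b → ⟦ b ∧ U y ⟧) (hit-∅ y))) (∑ᶠ-zero n))
               (trans (∑ᶠ-cong (λ q → cong (λ b → ⟦ b ⟧ * c q) (χ-∅ q))) (∑ᶠ-zero np))) (sym (trans (cong (D *_) size-∅) (*-zeroʳ D))))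
     search (y ∷ ys) with search ys
     ... | inj₁ g = inj₁ g
     ... | inj₂ (A , tA , hits) with nb p y BoolP.≟ true | U y BoolP.≟ true
     ...   | no n | _ = inj₂ (A , tA , (λ e _ → ⊥-elim (n e)) ∷ hits)
     ...   | _ | no n = inj₂ (A , tA , (λ _ e → ⊥-elim (n e)) ∷ hits)
     ...   | yes e | yes e′ with ext? (U ─ y) (bump c p)
     ...     | inj₂ ex = inj₁ (y , e , e′ , ex)
     ...     | inj₁ (B , viol) with witness y e′ B viol
     ...       | tB , hB = inj₂ (A ∪ B , union A B tA tB , (λ _ _ → hit-∪ʳ A B y hB) ∷ All.map (λ {z} f a b → hit-∪ˡ A B z (f a b)) hits)

     extend : ∃ Good
     extend with search (List.allFin n)
     ... | inj₁ g = g
     ... | inj₂ (A , (act , sz , pA , t) , hits) = ⊥-elim (<⇒≱ c<D (+-cancelˡ-≤ (D * size A) _ _ (begin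
           D * size A + D ≡⟨ trans (+-comm _ D) (sym (*-suc D (size A))) ⟩
           D * suc (size A) ≡⟨ cong (D *_) (sym size≡) ⟩
           D * size B ≤⟨ ext B actB (≤-trans (≤-reflexive size≡) (≤-trans sz (m≤m+n M M))) ⟩
           Γ# B U + weight B c ≤⟨ +-mono-≤ Γ≤ (≤-reflexive weight≡) ⟩
           Γ# A U + (weight A c + c p) ≡⟨ sym (+-assoc _ (weight A c) (c p)) ⟩
           supply A U c + c p ≤⟨ +-monoˡ-≤ (c p) t ⟩
           D * size A + c p ∎)))
       where
         open ≤-Reasoning
         B = A ∪ ⁅ p ⁆
         χB : ∀ q → χ B q ≡ χ A q ∨ (q == p)
         χB q = trans (χ-∪ A ⁅ p ⁆ q) (cong (χ A q ∨_) (χ-⁅⁆ p q))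
         actB : Active B
         actB q e with χ A q in eq | q FinP.≟ p
         ... | true | _ = act q eq
         ... | false | yes refl = p-active
         ... | false | no ne with trans (sym (trans (cong₂ _∨_ eq (==-≢ ne)) refl)) (trans (sym (χB q)) e)
         ...   | ()
         weight-B : ∀ c → weight B c ≡ weight A c + c p
         weight-B c = trans (∑ᶠ-cong pointwise) (trans (∑ᶠ-+ (λ q → ⟦ χ A q ⟧ * c q) (λ q → ⟦ q == p ⟧ * c q)) (cong (weight A c +_) (∑ᶠ-δ c p)))
           where
             pointwise : ∀ q → ⟦ χ B q ⟧ * c q ≡ ⟦ χ A q ⟧ * c q + ⟦ q == p ⟧ * c q
             pointwise q with q FinP.≟ p
             ... | yes refl = trans (cong (λ b → ⟦ b ⟧ * c q) (trans (χB q) (cong₂ _∨_ pA (==-refl q)))) (sym (cong (λ b → ⟦ b ⟧ * c q + 1 * c q) pA))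
             ... | no ne = trans (cong (λ b → ⟦ b ⟧ * c q) (trans (χB q) (trans (cong (χ A q ∨_) (==-≢ ne)) (BoolP.∨-identityʳ _)))) (sym (+-identityʳ _))
         weight≡ : weight B c ≡ weight A c + c p
         weight≡ = weight-B c
         size≡ : size B ≡ suc (size A)
         size≡ = trans (size-weight B) (trans (weight-B (λ _ → 1)) (trans (cong (_+ 1) (sym (size-weight A))) (+-comm _ 1)))
         Γ≤ : Γ# B U ≤ Γ# A U
         Γ≤ = ∑ᶠ-mono (λ y → ⟦⟧-mono (hit B y ∧ U y) (hit A y ∧ U y) (λ e → go y (∧-true e)))
           where
             go : ∀ y → hit B y ≡ true × U y ≡ true → hit A y ∧ U y ≡ true
             go y (hB , Uy) with hit-∪⁻ A ⁅ p ⁆ y hB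
             ... | inj₁ hA = cong₂ _∧_ hA Uy
             ... | inj₂ hp with hit-elim ⁅ p ⁆ y hp
             ...   | q , χq , nbq with ==-≡ {i = q} {p} (trans (sym (χ-⁅⁆ p q)) χq)
             ...     | refl = cong₂ _∧_ (All.lookup hits (MP.∈-allFin y) nbq Uy) Uy

   -- Sequences of assignments, newest first
   Move : Set
   Move = Fin np × Fin n

   unused : (Fin n → Bool) → List Move → Fin n → Bool
   unused U [] = U
   unused U ((p , y) ∷ ms) = unused U ms ─ y

   used-count : (Fin np → ℕ) → List Move → Fin np → ℕ
   used-count c [] = c
   used-count c ((p , y) ∷ ms) = bump (used-count c ms) p

   data Legal (U : Fin n → Bool) : List Move → Set where
     [] : Legal U []
     _∷_ : ∀ {p y ms} → nb p y ≡ true × unused U ms y ≡ true → Legal U ms → Legal U ((p , y) ∷ ms)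

   unused-mono : ∀ U {ms ms′} → ms′ ⊆ ms → ∀ y → unused U ms y ≡ true → unused U ms′ y ≡ true
   unused-mono U [] y e = e
   unused-mono U (_ ∷ʳ s) y e = unused-mono U s y (proj₁ (∧-true e))
   unused-mono U {(_ , z) ∷ _} (refl ∷ s) y e = cong₂ _∧_ (unused-mono U s y (proj₁ (∧-true e))) (proj₂ (∧-true e))

   legal-⊆ : ∀ U {ms ms′} → ms′ ⊆ ms → Legal U ms → Legal U ms′
   legal-⊆ U [] [] = []
   legal-⊆ U (_ ∷ʳ s) (_ ∷ l) = legal-⊆ U s l
   legal-⊆ U (refl ∷ s) ((a , b) ∷ l) = (a , unused-mono U s _ b) ∷ legal-⊆ U s l

   -- Undoing an assignment (p , y) never decreases the supply of a set, since y is a neighbour of p.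
   rollback : ∀ U c {ms ms′} → ms′ ⊆ ms → Legal U ms → ∀ A → supply A (unused U ms) (used-count c ms) ≤ supply A (unused U ms′) (used-count c ms′)
   rollback U c [] l A = ≤-refl
   rollback U c {(p , y) ∷ ms} {ms′} (_ ∷ʳ s) ((nb-p , y-free) ∷ l) A = ≤-trans (+-cancelʳ-≤ ⟦ hit A y ⟧ _ _ (≤-trans
       (≤-reflexive (supply-step A (unused U ms) (used-count c ms) p y y-free))
       (+-monoʳ-≤ (supply A (unused U ms) (used-count c ms)) (⟦⟧-mono (χ A p) (hit A y) (λ e → hit-intro A p y e nb-p))))) (rollback U c s l A)
   rollback U c {(p , y) ∷ ms} {(p , y) ∷ ms′} (refl ∷ s) ((nb-p , y-free) ∷ l) A = +-cancelʳ-≤ ⟦ hit A y ⟧ _ _ (begin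
     supply A (unused U ms ─ y) (bump (used-count c ms) p) + ⟦ hit A y ⟧ ≡⟨ supply-step A (unused U ms) (used-count c ms) p y y-free ⟩
     supply A (unused U ms) (used-count c ms) + ⟦ χ A p ⟧ ≤⟨ +-monoˡ-≤ ⟦ χ A p ⟧ (rollback U c s l A) ⟩
     supply A (unused U ms′) (used-count c ms′) + ⟦ χ A p ⟧ ≡⟨ sym (supply-step A (unused U ms′) (used-count c ms′) p y (unused-mono U s y y-free)) ⟩
     supply A (unused U ms′ ─ y) (bump (used-count c ms′) p) + ⟦ hit A y ⟧ ∎)
     where open ≤-Reasoning

   ext-⊆ : ∀ U c {ms ms′} → ms′ ⊆ ms → Legal U ms → Ext (unused U ms) (used-count c ms) → Ext (unused U ms′) (used-count c ms′)
   ext-⊆ U c s l ext A act sz = ≤-trans (ext A act sz) (rollback U c s l A)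

   unused-size : ∀ U ms → Legal U ms → # (unused U ms) + length ms ≡ # U
   unused-size U [] [] = +-identityʳ _
   unused-size U ((p , y) ∷ ms) ((_ , free) ∷ l) = trans (trans (+-suc _ _) (trans (cong (_+ length ms) (+-comm 1 (# (unused U ms ─ y)))) (cong (_+ length ms) (sym (─-split (unused U ms) (λ _ → true) y free))))) (unused-size U ms l)

module TreeGrowth where
 open ExtendabilityMethod
 open import Data.Nat using (_+_; _*_; _^_; _≤_; _<_; z≤n; s≤s)
 open import Data.Nat.Properties
 open import Data.Nat.Tactic.RingSolver using (solve-∀)
 open import Data.Fin using (zero; suc; combine; remQuot)
 open import Data.Bool using (_∧_; _∨_; not)
 open import Data.List using ([]; _∷_; length; _++_; map; _ʳ++_)
 open import Data.List.Relation.Binary.Sublist.Propositional using (_⊆_; []; _∷_; _∷ʳ_; ⊆-refl)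
 import Data.List.Relation.Binary.Sublist.Propositional.Properties as SubP
 open import Data.List.Membership.Propositional using (_∈_; _∉_; lose; find)
 open import Data.List.Relation.Unary.Any as Any using (Any; here; there)
 open import Data.List.Relation.Unary.All using ([]; _∷_)
 open import Data.List.Relation.Unary.AllPairs using ([]; _∷_)

 inList : ∀ {n} → List (Fin n) → Fin n → Bool
 inList [] i = false
 inList (x ∷ xs) i = (i == x) ∨ inList xs i

 inList-∈ : ∀ {n} (xs : List (Fin n)) i → inList xs i ≡ true → i ∈ xs
 inList-∈ (x ∷ xs) i e with i FinP.≟ x
 ... | yes p = here p
 ... | no _ = there (inList-∈ xs i e)

 ∈-inList : ∀ {n} {xs : List (Fin n)} {i} → i ∈ xs → inList xs i ≡ true
 ∈-inList {xs = x ∷ xs} (here refl) = cong (_∨ inList xs x) (==-refl x)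
 ∈-inList {xs = x ∷ xs} {i} (there p) = trans (cong ((i == x) ∨_) (∈-inList p)) (BoolP.∨-zeroʳ _)

 #-inList : ∀ {n} (xs : List (Fin n)) → Unique xs → # (inList xs) ≡ length xs
 #-inList {n} [] u = ∑ᶠ-zero n
 #-inList (x ∷ xs) (px ∷ u) = trans (∑ᶠ-cong pointwise) (trans (∑ᶠ-+ _ _) (cong₂ _+_ (∑ᶠ-δ (λ _ → 1) x) (#-inList xs u)))
   where
     pointwise : ∀ i → ⟦ (i == x) ∨ inList xs i ⟧ ≡ ⟦ i == x ⟧ * 1 + ⟦ inList xs i ⟧
     pointwise i with i FinP.≟ x
     ... | no _ = refl
     ... | yes refl with inList xs i in eq
     ...   | false = refl
     ...   | true = ⊥-elim (All.lookup px (inList-∈ xs i eq) refl)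

 ∧-falseˡ : ∀ {a} b → a ≡ false → a ∧ b ≡ false
 ∧-falseˡ b refl = refl

 record ColouredExpander (n ρ : ℕ) : Set where
   field
     adj     : Fin ρ → Fin n → Fin n → Bool
     adj-sym : ∀ r x y → adj r x y ≡ true → adj r y x ≡ true
     Λ       : ℕ
     joined  : ∀ r (X Y : Fin n → Bool) → (∀ x y → X x ≡ true → Y y ≡ true → adj r x y ≡ false) → # X * # Y ≤ Λ
     D M     : ℕ
     1≤M     : 1 ≤ M
     2≤D     : 2 ≤ D
     ρΛ≤M²   : ρ * Λ ≤ M * M

 module ColouredGraph {n ρ : ℕ} (G : ColouredExpander n ρ) (act : Fin n → Bool) where
   open ColouredExpander G

   pair : Fin n → Fin ρ → Fin (n * ρ)
   pair = combine

   src : Fin (n * ρ) → Fin n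
   src p = proj₁ (remQuot {n} ρ p)

   col : Fin (n * ρ) → Fin ρ
   col p = proj₂ (remQuot {n} ρ p)

   nb : Fin (n * ρ) → Fin n → Bool
   nb p y = adj (col p) (src p) y

   src-pair : ∀ x r → src (pair x r) ≡ x
   src-pair x r = cong proj₁ (FinP.remQuot-combine {n} {ρ} x r)

   col-pair : ∀ x r → col (pair x r) ≡ r
   col-pair x r = cong proj₂ (FinP.remQuot-combine {n} {ρ} x r)

   pair-nb : ∀ x r y → nb (pair x r) y ≡ adj r x y
   pair-nb x r y = cong₂ (λ c s → adj c s y) (col-pair x r) (src-pair x r)

   pair-≢ : ∀ {x x′} r r′ → x ≢ x′ → pair x r ≢ pair x′ r′
   pair-≢ r r′ ne e = ne (trans (sym (src-pair _ r)) (trans (cong src e) (src-pair _ r′)))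

   open Extendability nb (act ∘ src) D M 1≤M public

   large : ∀ A U → M ≤ size A → # U ≤ Γ# A U + M
   large A U M≤ = begin
     # U ≤⟨ ∑ᶠ-mono (λ y → split (U y) (hit A y)) ⟩
     ∑ᶠ (λ y → ⟦ hit A y ∧ U y ⟧ + ⟦ Y y ⟧) ≡⟨ ∑ᶠ-+ _ _ ⟩
     Γ# A U + # Y ≤⟨ +-monoʳ-≤ (Γ# A U) (*-cancelˡ-≤ M {{ℕ.>-nonZero 1≤M}} (begin
       M * # Y ≤⟨ *-monoˡ-≤ (# Y) M≤ ⟩
       size A * # Y ≡⟨ cong (_* # Y) (trans (∑ᶠ-combine n ρ _) (∑ᶠ-swap _)) ⟩
       ∑ᶠ (λ r → # (λ x → χ A (pair x r))) * # Y ≡⟨ sym (∑ᶠ-*ʳ (# Y) _) ⟩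
       ∑ᶠ (λ r → # (λ x → χ A (pair x r)) * # Y) ≤⟨ ∑ᶠ-mono (λ r → joined r (λ x → χ A (pair x r)) Y (λ x y → none r x y)) ⟩
       ∑ᶠ {ρ} (λ _ → Λ) ≡⟨ ∑ᶠ-const ρ Λ ⟩
       ρ * Λ ≤⟨ ρΛ≤M² ⟩
       M * M ∎)) ⟩
     Γ# A U + M ∎
     where
       open ≤-Reasoning
       Y : Fin n → Bool
       Y y = U y ∧ not (hit A y)
       split : ∀ u h → ⟦ u ⟧ ≤ ⟦ h ∧ u ⟧ + ⟦ u ∧ not h ⟧
       split false h = z≤n
       split true true = ≤-refl
       split true false = ≤-refl
       none : ∀ r x y → χ A (pair x r) ≡ true → Y y ≡ true → adj r x y ≡ false
       none r x y cx Yy with adj r x y in eq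
       ... | false = refl
       ... | true with trans (sym (cong not (hit-intro A (pair x r) y cx (trans (pair-nb x r y) eq)))) (proj₂ (∧-true {U y} Yy))
       ...   | ()

   -- Chain a rs y ms: the assignments ms (newest first) form a path from a to y whose labels, read from y, are rs.
   data Chain (a : Fin n) : List (Fin ρ) → Fin n → List Move → Set where
     []  : Chain a [] a []
     _∷_ : ∀ {r rs x y ms} → adj r x y ≡ true → Chain a rs x ms → Chain a (r ∷ rs) y ((pair x r , y) ∷ ms)

   data Walk : Fin n → List (Fin ρ) → Fin n → List (Fin n) → Set where
     []  : ∀ {x} → Walk x [] x []
     _∷_ : ∀ {x y z r rs vs} → adj r x y ≡ true → Walk y rs z vs → Walk x (r ∷ rs) z (y ∷ vs)

   children : List Move → List (Fin n)
   children = map proj₂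

   chain-glue : ∀ {a rs x ms rs′ z vs} → Chain a rs x ms → Walk x rs′ z vs → Walk a (rs ʳ++ rs′) z (children ms ʳ++ vs)
   chain-glue [] w = w
   chain-glue (e ∷ c) w = chain-glue c (e ∷ w)

   chain-walk : ∀ {b rs y ms} → Chain b rs y ms → Σ (List (Fin n)) λ vs → Walk y rs b vs × y ∷ vs ≡ children ms ++ b ∷ []
   chain-walk [] = [] , [] , refl
   chain-walk {y = y} (_∷_ {x = x} e c) with chain-walk c
   ... | vs , w , eq = x ∷ vs , adj-sym _ _ _ e ∷ w , cong (y ∷_) eq

   chain-tip : ∀ {a rs x ms} → Chain a rs x ms → x ≡ a ⊎ x ∈ children ms
   chain-tip [] = inj₁ refl
   chain-tip (e ∷ c) = inj₂ (here refl)

   chain-count : ∀ {a rs x ms} c base → Chain a rs x ms → ∀ z → z ≢ a → z ∉ children ms → ∀ r → used-count c (ms ++ base) (pair z r) ≡ used-count c base (pair z r)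
   chain-count c base [] z z≢a z∉ r = refl
   chain-count c base (_∷_ {r′} {x = x} {ms = ms} e ch) z z≢a z∉ r =
     trans (cong₂ _+_ (chain-count c base ch z z≢a (z∉ ∘ there) r) (cong ⟦_⟧ (==-≢ (pair-≢ r r′ z≢x)))) (+-identityʳ _)
     where
       z≢x : z ≢ x
       z≢x refl with chain-tip ch
       ... | inj₁ e = z≢a e
       ... | inj₂ p = z∉ (there p)

   unused⇒∉ : ∀ U ms y → unused U ms y ≡ true → y ∉ children ms
   unused⇒∉ U ((p , z) ∷ ms) y e (here refl) with trans (sym (proj₂ (∧-true {unused U ms y} e))) (cong not (==-refl y))
   ... | ()
   unused⇒∉ U ((p , z) ∷ ms) y e (there q) = unused⇒∉ U ms y (proj₁ (∧-true e)) q

   unused⇒U : ∀ U ms y → unused U ms y ≡ true → U y ≡ true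
   unused⇒U U [] y e = e
   unused⇒U U (_ ∷ ms) y e = unused⇒U U ms y (proj₁ (∧-true e))

   ¬unused : ∀ U ms y → U y ≡ false → unused U ms y ≡ false
   ¬unused U [] y e = e
   ¬unused U (m ∷ ms) y e = ∧-falseˡ _ (¬unused U ms y e)

   legal-unique : ∀ U ms → Legal U ms → Unique (children ms) × All (λ y → U y ≡ true) (children ms)
   legal-unique U [] [] = [] , []
   legal-unique U ((p , y) ∷ ms) ((_ , free) ∷ l) =
     (All.tabulate (λ {z} z∈ e → unused⇒∉ U ms y free (subst (_∈ children ms) (sym e) z∈)) ∷ proj₁ (legal-unique U ms l)) ,
     (unused⇒U U ms y free ∷ proj₂ (legal-unique U ms l))

   true≢false : ∀ {b : Bool} → b ≡ true → b ≡ false → ⊥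
   true≢false refl ()

   module Growth (U₀ : Fin n → Bool) (c₀ : Fin (n * ρ) → ℕ) (U₀-act : ∀ y → U₀ y ≡ true → act y ≡ true)
                 (Tmax : ℕ) (room : (D + D) * M + M + Tmax < # U₀) where

     Fresh : List Move → Set
     Fresh ms = ∀ y → unused U₀ ms y ≡ true → ∀ r → used-count c₀ ms (pair y r) ≡ 0

     Avail : List Move → Fin n → Set
     Avail ms x = act x ≡ true × unused U₀ ms x ≡ false × (∀ r → used-count c₀ ms (pair x r) ≡ 0)

     many : ∀ ms → Legal U₀ ms → length ms ≤ Tmax → (D + D) * M + M < # (unused U₀ ms)
     many ms l le = +-cancelʳ-< (length ms) _ _ (begin-strict
       (D + D) * M + M + length ms ≤⟨ +-monoʳ-≤ ((D + D) * M + M) le ⟩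
       (D + D) * M + M + Tmax <⟨ room ⟩
       # U₀ ≡⟨ sym (unused-size U₀ ms l) ⟩
       # (unused U₀ ms) + length ms ∎)
       where open ≤-Reasoning

     module _ (base : List Move) (a : Fin n) where

       LeafOK : List (Fin ρ) → List Move → Fin n × List Move → Set
       LeafOK rs new (x , ms) = Chain a rs x ms × ms ⊆ new × Avail (new ++ base) x × (x ≡ a ⊎ unused U₀ base x ≡ true)

       Outside : List Move → Set
       Outside new = ∀ x → unused U₀ base x ≡ false → x ≢ a → ∀ r → used-count c₀ (new ++ base) (pair x r) ≡ used-count c₀ base (pair x r)

       record State (new : List Move) : Set where
         field
           legal   : Legal U₀ (new ++ base)
           ext     : Ext (unused U₀ (new ++ base)) (used-count c₀ (new ++ base))
           fresh   : Fresh (new ++ base)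
           outside : Outside new

       record Tree (rs : List (Fin ρ)) (w s : ℕ) : Set where
         field
           new    : List Move
           state  : State new
           leaves : List (Fin n × List Move)
           count  : length leaves ≡ w
           uniq   : Unique (map proj₁ leaves)
           ok     : All (LeafOK rs new) leaves
           bound  : length (new ++ base) ≤ s
         open State state public

       Leaves : Set
       Leaves = List (Fin n × List Move)

       -- The children still to be given to the leaf x of the previous level, and the leaves of the two levels.
       record Stage (rs : List (Fin ρ)) (r : Fin ρ) (todo : Leaves) (w s : ℕ) : Set where
         field
           new     : List Move
           state   : State new
           done    : Leaves
           count   : length done ≡ w
           uniq    : Unique (map proj₁ (done ++ todo))
           done-ok : All (LeafOK (r ∷ rs) new) done
           todo-ok : All (LeafOK rs new) todo
           bound   : length (new ++ base) ≤ s

       record Partial (rs : List (Fin ρ)) (r : Fin ρ) (x : Fin n) (k : ℕ) (todo : Leaves) (w s : ℕ) : Set where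
         field
           new     : List Move
           state   : State new
           done    : Leaves
           count   : length done ≡ w
           uniq    : Unique (x ∷ map proj₁ (done ++ todo))
           done-ok : All (LeafOK (r ∷ rs) new) done
           todo-ok : All (LeafOK rs new) todo
           bound   : length (new ++ base) ≤ s
           path    : List Move
           chain   : Chain a rs x path
           path⊆   : path ⊆ new
           x-act   : act x ≡ true
           x-used  : unused U₀ (new ++ base) x ≡ false
           x-count : used-count c₀ (new ++ base) (pair x r) + k ≤ D
           x-from  : x ≡ a ⊎ unused U₀ base x ≡ true

       add-child : ∀ {rs r x k todo w s} → s ≤ Tmax → Partial rs r x (suc k) todo w s → Partial rs r x k todo (suc w) (suc s)
       add-child {rs} {r} {x} {k} {todo} {w} {s} s≤ P = record
         { new = m ∷ new
         ; state = record
           { legal = (nb-y , y-free) ∷ legal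
           ; ext = ext-y
           ; fresh = λ z z-free r′ → trans (cong₂ _+_ (fresh z (proj₁ (∧-true z-free)) r′) (cong ⟦_⟧ (==-≢ (pair-≢ r′ r (free≢ z (proj₁ (∧-true z-free))))))) refl
           ; outside = λ z z-used z≢a r′ → trans (cong₂ _+_ (outside z z-used z≢a r′) (cong ⟦_⟧ (==-≢ (pair-≢ r′ r (outside≢ z z-used z≢a))))) (+-identityʳ _) }
         ; done = (y , m ∷ path) ∷ done
         ; count = cong suc count
         ; uniq = (≢-sym (free≢ y y-free) ∷ head uniq) ∷ (All.tabulate (λ {z} z∈ e → not-leaf z z∈ (subst (λ t → unused U₀ ms t ≡ true) e y-free)) ∷ tail uniq)
         ; done-ok = ((trans (sym (pair-nb x r y)) nb-y ∷ chain) , (refl ∷ path⊆) ,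
               (U₀-act y (unused⇒U U₀ ms y y-free) , trans (cong (λ b → unused U₀ ms y ∧ not b) (==-refl y)) (BoolP.∧-zeroʳ _) ,
                (λ r′ → cong₂ _+_ (fresh y y-free r′) (cong ⟦_⟧ (==-≢ (pair-≢ r′ r (free≢ y y-free)))))) ,
               inj₂ (unused-mono U₀ (SubP.++⁺ˡ new ⊆-refl) y y-free)) ∷ keep (λ z∈ → MP.∈-++⁺ˡ z∈) done-ok
         ; todo-ok = keep (λ z∈ → MP.∈-++⁺ʳ done z∈) todo-ok
         ; bound = s≤s bound
         ; path = path ; chain = chain ; path⊆ = m ∷ʳ path⊆
         ; x-act = x-act
         ; x-used = ∧-falseˡ (not (x == y)) x-used
         ; x-count = ≤-trans (≤-reflexive (trans (cong (λ t → used-count c₀ ms (pair x r) + t + k) (cong ⟦_⟧ (==-refl (pair x r)))) (lem (used-count c₀ ms (pair x r)) k))) x-count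
         ; x-from = x-from }
         where
           open Partial P
           open State state
           ms = new ++ base
           p = pair x r
           lem : ∀ a k → a + 1 + k ≡ a + suc k
           lem = solve-∀
           found = Extend.extend large (unused U₀ ms) (used-count c₀ ms) ext (many ms legal (≤-trans bound s≤)) p
                     (trans (cong act (src-pair x r)) x-act) (≤-trans (≤-reflexive (+-comm 1 _)) (≤-trans (+-monoʳ-≤ _ (s≤s z≤n)) x-count))
           y = proj₁ found
           m = (p , y)
           nb-y = proj₁ (proj₂ found)
           y-free = proj₁ (proj₂ (proj₂ found))
           ext-y = proj₂ (proj₂ (proj₂ found))
           free≢ : ∀ z → unused U₀ ms z ≡ true → z ≢ x
           free≢ z e refl = true≢false e x-used
           outside≢ : ∀ z → unused U₀ base z ≡ false → z ≢ a → z ≢ x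
           outside≢ z e z≢a refl with x-from
           ... | inj₁ q = z≢a q
           ... | inj₂ q = true≢false q e
           head : ∀ {u : Fin n} {us} → Unique (u ∷ us) → All (u ≢_) us
           head (h ∷ _) = h
           tail : ∀ {u : Fin n} {us} → Unique (u ∷ us) → Unique us
           tail (_ ∷ t) = t
           used-leaf : ∀ {rs} {l} → LeafOK rs new l → unused U₀ ms (proj₁ l) ≡ false
           used-leaf (_ , _ , (_ , u , _) , _) = u
           not-leaf : ∀ z → z ∈ map proj₁ (done ++ todo) → unused U₀ ms z ≡ true → ⊥
           not-leaf z z∈ free with MP.∈-map⁻ proj₁ z∈
           ... | l , l∈ , refl with MP.∈-++⁻ done l∈
           ...   | inj₁ q = true≢false free (used-leaf {r ∷ rs} (All.lookup done-ok q))
           ...   | inj₂ q = true≢false free (used-leaf {rs} (All.lookup todo-ok q))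
           keep : ∀ {rs′ ls} → (∀ {l} → l ∈ ls → l ∈ done ++ todo) → All (LeafOK rs′ new) ls → All (LeafOK rs′ (m ∷ new)) ls
           keep inc oks = All.tabulate (λ {l} l∈ → upd l (inc l∈) (All.lookup oks l∈))
             where
               upd : ∀ {rs′} l → l ∈ done ++ todo → LeafOK rs′ new l → LeafOK rs′ (m ∷ new) l
               upd (z , zs) l∈ (ch , sub , (za , zu , zc) , zf) = ch , (m ∷ʳ sub) , (za , ∧-falseˡ (not (z == y)) zu ,
                 (λ r′ → cong₂ _+_ (zc r′) (cong ⟦_⟧ (==-≢ (pair-≢ r′ r (λ e → All.lookup (head uniq) (MP.∈-map⁺ proj₁ l∈) (sym e))))))) , zf

       add-children : ∀ {rs r x todo w s} k → s + k ≤ suc Tmax → Partial rs r x k todo w s → Stage rs r todo (k + w) (k + s)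
       add-children zero le P = record { new = new ; state = state ; done = done ; count = count ; uniq = tail uniq ; done-ok = done-ok ; todo-ok = todo-ok ; bound = bound }
         where
           open Partial P
           tail : ∀ {u : Fin n} {us} → Unique (u ∷ us) → Unique us
           tail (_ ∷ t) = t
       add-children {rs} {r} {todo = todo} {w} {s} (suc k) le P = subst₂ (Stage rs r todo) (+-suc k w) (+-suc k s)
         (add-children k (≤-trans (≤-reflexive (sym (+-suc s k))) le) (add-child (≤-trans (m≤m+n s k) (ℕ.s≤s⁻¹ (≤-trans (≤-reflexive (sym (+-suc s k))) le))) P))

       grow-stage : ∀ {rs r} k → k ≤ D → ∀ todo {w s} → s + k * length todo ≤ suc Tmax → Stage rs r todo w s → Stage rs r [] (length todo * k + w) (length todo * k + s)
       grow-stage k k≤D [] le S = S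
       grow-stage {rs} {r} k k≤D ((x , ms) ∷ todo) {w} {s} le S = subst₂ (Stage rs r []) (lem (length todo * k) k w) (lem (length todo * k) k s)
           (grow-stage k k≤D todo (≤-trans (≤-reflexive (lem₂ k s (length todo))) le) (add-children k (≤-trans (+-monoʳ-≤ s (m≤m*n′ k (length todo))) le) P))
         where
           open Stage S
           lem : ∀ a b c → a + (b + c) ≡ b + a + c
           lem = solve-∀
           lem₂ : ∀ k s t → k + s + k * t ≡ s + k * suc t
           lem₂ = solve-∀
           m≤m*n′ : ∀ k t → k ≤ k * suc t
           m≤m*n′ k t = ≤-trans (m≤m+n k (k * t)) (≤-reflexive (sym (*-suc k t)))
           x-ok : LeafOK rs new (x , ms)
           x-ok = All.head todo-ok
           P : Partial rs r x k todo w s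
           P = record { new = new ; state = state ; done = done ; count = count
             ; uniq = move done uniq
             ; done-ok = done-ok ; todo-ok = All.tail todo-ok ; bound = bound ; path = ms ; chain = proj₁ x-ok ; path⊆ = proj₁ (proj₂ x-ok)
             ; x-act = proj₁ (proj₁ (proj₂ (proj₂ x-ok))) ; x-used = proj₁ (proj₂ (proj₁ (proj₂ (proj₂ x-ok))))
             ; x-count = ≤-trans (≤-reflexive (cong (_+ k) (proj₂ (proj₂ (proj₁ (proj₂ (proj₂ x-ok)))) r))) k≤D
             ; x-from = proj₂ (proj₂ (proj₂ x-ok)) }
             where
               move : ∀ ls → Unique (map proj₁ (ls ++ (x , ms) ∷ todo)) → Unique (x ∷ map proj₁ (ls ++ todo))
               move [] u = u
               move ((z , _) ∷ ls) (pz ∷ u) with move ls u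
               ... | px ∷ u′ = ((λ e → All.lookup pz (MP.∈-map⁺ proj₁ (MP.∈-++⁺ʳ ls (here refl))) (sym e)) ∷ px) ∷
                     (All.tabulate (λ {v} v∈ → All.lookup pz (inc v v∈)) ∷ u′)
                 where
                   inc : ∀ v → v ∈ map proj₁ (ls ++ todo) → v ∈ map proj₁ (ls ++ (x , ms) ∷ todo)
                   inc v v∈ with MP.∈-map⁻ proj₁ v∈
                   ... | l , l∈ , refl with MP.∈-++⁻ ls l∈
                   ...   | inj₁ q = MP.∈-map⁺ proj₁ (MP.∈-++⁺ˡ q)
                   ...   | inj₂ q = MP.∈-map⁺ proj₁ (MP.∈-++⁺ʳ ls (there q))

       grow-level : ∀ {rs w s} r k → k ≤ D → s + k * w ≤ suc Tmax → Tree rs w s → Tree (r ∷ rs) (w * k) (w * k + s)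
       grow-level {rs} {w} {s} r k k≤D le T = record { new = S.new ; state = S.state ; leaves = S.done ; count = trans S.count (trans (+-identityʳ _) (cong (_* k) count))
           ; uniq = subst (λ ls → Unique (map proj₁ ls)) (ListP.++-identityʳ S.done) S.uniq ; ok = S.done-ok ; bound = ≤-trans S.bound (≤-reflexive (cong (λ t → t * k + s) count)) }
         where
           open Tree T
           unfed : Stage rs r leaves 0 s
           unfed = record { new = new ; state = state ; done = [] ; count = refl ; uniq = uniq ; done-ok = [] ; todo-ok = ok ; bound = bound }
           module S = Stage (grow-stage {rs} {r} k k≤D leaves {0} {s} (≤-trans (≤-reflexive (cong (λ t → s + k * t) count)) le) unfed)

       root : State [] → Avail base a → Tree [] 1 (length base)
       root st av = record { new = [] ; state = st ; leaves = (a , []) ∷ [] ; count = refl ; uniq = [] ∷ [] ; ok = ([] , [] , av , inj₁ refl) ∷ [] ; bound = ≤-refl }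

       grow-path : ∀ {rs s} ls → s + length ls ≤ suc Tmax → Tree rs 1 s → Tree (ls ʳ++ rs) 1 (s + length ls)
       grow-path {rs} {s} [] le T = subst (Tree rs 1) (sym (+-identityʳ s)) T
       grow-path {rs} {s} (r ∷ ls) le T = subst (Tree (ls ʳ++ (r ∷ rs)) 1) (sym (+-suc s (length ls)))
         (grow-path ls (≤-trans (≤-reflexive (sym (+-suc s (length ls)))) le) (grow-level r 1 (≤-trans (s≤s z≤n) 2≤D) (≤-trans (+-monoʳ-≤ s (s≤s z≤n)) le) T))

       total : ℕ → ℕ → ℕ
       total w zero = 0
       total w (suc t) = w * D + total (w * D) t

       grow-tree : ∀ {rs w s} ls → s + total w (length ls) ≤ suc Tmax → Tree rs w s → Tree (ls ʳ++ rs) (w * D ^ length ls) (s + total w (length ls))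
       grow-tree {rs} {w} {s} [] le T = subst₂ (Tree rs) (sym (*-identityʳ w)) (sym (+-identityʳ s)) T
       grow-tree {rs} {w} {s} (r ∷ ls) le T = subst₂ (Tree (ls ʳ++ (r ∷ rs))) (*-assoc w D _) (lem s (w * D) (total (w * D) (length ls)))
           (grow-tree ls (≤-trans (≤-reflexive (lem s (w * D) (total (w * D) (length ls)))) le)
             (grow-level r D ≤-refl (≤-trans (≤-reflexive (cong (s +_) (*-comm D w))) (≤-trans (+-monoʳ-≤ s (m≤m+n (w * D) _)) le)) T))
         where
           lem : ∀ a b c → b + a + c ≡ a + (b + c)
           lem = solve-∀

     -- each level at least doubles, so all levels together are at most twice the last one
     total-bound : ∀ base a w t → total base a w t + 2 * w ≤ 2 * (w * D ^ t)
     total-bound base a w zero = ≤-reflexive (cong (2 *_) (sym (*-identityʳ w)))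
     total-bound base a w (suc t) = begin
       w * D + total base a (w * D) t + 2 * w ≡⟨ lem (w * D) (total base a (w * D) t) (2 * w) ⟩
       total base a (w * D) t + (w * D + 2 * w) ≤⟨ +-monoʳ-≤ (total base a (w * D) t) (+-monoʳ-≤ (w * D) (≤-trans (*-monoˡ-≤ w 2≤D) (≤-reflexive (*-comm D w)))) ⟩
       total base a (w * D) t + (w * D + w * D) ≡⟨ cong (total base a (w * D) t +_) (lem₂ (w * D)) ⟩
       total base a (w * D) t + 2 * (w * D) ≤⟨ total-bound base a (w * D) t ⟩
       2 * (w * D * D ^ t) ≡⟨ cong (2 *_) (*-assoc w D (D ^ t)) ⟩
       2 * (w * (D * D ^ t)) ∎
       where
         open ≤-Reasoning
         lem : ∀ a b c → a + b + c ≡ b + (a + c)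
         lem = solve-∀
         lem₂ : ∀ a → a + a ≡ 2 * a
         lem₂ = solve-∀

     record Connection (a b : Fin n) (ls : List (Fin ρ)) : Set where
       field
         interior : List (Fin n)
         walk     : Walk a ls b (interior ++ b ∷ [])
         uniq     : Unique interior
         inside   : All (λ y → U₀ y ≡ true) interior
         U₁       : Fin n → Bool
         c₁       : Fin (n * ρ) → ℕ
         ext      : Ext U₁ c₁
         U₁⊆      : ∀ y → U₁ y ≡ true → U₀ y ≡ true × y ∉ interior
         U₁-size  : # U₁ + length interior ≡ # U₀
         fresh    : ∀ y → U₁ y ≡ true → ∀ r → c₁ (pair y r) ≡ 0
         outside  : ∀ x → U₀ x ≡ false → x ≢ a → x ≢ b → ∀ r → c₁ (pair x r) ≡ c₀ (pair x r)

     module _ (fresh₀ : ∀ y → U₀ y ≡ true → ∀ r → c₀ (pair y r) ≡ 0) {a b : Fin n} (Ua : U₀ a ≡ false) (Ub : U₀ b ≡ false)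
              {rsA rsB wA wB sA sB} (treeA : Tree [] a rsA wA sA) (treeB : Tree (Tree.new treeA ++ []) b rsB wB sB) (r : Fin ρ) (big : Λ < wA * wB) where
       private
         module A = Tree treeA
         module B = Tree treeB

       join-trees : Connection a b (rsA ʳ++ (r ∷ rsB))
       join-trees = finish (Any.any? (λ l → Any.any? (λ l′ → adj r (proj₁ l) (proj₁ l′) BoolP.≟ true) B.leaves) A.leaves)
        where
         finish : Dec (Any (λ l → Any (λ l′ → adj r (proj₁ l) (proj₁ l′) ≡ true) B.leaves) A.leaves) → Connection a b (rsA ʳ++ (r ∷ rsB))
         finish (no none) = ⊥-elim (<⇒≱ big (subst₂ (λ x y → x * y ≤ Λ) (sizes A.leaves A.uniq (A.count))
               (sizes B.leaves B.uniq (B.count)) (joined r (inList (map proj₁ A.leaves)) (inList (map proj₁ B.leaves)) no-edge)))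
           where
             sizes : ∀ ls {k} → Unique (map proj₁ ls) → length ls ≡ k → # (inList (map proj₁ ls)) ≡ k
             sizes ls u e = trans (#-inList (map proj₁ ls) u) (trans (ListP.length-map proj₁ ls) e)
             no-edge : ∀ x y → inList (map proj₁ A.leaves) x ≡ true → inList (map proj₁ B.leaves) y ≡ true → adj r x y ≡ false
             no-edge x y ex ey with MP.∈-map⁻ proj₁ (inList-∈ _ x ex) | MP.∈-map⁻ proj₁ (inList-∈ _ y ey)
             ... | l , l∈ , refl | l′ , l′∈ , refl with adj r (proj₁ l) (proj₁ l′) in eq
             ...   | false = refl
             ...   | true = ⊥-elim (none (lose l∈ (lose l′∈ eq)))
         finish (yes some) with find some
         ... | (x , msA) , x∈ , some′ with find some′
         ...   | (y , msB) , y∈ , edge with All.lookup A.ok x∈ | All.lookup B.ok y∈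
         ...     | chA , subA , _ , _ | chB , subB , _ , _ with chain-walk chB
         ...       | vs , wB , vs≡ = record
           { interior = interior
           ; walk = subst (λ us → Walk a (rsA ʳ++ (r ∷ rsB)) b us) vertices≡ (chain-glue chA (edge ∷ wB))
           ; uniq = unique-ʳ++ (children msA) (children msB) unique-ms
           ; inside = All.tabulate (λ {z} z∈ → All.lookup (proj₂ (legal-unique U₀ ms legal)) (∈ms z∈))
           ; U₁ = unused U₀ ms
           ; c₁ = used-count c₀ ms
           ; ext = ext-⊆ U₀ c₀ ms⊆ B.legal B.ext
           ; U₁⊆ = λ z e → unused⇒U U₀ ms z e , λ z∈ → unused⇒∉ U₀ ms z e (∈ms z∈)
           ; U₁-size = trans (cong (# (unused U₀ ms) +_) length≡) (unused-size U₀ ms legal)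
           ; fresh = λ z e r′ → trans (count z (λ { refl → true≢false (unused⇒U U₀ ms a e) Ua }) (λ { refl → true≢false (unused⇒U U₀ ms b e) Ub }) (unused⇒∉ U₀ ms z e) r′) (fresh₀ z (unused⇒U U₀ ms z e) r′)
           ; outside = λ z Uz z≢a z≢b r′ → count z z≢a z≢b (λ z∈ → true≢false (All.lookup (proj₂ (legal-unique U₀ ms legal)) z∈) Uz) r′ }
           where
             ms = msB ++ msA
             ms⊆ : ms ⊆ B.new ++ (A.new ++ [])
             ms⊆ = SubP.++⁺ subB (SubP.++⁺ʳ [] subA)
             legal : Legal U₀ ms
             legal = legal-⊆ U₀ ms⊆ B.legal
             interior = children msA ʳ++ children msB
             vertices≡ : children msA ʳ++ (y ∷ vs) ≡ interior ++ b ∷ []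
             vertices≡ = trans (cong (children msA ʳ++_) vs≡) (sym (ʳ++-++′ (children msA) (children msB) (b ∷ [])))
               where
                 ʳ++-++′ : ∀ (xs ys zs : List (Fin n)) → (xs ʳ++ ys) ++ zs ≡ xs ʳ++ (ys ++ zs)
                 ʳ++-++′ [] ys zs = refl
                 ʳ++-++′ (x ∷ xs) ys zs = ʳ++-++′ xs (x ∷ ys) zs
             ∈-ʳ++ : ∀ (xs ys : List (Fin n)) {z} → z ∈ xs ʳ++ ys → z ∈ ys ++ xs
             ∈-ʳ++ [] ys p = subst (_ ∈_) (sym (ListP.++-identityʳ ys)) p
             ∈-ʳ++ (x ∷ xs) ys p with ∈-ʳ++ xs (x ∷ ys) p
             ... | here e = MP.∈-++⁺ʳ ys (here e)
             ... | there q with MP.∈-++⁻ ys q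
             ...   | inj₁ q′ = MP.∈-++⁺ˡ q′
             ...   | inj₂ q′ = MP.∈-++⁺ʳ ys (there q′)
             ∈ms : ∀ {z} → z ∈ interior → z ∈ children ms
             ∈ms z∈ = subst (_ ∈_) (sym (ListP.map-++ proj₂ msB msA)) (∈-ʳ++ (children msA) (children msB) z∈)
             length≡ : length interior ≡ length ms
             length≡ = trans (ListP.length-ʳ++ (children msA)) (trans (cong₂ _+_ (ListP.length-map proj₂ msA) (ListP.length-map proj₂ msB)) (trans (+-comm (length msA) _) (sym (ListP.length-++ msB))))
             count : ∀ z → z ≢ a → z ≢ b → z ∉ children ms → ∀ r′ → used-count c₀ ms (pair z r′) ≡ c₀ (pair z r′)
             count z z≢a z≢b z∉ r′ = trans (chain-count c₀ msA chB z z≢b (λ p → z∉ (subst (z ∈_) (sym (ListP.map-++ proj₂ msB msA)) (MP.∈-++⁺ˡ p))) r′)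
               (trans (cong (λ l → used-count c₀ l (pair z r′)) (sym (ListP.++-identityʳ msA)))
                 (chain-count c₀ [] chA z z≢a (λ p → z∉ (subst (z ∈_) (sym (ListP.map-++ proj₂ msB msA)) (MP.∈-++⁺ʳ (children msB) p))) r′))
             unique-ms : Unique (children msB ++ children msA)
             unique-ms = subst Unique (ListP.map-++ proj₂ msB msA) (proj₁ (legal-unique U₀ ms legal))
             unique-ʳ++ : ∀ (xs ys : List (Fin n)) → Unique (ys ++ xs) → Unique (xs ʳ++ ys)
             unique-ʳ++ [] ys u = subst Unique (ListP.++-identityʳ ys) u
             unique-ʳ++ (x ∷ xs) ys u = unique-ʳ++ xs (x ∷ ys) (front ys u)
               where
                 front : ∀ ys → Unique (ys ++ x ∷ xs) → Unique (x ∷ ys ++ xs)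
                 front [] u = u
                 front (y ∷ ys) (py ∷ u) with front ys u
                 ... | px ∷ u′ = ((λ e → All.lookup py (MP.∈-++⁺ʳ ys (here refl)) (sym e)) ∷ px) ∷
                       (All.tabulate (λ {v} v∈ → All.lookup py (inc v∈)) ∷ u′)
                   where
                     inc : ∀ {v} → v ∈ ys ++ xs → v ∈ ys ++ x ∷ xs
                     inc v∈ with MP.∈-++⁻ ys v∈
                     ... | inj₁ q = MP.∈-++⁺ˡ q
                     ... | inj₂ q = MP.∈-++⁺ʳ ys (there q)

     connect : Ext U₀ c₀ → (∀ y → U₀ y ≡ true → ∀ r → c₀ (pair y r) ≡ 0) →
       ∀ a b → a ≢ b → act a ≡ true → act b ≡ true → U₀ a ≡ false → U₀ b ≡ false → (∀ r → c₀ (pair a r) ≡ 0) → (∀ r → c₀ (pair b r) ≡ 0) →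
       ∀ l₀ l₁ r l₂ t → length l₁ ≡ t → length l₂ ≡ t → Λ < D ^ t * D ^ t → length l₀ + 4 * D ^ t ≤ Tmax →
       Connection a b (l₀ ++ l₁ ++ r ∷ l₂)
     connect ext₀ fresh₀ a b a≢b act-a act-b Ua Ub ca cb l₀ l₁ r l₂ t l₁≡ l₂≡ big fits =
       subst (Connection a b) labels≡ (join-trees fresh₀ Ua Ub treeA (treeB treeA) r
         (subst (Λ <_) (cong₂ _*_ (sym (trans (*-identityˡ _) (cong (D ^_) l₁≡))) (sym (trans (*-identityˡ _) (cong (D ^_) l₂ʳ≡)))) big))
       where
         l₂ʳ = l₂ ʳ++ []
         l₂ʳ≡ : length l₂ʳ ≡ t
         l₂ʳ≡ = trans (ListP.length-ʳ++ l₂) (trans (+-identityʳ _) l₂≡)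
         total≤ : ∀ base x s → s ≡ t → total base x 1 s ≤ 2 * D ^ t
         total≤ base x s refl = ≤-trans (m≤m+n (total base x 1 t) 2) (≤-trans (total-bound base x 1 t) (≤-reflexive (cong (2 *_) (*-identityˡ (D ^ t)))))
         treeA : Tree [] a (l₁ ʳ++ (l₀ ʳ++ [])) (1 * D ^ length l₁) (length l₀ + total [] a 1 (length l₁))
         treeA = grow-tree [] a l₁ (≤-trans (+-monoʳ-≤ (length l₀) (≤-trans (total≤ [] a (length l₁) l₁≡) (*-monoˡ-≤ (D ^ t) (s≤s (s≤s (z≤n {2})))))) (m≤n⇒m≤1+n fits))
           (grow-path [] a l₀ (≤-trans (m≤m+n (length l₀) _) (m≤n⇒m≤1+n fits))
             (root [] a (record { legal = [] ; ext = ext₀ ; fresh = fresh₀ ; outside = λ _ _ _ _ → refl }) (act-a , Ua , ca)))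
         treeB : (A : Tree [] a (l₁ ʳ++ (l₀ ʳ++ [])) (1 * D ^ length l₁) (length l₀ + total [] a 1 (length l₁))) →
                 Tree (Tree.new A ++ []) b (l₂ʳ ʳ++ []) (1 * D ^ length l₂ʳ) (length (Tree.new A ++ []) + total (Tree.new A ++ []) b 1 (length l₂ʳ))
         treeB A = grow-tree base b l₂ʳ (begin
             length base + total base b 1 (length l₂ʳ) ≤⟨ +-mono-≤ (Tree.bound A) (total≤ base b (length l₂ʳ) l₂ʳ≡) ⟩
             length l₀ + total [] a 1 (length l₁) + 2 * D ^ t ≤⟨ +-monoˡ-≤ (2 * D ^ t) (+-monoʳ-≤ (length l₀) (total≤ [] a (length l₁) l₁≡)) ⟩
             length l₀ + 2 * D ^ t + 2 * D ^ t ≡⟨ lem (length l₀) (D ^ t) ⟩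
             length l₀ + 4 * D ^ t ≤⟨ m≤n⇒m≤1+n fits ⟩
             suc Tmax ∎)
           (root base b (record { legal = Tree.legal A ; ext = Tree.ext A ; fresh = Tree.fresh A ; outside = λ _ _ _ _ → refl })
             (act-b , ¬unused U₀ base b Ub , λ r → trans (Tree.outside A b Ub (≢-sym a≢b) r) (cb r)))
           where
             open ≤-Reasoning
             base = Tree.new A ++ []
             lem : ∀ l d → l + 2 * d + 2 * d ≡ l + 4 * d
             lem = solve-∀
         labels≡ : (l₁ ʳ++ (l₀ ʳ++ [])) ʳ++ (r ∷ (l₂ʳ ʳ++ [])) ≡ l₀ ++ l₁ ++ r ∷ l₂
         labels≡ = trans (ListP.ʳ++-ʳ++ l₁) (trans (ListP.ʳ++-ʳ++ l₀) (cong (λ zs → l₀ ++ l₁ ++ r ∷ zs) (trans (ListP.ʳ++-ʳ++ l₂) (ListP.++-identityʳ l₂))))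

module ReservedSets where
 open ExtendabilityMethod
 open TreeGrowth
 open import Data.Nat using (_+_; _*_; _≤_; _<_; z≤n; s≤s)
 open import Data.Nat.Properties
 open import Data.Nat.Tactic.RingSolver using (solve-∀)
 open import Data.Fin using (zero; suc)
 open import Data.Fin.Subset using (Subset)
 open import Data.Fin.Subset.Properties using (anySubset?)
 open import Data.Bool using (_∧_; _∨_; not)
 open import Data.List using ([]; _∷_; length; _++_)
 import Data.Vec.Properties as VecP
 open import Data.Vec using ([]; _∷_)
 open import Data.List.Membership.Propositional using (_∈_; _∉_)
 open import Data.List.Relation.Unary.Any using (here; there)
 open import Data.List.Relation.Unary.All using ([]; _∷_)
 open import Data.List.Relation.Unary.AllPairs using ([]; _∷_)
 open import Relation.Nullary.Decidable using (_×-dec_; _→-dec_)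

 _∖_ : ∀ {n} → (Fin n → Bool) → (Fin n → Bool) → Fin n → Bool
 (U ∖ Z) y = U y ∧ not (Z y)

 #-∖ : ∀ {n} (U Z : Fin n → Bool) → # U ≤ # (U ∖ Z) + # Z
 #-∖ U Z = ≤-trans (∑ᶠ-mono (λ y → split (U y) (Z y))) (≤-reflexive (∑ᶠ-+ _ _))
   where
     split : ∀ u z → ⟦ u ⟧ ≤ ⟦ u ∧ not z ⟧ + ⟦ z ⟧
     split false z = z≤n
     split true true = ≤-refl
     split true false = ≤-refl

 #-inList≤ : ∀ {n} (xs : List (Fin n)) → # (inList xs) ≤ length xs
 #-inList≤ {n} [] = ≤-reflexive (∑ᶠ-zero n)
 #-inList≤ (x ∷ xs) = ≤-trans (∑ᶠ-mono (λ i → split (i == x) (inList xs i))) (≤-trans (≤-reflexive (∑ᶠ-+ _ _))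
     (+-mono-≤ (≤-reflexive (∑ᶠ-δ (λ _ → 1) x)) (#-inList≤ xs)))
   where
     split : ∀ a b → ⟦ a ∨ b ⟧ ≤ ⟦ a ⟧ * 1 + ⟦ b ⟧
     split true b = s≤s z≤n
     split false b = ≤-refl

 ∃-outside : ∀ {n} (X : Fin n → Bool) (xs : List (Fin n)) → length xs < # X → ∃ λ y → X y ≡ true × y ∉ xs
 ∃-outside X xs lt with FinP.any? (λ y → (X y BoolP.≟ true) ×-dec (inList xs y BoolP.≟ false))
 ... | yes (y , a , b) = y , a , λ y∈ → true≢false′ (∈-inList y∈) b
   where
     true≢false′ : ∀ {b} → b ≡ true → b ≡ false → ⊥
     true≢false′ refl ()
 ... | no none = ⊥-elim (<⇒≱ lt (≤-trans (∑ᶠ-mono (λ y → ⟦⟧-mono (X y) (inList xs y) (λ e → in-list y e (inList xs y) refl))) (#-inList≤ xs)))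
   where
     in-list : ∀ y → X y ≡ true → ∀ b → inList xs y ≡ b → inList xs y ≡ true
     in-list y e true eq = eq
     in-list y e false eq = ⊥-elim (none (y , e , eq))

 module Cleanup {n ρ : ℕ} (G : ColouredExpander n ρ) where
   open ColouredExpander G
   open ColouredGraph G (λ _ → true)

   owners : Subset (n * ρ) → Fin n → Bool
   owners A x = anyᵇ (λ r → χ A (pair x r))

   #-owners : ∀ A → # (owners A) ≤ size A
   #-owners A = ≤-trans (∑ᶠ-mono (λ x → anyᵇ-≤ (λ r → χ A (pair x r)))) (≤-reflexive (sym (∑ᶠ-combine n ρ _)))

   owner : ∀ A p → χ A p ≡ true → owners A (src p) ≡ true
   owner A p e = anyᵇ-intro _ (col p) (trans (cong (χ A) (FinP.combine-remQuot {n} ρ p)) e)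

   Avoids : (Fin n → Bool) → Subset (n * ρ) → Set
   Avoids Z A = ∀ p → χ A p ≡ true → Z (src p) ≡ false

   -- A maximal set A of fewer than M demanders which does not expand outside itself; its owners Z are removed.
   cleanup : ∀ (V : Fin n → Bool) → (3 * D + 4) * M < # V →
     ∃ λ Z → # Z < M × (∀ A → Avoids Z A → size A ≤ M + M → D * size A ≤ Γ# A (V ∖ Z))
   cleanup V big = go M ∅ (≤-reflexive (sym (cong (_+ M) size-∅))) (subst (_< M) (sym size-∅) 1≤M)
       (≤-trans (≤-reflexive (trans (∑ᶠ-cong (λ y → cong (λ b → ⟦ b ∧ (V ∖ owners ∅) y ⟧) (hit-∅ y))) (∑ᶠ-zero n))) z≤n)
     where
       go : ∀ fuel A → M ≤ size A + fuel → size A < M → Γ# A (V ∖ owners A) ≤ D * size A →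
            ∃ λ Z → # Z < M × (∀ A → Avoids Z A → size A ≤ M + M → D * size A ≤ Γ# A (V ∖ Z))
       go zero A f s t = ⊥-elim (<⇒≱ s (≤-trans f (≤-reflexive (+-identityʳ _))))
       go (suc fuel) A f s t with anySubset? (λ B → FinP.all? (λ p → (χ B p BoolP.≟ true) →-dec (owners A (src p) BoolP.≟ false)) ×-dec
                                    ((size B ≤? M + M) ×-dec (Γ# B (V ∖ owners A) <? D * size B)))
       ... | no none = owners A , ≤-<-trans (#-owners A) s , λ B av sz → ≮⇒≥ (λ lt → none (B , av , sz , lt))
       ... | yes (B , av , szB , lt) = go fuel C f′ s′ t′
         where
           C = A ∪ B
           1≤B : 1 ≤ size B
           1≤B with size B
           ... | zero = ⊥-elim (<⇒≱ lt (≤-trans (≤-reflexive (*-zeroʳ D)) z≤n))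
           ... | suc _ = s≤s z≤n
           disjoint : size (A ∩ B) ≡ 0
           disjoint = trans (∑ᶠ-cong (λ p → cong ⟦_⟧ (trans (χ-∩ A B p) (empty p (χ A p) (χ B p) refl refl)))) (∑ᶠ-zero (n * ρ))
             where
               empty : ∀ p a b → χ A p ≡ a → χ B p ≡ b → a ∧ b ≡ false
               empty p false b ea eb = refl
               empty p true false ea eb = refl
               empty p true true ea eb = ⊥-elim (true≢false (owner A p ea) (av p eb))
           sizeC : size C ≡ size A + size B
           sizeC = trans (sym (+-identityʳ _)) (trans (cong (size C +_) (sym disjoint)) (size-modular A B))
           f′ : M ≤ size C + fuel
           f′ = ≤-trans f (≤-trans (≤-reflexive (+-suc (size A) fuel)) (≤-trans (≤-reflexive (+-comm 1 _)) (≤-trans (+-monoʳ-≤ (size A + fuel) 1≤B)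
                  (≤-reflexive (trans (lem (size A) fuel (size B)) (cong (_+ fuel) (sym sizeC)))))))
             where
               lem : ∀ a f b → a + f + b ≡ a + b + f
               lem = solve-∀
           shrink : ∀ y → (V ∖ owners C) y ≡ true → (V ∖ owners A) y ≡ true
           shrink y e with ∧-true {V y} e
           ... | a , b with owners A y in eq
           ...   | false = cong₂ _∧_ a refl
           ...   | true with anyᵇ-elim _ eq
           ...     | r , c = ⊥-elim (true≢false b (cong not (anyᵇ-intro (λ r → χ C (pair y r)) r (trans (χ-∪ A B (pair y r)) (cong (_∨ χ B (pair y r)) c)))))
           t′ : Γ# C (V ∖ owners C) ≤ D * size C
           t′ = begin
             Γ# C (V ∖ owners C) ≤⟨ ∑ᶠ-mono (λ y → ⟦⟧-mono (hit C y ∧ (V ∖ owners C) y) (hit C y ∧ (V ∖ owners A) y) (λ e → cong₂ _∧_ (proj₁ (∧-true {hit C y} e)) (shrink y (proj₂ (∧-true {hit C y} e))))) ⟩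
             Γ# C (V ∖ owners A) ≤⟨ m≤m+n _ _ ⟩
             Γ# C (V ∖ owners A) + Γ# (A ∩ B) (V ∖ owners A) ≤⟨ submodular A B (V ∖ owners A) ⟩
             Γ# A (V ∖ owners A) + Γ# B (V ∖ owners A) ≤⟨ +-mono-≤ t (<⇒≤ lt) ⟩
             D * size A + D * size B ≡⟨ trans (sym (*-distribˡ-+ D _ _)) (cong (D *_) (sym sizeC)) ⟩
             D * size C ∎
             where open ≤-Reasoning
           sz3 : size C ≤ 3 * M
           sz3 = ≤-trans (≤-reflexive sizeC) (≤-trans (+-mono-≤ (<⇒≤ s) szB) (≤-reflexive (lem M)))
             where
               lem : ∀ M → M + (M + M) ≡ 3 * M
               lem = solve-∀
           s′ : size C < M
           s′ = ≰⇒> (λ M≤ → <⇒≱ big (begin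
             # V ≤⟨ #-∖ V (owners C) ⟩
             # (V ∖ owners C) + # (owners C) ≤⟨ +-mono-≤ (large C (V ∖ owners C) M≤) (≤-trans (#-owners C) sz3) ⟩
             Γ# C (V ∖ owners C) + M + 3 * M ≤⟨ +-monoˡ-≤ (3 * M) (+-monoˡ-≤ M (≤-trans t′ (*-monoʳ-≤ D sz3))) ⟩
             D * (3 * M) + M + 3 * M ≡⟨ lem D M ⟩
             (3 * D + 4) * M ∎))
             where
               open ≤-Reasoning
               lem : ∀ D M → D * (3 * M) + M + 3 * M ≡ (3 * D + 4) * M
               lem = solve-∀

   module Stars (Δ : ℕ) (sparse : ∀ r (X T : Fin n → Bool) → (∀ x → X x ≡ true → # (λ y → T y ∧ adj r x y) ≤ Δ) → n ≤ 3 * # T → # X * # T ≤ 16 * Λ)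
                (adj-irr : ∀ r x → adj r x x ≡ false) where

     good-vertex : ∀ (T : Fin n → Bool) → n ≤ 3 * # T → 4 * M < # T → ∃ λ b → T b ≡ true × (∀ r → Δ < # (λ y → T y ∧ adj r b y))
     good-vertex T n≤ 4M< with FinP.any? (λ b → (T b BoolP.≟ true) ×-dec FinP.all? (λ r → Δ <? # (λ y → T y ∧ adj r b y)))
     ... | yes (b , Tb , g) = b , Tb , g
     ... | no none = ⊥-elim (<⇒≱ (*-mono-< 4M< 4M<) (begin
       # T * # T ≤⟨ *-monoˡ-≤ (# T) (∑ᶠ-mono (λ x → ≤-trans (⟦⟧-mono (T x) (anyᵇ (λ r → bad r x)) (cover x)) (anyᵇ-≤ (λ r → bad r x)))) ⟩
       ∑ᶠ (λ x → # (λ r → bad r x)) * # T ≡⟨ cong (_* # T) (∑ᶠ-swap _) ⟩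
       ∑ᶠ (λ r → # (bad r)) * # T ≡⟨ sym (∑ᶠ-*ʳ (# T) _) ⟩
       ∑ᶠ (λ r → # (bad r) * # T) ≤⟨ ∑ᶠ-mono (λ r → sparse r (bad r) T (λ x e → bad-≤ r x (proj₂ (∧-true {T x} e))) n≤) ⟩
       ∑ᶠ {ρ} (λ _ → 16 * Λ) ≡⟨ trans (∑ᶠ-const ρ _) (lem ρ Λ) ⟩
       16 * (ρ * Λ) ≤⟨ *-monoʳ-≤ 16 ρΛ≤M² ⟩
       16 * (M * M) ≡⟨ lem′ M ⟩
       4 * M * (4 * M) ∎))
       where
         open ≤-Reasoning
         lem : ∀ a b → a * (16 * b) ≡ 16 * (a * b)
         lem = solve-∀
         lem′ : ∀ M → 16 * (M * M) ≡ 4 * M * (4 * M)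
         lem′ = solve-∀
         deg≤? : ∀ r x → Bool
         deg≤? r x = # (λ y → T y ∧ adj r x y) ℕ.≤ᵇ Δ
         bad : Fin ρ → Fin n → Bool
         bad r x = T x ∧ deg≤? r x
         bad-≤ : ∀ r x → deg≤? r x ≡ true → # (λ y → T y ∧ adj r x y) ≤ Δ
         bad-≤ r x e = ≤ᵇ⇒≤ _ Δ (subst Bool.T (sym e) _)
         cover : ∀ x → T x ≡ true → anyᵇ (λ r → bad r x) ≡ true
         cover x Tx with FinP.any? (λ r → bad r x BoolP.≟ true)
         ... | yes (r , e) = anyᵇ-intro _ r e
         ... | no nb′ = ⊥-elim (none (x , Tx , λ r → ≰⇒> (λ le → nb′ (r , cong₂ _∧_ Tx (dec-true r le)))))
           where
             T⇒true : ∀ b → Bool.T b → b ≡ true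
             T⇒true true _ = refl
             dec-true : ∀ r → # (λ y → T y ∧ adj r x y) ≤ Δ → deg≤? r x ≡ true
             dec-true r le = T⇒true _ (≤⇒≤ᵇ le)

     pick-leaves : ∀ (T : Fin n → Bool) (b : Fin n) → (∀ r → Δ < # (λ y → T y ∧ adj r b y)) → ∀ k (γ : Fin k → Fin ρ) (ex : List (Fin n)) → length ex + k ≤ suc Δ →
       Σ (Vec (Fin n) k) λ leaf → (∀ j → T (Vec.lookup leaf j) ≡ true × adj (γ j) b (Vec.lookup leaf j) ≡ true) × (Unique ex → Unique (Vec.toList leaf ++ ex))
     pick-leaves T b deg zero γ ex le = [] , (λ ()) , λ u → u
     pick-leaves T b deg (suc k) γ ex le with pick-leaves T b deg k (γ ∘ suc) ex (≤-trans (+-monoʳ-≤ (length ex) (n≤1+n k)) le)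
     ... | leaf , ok , uq with ∃-outside (λ y → T y ∧ adj (γ zero) b y) (Vec.toList leaf ++ ex) (≤-<-trans len≤ (deg (γ zero)))
       where
         len≤ : length (Vec.toList leaf ++ ex) ≤ Δ
         len≤ = ≤-trans (≤-reflexive (trans (ListP.length-++ (Vec.toList leaf)) (trans (cong (_+ length ex) (VecP.length-toList leaf)) (+-comm k _)))) (ℕ.s≤s⁻¹ (≤-trans (≤-reflexive (sym (+-suc (length ex) k))) le))
     ...   | y , Ty , y∉ = y ∷ leaf , (λ { zero → ∧-true {T y} Ty ; (suc j) → ok j }) , λ u → All.tabulate (λ {z} z∈ e → y∉ (subst (_∈ _) (sym e) z∈)) ∷ uq u

     record StarFamily (k : ℕ) (V : Fin n → Bool) (γ : Fin k → Fin Δ → Fin ρ) : Set where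
       field
         centre  : Fin k → Fin n
         leaf    : Fin k → Vec (Fin n) Δ
         all     : List (Fin n)
         inside  : All (λ x → V x ≡ true) all
         uniq    : Unique all
         size-all : length all ≡ k * suc Δ
         edge    : ∀ i j → adj (γ i j) (centre i) (Vec.lookup (leaf i) j) ≡ true
         centre∈ : ∀ i → centre i ∈ all
         leaf∈   : ∀ i j → Vec.lookup (leaf i) j ∈ all
         centre≢ : ∀ i i′ → centre i ≡ centre i′ → i ≡ i′
         leaf≢centre : ∀ i j i′ → Vec.lookup (leaf i) j ≢ centre i′
         leaf≢   : ∀ i j i′ j′ → Vec.lookup (leaf i) j ≡ Vec.lookup (leaf i′) j′ → i ≡ i′ × j ≡ j′

     star-cons : ∀ {k V} {γ : Fin (suc k) → Fin Δ → Fin ρ} (rest : StarFamily k V (γ ∘ suc)) b → (V ∖ inList (StarFamily.all rest)) b ≡ true → (lf : Vec (Fin n) Δ) →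
       (∀ j → (V ∖ inList (StarFamily.all rest)) (Vec.lookup lf j) ≡ true × adj (γ zero j) b (Vec.lookup lf j) ≡ true) → Unique (Vec.toList lf ++ b ∷ []) → StarFamily (suc k) V γ
     star-cons {k} {V} {γ} rest b Tb lf lf-ok lf-b-uniq = record
       { centre = λ { zero → b ; (suc i) → centre i }
       ; leaf = λ { zero → lf ; (suc i) → leaf i }
       ; all = b ∷ (Vec.toList lf ++ all)
       ; inside = proj₁ (∧-true {V b} Tb) ∷ All.tabulate (λ {x} x∈ → in-V x (MP.∈-++⁻ (Vec.toList lf) x∈))
       ; uniq = All.tabulate (λ {x} x∈ e → b∉ (subst (_∈ _) (sym e) x∈)) ∷ lf-uniq
       ; size-all = cong suc (trans (ListP.length-++ (Vec.toList lf)) (cong₂ _+_ (VecP.length-toList lf) size-all))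
       ; edge = λ { zero j → proj₂ (lf-ok j) ; (suc i) j → edge i j }
       ; centre∈ = λ { zero → here refl ; (suc i) → there (MP.∈-++⁺ʳ (Vec.toList lf) (centre∈ i)) }
       ; leaf∈ = λ { zero j → there (MP.∈-++⁺ˡ (lookup∈ lf j)) ; (suc i) j → there (MP.∈-++⁺ʳ (Vec.toList lf) (leaf∈ i j)) }
       ; centre≢ = λ { zero zero e → refl ; zero (suc i) e → ⊥-elim (b∉all (subst (_∈ all) (sym e) (centre∈ i)))
                     ; (suc i) zero e → ⊥-elim (b∉all (subst (_∈ all) e (centre∈ i))) ; (suc i) (suc i′) e → cong suc (centre≢ i i′ e) }
       ; leaf≢centre = λ { zero j zero e → b∉ (MP.∈-++⁺ˡ (subst (_∈ Vec.toList lf) e (lookup∈ lf j)))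
                         ; zero j (suc i) e → lf∉all j (subst (_∈ all) (sym e) (centre∈ i))
                         ; (suc i) j zero e → b∉all (subst (_∈ all) e (leaf∈ i j))
                         ; (suc i) j (suc i′) → leaf≢centre i j i′ }
       ; leaf≢ = λ { zero j zero j′ e → refl , vec-inj lf (unique-prefix (Vec.toList lf) lf-uniq) j j′ e
                   ; zero j (suc i) j′ e → ⊥-elim (lf∉all j (subst (_∈ all) (sym e) (leaf∈ i j′)))
                   ; (suc i) j zero j′ e → ⊥-elim (lf∉all j′ (subst (_∈ all) e (leaf∈ i j)))
                   ; (suc i) j (suc i′) j′ e → (cong suc (proj₁ (leaf≢ i j i′ j′ e))) , proj₂ (leaf≢ i j i′ j′ e) } }
       where
         open StarFamily rest
         T : Fin n → Bool
         T = V ∖ inList all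
         lookup∈ : ∀ {k} (v : Vec (Fin n) k) j → Vec.lookup v j ∈ Vec.toList v
         lookup∈ (x ∷ v) zero = here refl
         lookup∈ (x ∷ v) (suc j) = there (lookup∈ v j)
         ∈lookup : ∀ {k} (v : Vec (Fin n) k) {x} → x ∈ Vec.toList v → ∃ λ j → x ≡ Vec.lookup v j
         ∈lookup (y ∷ v) (here e) = zero , e
         ∈lookup (y ∷ v) (there p) with ∈lookup v p
         ... | j , e = suc j , e
         not-all : ∀ x → T x ≡ true → x ∉ all
         not-all x Tx x∈ = true≢false (proj₂ (∧-true {V x} Tx)) (cong not (∈-inList x∈))
         b∉all : b ∉ all
         b∉all = not-all b Tb
         lf∉all : ∀ j → Vec.lookup lf j ∉ all
         lf∉all j = not-all _ (proj₁ (lf-ok j))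
         unique-prefix : ∀ (xs : List (Fin n)) {ys} → Unique (xs ++ ys) → Unique xs
         unique-prefix [] u = []
         unique-prefix (x ∷ xs) (px ∷ u) = All.tabulate (λ z∈ → All.lookup px (MP.∈-++⁺ˡ z∈)) ∷ unique-prefix xs u
         last∉ : ∀ (xs : List (Fin n)) {z} → Unique (xs ++ z ∷ []) → z ∉ xs
         last∉ (x ∷ xs) (px ∷ u) (here refl) = All.lookup px (MP.∈-++⁺ʳ xs (here refl)) refl
         last∉ (x ∷ xs) (px ∷ u) (there p) = last∉ xs u p
         lf-uniq : Unique (Vec.toList lf ++ all)
         lf-uniq = UP.++⁺ (unique-prefix (Vec.toList lf) lf-b-uniq) uniq (λ { (x∈ , x∈all) → not-leaf _ (∈lookup lf x∈) x∈all })
           where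
             not-leaf : ∀ x → (∃ λ j → x ≡ Vec.lookup lf j) → x ∉ all
             not-leaf x (j , refl) = lf∉all j
         b∉ : b ∉ Vec.toList lf ++ all
         b∉ b∈ with MP.∈-++⁻ (Vec.toList lf) b∈
         ... | inj₁ q = last∉ (Vec.toList lf) lf-b-uniq q
         ... | inj₂ q = b∉all q
         in-V : ∀ x → x ∈ Vec.toList lf ⊎ x ∈ all → V x ≡ true
         in-V x (inj₂ q) = All.lookup inside q
         in-V x (inj₁ q) with ∈lookup lf q
         ... | j , refl = proj₁ (∧-true {V _} (proj₁ (lf-ok j)))
         vec-inj : ∀ {k} (v : Vec (Fin n) k) → Unique (Vec.toList v) → ∀ j j′ → Vec.lookup v j ≡ Vec.lookup v j′ → j ≡ j′
         vec-inj (x ∷ v) (px ∷ u) zero zero e = refl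
         vec-inj (x ∷ v) (px ∷ u) zero (suc j′) e = ⊥-elim (All.lookup px (lookup∈ v j′) e)
         vec-inj (x ∷ v) (px ∷ u) (suc j) zero e = ⊥-elim (All.lookup px (lookup∈ v j) (sym e))
         vec-inj (x ∷ v) (px ∷ u) (suc j) (suc j′) e = cong suc (vec-inj v u j j′ e)

     stars : ∀ k (V : Fin n → Bool) (γ : Fin k → Fin Δ → Fin ρ) → n + 3 * (k * suc Δ) ≤ 3 * # V → 4 * M + k * suc Δ < # V → StarFamily k V γ
     stars zero V γ _ _ = record { centre = λ () ; leaf = λ () ; all = [] ; inside = [] ; uniq = [] ; size-all = refl ; edge = λ () ; centre∈ = λ () ; leaf∈ = λ ()
       ; centre≢ = λ () ; leaf≢centre = λ () ; leaf≢ = λ () }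
     stars (suc k) V γ h₁ h₂ = next (stars k V (γ ∘ suc) (≤-trans (+-monoʳ-≤ n (*-monoʳ-≤ 3 (m≤n+m (k * suc Δ) (suc Δ)))) h₁) (≤-<-trans (+-monoʳ-≤ (4 * M) (m≤n+m (k * suc Δ) (suc Δ))) h₂))
       where
         open ≤-Reasoning
         next : StarFamily k V (γ ∘ suc) → StarFamily (suc k) V γ
         next rest = choose (good-vertex T n≤T 4M<T)
           where
             T : Fin n → Bool
             T = V ∖ inList (StarFamily.all rest)
             #V≤ : # V ≤ # T + k * suc Δ
             #V≤ = ≤-trans (#-∖ V (inList (StarFamily.all rest))) (+-monoʳ-≤ (# T) (≤-trans (#-inList≤ (StarFamily.all rest)) (≤-reflexive (StarFamily.size-all rest))))
             n≤T : n ≤ 3 * # T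
             n≤T = +-cancelʳ-≤ (3 * (k * suc Δ)) _ _ (begin
               n + 3 * (k * suc Δ) ≤⟨ +-monoʳ-≤ n (*-monoʳ-≤ 3 (m≤n+m (k * suc Δ) (suc Δ))) ⟩
               n + 3 * (suc k * suc Δ) ≤⟨ h₁ ⟩
               3 * # V ≤⟨ *-monoʳ-≤ 3 #V≤ ⟩
               3 * (# T + k * suc Δ) ≡⟨ *-distribˡ-+ 3 (# T) _ ⟩
               3 * # T + 3 * (k * suc Δ) ∎)
             4M<T : 4 * M < # T
             4M<T = +-cancelʳ-< (k * suc Δ) _ _ (begin-strict
               4 * M + k * suc Δ ≤⟨ +-monoʳ-≤ (4 * M) (m≤n+m (k * suc Δ) (suc Δ)) ⟩
               4 * M + suc k * suc Δ <⟨ h₂ ⟩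
               # V ≤⟨ #V≤ ⟩
               # T + k * suc Δ ∎)
             choose : (∃ λ b → T b ≡ true × (∀ r → Δ < # (λ y → T y ∧ adj r b y))) → StarFamily (suc k) V γ
             choose (b , Tb , deg) = finish (pick-leaves T b deg Δ (γ zero) (b ∷ []) ≤-refl)
               where
                 finish : (Σ (Vec (Fin n) Δ) λ leaf → (∀ j → T (Vec.lookup leaf j) ≡ true × adj (γ zero j) b (Vec.lookup leaf j) ≡ true) × (Unique (b ∷ []) → Unique (Vec.toList leaf ++ b ∷ []))) → StarFamily (suc k) V γ
                 finish (lf , ok , uq) = star-cons rest b Tb lf ok (uq ([] ∷ []))

module SubdivisionEmbedding where
 open ExtendabilityMethod
 open TreeGrowth
 open ReservedSets
 open import Data.Nat using (_+_; _*_; _^_; _≤_; _<_; z≤n; s≤s)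
 open import Data.Nat.Properties
 open import Data.Nat.Tactic.RingSolver using (solve-∀)
 open import Data.Fin using (zero; suc; toℕ; inject₁; fromℕ) renaming (_<_ to _<ᶠ_)
 open import Data.Bool using (_∧_; not)
 open import Data.List using ([]; _∷_; length; _++_; map; zip; tabulate; allFin; cartesianProduct; filter)
 open import Data.Vec using ([]; _∷_)
 open import Data.List.Membership.Propositional using (_∈_; _∉_)
 open import Data.List.Relation.Unary.Any using (here; there)
 open import Data.List.Relation.Unary.All using ([]; _∷_)
 open import Data.List.Relation.Unary.AllPairs using ([]; _∷_)
 open import Relation.Nullary.Decidable using (¬?)
 open import Relation.Binary.Definitions using (tri<; tri≈; tri>)

 record Skeleton (ρ m Δ : ℕ) : Set where
   field
     branch       : Fin Δ → Fin m
     branch-inj   : ∀ i j → branch i ≡ branch j → i ≡ j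
     inner        : Fin Δ → Fin Δ → ℕ
     path         : (i j : Fin Δ) → i <ᶠ j → Fin (4 + inner i j) → Fin m
     lab          : (i j : Fin Δ) → i <ᶠ j → Fin (3 + inner i j) → Fin ρ
     path-start   : ∀ i j p → path i j p zero ≡ branch i
     path-end     : ∀ i j p → path i j p (fromℕ (3 + inner i j)) ≡ branch j
     internal-inj : ∀ i j p k i′ j′ p′ k′ → 0 < toℕ k → toℕ k < 3 + inner i j → 0 < toℕ k′ → toℕ k′ < 3 + inner i′ j′ →
                    path i j p k ≡ path i′ j′ p′ k′ → i ≡ i′ × j ≡ j′ × toℕ k ≡ toℕ k′
     internal-not-branch : ∀ i j p k b → 0 < toℕ k → toℕ k < 3 + inner i j → path i j p k ≢ branch b
     covering     : ∀ v → (∃ λ b → branch b ≡ v) ⊎ (Σ (Fin Δ) λ i → Σ (Fin Δ) λ j → Σ (i <ᶠ j) λ p → Σ (Fin (4 + inner i j)) λ k →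
                    0 < toℕ k × toℕ k < 3 + inner i j × path i j p k ≡ v)

 unique-length : ∀ {m} (xs : List (Fin m)) → Unique xs → length xs ≤ m
 unique-length {m} xs u = ≤-trans (≤-reflexive (sym (#-inList xs u))) (≤-trans (∑ᶠ-mono (λ i → ⟦⟧≤1 (inList xs i))) (≤-reflexive (trans (∑ᶠ-const m 1) (*-identityʳ m))))

 unique-map : ∀ {A B : Set} (f : A → B) (xs : List A) → (∀ x y → x ∈ xs → y ∈ xs → f x ≡ f y → x ≡ y) → Unique xs → Unique (map f xs)
 unique-map f [] inj [] = []
 unique-map f (x ∷ xs) inj (px ∷ u) = All.tabulate (λ {y} y∈ e → no-dup y y∈ e) ∷ unique-map f xs (λ a b p q → inj a b (there p) (there q)) u
   where
     no-dup : ∀ y → y ∈ map f xs → f x ≢ y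
     no-dup y y∈ e with MP.∈-map⁻ f y∈
     ... | z , z∈ , refl = All.lookup px z∈ (inj x z (here refl) (there z∈) e)

 unique-++ : ∀ {A : Set} (xs ys : List A) → Unique xs → Unique ys → (∀ x → x ∈ xs → x ∉ ys) → Unique (xs ++ ys)
 unique-++ xs ys u v d = UP.++⁺ u v (λ { (p , q) → d _ p q })

 zip-++ : ∀ {A B : Set} (as : List A) (cs : List B) {bs ds} → length as ≡ length cs → zip (as ++ bs) (cs ++ ds) ≡ zip as cs ++ zip bs ds
 zip-++ [] [] e = refl
 zip-++ (a ∷ as) (c ∷ cs) e = cong (_ ∷_) (zip-++ as cs (suc-injective e))

 map-proj₁-zip : ∀ {A B : Set} (as : List A) (cs : List B) → length as ≡ length cs → map proj₁ (zip as cs) ≡ as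
 map-proj₁-zip [] [] e = refl
 map-proj₁-zip (a ∷ as) (c ∷ cs) e = cong (a ∷_) (map-proj₁-zip as cs (suc-injective e))

 map-proj₂-zip : ∀ {A B : Set} (as : List A) (cs : List B) → length as ≡ length cs → map proj₂ (zip as cs) ≡ cs
 map-proj₂-zip [] [] e = refl
 map-proj₂-zip (a ∷ as) (c ∷ cs) e = cong (c ∷_) (map-proj₂-zip as cs (suc-injective e))

 tabulate-snoc : ∀ {A : Set} {n} (f : Fin (suc n) → A) → tabulate f ≡ tabulate (f ∘ inject₁) ++ f (fromℕ n) ∷ []
 tabulate-snoc {n = zero} f = refl
 tabulate-snoc {n = suc n} f = cong (f zero ∷_) (tabulate-snoc (f ∘ suc))

 split-list : ∀ {A : Set} (ls : List A) a b → length ls ≡ a + b → Σ (List A) λ xs → Σ (List A) λ ys → ls ≡ xs ++ ys × length xs ≡ a × length ys ≡ b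
 split-list ls zero b e = [] , ls , refl , refl , e
 split-list (l ∷ ls) (suc a) b e with split-list ls a b (suc-injective e)
 ... | xs , ys , p , q , r = l ∷ xs , ys , cong (l ∷_) p , cong suc q , r

 record EmbeddingProblem {n ρ : ℕ} (G : ColouredExpander n ρ) (m Δ : ℕ) : Set where
   open ColouredExpander G
   field
     adj-irr     : ∀ r x → adj r x x ≡ false
     H           : Skeleton ρ m Δ
     r₀          : Fin ρ
     sparse      : ∀ r (X T : Fin n → Bool) → (∀ x → X x ≡ true → # (λ y → T y ∧ adj r x y) ≤ Δ) → n ≤ 3 * # T → # X * # T ≤ 16 * Λ
     t           : ℕ
     Λ<D²ᵗ       : Λ < D ^ t * D ^ t
     long        : ∀ i j → i <ᶠ j → 2 * t ≤ Skeleton.inner H i j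
     room        : m + ((D + D) * M + M + M + 4 * D ^ t) < n
     stars-room₁ : n + 3 * (Δ * suc Δ + (suc ((3 * D + 4) * M) + M)) ≤ 3 * n
     stars-room₂ : 4 * M + Δ * suc Δ + (suc ((3 * D + 4) * M) + M) < n

 module Assembly {n ρ m Δ : ℕ} {G : ColouredExpander n ρ} (P : EmbeddingProblem G m Δ) where
   open ColouredExpander G
   open EmbeddingProblem P
   open Skeleton H
   open Cleanup G using (cleanup; module Stars)
   open Stars Δ sparse adj-irr

   γ : Fin Δ → Fin Δ → Fin ρ
   γ i j with FinP.<-cmp i j
   ... | tri< p _ _ = lab i j p zero
   ... | tri≈ _ _ _ = r₀
   ... | tri> _ _ p = lab j i p (fromℕ (2 + inner j i))

   γ-< : ∀ i j p → γ i j ≡ lab i j p zero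
   γ-< i j p with FinP.<-cmp i j
   ... | tri< p′ _ _ = cong (λ q → lab i j q zero) (FinP.<-irrelevant p′ p)
   ... | tri≈ ¬p _ _ = ⊥-elim (¬p p)
   ... | tri> ¬p _ _ = ⊥-elim (¬p p)

   γ-> : ∀ i j p → γ j i ≡ lab i j p (fromℕ (2 + inner i j))
   γ-> i j p with FinP.<-cmp j i
   ... | tri< _ _ ¬p = ⊥-elim (¬p p)
   ... | tri≈ _ _ ¬p = ⊥-elim (¬p p)
   ... | tri> _ _ p′ = cong (λ q → lab i j q (fromℕ (2 + inner i j))) (FinP.<-irrelevant p′ p)

   before-last : ∀ i j → Fin (4 + inner i j)
   before-last i j = suc (suc (inject₁ (fromℕ (inner i j))))

   toℕ-before-last : ∀ i j → toℕ (before-last i j) ≡ 2 + inner i j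
   toℕ-before-last i j = cong (λ x → suc (suc x)) (trans (FinP.toℕ-inject₁ (fromℕ (inner i j))) (FinP.toℕ-fromℕ (inner i j)))

   end : Fin Δ → Fin Δ → Fin m
   end i j with FinP.<-cmp i j
   ... | tri< p _ _ = path i j p (suc zero)
   ... | tri≈ _ _ _ = branch i
   ... | tri> _ _ p = path j i p (before-last j i)

   end-< : ∀ i j p → end i j ≡ path i j p (suc zero)
   end-< i j p with FinP.<-cmp i j
   ... | tri< p′ _ _ = cong (λ q → path i j q (suc zero)) (FinP.<-irrelevant p′ p)
   ... | tri≈ ¬p _ _ = ⊥-elim (¬p p)
   ... | tri> ¬p _ _ = ⊥-elim (¬p p)

   end-> : ∀ i j p → end j i ≡ path i j p (before-last i j)
   end-> i j p with FinP.<-cmp j i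
   ... | tri< _ _ ¬p = ⊥-elim (¬p p)
   ... | tri≈ _ _ ¬p = ⊥-elim (¬p p)
   ... | tri> _ _ p′ = cong (λ q → path i j q (before-last i j)) (FinP.<-irrelevant p′ p)

   data EndView (i j : Fin Δ) : Set where
     first : (p : i <ᶠ j) → end i j ≡ path i j p (suc zero) → EndView i j
     last  : (p : j <ᶠ i) → end i j ≡ path j i p (before-last j i) → EndView i j

   end-view : ∀ i j → i ≢ j → EndView i j
   end-view i j ne with FinP.<-cmp i j in eq
   ... | tri< p _ _ = first p (end-< i j p)
   ... | tri≈ _ e _ = ⊥-elim (ne e)
   ... | tri> _ _ p = last p (end-> j i p)

   1-internal : ∀ i j → 0 < 1 × 1 < 3 + inner i j
   1-internal i j = s≤s z≤n , s≤s (s≤s z≤n)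

   before-last-internal : ∀ i j → 0 < toℕ (before-last i j) × toℕ (before-last i j) < 3 + inner i j
   before-last-internal i j = s≤s z≤n , ≤-reflexive (cong suc (toℕ-before-last i j))

   end≢branch : ∀ i j b → i ≢ j → end i j ≢ branch b
   end≢branch i j b ne e with end-view i j ne
   ... | first p q = internal-not-branch i j p (suc zero) b (proj₁ (1-internal i j)) (proj₂ (1-internal i j)) (trans (sym q) e)
   ... | last p q = internal-not-branch j i p (before-last j i) b (proj₁ (before-last-internal j i)) (proj₂ (before-last-internal j i)) (trans (sym q) e)

   end-inj : ∀ i j i′ j′ → i ≢ j → i′ ≢ j′ → end i j ≡ end i′ j′ → i ≡ i′ × j ≡ j′
   end-inj i j i′ j′ ne ne′ e with end-view i j ne | end-view i′ j′ ne′
   ... | first p q | first p′ q′ with internal-inj i j p (suc zero) i′ j′ p′ (suc zero) (s≤s z≤n) (s≤s (s≤s z≤n)) (s≤s z≤n) (s≤s (s≤s z≤n)) (trans (sym q) (trans e q′))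
   ...   | a , b , _ = a , b
   end-inj i j i′ j′ ne ne′ e | last p q | last p′ q′ with internal-inj j i p _ j′ i′ p′ _ (proj₁ (before-last-internal j i)) (proj₂ (before-last-internal j i)) (proj₁ (before-last-internal j′ i′)) (proj₂ (before-last-internal j′ i′)) (trans (sym q) (trans e q′))
   ...   | a , b , _ = b , a
   end-inj i j i′ j′ ne ne′ e | first p q | last p′ q′ with internal-inj i j p (suc zero) j′ i′ p′ _ (s≤s z≤n) (s≤s (s≤s z≤n)) (proj₁ (before-last-internal j′ i′)) (proj₂ (before-last-internal j′ i′)) (trans (sym q) (trans e q′))
   ...   | _ , _ , c with trans c (toℕ-before-last j′ i′)
   ...     | ()
   end-inj i j i′ j′ ne ne′ e | last p q | first p′ q′ with internal-inj j i p _ i′ j′ p′ (suc zero) (proj₁ (before-last-internal j i)) (proj₂ (before-last-internal j i)) (s≤s z≤n) (s≤s (s≤s z≤n)) (trans (sym q) (trans e q′))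
   ...   | _ , _ , c with trans (sym c) (toℕ-before-last j i)
   ...     | ()

   Pairs : Set
   Pairs = List (Fin Δ × Fin Δ)

   diff? : (ij : Fin Δ × Fin Δ) → Dec (proj₁ ij ≢ proj₂ ij)
   diff? (i , j) = ¬? (i FinP.≟ j)

   less? : (ij : Fin Δ × Fin Δ) → Dec (proj₁ ij <ᶠ proj₂ ij)
   less? (i , j) = i FinP.<? j

   square offdiag increasing : Pairs
   square = cartesianProduct (allFin Δ) (allFin Δ)
   offdiag = filter diff? square
   increasing = filter less? square

   square-unique : Unique square
   square-unique = UP.cartesianProduct⁺ (UP.allFin⁺ Δ) (UP.allFin⁺ Δ)

   ∈square : ∀ i j → (i , j) ∈ square
   ∈square i j = MP.∈-cartesianProduct⁺ (MP.∈-allFin i) (MP.∈-allFin j)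

   -- V₂ is reserved for expansion, the stars are taken from V₁
   V₁ V₂ : Fin n → Bool
   V₂ y = toℕ y ℕ.<ᵇ suc ((3 * D + 4) * M)
   V₁ y = not (V₂ y)

   #-initial : ∀ {n} k → k ≤ n → # {n} (λ y → toℕ y ℕ.<ᵇ k) ≡ k
   #-initial {n} zero le = ∑ᶠ-zero n
   #-initial {suc n} (suc k) (s≤s le) = trans (∑ᶠ-suc _) (cong suc (#-initial k le))

   reserve<n : suc ((3 * D + 4) * M) ≤ n
   reserve<n = ≤-trans (m≤m+n _ M) (≤-trans (m≤n+m _ (4 * M + Δ * suc Δ)) (<⇒≤ stars-room₂))

   #V₂ : # V₂ ≡ suc ((3 * D + 4) * M)
   #V₂ = #-initial _ reserve<n

   cleaned : ∃ λ Z → # Z < M × (∀ A → Cleanup.Avoids G Z A → _ → _)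
   cleaned = cleanup V₂ (≤-reflexive (sym #V₂))

   Z act : Fin n → Bool
   Z = proj₁ cleaned
   act = not ∘ Z

   open ColouredGraph G act

   expand : ∀ A → Active A → size A ≤ M + M → D * size A ≤ Γ# A (V₂ ∖ Z)
   expand A a sz = proj₂ (proj₂ cleaned) A (λ p e → not-true (a p e)) sz
     where
       not-true : ∀ {b} → not b ≡ true → b ≡ false
       not-true {false} _ = refl

   #V₁∖Z : n ≤ # (V₁ ∖ Z) + (suc ((3 * D + 4) * M) + M)
   #V₁∖Z = begin
     n ≡⟨ sym (trans (∑ᶠ-const n 1) (*-identityʳ n)) ⟩
     # {n} (λ _ → true) ≤⟨ #-∖ (λ _ → true) V₂ ⟩
     # V₁ + # V₂ ≤⟨ +-monoˡ-≤ (# V₂) (#-∖ V₁ Z) ⟩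
     # (V₁ ∖ Z) + # Z + # V₂ ≤⟨ +-mono-≤ (+-monoʳ-≤ (# (V₁ ∖ Z)) (<⇒≤ (proj₁ (proj₂ cleaned)))) (≤-reflexive #V₂) ⟩
     # (V₁ ∖ Z) + M + suc ((3 * D + 4) * M) ≡⟨ lem (# (V₁ ∖ Z)) M (suc ((3 * D + 4) * M)) ⟩
     # (V₁ ∖ Z) + (suc ((3 * D + 4) * M) + M) ∎
     where
       open ≤-Reasoning
       lem : ∀ a b c → a + b + c ≡ a + (c + b)
       lem = solve-∀

   family : StarFamily Δ (V₁ ∖ Z) γ
   family = stars Δ (V₁ ∖ Z) γ
     (+-cancelʳ-≤ (3 * reserve) _ _ (begin
       n + 3 * (Δ * suc Δ) + 3 * reserve ≡⟨ trans (+-assoc n _ _) (cong (n +_) (sym (*-distribˡ-+ 3 (Δ * suc Δ) reserve))) ⟩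
       n + 3 * (Δ * suc Δ + reserve) ≤⟨ stars-room₁ ⟩
       3 * n ≤⟨ *-monoʳ-≤ 3 #V₁∖Z ⟩
       3 * (# (V₁ ∖ Z) + reserve) ≡⟨ *-distribˡ-+ 3 (# (V₁ ∖ Z)) reserve ⟩
       3 * # (V₁ ∖ Z) + 3 * reserve ∎))
     (+-cancelʳ-< reserve _ _ (<-≤-trans stars-room₂ #V₁∖Z))
     where
       open ≤-Reasoning
       reserve = suc ((3 * D + 4) * M) + M

   module Embed (F : StarFamily Δ (V₁ ∖ Z) γ) where
     open StarFamily F using (centre; all; inside; edge; centre∈; leaf∈; centre≢; leaf≢centre; leaf≢)

     leaf : Fin Δ → Fin Δ → Fin n
     leaf i j = Vec.lookup (StarFamily.leaf F i) j

     in-V₁ : ∀ {x} → x ∈ all → V₁ x ≡ true × act x ≡ true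
     in-V₁ x∈ = ∧-true (All.lookup inside x∈)

     Placement : Set
     Placement = List (Fin m × Fin n)

     pl₀ : Placement
     pl₀ = map (λ i → branch i , centre i) (allFin Δ) ++ map (λ { (i , j) → end i j , leaf i j }) offdiag

     ∈offdiag : ∀ i j → i ≢ j → (i , j) ∈ offdiag
     ∈offdiag i j ne = MP.∈-filter⁺ diff? (∈square i j) ne

     offdiag∈ : ∀ {i j} → (i , j) ∈ offdiag → i ≢ j
     offdiag∈ p = proj₂ (MP.∈-filter⁻ diff? {xs = square} p)

     pl₀-branch : ∀ i → (branch i , centre i) ∈ pl₀
     pl₀-branch i = MP.∈-++⁺ˡ (MP.∈-map⁺ (λ i → branch i , centre i) (MP.∈-allFin i))

     pl₀-end : ∀ i j → i ≢ j → (end i j , leaf i j) ∈ pl₀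
     pl₀-end i j ne = MP.∈-++⁺ʳ (map (λ i → branch i , centre i) (allFin Δ)) (MP.∈-map⁺ (λ { (i , j) → end i j , leaf i j }) (∈offdiag i j ne))

     pl₀-elim : ∀ {e} → e ∈ pl₀ → (∃ λ i → e ≡ (branch i , centre i)) ⊎ (Σ (Fin Δ) λ i → Σ (Fin Δ) λ j → i ≢ j × e ≡ (end i j , leaf i j))
     pl₀-elim {e} e∈ with MP.∈-++⁻ (map (λ i → branch i , centre i) (allFin Δ)) e∈
     ... | inj₁ q with MP.∈-map⁻ (λ i → branch i , centre i) q
     ...   | i , _ , eq = inj₁ (i , eq)
     pl₀-elim {e} e∈ | inj₂ q with MP.∈-map⁻ (λ { (i , j) → end i j , leaf i j }) q
     ...   | (i , j) , ij∈ , eq = inj₂ (i , j , offdiag∈ ij∈ , eq)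

     pl₀-unique : Unique pl₀
     pl₀-unique = unique-++ _ _ (unique-map _ (allFin Δ) (λ i j _ _ e → branch-inj i j (cong proj₁ e)) (UP.allFin⁺ Δ))
       (unique-map _ offdiag (λ { (i , j) (i′ , j′) p q e → cong₂ _,_ (proj₁ (end-inj i j i′ j′ (offdiag∈ p) (offdiag∈ q) (cong proj₁ e))) (proj₂ (end-inj i j i′ j′ (offdiag∈ p) (offdiag∈ q) (cong proj₁ e))) })
         (UP.filter⁺ diff? square-unique))
       (λ x p q → disj x p q)
       where
         disj : ∀ x → x ∈ map (λ i → branch i , centre i) (allFin Δ) → x ∉ map (λ { (i , j) → end i j , leaf i j }) offdiag
         disj x p q with MP.∈-map⁻ (λ i → branch i , centre i) p | MP.∈-map⁻ (λ { (i , j) → end i j , leaf i j }) q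
         ... | b , _ , refl | (i , j) , ij∈ , e = end≢branch i j b (offdiag∈ ij∈) (sym (cong proj₁ e))

     pl₀-inj₁ : ∀ x y → x ∈ pl₀ → y ∈ pl₀ → proj₁ x ≡ proj₁ y → x ≡ y
     pl₀-inj₁ x y p q e with pl₀-elim p | pl₀-elim q
     ... | inj₁ (i , refl) | inj₁ (j , refl) with branch-inj i j e
     ...   | refl = refl
     pl₀-inj₁ x y p q e | inj₁ (b , refl) | inj₂ (i , j , ne , refl) = ⊥-elim (end≢branch i j b ne (sym e))
     pl₀-inj₁ x y p q e | inj₂ (i , j , ne , refl) | inj₁ (b , refl) = ⊥-elim (end≢branch i j b ne e)
     pl₀-inj₁ x y p q e | inj₂ (i , j , ne , refl) | inj₂ (i′ , j′ , ne′ , refl) with end-inj i j i′ j′ ne ne′ e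
     ...   | refl , refl = refl

     pl₀-inj₂ : ∀ x y → x ∈ pl₀ → y ∈ pl₀ → proj₂ x ≡ proj₂ y → x ≡ y
     pl₀-inj₂ x y p q e with pl₀-elim p | pl₀-elim q
     ... | inj₁ (i , refl) | inj₁ (j , refl) with centre≢ i j e
     ...   | refl = refl
     pl₀-inj₂ x y p q e | inj₁ (b , refl) | inj₂ (i , j , ne , refl) = ⊥-elim (leaf≢centre i j b (sym e))
     pl₀-inj₂ x y p q e | inj₂ (i , j , ne , refl) | inj₁ (b , refl) = ⊥-elim (leaf≢centre i j b e)
     pl₀-inj₂ x y p q e | inj₂ (i , j , ne , refl) | inj₂ (i′ , j′ , ne′ , refl) with leaf≢ i j i′ j′ e
     ...   | refl , refl = refl

     pl₀-inside : ∀ {x} → x ∈ map proj₂ pl₀ → x ∈ all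
     pl₀-inside x∈ with MP.∈-map⁻ proj₂ x∈
     ... | e , e∈ , refl with pl₀-elim e∈
     ...   | inj₁ (i , refl) = centre∈ i
     ...   | inj₂ (i , j , ne , refl) = leaf∈ i j

     Placed : Placement → ∀ i j → i <ᶠ j → Set
     Placed pl i j p = ∀ k → Σ (Fin n) λ u → Σ (Fin n) λ v → (path i j p (inject₁ k) , u) ∈ pl × (path i j p (suc k) , v) ∈ pl × adj (lab i j p k) u v ≡ true

     Origin : Pairs → Fin m → Set
     Origin todo h = (∃ λ b → h ≡ branch b) ⊎ (Σ (Fin Δ) λ i → Σ (Fin Δ) λ j → Σ (i <ᶠ j) λ p → Σ (Fin (4 + inner i j)) λ k →
       h ≡ path i j p k × 0 < toℕ k × toℕ k < 3 + inner i j × (toℕ k ≡ 1 ⊎ toℕ k ≡ 2 + inner i j ⊎ (i , j) ∉ todo))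

     record State (todo : Pairs) : Set where
       field
         pl      : Placement
         pl₀⊆    : ∀ {e} → e ∈ pl₀ → e ∈ pl
         uniqH   : Unique (map proj₁ pl)
         uniqV   : Unique (map proj₂ pl)
         U       : Fin n → Bool
         c       : Fin (n * ρ) → ℕ
         ext     : Ext U c
         U-ok    : ∀ y → U y ≡ true → act y ≡ true × y ∉ map proj₂ pl
         U-size  : n ≤ # U + length pl + M
         fresh   : ∀ y → U y ≡ true → ∀ r → c (pair y r) ≡ 0
         pending : ∀ {i j} → (i , j) ∈ todo → ∀ r → c (pair (leaf i j) r) ≡ 0 × c (pair (leaf j i) r) ≡ 0
         done    : ∀ i j p → (i , j) ∉ todo → Placed pl i j p
         origin  : ∀ {h} → h ∈ map proj₁ pl → Origin todo h

     walk-snoc : ∀ {x y z ls vs r} → Walk x ls y vs → adj r y z ≡ true → Walk x (ls ++ r ∷ []) z (vs ++ z ∷ [])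
     walk-snoc [] e = e ∷ []
     walk-snoc (e′ ∷ w) e = e′ ∷ walk-snoc w e

     walk-length : ∀ {x y ls vs} → Walk x ls y vs → length vs ≡ length ls
     walk-length [] = refl
     walk-length (_ ∷ w) = cong suc (walk-length w)

     walk-placed : ∀ {L x z vs pl} (path : Fin (suc L) → Fin m) (lb : Fin L → Fin ρ) → Walk x (tabulate lb) z vs →
       (∀ {e} → e ∈ zip (tabulate path) (x ∷ vs) → e ∈ pl) →
       ∀ k → Σ (Fin n) λ u → Σ (Fin n) λ v → (path (inject₁ k) , u) ∈ pl × (path (suc k) , v) ∈ pl × adj (lb k) u v ≡ true
     walk-placed {suc L} {x} path lb (_∷_ {y = y} e w) sub zero = x , y , sub (here refl) , sub (there (here refl)) , e
     walk-placed {suc L} path lb (e ∷ w) sub (suc k) = walk-placed (path ∘ suc) (lb ∘ suc) w (sub ∘ there) k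

     module Step (i j : Fin Δ) (p : i <ᶠ j) (todo : Pairs) (ij∉ : (i , j) ∉ todo) (todo-< : ∀ {e} → e ∈ todo → proj₁ e <ᶠ proj₂ e) (S : State ((i , j) ∷ todo)) where
       open State S

       i≢j : i ≢ j
       i≢j refl = <-irrefl refl p

       K = inner i j

       hint : List (Fin m)
       hint = tabulate {n = K} (λ k → path i j p (suc (suc (inject₁ (inject₁ k)))))

       hint-index : ∀ (k : Fin K) → toℕ (suc (suc (inject₁ (inject₁ k)))) ≡ 2 + toℕ k
       hint-index k = cong (λ x → suc (suc x)) (trans (FinP.toℕ-inject₁ (inject₁ k)) (FinP.toℕ-inject₁ k))

       hint< : ∀ (k : Fin K) → toℕ (suc (suc (inject₁ (inject₁ k)))) < 2 + K
       hint< k = ≤-trans (≤-reflexive (cong suc (hint-index k))) (s≤s (s≤s (FinP.toℕ<n k)))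

       hint∈ : ∀ {h} → h ∈ hint → ∃ λ k → h ≡ path i j p (suc (suc (inject₁ (inject₁ k))))
       hint∈ h∈ = MP.∈-tabulate⁻ h∈

       hint-new : ∀ {h} → h ∈ hint → h ∉ map proj₁ pl
       hint-new {h} h∈ h∈pl with hint∈ h∈ | origin h∈pl
       ... | k , refl | inj₁ (b , e) = internal-not-branch i j p _ b (s≤s z≤n) (m≤n⇒m≤1+n (hint< k)) e
       ... | k , refl | inj₂ (i′ , j′ , p′ , k′ , e , lo , hi , why) with internal-inj i j p _ i′ j′ p′ k′ (s≤s z≤n) (m≤n⇒m≤1+n (hint< k)) lo hi e
       ...   | refl , refl , kk with why
       ...     | inj₁ k′≡1 with trans (sym (hint-index k)) (trans kk k′≡1)
       ...       | ()
       hint-new {h} h∈ h∈pl | k , refl | inj₂ (i′ , j′ , p′ , k′ , e , lo , hi , why) | refl , refl , kk | inj₂ (inj₁ k′≡) = <-irrefl (trans kk k′≡) (hint< k)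
       hint-new {h} h∈ h∈pl | k , refl | inj₂ (i′ , j′ , p′ , k′ , e , lo , hi , why) | refl , refl , kk | inj₂ (inj₂ ∉todo) = ∉todo (here refl)

       hint-unique : Unique hint
       hint-unique = UP.tabulate⁺ (λ {k} {k′} e → FinP.toℕ-injective (suc-injective (suc-injective (trans (sym (hint-index k)) (trans (proj₂ (proj₂ (internal-inj i j p _ i j p _ (s≤s z≤n) (m≤n⇒m≤1+n (hint< k)) (s≤s z≤n) (m≤n⇒m≤1+n (hint< k′)) e))) (hint-index k′))))))

       pl-room : length pl + K ≤ m
       pl-room = ≤-trans (≤-reflexive (trans (cong₂ _+_ (sym (ListP.length-map proj₁ pl)) (sym (ListP.length-tabulate _))) (trans (+-comm _ (length hint)) (sym (ListP.length-++ hint)))))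
         (unique-length (hint ++ map proj₁ pl) (unique-++ hint _ hint-unique uniqH (λ h → hint-new)))

       Tmax : ℕ
       Tmax = K + 4 * D ^ t

       U-room : (D + D) * M + M + Tmax < # U
       U-room = +-cancelʳ-< (length pl + M) _ _ (begin-strict
         (D + D) * M + M + (K + 4 * D ^ t) + (length pl + M) ≡⟨ lem ((D + D) * M + M) K (4 * D ^ t) (length pl) M ⟩
         length pl + K + ((D + D) * M + M + M + 4 * D ^ t) ≤⟨ +-monoˡ-≤ _ pl-room ⟩
         m + ((D + D) * M + M + M + 4 * D ^ t) <⟨ room ⟩
         n ≤⟨ U-size ⟩
         # U + length pl + M ≡⟨ +-assoc (# U) _ M ⟩
         # U + (length pl + M) ∎)
         where
           open ≤-Reasoning
           lem : ∀ a k d l m → a + (k + d) + (l + m) ≡ l + k + (a + m + d)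
           lem = solve-∀

       a = leaf i j
       b = leaf j i

       leaf-placed : ∀ i j → i ≢ j → leaf i j ∈ map proj₂ pl
       leaf-placed i j ne = MP.∈-map⁺ proj₂ (pl₀⊆ (pl₀-end i j ne))

       leaf-used : ∀ i j → i ≢ j → U (leaf i j) ≡ false
       leaf-used i j ne with U (leaf i j) in eq
       ... | false = refl
       ... | true = ⊥-elim (proj₂ (U-ok _ eq) (leaf-placed i j ne))

       labels : List (Fin ρ)
       labels = tabulate {n = suc K} (λ k → lab i j p (suc (inject₁ k)))

       split : Σ (List (Fin ρ)) λ l₀ → Σ (List (Fin ρ)) λ l₁ → Σ (Fin ρ) λ r → Σ (List (Fin ρ)) λ l₂ →
               labels ≡ l₀ ++ l₁ ++ r ∷ l₂ × length l₁ ≡ t × length l₂ ≡ t × length l₀ ≤ K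
       split with split-list labels (K ℕ.∸ 2 * t) (suc (2 * t)) (trans (ListP.length-tabulate (λ (k : Fin (suc K)) → lab i j p (suc (inject₁ k)))) (trans (cong suc (sym (m∸n+n≡m (long i j p)))) (sym (+-suc _ _))))
       ... | l₀ , rest , e , e₀ , e₁ with split-list rest t (suc t) (trans e₁ (lem t))
         where
           lem : ∀ t → suc (2 * t) ≡ t + suc t
           lem = solve-∀
       ...   | l₁ , r ∷ l₂ , e′ , e₂ , e₃ = l₀ , l₁ , r , l₂ , trans e (cong (l₀ ++_) e′) , e₂ , suc-injective e₃ , ≤-trans (≤-reflexive e₀) (m∸n≤m K (2 * t))

       connection : Growth.Connection U c (λ y e → proj₁ (U-ok y e)) Tmax U-room a b labels
       connection with split
       ... | l₀ , l₁ , r , l₂ , e , e₁ , e₂ , e₀ = subst (Growth.Connection U c (λ y e → proj₁ (U-ok y e)) Tmax U-room a b) (sym e)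
         (Growth.connect U c (λ y e → proj₁ (U-ok y e)) Tmax U-room ext fresh a b (λ q → i≢j (proj₁ (leaf≢ i j j i q)))
           (proj₂ (in-V₁ (leaf∈ i j))) (proj₂ (in-V₁ (leaf∈ j i))) (leaf-used i j i≢j) (leaf-used j i (≢-sym i≢j))
           (λ r → proj₁ (pending (here refl) r)) (λ r → proj₂ (pending (here refl) r)) l₀ l₁ r l₂ t e₁ e₂ Λ<D²ᵗ (+-monoˡ-≤ (4 * D ^ t) e₀))

       module Next (C : Growth.Connection U c (λ y e → proj₁ (U-ok y e)) Tmax U-room a b labels) where
         open Growth.Connection C renaming (uniq to interior-uniq; inside to interior-inside; outside to c₁-outside; ext to ext₁; fresh to fresh₁)

         interior-length : length hint ≡ length interior
         interior-length = trans (ListP.length-tabulate (λ (k : Fin K) → path i j p (suc (suc (inject₁ (inject₁ k)))))) (suc-injective (sym (trans (+-comm 1 _) (trans (sym (ListP.length-++ interior)) (trans (walk-length walk) (ListP.length-tabulate (λ (k : Fin (suc K)) → lab i j p (suc (inject₁ k)))))))))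

         pl₁ : Placement
         pl₁ = zip hint interior ++ pl

         fst-pl₁ : map proj₁ pl₁ ≡ hint ++ map proj₁ pl
         fst-pl₁ = trans (ListP.map-++ proj₁ (zip hint interior) pl) (cong (_++ map proj₁ pl) (map-proj₁-zip hint interior interior-length))

         snd-pl₁ : map proj₂ pl₁ ≡ interior ++ map proj₂ pl
         snd-pl₁ = trans (ListP.map-++ proj₂ (zip hint interior) pl) (cong (_++ map proj₂ pl) (map-proj₂-zip hint interior interior-length))

         full-walk : Walk (centre i) (tabulate (lab i j p)) (centre j) (a ∷ (interior ++ b ∷ []) ++ centre j ∷ [])
         full-walk = subst (λ ls → Walk (centre i) ls (centre j) (a ∷ (interior ++ b ∷ []) ++ centre j ∷ [])) (cong (lab i j p zero ∷_) (sym (tabulate-snoc (λ k → lab i j p (suc k)))))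
           (subst (λ r → adj r (centre i) a ≡ true) (γ-< i j p) (edge i j) ∷ walk-snoc walk (adj-sym _ (centre j) b (subst (λ r → adj r (centre j) b ≡ true) (γ-> i j p) (edge j i))))

         positions : tabulate (path i j p) ≡ path i j p zero ∷ path i j p (suc zero) ∷ hint ++ path i j p (before-last i j) ∷ path i j p (fromℕ (3 + K)) ∷ []
         positions = cong (λ l → path i j p zero ∷ path i j p (suc zero) ∷ l)
           (trans (tabulate-snoc (λ k → path i j p (suc (suc k)))) (trans (cong (_++ path i j p (fromℕ (3 + K)) ∷ []) (tabulate-snoc (λ k → path i j p (suc (suc (inject₁ k)))))) (ListP.++-assoc hint _ _)))

         placed : Placed pl₁ i j p
         placed = walk-placed (path i j p) (lab i j p) full-walk (λ {e} e∈ → sort e (subst (e ∈_) zipped e∈))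
           where
             zipped : zip (tabulate (path i j p)) (centre i ∷ a ∷ (interior ++ b ∷ []) ++ centre j ∷ []) ≡
                      (path i j p zero , centre i) ∷ (path i j p (suc zero) , a) ∷ (zip hint interior ++ (path i j p (before-last i j) , b) ∷ (path i j p (fromℕ (3 + K)) , centre j) ∷ [])
             zipped = trans (cong₂ zip positions (cong (λ l → centre i ∷ a ∷ l) (ListP.++-assoc interior _ _)))
               (cong (λ l → (path i j p zero , centre i) ∷ (path i j p (suc zero) , a) ∷ l) (zip-++ hint interior interior-length))
             old : ∀ {e} → e ∈ pl₀ → e ∈ pl₁
             old e∈ = MP.∈-++⁺ʳ (zip hint interior) (pl₀⊆ e∈)
             sort : ∀ e → e ∈ (path i j p zero , centre i) ∷ (path i j p (suc zero) , a) ∷ (zip hint interior ++ (path i j p (before-last i j) , b) ∷ (path i j p (fromℕ (3 + K)) , centre j) ∷ []) → e ∈ pl₁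
             sort e (here refl) = old (subst (λ h → (h , centre i) ∈ pl₀) (sym (path-start i j p)) (pl₀-branch i))
             sort e (there (here refl)) = old (subst (λ h → (h , a) ∈ pl₀) (end-< i j p) (pl₀-end i j i≢j))
             sort e (there (there q)) with MP.∈-++⁻ (zip hint interior) q
             ... | inj₁ q′ = MP.∈-++⁺ˡ q′
             ... | inj₂ (here refl) = old (subst (λ h → (h , b) ∈ pl₀) (end-> i j p) (pl₀-end j i (≢-sym i≢j)))
             ... | inj₂ (there (here refl)) = old (subst (λ h → (h , centre j) ∈ pl₀) (sym (path-end i j p)) (pl₀-branch j))

         next : State todo
         next = record
           { pl = pl₁
           ; pl₀⊆ = λ e∈ → MP.∈-++⁺ʳ (zip hint interior) (pl₀⊆ e∈)
           ; uniqH = subst Unique (sym fst-pl₁) (unique-++ hint _ hint-unique uniqH (λ h → hint-new))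
           ; uniqV = subst Unique (sym snd-pl₁) (unique-++ interior _ interior-uniq uniqV (λ x x∈ → proj₂ (U-ok x (All.lookup interior-inside x∈))))
           ; U = U₁ ; c = c₁ ; ext = ext₁
           ; U-ok = λ y e → proj₁ (U-ok y (proj₁ (U₁⊆ y e))) , λ y∈ → avoid y e (MP.∈-++⁻ interior (subst (y ∈_) snd-pl₁ y∈))
           ; U-size = ≤-trans U-size (≤-reflexive (cong (_+ M) (trans (cong (_+ length pl) (sym U₁-size)) (trans (+-assoc (# U₁) _ _) (cong (# U₁ +_)
                (trans (cong (length interior +_) (sym (ListP.length-map proj₂ pl))) (trans (sym (ListP.length-++ interior)) (trans (cong length (sym snd-pl₁)) (ListP.length-map proj₂ pl₁)))))))))
           ; fresh = fresh₁
           ; pending = λ {i′} {j′} ij∈ r → still i′ j′ ij∈ r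
           ; done = λ i′ j′ p′ ∉todo → finished i′ j′ p′ ∉todo
           ; origin = λ {h} h∈ → from h (MP.∈-++⁻ hint (subst (h ∈_) fst-pl₁ h∈)) }
           where
             avoid : ∀ y → U₁ y ≡ true → y ∈ interior ⊎ y ∈ map proj₂ pl → ⊥
             avoid y e (inj₁ q) = proj₂ (U₁⊆ y e) q
             avoid y e (inj₂ q) = proj₂ (U-ok y (proj₁ (U₁⊆ y e))) q
             keep : ∀ x y → x ≢ y → (x ≡ i → y ≡ j → ⊥) → (x ≡ j → y ≡ i → ⊥) → ∀ r → c (pair (leaf x y) r) ≡ 0 → c₁ (pair (leaf x y) r) ≡ 0
             keep x y ne n₁ n₂ r e = trans (c₁-outside (leaf x y) (leaf-used x y ne) (λ q → n₁ (proj₁ (leaf≢ x y i j q)) (proj₂ (leaf≢ x y i j q))) (λ q → n₂ (proj₁ (leaf≢ x y j i q)) (proj₂ (leaf≢ x y j i q))) r) e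
             still : ∀ i′ j′ → (i′ , j′) ∈ todo → ∀ r → c₁ (pair (leaf i′ j′) r) ≡ 0 × c₁ (pair (leaf j′ i′) r) ≡ 0
             still i′ j′ ij∈ r = keep i′ j′ (λ { refl → <-irrefl refl p′ }) same flip r (proj₁ (pending (there ij∈) r)) ,
                                 keep j′ i′ (λ { refl → <-irrefl refl p′ }) (λ x y → flip y x) (λ x y → same y x) r (proj₂ (pending (there ij∈) r))
               where
                 p′ = todo-< ij∈
                 same : i′ ≡ i → j′ ≡ j → ⊥
                 same refl refl = ij∉ ij∈
                 flip : i′ ≡ j → j′ ≡ i → ⊥
                 flip refl refl = <-asym p p′
             lift : ∀ {i′ j′ p′} → Placed pl i′ j′ p′ → Placed pl₁ i′ j′ p′
             lift f k with f k
             ... | u , v , e₁ , e₂ , e₃ = u , v , MP.∈-++⁺ʳ (zip hint interior) e₁ , MP.∈-++⁺ʳ (zip hint interior) e₂ , e₃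
             finished : ∀ i′ j′ p′ → (i′ , j′) ∉ todo → Placed pl₁ i′ j′ p′
             finished i′ j′ p′ ∉todo with i′ FinP.≟ i | j′ FinP.≟ j
             ... | yes refl | yes refl = subst (Placed pl₁ i j) (FinP.<-irrelevant p p′) placed
             ... | yes refl | no ne = lift {i′} {j′} {p′} (done i′ j′ p′ (λ { (here e) → ne (cong proj₂ e) ; (there q) → ∉todo q }))
             ... | no ne | _ = lift {i′} {j′} {p′} (done i′ j′ p′ (λ { (here e) → ne (cong proj₁ e) ; (there q) → ∉todo q }))
             from : ∀ h → h ∈ hint ⊎ h ∈ map proj₁ pl → Origin todo h
             from h (inj₁ q) with hint∈ q
             ... | k , e = inj₂ (i , j , p , _ , e , s≤s z≤n , m≤n⇒m≤1+n (hint< k) , inj₂ (inj₂ ij∉))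
             from h (inj₂ q) with origin q
             ... | inj₁ r = inj₁ r
             ... | inj₂ (i′ , j′ , p′ , k′ , e , lo , hi , why) = inj₂ (i′ , j′ , p′ , k′ , e , lo , hi , weaken why)
               where
                 weaken : toℕ k′ ≡ 1 ⊎ toℕ k′ ≡ 2 + inner i′ j′ ⊎ (i′ , j′) ∉ (i , j) ∷ todo → toℕ k′ ≡ 1 ⊎ toℕ k′ ≡ 2 + inner i′ j′ ⊎ (i′ , j′) ∉ todo
                 weaken (inj₁ x) = inj₁ x
                 weaken (inj₂ (inj₁ x)) = inj₂ (inj₁ x)
                 weaken (inj₂ (inj₂ x)) = inj₂ (inj₂ (x ∘ there))

       step : State todo
       step = Next.next connection

     run : ∀ todo → Unique todo → (∀ {e} → e ∈ todo → proj₁ e <ᶠ proj₂ e) → State todo → State []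
     run [] u lt S = S
     run ((i , j) ∷ todo) (h ∷ u) lt S = run todo u (lt ∘ there) (Step.step i j (lt (here refl)) todo (λ q → All.lookup h q refl) (lt ∘ there) S)

     U₀ : Fin n → Bool
     U₀ y = act y ∧ not (inList (map proj₂ pl₀) y)

     increasing< : ∀ {e} → e ∈ increasing → proj₁ e <ᶠ proj₂ e
     increasing< e∈ = proj₂ (MP.∈-filter⁻ less? {xs = square} e∈)

     start : State increasing
     start = record
       { pl = pl₀ ; pl₀⊆ = λ e∈ → e∈
       ; uniqH = unique-map proj₁ pl₀ pl₀-inj₁ pl₀-unique
       ; uniqV = unique-map proj₂ pl₀ pl₀-inj₂ pl₀-unique
       ; U = U₀ ; c = λ _ → 0
       ; ext = λ A a sz → ≤-trans (expand A a sz) (≤-trans (∑ᶠ-mono (λ y → ⟦⟧-mono (hit A y ∧ (V₂ ∖ Z) y) (hit A y ∧ U₀ y)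
             (λ e → cong₂ _∧_ (proj₁ (∧-true {hit A y} e)) (V₂⊆U₀ y (proj₂ (∧-true {hit A y} e)))))) (m≤m+n _ _))
       ; U-ok = λ y e → proj₁ (∧-true {act y} e) , λ y∈ → true≢false (proj₂ (∧-true {act y} e)) (cong not (∈-inList y∈))
       ; U-size = begin
           n ≡⟨ sym (trans (∑ᶠ-const n 1) (*-identityʳ n)) ⟩
           # {n} (λ _ → true) ≤⟨ #-∖ (λ _ → true) Z ⟩
           # act + # Z ≤⟨ +-mono-≤ (#-∖ act (inList (map proj₂ pl₀))) (<⇒≤ (proj₁ (proj₂ cleaned))) ⟩
           # U₀ + # (inList (map proj₂ pl₀)) + M ≤⟨ +-monoˡ-≤ M (+-monoʳ-≤ (# U₀) (≤-trans (#-inList≤ (map proj₂ pl₀)) (≤-reflexive (ListP.length-map proj₂ pl₀)))) ⟩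
           # U₀ + length pl₀ + M ∎
       ; fresh = λ _ _ _ → refl
       ; pending = λ _ _ → refl , refl
       ; done = λ i j p ∉inc → ⊥-elim (∉inc (MP.∈-filter⁺ less? (∈square i j) p))
       ; origin = λ {h} h∈ → from h h∈ }
       where
         open ≤-Reasoning
         V₂⊆U₀ : ∀ y → (V₂ ∖ Z) y ≡ true → U₀ y ≡ true
         V₂⊆U₀ y e with inList (map proj₂ pl₀) y in eq
         ... | false = cong₂ _∧_ (proj₂ (∧-true {V₂ y} e)) refl
         ... | true = ⊥-elim (true≢false (proj₁ (in-V₁ (pl₀-inside (inList-∈ _ y eq)))) (cong not (proj₁ (∧-true {V₂ y} e))))
         from : ∀ h → h ∈ map proj₁ pl₀ → Origin increasing h
         from h h∈ with MP.∈-map⁻ proj₁ h∈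
         ... | e , e∈ , refl with pl₀-elim e∈
         ...   | inj₁ (b , refl) = inj₁ (b , refl)
         ...   | inj₂ (i , j , ne , refl) with end-view i j ne
         ...     | first p q = inj₂ (i , j , p , suc zero , q , s≤s z≤n , s≤s (s≤s z≤n) , inj₁ refl)
         ...     | last p q = inj₂ (j , i , p , before-last j i , q , proj₁ (before-last-internal j i) , proj₂ (before-last-internal j i) , inj₂ (inj₁ (toℕ-before-last j i)))

     final : State []
     final = run increasing (UP.filter⁺ less? square-unique) increasing< start

     Embedding : Set
     Embedding = Σ (Fin m → Fin n) λ φ → (∀ u v → φ u ≡ φ v → u ≡ v) ×
       (∀ i j p k → adj (lab i j p k) (φ (path i j p (inject₁ k))) (φ (path i j p (suc k))) ≡ true)

     conclude : State [] → Embedding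
     conclude S = φ , inj , edges
       where
         open State S
         total : ∀ h → ∃ λ x → (h , x) ∈ pl
         total h with covering h
         ... | inj₁ (b , refl) = centre b , pl₀⊆ (pl₀-branch b)
         ... | inj₂ (i , j , p , suc k , lo , hi , refl) with done i j p (λ ()) k
         ...   | u , v , _ , q , _ = v , q
         φ : Fin m → Fin n
         φ h = proj₁ (total h)
         functional : ∀ (pl : Placement) → Unique (map proj₁ pl) → ∀ {h x y} → (h , x) ∈ pl → (h , y) ∈ pl → x ≡ y
         functional (e ∷ pl) (px ∷ u) (here refl) (here refl) = refl
         functional (e ∷ pl) (px ∷ u) (here refl) (there q) = ⊥-elim (All.lookup px (MP.∈-map⁺ proj₁ q) refl)
         functional (e ∷ pl) (px ∷ u) (there p) (here refl) = ⊥-elim (All.lookup px (MP.∈-map⁺ proj₁ p) refl)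
         functional (e ∷ pl) (px ∷ u) (there p) (there q) = functional pl u p q
         injective : ∀ (pl : Placement) → Unique (map proj₂ pl) → ∀ {h h′ x} → (h , x) ∈ pl → (h′ , x) ∈ pl → h ≡ h′
         injective (e ∷ pl) (px ∷ u) (here refl) (here refl) = refl
         injective (e ∷ pl) (px ∷ u) (here refl) (there q) = ⊥-elim (All.lookup px (MP.∈-map⁺ proj₂ q) refl)
         injective (e ∷ pl) (px ∷ u) (there p) (here refl) = ⊥-elim (All.lookup px (MP.∈-map⁺ proj₂ p) refl)
         injective (e ∷ pl) (px ∷ u) (there p) (there q) = injective pl u p q
         inj : ∀ u v → φ u ≡ φ v → u ≡ v
         inj u v e = injective pl uniqV (proj₂ (total u)) (subst (λ x → (v , x) ∈ pl) (sym e) (proj₂ (total v)))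
         edges : ∀ i j p k → adj (lab i j p k) (φ (path i j p (inject₁ k))) (φ (path i j p (suc k))) ≡ true
         edges i j p k with done i j p (λ ()) k
         ... | u , v , e₁ , e₂ , e₃ = subst₂ (λ x y → adj (lab i j p k) x y ≡ true) (functional pl uniqH e₁ (proj₂ (total _))) (functional pl uniqH e₂ (proj₂ (total _))) e₃

     embedding : Embedding
     embedding = conclude final

   embed : Embed.Embedding family
   embed = Embed.embedding family

module ScaleChoice where
 open import Data.Nat using (_+_; _*_; _^_; _∸_; _≤_; _<_; z≤n; s≤s; NonZero)
 open import Data.Nat.Properties
 open import Data.Nat.DivMod using (_/_; _%_; m≡m%n+[m/n]*n; m%n<n)
 open import Data.Nat.Tactic.RingSolver using (solve-∀)
 open import Relation.Unary using (Decidable)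

 crossing : ∀ {P : ℕ → Set} → Decidable P → ¬ P 0 → ∀ N → P N → ∃ λ k → suc k ≤ N × ¬ P k × P (suc k)
 crossing P? ¬P0 zero p = ⊥-elim (¬P0 p)
 crossing P? ¬P0 (suc N) p with P? N
 ... | no ¬p = N , ≤-refl , ¬p , p
 ... | yes p′ with crossing P? ¬P0 N p′
 ...   | k , k<N , x = k , m≤n⇒m≤1+n k<N , x

 ^-cancelˡ-≤ : ∀ c x y → .{{NonZero c}} → x ^ c ≤ y ^ c → x ≤ y
 ^-cancelˡ-≤ c x y h with x ≤? y
 ... | yes p = p
 ... | no ¬p = ⊥-elim (<⇒≱ (^-monoˡ-< c (≰⇒> ¬p)) h)

 n≤n^ : ∀ n c → .{{NonZero c}} → n ≤ n ^ c
 n≤n^ zero c = z≤n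
 n≤n^ (suc n) (suc c) = subst (_≤ suc n ^ suc c) (*-identityʳ (suc n)) (*-monoʳ-≤ (suc n) (m^n>0 (suc n) c))

 square-cancel-≤ : ∀ x y → x * x ≤ y * y → x ≤ y
 square-cancel-≤ x y h = ^-cancelˡ-≤ 2 x y (subst₂ _≤_ (cong (x *_) (sym (*-identityʳ x))) (cong (y *_) (sym (*-identityʳ y))) h)

 ≤⌈/⌉* : ∀ b a → .{{_ : NonZero a}} → b ≤ ((b + (a ∸ 1)) / a) * a
 ≤⌈/⌉* b a@(suc c) = +-cancelʳ-≤ c b _ (begin
   b + c ≡⟨ m≡m%n+[m/n]*n (b + c) a ⟩
   (b + c) % a + ((b + c) / a) * a ≤⟨ +-monoˡ-≤ _ (≤-pred (m%n<n (b + c) a)) ⟩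
   c + ((b + c) / a) * a ≡⟨ +-comm c _ ⟩
   ((b + c) / a) * a + c ∎)
   where open ≤-Reasoning

 record Scales (ρ Q k C : ℕ) : Set where
   field
     D M t  : ℕ
     1≤M    : 1 ≤ M
     2≤D    : 2 ≤ D
     ρΛ≤M²  : ρ * (9 * Q) ≤ M * M
     Λ<D²ᵗ  : 9 * Q < D ^ t * D ^ t
     t≤     : t ≤ k + 2
     Dᵗ≤DM  : D ^ t ≤ D * M
     16DM≤C : 16 * (D * M) ≤ C

 -- D is about (ρ²Q)^(a/2b) and M is about 3 (ρQ)^(1/2); both are rounded up by a factor of at most 2, whence 16DM ≤ 192 (ρQ)^(1/2) (ρ²Q)^(a/2b).
 scales : ∀ a b ρ Q k C → .{{_ : NonZero a}} .{{_ : NonZero b}} → 1 ≤ ρ → 2 ≤ Q → b ≤ k * a →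
   200 ^ (2 * b) * ρ ^ (b + 2 * a) * Q ^ (a + b) ≤ C ^ (2 * b) → Scales ρ Q k C
 scales a b ρ Q k C 1≤ρ 2≤Q b≤ka big = record
   { D = D ; M = 3 * s ; t = t ; 1≤M = s≤s z≤n ; 2≤D = s≤s (s≤s z≤n)
   ; ρΛ≤M² = ≤-trans (≤-reflexive (lem₁ ρ Q)) (≤-trans (*-monoʳ-≤ 9 s-big) (≤-reflexive (lem₂ s)))
   ; Λ<D²ᵗ = t-big ; t≤ = t≤ ; Dᵗ≤DM = *-monoʳ-≤ D Dᵗ≤M
   ; 16DM≤C = ^-cancelˡ-≤ (2 * b) _ _ (≤-trans size big) }
   where
     open ≤-Reasoning
     instance
       2b≢0 : NonZero (2 * b)
       2b≢0 = m*n≢0 2 b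

     lem₁ : ∀ ρ Q → ρ * (9 * Q) ≡ 9 * (ρ * Q)
     lem₁ = solve-∀
     lem₂ : ∀ s → 9 * (s * s) ≡ 3 * s * (3 * s)
     lem₂ = solve-∀

     2≤ρQ : 2 ≤ ρ * Q
     2≤ρQ = ≤-trans 2≤Q (≤-trans (≤-reflexive (sym (*-identityˡ Q))) (*-monoˡ-≤ Q 1≤ρ))

     Q≤ρ²Q : Q ≤ ρ * ρ * Q
     Q≤ρ²Q = ≤-trans (≤-reflexive (sym (*-identityˡ Q))) (*-monoˡ-≤ Q (*-mono-≤ 1≤ρ 1≤ρ))

     W = (ρ * ρ * Q) ^ a

     2≤W : 2 ≤ W
     2≤W = ≤-trans (≤-trans 2≤Q Q≤ρ²Q) (n≤n^ (ρ * ρ * Q) a)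

     cross-s = crossing (λ x → ρ * Q ≤? suc x * suc x) (λ h → <⇒≱ 2≤ρQ h) (ρ * Q) (≤-trans (n≤1+n _) (m≤m*n (suc (ρ * Q)) (suc (ρ * Q))))
     s′ = suc (proj₁ cross-s)
     s = suc s′
     s-big : ρ * Q ≤ s * s
     s-big = proj₂ (proj₂ (proj₂ cross-s))
     s-small : s′ * s′ ≤ ρ * Q
     s-small = <⇒≤ (≰⇒> (proj₁ (proj₂ (proj₂ cross-s))))

     cross-D = crossing (λ x → W ≤? suc x ^ (2 * b)) (λ h → <⇒≱ 2≤W (subst (W ≤_) (^-zeroˡ (2 * b)) h)) W (≤-trans (n≤1+n W) (n≤n^ (suc W) (2 * b)))
     D′ = suc (proj₁ cross-D)
     D = suc D′
     D-big : W ≤ D ^ (2 * b)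
     D-big = proj₂ (proj₂ (proj₂ cross-D))
     D-small : D′ ^ (2 * b) ≤ W
     D-small = <⇒≤ (≰⇒> (proj₁ (proj₂ (proj₂ cross-D))))

     suc≤2* : ∀ x → suc (suc x) ≤ 2 * suc x
     suc≤2* x = ≤-trans (m≤m+n (suc (suc x)) x) (≤-reflexive (lem x))
       where
         lem : ∀ x → suc (suc x) + x ≡ 2 * suc x
         lem = solve-∀

     Q≤D²ᵏ : Q ≤ D ^ (2 * k)
     Q≤D²ᵏ = ^-cancelˡ-≤ a Q _ (begin
       Q ^ a ≤⟨ ^-monoˡ-≤ a Q≤ρ²Q ⟩
       W ≤⟨ D-big ⟩
       D ^ (2 * b) ≤⟨ ^-monoʳ-≤ D (*-monoʳ-≤ 2 b≤ka) ⟩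
       D ^ (2 * (k * a)) ≡⟨ cong (D ^_) (sym (*-assoc 2 k a)) ⟩
       D ^ (2 * k * a) ≡⟨ sym (^-*-assoc D (2 * k) a) ⟩
       (D ^ (2 * k)) ^ a ∎)

     t-reached : 9 * Q < D ^ (k + 2) * D ^ (k + 2)
     t-reached = begin-strict
       9 * Q <⟨ *-monoˡ-< Q {{ℕ.>-nonZero (≤-trans (s≤s z≤n) 2≤Q)}} (s≤s (m≤m+n 9 6)) ⟩
       16 * Q ≤⟨ *-mono-≤ (^-monoˡ-≤ 4 (s≤s (s≤s (z≤n {proj₁ cross-D})))) Q≤D²ᵏ ⟩
       D ^ 4 * D ^ (2 * k) ≡⟨ sym (^-distribˡ-+-* D 4 (2 * k)) ⟩
       D ^ (4 + 2 * k) ≡⟨ cong (D ^_) (lem k) ⟩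
       D ^ (k + 2 + (k + 2)) ≡⟨ ^-distribˡ-+-* D (k + 2) (k + 2) ⟩
       D ^ (k + 2) * D ^ (k + 2) ∎
       where
         lem : ∀ k → 4 + 2 * k ≡ k + 2 + (k + 2)
         lem = solve-∀

     cross-t = crossing (λ t → 9 * Q <? D ^ t * D ^ t) (λ h → <⇒≱ h (≤-trans (s≤s z≤n) (*-monoʳ-≤ 9 2≤Q))) (k + 2) t-reached
     t′ = proj₁ cross-t
     t = suc t′
     t≤ : t ≤ k + 2
     t≤ = proj₁ (proj₂ cross-t)
     t-big : 9 * Q < D ^ t * D ^ t
     t-big = proj₂ (proj₂ (proj₂ cross-t))

     Dᵗ≤M : D ^ t′ ≤ 3 * s
     Dᵗ≤M = square-cancel-≤ (D ^ t′) (3 * s) (begin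
       D ^ t′ * D ^ t′ ≤⟨ ≮⇒≥ (proj₁ (proj₂ (proj₂ cross-t))) ⟩
       9 * Q ≤⟨ *-monoʳ-≤ 9 (≤-trans (≤-reflexive (sym (*-identityˡ Q))) (*-monoˡ-≤ Q 1≤ρ)) ⟩
       9 * (ρ * Q) ≤⟨ *-monoʳ-≤ 9 s-big ⟩
       9 * (s * s) ≡⟨ lem₂ s ⟩
       3 * s * (3 * s) ∎)

     ^-* : ∀ x y c → (x * y) ^ c ≡ x ^ c * y ^ c
     ^-* x y zero = refl
     ^-* x y (suc c) = trans (cong (x * y *_) (^-* x y c)) (lem x y (x ^ c) (y ^ c))
       where
         lem : ∀ x y a b → x * y * (a * b) ≡ x * a * (y * b)
         lem = solve-∀

     size : (16 * (D * (3 * s))) ^ (2 * b) ≤ 200 ^ (2 * b) * ρ ^ (b + 2 * a) * Q ^ (a + b)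
     size = begin
       (16 * (D * (3 * s))) ^ (2 * b) ≤⟨ ^-monoˡ-≤ (2 * b) (*-monoʳ-≤ 16 (*-mono-≤ (suc≤2* (proj₁ cross-D)) (*-monoʳ-≤ 3 (suc≤2* (proj₁ cross-s))))) ⟩
       (16 * (2 * D′ * (3 * (2 * s′)))) ^ (2 * b) ≡⟨ cong (_^ (2 * b)) (lem₃ D′ s′) ⟩
       (192 * (D′ * s′)) ^ (2 * b) ≡⟨ trans (^-* 192 (D′ * s′) (2 * b)) (cong (192 ^ (2 * b) *_) (^-* D′ s′ (2 * b))) ⟩
       192 ^ (2 * b) * (D′ ^ (2 * b) * s′ ^ (2 * b)) ≤⟨ *-mono-≤ (^-monoˡ-≤ (2 * b) (m≤m+n 192 8)) (*-mono-≤ D-small (≤-trans (≤-reflexive (trans (sym (^-*-assoc s′ 2 b)) (cong (λ z → (s′ * z) ^ b) (*-identityʳ s′)))) (^-monoˡ-≤ b s-small))) ⟩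
       200 ^ (2 * b) * (W * (ρ * Q) ^ b) ≡⟨ cong (200 ^ (2 * b) *_) (cong₂ _*_ (trans (^-* (ρ * ρ) Q a) (cong (_* Q ^ a) (trans (cong (λ z → (ρ * z) ^ a) (sym (*-identityʳ ρ))) (^-*-assoc ρ 2 a)))) (^-* ρ Q b)) ⟩
       200 ^ (2 * b) * (ρ ^ (2 * a) * Q ^ a * (ρ ^ b * Q ^ b)) ≡⟨ lem₄ (200 ^ (2 * b)) (ρ ^ (2 * a)) (Q ^ a) (ρ ^ b) (Q ^ b) ⟩
       200 ^ (2 * b) * (ρ ^ b * ρ ^ (2 * a)) * (Q ^ a * Q ^ b) ≡⟨ sym (cong₂ (λ x y → 200 ^ (2 * b) * x * y) (^-distribˡ-+-* ρ b (2 * a)) (^-distribˡ-+-* Q a b)) ⟩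
       200 ^ (2 * b) * ρ ^ (b + 2 * a) * Q ^ (a + b) ∎
       where
         lem₃ : ∀ x y → 16 * (2 * x * (3 * (2 * y))) ≡ 192 * (x * y)
         lem₃ = solve-∀
         lem₄ : ∀ a b c d e → a * (b * c * (d * e)) ≡ a * (d * b) * (c * e)
         lem₄ = solve-∀

module DistanceGraphs where
 open FiniteSums
 open FiniteFields
 open SphereSums
 open SphereMixing
 open ExtendabilityMethod using (⟦_⟧; ∑ᶠ; ∑ᶠ-0; ∑ᶠ-suc; ∑ᶠ-cong; ∑ᶠ-mono; ∑ᶠ-*ʳ; ∑ᶠ-zero; #)
 import Defs
 open import Algebra.Bundles using (CommutativeRing)
 open import Algebra.Bundles.Raw using (RawRing)
 open import Algebra.Morphism.Structures using (IsRingMonomorphism)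
 import Algebra.Morphism.RingMonomorphism as RingMono
 import Data.Nat.Tactic.RingSolver as ℕSolver
 open import Data.Integer as Z using (+_; 0ℤ; 1ℤ)
 open import Data.Integer.Tactic.RingSolver using (solve-∀)
 open import Data.Fin using (zero; suc)
 open import Data.Bool using (_∧_; if_then_else_)
 open import Data.List using ([]; _∷_; tabulate; allFin)
 open import Data.List.Relation.Unary.All using ([]; _∷_)
 open import Data.List.Relation.Unary.AllPairs using (AllPairs; []; _∷_)
 open import Data.Vec using ([]; _∷_)
 open import Relation.Nullary.Decidable using (dec-false)

 does-true : ∀ {A : Set} (a : Dec A) → does a ≡ true → A
 does-true (yes x) _ = x

 bit-*-0 : ∀ b {x} → (b ≡ true → x ≡ 0) → ⟦ b ⟧ ℕ.* x ≡ 0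
 bit-*-0 false h = refl
 bit-*-0 true h = trans (ℕP.*-identityˡ _) (h refl)

 bit-∧-0 : ∀ b c → (b ≡ true → c ≡ false) → ⟦ b ∧ c ⟧ ≡ 0
 bit-∧-0 false c h = refl
 bit-∧-0 true c h = cong ⟦_⟧ (h refl)

 bit-*-≤ : ∀ b {x y} → (b ≡ true → x ℕ.≤ y) → ⟦ b ⟧ ℕ.* x ℕ.≤ ⟦ b ⟧ ℕ.* y
 bit-*-≤ false h = ℕ.z≤n
 bit-*-≤ true h = ℕP.*-monoʳ-≤ 1 (h refl)

 distinct-lookup : ∀ {A : Set} {S : A → A → Set} {xs} → (∀ {x y} → S x y → S y x) → AllPairs (λ x y → ¬ S x y) xs →
                   ∀ i j → S (List.lookup xs i) (List.lookup xs j) → i ≡ j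
 distinct-lookup sy (px ∷ ps) zero zero s = refl
 distinct-lookup {xs = x ∷ xs} sy (px ∷ ps) zero (suc j) s = ⊥-elim (All.lookup px (MP.∈-lookup j) s)
 distinct-lookup {xs = x ∷ xs} sy (px ∷ ps) (suc i) zero s = ⊥-elim (All.lookup px (MP.∈-lookup i) (sy s))
 distinct-lookup sy (px ∷ ps) (suc i) (suc j) s = cong suc (distinct-lookup sy ps i j s)

 module _ (K : Defs.Field) {q : ℕ} (hc : Defs.HasCard K q) where
   private
     module K = Defs.Field K
     open Defs.HasCard hc

   index : K.Carrier → Fin q
   index x = proj₁ (enum-surj x)

   enum-index : ∀ x → enum (index x) K.≈ x
   enum-index x = proj₂ (enum-surj x)

   index-cong : ∀ {x y} → x K.≈ y → index x ≡ index y
   index-cong e = enum-inj _ _ (K.trans (enum-index _) (K.trans e (K.sym (enum-index _))))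

   index-injective : ∀ {x y} → index x ≡ index y → x K.≈ y
   index-injective {x} {y} e = K.trans (K.sym (enum-index x)) (K.trans (K.reflexive (cong enum e)) (enum-index y))

   private
     finRing : RawRing 0ℓ 0ℓ
     finRing = record { Carrier = Fin q ; _≈_ = _≡_ ; _+_ = λ i j → index (enum i K.+ enum j) ; _*_ = λ i j → index (enum i K.* enum j)
                      ; -_ = λ i → index (K.- enum i) ; 0# = index K.0# ; 1# = index K.1# }
     module R = RawRing finRing

     enum-mono : IsRingMonomorphism finRing (CommutativeRing.rawRing K.commRing) enum
     enum-mono = record
       { isRingHomomorphism = record
         { isSemiringHomomorphism = record
           { isNearSemiringHomomorphism = record
             { +-isMonoidHomomorphism = record
               { isMagmaHomomorphism = record { isRelHomomorphism = record { cong = K.reflexive ∘ cong enum } ; homo = λ i j → enum-index _ }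
               ; ε-homo = enum-index _ }
             ; *-homo = λ i j → enum-index _ }
           ; 1#-homo = enum-index _ }
         ; -‿homo = λ i → enum-index _ }
       ; injective = λ {i} {j} → enum-inj i j }

     nonzero : ∀ {i} → i ≢ R.0# → ¬ (enum i K.≈ K.0#)
     nonzero n e = n (enum-inj _ _ (K.trans e (K.sym (enum-index _))))

     reciprocal : Fin q → Fin q
     reciprocal i with i FinP.≟ R.0#
     ... | yes _ = R.0#
     ... | no n = index (proj₁ (K.inverse (enum i) (nonzero n)))

     reciprocal-r : ∀ i → i ≢ R.0# → i R.* reciprocal i ≡ R.1#
     reciprocal-r i n with i FinP.≟ R.0#
     ... | yes e = ⊥-elim (n e)
     ... | no n′ = index-cong (K.trans (K.*-cong K.refl (enum-index _)) (proj₂ (K.inverse (enum i) (nonzero n′))))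

     reciprocal-0 : reciprocal R.0# ≡ R.0#
     reciprocal-0 with R.0# FinP.≟ R.0#
     ... | yes _ = refl
     ... | no n = ⊥-elim (n refl)

   finiteField : FiniteField
   finiteField = record
     { C = Fin q ; _⊕_ = R._+_ ; _⊛_ = R._*_ ; ⊖_ = R.-_ ; inv = reciprocal ; 0ᶠ = R.0# ; 1ᶠ = R.1#
     ; isCR = RingMono.isCommutativeRing enum-mono (CommutativeRing.isCommutativeRing K.commRing)
     ; 1≢0 = λ e → K.1≉0 (index-injective e) ; inv-r = reciprocal-r ; inv-0 = reciprocal-0 ; fin = Finite-Fin q }

   finiteField-order : FiniteField.order finiteField ≡ q
   finiteField-order = ListP.length-tabulate {n = q} (λ i → i)

   module _ (two≢0 : FieldFacts.two finiteField ≢ FiniteField.0ᶠ finiteField) where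
     open Sphere finiteField two≢0 using (N; _⊕ᵛ_; ⊖ᵛ_)
     open FiniteField finiteField using (_⊕_; _⊛_; ⊖_; 0ᶠ; module Solver; -‿inverseʳ; zeroˡ; +-identityˡ)

     indexᵛ : ∀ {d} → Defs.Point K d → Vec (Fin q) d
     indexᵛ = Vec.map index

     indexᵛ-injective : ∀ {d} (x y : Defs.Point K d) → indexᵛ x ≡ indexᵛ y → Defs._≈ᵥ_ K x y
     indexᵛ-injective (a ∷ x) (b ∷ y) e zero = index-injective (cong Vec.head e)
     indexᵛ-injective (a ∷ x) (b ∷ y) e (suc i) = indexᵛ-injective x y (cong Vec.tail e) i

     N-difference : ∀ {d} (x y : Defs.Point K d) → enum (N (indexᵛ x ⊕ᵛ (⊖ᵛ (indexᵛ y)))) K.≈ Defs.‖_‖ K (Defs._−ᵥ_ K x y)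
     N-difference [] [] = enum-index _
     N-difference (a ∷ x) (b ∷ y) = K.trans (enum-index _) (K.+-cong (K.trans (enum-index _) (K.*-cong diff diff)) (N-difference x y))
       where
         diff : enum (index a ⊕ ⊖ (index b)) K.≈ (a K.- b)
         diff = K.trans (enum-index _) (K.+-cong (enum-index a) (K.trans (enum-index _) (K.-‿cong (enum-index b))))

     N-difference-sym : ∀ {d} (u v : Vec (Fin q) d) → N (u ⊕ᵛ (⊖ᵛ v)) ≡ N (v ⊕ᵛ (⊖ᵛ u))
     N-difference-sym [] [] = refl
     N-difference-sym (a ∷ u) (b ∷ v) = cong₂ _⊕_ (solve 2 (λ a b → (a :+ (:- b)) :* (a :+ (:- b)) := (b :+ (:- a)) :* (b :+ (:- a))) refl a b) (N-difference-sym u v)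
       where open Solver

     N-difference-0 : ∀ {d} (u : Vec (Fin q) d) → N (u ⊕ᵛ (⊖ᵛ u)) ≡ 0ᶠ
     N-difference-0 [] = refl
     N-difference-0 (a ∷ u) = trans (cong₂ _⊕_ (trans (cong (λ z → z ⊛ z) (-‿inverseʳ a)) (zeroˡ _)) (N-difference-0 u)) (+-identityˡ _)

 ∑-allFin : ∀ n (f : Fin n → ℕ) → ∑ (allFin n) (λ i → + f i) ≡ + ∑ᶠ f
 ∑-allFin n f = go n (λ i → i)
   where
     go : ∀ k (g : Fin k → Fin n) → ∑ (tabulate g) (λ i → + f i) ≡ + ∑ᶠ (f ∘ g)
     go zero g = cong +_ (sym (∑ᶠ-0 (f ∘ g)))
     go (suc k) g = trans (+ˡ (+ f (g zero)) (go k (g ∘ suc))) (trans (sym (ℤP.pos-+ (f (g zero)) (∑ᶠ (f ∘ g ∘ suc)))) (cong +_ (sym (∑ᶠ-suc (f ∘ g)))))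

 -- If v is at most the fraction 1 − 1/c of u, then u − v ≥ u/c.
 deviation : ∀ c u v Λ → suc c ℕ.* v ℕ.+ u ℕ.≤ suc c ℕ.* u → (+ v Z.- + u) Z.* (+ v Z.- + u) Z.≤ + Λ Z.* + u → u ℕ.≤ suc c ℕ.* suc c ℕ.* Λ
 deviation c zero v Λ h dev = ℕ.z≤n
 deviation c u@(suc _) v Λ h dev = ℕP.*-cancelʳ-≤ u (suc c ℕ.* suc c ℕ.* Λ) u (begin
   u ℕ.* u ≤⟨ ℕP.*-mono-≤ u≤ u≤ ⟩
   (suc c ℕ.* w) ℕ.* (suc c ℕ.* w) ≡⟨ lem₁ (suc c) w ⟩
   (suc c ℕ.* suc c) ℕ.* (w ℕ.* w) ≤⟨ ℕP.*-monoʳ-≤ (suc c ℕ.* suc c) (ℤP.drop‿+≤+ (subst₂ Z._≤_ (trans (cong (λ z → (+ v Z.- z) Z.* (+ v Z.- z)) u≡) (trans (lem₂ (+ v) (+ w)) (sym (ℤP.pos-* w w)))) (sym (ℤP.pos-* Λ u)) dev)) ⟩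
   (suc c ℕ.* suc c) ℕ.* (Λ ℕ.* u) ≡⟨ sym (ℕP.*-assoc (suc c ℕ.* suc c) Λ u) ⟩
   suc c ℕ.* suc c ℕ.* Λ ℕ.* u ∎)
   where
     open ℕP.≤-Reasoning
     w = u ℕ.∸ v
     v≤u : v ℕ.≤ u
     v≤u = ℕP.*-cancelˡ-≤ (suc c) (ℕP.≤-trans (ℕP.m≤m+n (suc c ℕ.* v) u) h)
     u≡ : + u ≡ + v Z.+ + w
     u≡ = trans (cong +_ (sym (ℕP.m+[n∸m]≡n v≤u))) (ℤP.pos-+ v w)
     u≤ : u ℕ.≤ suc c ℕ.* w
     u≤ = ℕP.+-cancelˡ-≤ (suc c ℕ.* v) _ _ (ℕP.≤-trans h (ℕP.≤-reflexive (trans (cong (suc c ℕ.*_) (sym (ℕP.m+[n∸m]≡n v≤u))) (ℕP.*-distribˡ-+ (suc c) v w))))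
     lem₁ : ∀ c w → c ℕ.* w ℕ.* (c ℕ.* w) ≡ c ℕ.* c ℕ.* (w ℕ.* w)
     lem₁ = ℕSolver.solve-∀
     lem₂ : ∀ v w → (v Z.- (v Z.+ w)) Z.* (v Z.- (v Z.+ w)) ≡ w Z.* w
     lem₂ = solve-∀

 module DistanceGraph (K : Defs.Field) {q : ℕ} (hc : Defs.HasCard K q) (p k h : ℕ) (p-prime : Prime p) (p-odd : p ≡ suc (2 ℕ.* h)) (q≡ : q ≡ p ℕ.^ k)
                      {d : ℕ} (E : Defs.PointSet K d) (R : Defs.DistSet K) where
   private
     module K = Defs.Field K
     F = finiteField K hc
     open FiniteField F using (_≟_; 0ᶠ; δ)
     orderF : FiniteField.order F ≡ p ℕ.^ k
     orderF = trans (finiteField-order K hc) q≡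
     two≢0 : FieldFacts.two F ≢ 0ᶠ
     two≢0 = FieldFacts.OddChar.two≢0 F p k h p-prime p-odd orderF
     open Sphere F two≢0 using (N; _⊕ᵛ_; ⊖ᵛ_)

   n ρ : ℕ
   n = Defs.card K E
   ρ = Defs.dcard K R

   point : Fin n → Defs.Point K d
   point = List.lookup (Defs.PointSet.elems E)

   point-injective : ∀ i j → Defs._≈ᵥ_ K (point i) (point j) → i ≡ j
   point-injective = distinct-lookup {S = Defs._≈ᵥ_ K} (λ s i → K.sym (s i)) (Defs.PointSet.distinct E)

   distance : Fin ρ → K.Carrier
   distance = List.lookup (Defs.DistSet.elems R)

   private
     pt : Fin n → Vec (Fin q) d
     pt i = indexᵛ K hc two≢0 (point i)

     pt-inj : ∀ i j → pt i ≡ pt j → i ≡ j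
     pt-inj i j e = point-injective i j (indexᵛ-injective K hc two≢0 (point i) (point j) e)

     dist : Fin ρ → Fin q
     dist r = index K hc (distance r)

     dist≢0 : ∀ r → dist r ≢ 0ᶠ
     dist≢0 r e = All.lookup (Defs.DistSet.nonzero R) (MP.∈-lookup r) (index-injective K hc e)

     norm : Fin n → Fin n → Fin q
     norm i j = N (pt j ⊕ᵛ (⊖ᵛ (pt i)))

   adj : Fin ρ → Fin n → Fin n → Bool
   adj r i j = does (norm i j ≟ dist r)

   adj⇒distance : ∀ r i j → adj r i j ≡ true → Defs.‖_‖ K (Defs._−ᵥ_ K (point i) (point j)) K.≈ distance r
   adj⇒distance r i j e = K.trans (K.sym (N-difference K hc two≢0 (point i) (point j)))
     (K.trans (K.reflexive (cong (Defs.HasCard.enum hc) (trans (N-difference-sym K hc two≢0 (pt i) (pt j)) (does-true (norm i j ≟ dist r) e)))) (enum-index K hc (distance r)))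

   adj-sym : ∀ r i j → adj r i j ≡ true → adj r j i ≡ true
   adj-sym r i j e = subst (λ z → does (z ≟ dist r) ≡ true) (N-difference-sym K hc two≢0 (pt j) (pt i)) e

   adj-irr : ∀ r i → adj r i i ≡ false
   adj-irr r i = dec-false (norm i i ≟ dist r) (λ e → dist≢0 r (trans (sym e) (N-difference-0 K hc two≢0 (pt i))))

   e : Fin ρ → (X Y : Fin n → Bool) → ℕ
   e r X Y = ∑ᶠ (λ i → ⟦ X i ⟧ ℕ.* # (λ j → Y j ∧ adj r i j))

   e-mixing : ∀ r X Y → (+ (q ℕ.* e r X Y) Z.- + (# X ℕ.* # Y)) Z.* (+ (q ℕ.* e r X Y) Z.- + (# X ℕ.* # Y)) Z.≤ + (9 ℕ.* q ℕ.^ suc d) Z.* + (# X ℕ.* # Y)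
   e-mixing r X Y = subst₂ Z._≤_ (cong (λ z → z Z.* z) (cong₂ Z._-_ q*edges (sum*sum a∑ b∑)))
       (cong₂ Z._*_ (trans (cong (λ z → + 9 Z.* + (z ℕ.^ suc d)) (finiteField-order K hc)) (sym (ℤP.pos-* 9 (q ℕ.^ suc d)))) (sum*sum (squares X) (squares Y))) P.mixing-points
     where
       module P = ExpanderMixing.Points F p k h p-prime p-odd orderF d pt pt-inj (dist r) (dist≢0 r) (λ i → + ⟦ X i ⟧) (λ j → + ⟦ Y j ⟧)
       sum*sum : ∀ {x y} {a b : ℕ} → x ≡ + a → y ≡ + b → x Z.* y ≡ + (a ℕ.* b)
       sum*sum {a = a} {b} refl refl = sym (ℤP.pos-* a b)
       a∑ = ∑-allFin n (λ i → ⟦ X i ⟧)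
       b∑ = ∑-allFin n (λ i → ⟦ Y i ⟧)
       squares : ∀ (X : Fin n → Bool) → ∑ (allFin n) (λ i → + ⟦ X i ⟧ Z.* + ⟦ X i ⟧) ≡ + # X
       squares X = trans (∑-cong (allFin n) (λ i → square (X i))) (∑-allFin n (λ i → ⟦ X i ⟧))
         where
           square : ∀ b → + ⟦ b ⟧ Z.* + ⟦ b ⟧ ≡ + ⟦ b ⟧
           square true = refl
           square false = refl
       bit : ∀ b c → + ⟦ b ⟧ Z.* (if c then 1ℤ else 0ℤ) ≡ + ⟦ b ∧ c ⟧
       bit true true = refl
       bit true false = refl
       bit false true = refl
       bit false false = refl
       q*edges : + FiniteField.order F Z.* P.edges ≡ + (q ℕ.* e r X Y)
       q*edges = sum*sum (cong +_ (finiteField-order K hc)) (trans (∑-cong (allFin n) (λ i →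
         trans (cong (+ ⟦ X i ⟧ Z.*_) (trans (∑-cong (allFin n) (λ j → bit (Y j) (adj r i j))) (∑-allFin n (λ j → ⟦ Y j ∧ adj r i j ⟧))))
               (sym (ℤP.pos-* ⟦ X i ⟧ (# (λ j → Y j ∧ adj r i j)))))) (∑-allFin n (λ i → ⟦ X i ⟧ ℕ.* # (λ j → Y j ∧ adj r i j))))

   joined : ∀ r (X Y : Fin n → Bool) → (∀ x y → X x ≡ true → Y y ≡ true → adj r x y ≡ false) → # X ℕ.* # Y ℕ.≤ 9 ℕ.* q ℕ.^ suc d
   joined r X Y no-edge = subst (# X ℕ.* # Y ℕ.≤_) (ℕP.*-identityˡ (9 ℕ.* q ℕ.^ suc d)) (deviation 0 (# X ℕ.* # Y) (q ℕ.* e r X Y) (9 ℕ.* q ℕ.^ suc d)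
       (ℕP.≤-reflexive (cong (λ z → 1 ℕ.* z ℕ.+ # X ℕ.* # Y) (trans (cong (q ℕ.*_) none) (ℕP.*-zeroʳ q)) ∙ sym (ℕP.*-identityˡ (# X ℕ.* # Y)))) (e-mixing r X Y))
     where
       _∙_ = trans
       inner : ∀ i → ⟦ X i ⟧ ℕ.* # (λ j → Y j ∧ adj r i j) ≡ 0
       inner i = bit-*-0 (X i) (λ Xi → trans (∑ᶠ-cong (λ j → bit-∧-0 (Y j) (adj r i j) (no-edge i j Xi))) (∑ᶠ-zero n))
       none : e r X Y ≡ 0
       none = trans (∑ᶠ-cong inner) (∑ᶠ-zero n)

   sparse : ∀ Δ → 4 ℕ.* q ℕ.* Δ ℕ.≤ n → ∀ r (X T : Fin n → Bool) → (∀ x → X x ≡ true → # (λ y → T y ∧ adj r x y) ℕ.≤ Δ) →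
            n ℕ.≤ 3 ℕ.* # T → # X ℕ.* # T ℕ.≤ 16 ℕ.* (9 ℕ.* q ℕ.^ suc d)
   sparse Δ small r X T few many = deviation 3 (# X ℕ.* # T) (q ℕ.* e r X T) (9 ℕ.* q ℕ.^ suc d)
       (ℕP.≤-trans (ℕP.+-monoˡ-≤ (# X ℕ.* # T) bound) (ℕP.≤-reflexive (lem₂ (# X ℕ.* # T)))) (e-mixing r X T)
     where
       open ℕP.≤-Reasoning
       row : ∀ i → ⟦ X i ⟧ ℕ.* # (λ j → T j ∧ adj r i j) ℕ.≤ ⟦ X i ⟧ ℕ.* Δ
       row i = bit-*-≤ (X i) (few i)
       e≤ : e r X T ℕ.≤ # X ℕ.* Δ
       e≤ = ℕP.≤-trans (∑ᶠ-mono row) (ℕP.≤-reflexive (∑ᶠ-*ʳ Δ (λ i → ⟦ X i ⟧)))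
       bound : 4 ℕ.* (q ℕ.* e r X T) ℕ.≤ 3 ℕ.* (# X ℕ.* # T)
       bound = begin
         4 ℕ.* (q ℕ.* e r X T) ≤⟨ ℕP.*-monoʳ-≤ 4 (ℕP.*-monoʳ-≤ q e≤) ⟩
         4 ℕ.* (q ℕ.* (# X ℕ.* Δ)) ≡⟨ lem₁ q (# X) Δ ⟩
         # X ℕ.* (4 ℕ.* q ℕ.* Δ) ≤⟨ ℕP.*-monoʳ-≤ (# X) (ℕP.≤-trans small many) ⟩
         # X ℕ.* (3 ℕ.* # T) ≡⟨ lem₃ (# X) (# T) ⟩
         3 ℕ.* (# X ℕ.* # T) ∎
         where
           lem₁ : ∀ q x d → 4 ℕ.* (q ℕ.* (x ℕ.* d)) ≡ x ℕ.* (4 ℕ.* q ℕ.* d)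
           lem₁ = ℕSolver.solve-∀
           lem₃ : ∀ x t → x ℕ.* (3 ℕ.* t) ≡ 3 ℕ.* (x ℕ.* t)
           lem₃ = ℕSolver.solve-∀
       lem₂ : ∀ u → 3 ℕ.* u ℕ.+ u ≡ 4 ℕ.* u
       lem₂ = ℕSolver.solve-∀

module Containment where
 open TreeGrowth using (ColouredExpander)
 open SubdivisionEmbedding
 open ScaleChoice
 open DistanceGraphs
 import Defs
 open import Data.Nat using (_+_; _*_; _^_; _∸_; _≤_; _<_; z≤n; s≤s; NonZero)
 open import Data.Nat.Properties
 open import Data.Nat.Primality using (prime⇒nonTrivial)
 open import Data.Nat.Tactic.RingSolver using (solve-∀)
 open import Data.Fin using (zero; suc; toℕ; inject₁; fromℕ; fromℕ<; cast; combine; remQuot; punchIn) renaming (_<_ to _<ᶠ_)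
 open import Data.List.Relation.Unary.Any as Any using (Any)
 open import Data.Sum using ([_,_]′)
 open import Relation.Binary.Definitions using (tri<; tri≈; tri>)

 -- Each ordered pair of branching vertices is charged nine internal vertices of its path: positions 1, …, 9 for (i , j) with i < j and 10, …, 18 for (j , i).
 module InternalVertices {ρ m Δ : ℕ} (H : Skeleton ρ m (suc Δ)) (long : ∀ i j → i <ᶠ j → 16 ≤ Skeleton.inner H i j) where
   open Skeleton H

   private
     position : ∀ i j → i <ᶠ j → ∀ x → x < 18 → Fin (4 + inner i j)
     position i j p x x< = fromℕ< {suc x} (m≤n⇒m≤1+n (s≤s (≤-trans x< (+-monoʳ-≤ 2 (long i j p)))))

     position-toℕ : ∀ i j p x x< → toℕ (position i j p x x<) ≡ suc x
     position-toℕ i j p x x< = FinP.toℕ-fromℕ< (m≤n⇒m≤1+n (s≤s (≤-trans x< (+-monoʳ-≤ 2 (long i j p)))))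

     position-low : ∀ i j p x x< → 0 < toℕ (position i j p x x<)
     position-low i j p x x< = ≤-trans (s≤s z≤n) (≤-reflexive (sym (position-toℕ i j p x x<)))

     position-high : ∀ i j p x x< → toℕ (position i j p x x<) < 3 + inner i j
     position-high i j p x x< = ≤-trans (≤-reflexive (cong suc (position-toℕ i j p x x<))) (s≤s (≤-trans x< (+-monoʳ-≤ 2 (long i j p))))

     place-injective : ∀ i j p x x< i′ j′ p′ x′ x′< → path i j p (position i j p x x<) ≡ path i′ j′ p′ (position i′ j′ p′ x′ x′<) → i ≡ i′ × j ≡ j′ × x ≡ x′
     place-injective i j p x x< i′ j′ p′ x′ x′< e with internal-inj i j p (position i j p x x<) i′ j′ p′ (position i′ j′ p′ x′ x′<)
       (position-low i j p x x<) (position-high i j p x x<) (position-low i′ j′ p′ x′ x′<) (position-high i′ j′ p′ x′ x′<) e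
     ... | i≡ , j≡ , x≡ = i≡ , j≡ , suc-injective (trans (sym (position-toℕ i j p x x<)) (trans x≡ (position-toℕ i′ j′ p′ x′ x′<)))

     low : (k : Fin 9) → toℕ k < 18
     low k = ≤-trans (FinP.toℕ<n k) (m≤m+n 9 9)
     high : (k : Fin 9) → 9 + toℕ k < 18
     high k = s≤s (+-monoʳ-≤ 9 (≤-pred (FinP.toℕ<n k)))

     charge : ∀ i j → i ≢ j → Fin 9 → Fin m
     charge i j ne k with FinP.<-cmp i j
     ... | tri< p _ _ = path i j p (position i j p (toℕ k) (low k))
     ... | tri≈ _ e _ = ⊥-elim (ne e)
     ... | tri> _ _ p = path j i p (position j i p (9 + toℕ k) (high k))

     separate : ∀ (k k′ : Fin 9) → toℕ k ≢ 9 + toℕ k′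
     separate k k′ e = <⇒≱ (FinP.toℕ<n k) (≤-trans (m≤m+n 9 (toℕ k′)) (≤-reflexive (sym e)))

     charge-injective : ∀ i j ne k i′ j′ ne′ k′ → charge i j ne k ≡ charge i′ j′ ne′ k′ → i ≡ i′ × j ≡ j′ × k ≡ k′
     charge-injective i j ne k i′ j′ ne′ k′ e with FinP.<-cmp i j | FinP.<-cmp i′ j′
     ... | tri≈ _ q _ | _ = ⊥-elim (ne q)
     ... | tri< _ _ _ | tri≈ _ q _ = ⊥-elim (ne′ q)
     ... | tri> _ _ _ | tri≈ _ q _ = ⊥-elim (ne′ q)
     ... | tri< p _ _ | tri< p′ _ _ with place-injective i j p (toℕ k) (low k) i′ j′ p′ (toℕ k′) (low k′) e
     ...   | i≡ , j≡ , k≡ = i≡ , j≡ , FinP.toℕ-injective k≡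
     charge-injective i j ne k i′ j′ ne′ k′ e | tri> _ _ p | tri> _ _ p′ with place-injective j i p (9 + toℕ k) (high k) j′ i′ p′ (9 + toℕ k′) (high k′) e
     ...   | j≡ , i≡ , k≡ = i≡ , j≡ , FinP.toℕ-injective (+-cancelˡ-≡ 9 _ _ k≡)
     charge-injective i j ne k i′ j′ ne′ k′ e | tri< p _ _ | tri> _ _ p′ = ⊥-elim (separate k k′ (proj₂ (proj₂ (place-injective i j p (toℕ k) (low k) j′ i′ p′ (9 + toℕ k′) (high k′) e))))
     charge-injective i j ne k i′ j′ ne′ k′ e | tri> _ _ p | tri< p′ _ _ = ⊥-elim (separate k′ k (sym (proj₂ (proj₂ (place-injective j i p (9 + toℕ k) (high k) i′ j′ p′ (toℕ k′) (low k′) e)))))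

     flat : Fin (suc Δ * (Δ * 9)) → Fin m
     flat x = charge i (punchIn i j) (≢-sym (FinP.punchInᵢ≢i i j)) k
       where
         i = proj₁ (remQuot {suc Δ} (Δ * 9) x)
         y = proj₂ (remQuot {suc Δ} (Δ * 9) x)
         j = proj₁ (remQuot {Δ} 9 y)
         k = proj₂ (remQuot {Δ} 9 y)

     remQuot-injective : ∀ {m} n (x y : Fin (m * n)) → proj₁ (remQuot {m} n x) ≡ proj₁ (remQuot {m} n y) → proj₂ (remQuot {m} n x) ≡ proj₂ (remQuot {m} n y) → x ≡ y
     remQuot-injective {m} n x y e₁ e₂ = trans (sym (FinP.combine-remQuot {m} n x)) (trans (cong₂ combine e₁ e₂) (FinP.combine-remQuot {m} n y))

     flat-injective : ∀ {x y} → flat x ≡ flat y → x ≡ y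
     flat-injective {x} {y} e with charge-injective _ _ _ _ _ _ _ _ e
     ... | i≡ , j≡ , k≡ = remQuot-injective {suc Δ} (Δ * 9) x y i≡ (remQuot-injective {Δ} 9 _ _ (FinP.punchIn-injective _ _ _ (trans j≡ (cong (λ z → punchIn z _) (sym i≡)))) k≡)

   9Δ²≤m : suc Δ * (Δ * 9) ≤ m
   9Δ²≤m = FinP.injective⇒≤ flat-injective

 module FromSubdivision (K : Defs.Field) (R : Defs.DistSet K) {m Δ : ℕ} (H : Defs.Subdivision K R m Δ)
                        (3≤len : ∀ i j → i <ᶠ j → 3 ≤ Defs.Subdivision.len H i j) where
   open Defs.Subdivision H
   private
     module K = Defs.Field K

   inner : Fin Δ → Fin Δ → ℕ
   inner i j = len i j ∸ 3

   3+inner : ∀ i j → i <ᶠ j → 3 + inner i j ≡ len i j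
   3+inner i j p = m+[n∸m]≡n (3≤len i j p)

   private
     path′ : (i j : Fin Δ) → i <ᶠ j → Fin (4 + inner i j) → Fin m
     path′ i j p k = path i j p (cast (cong suc (3+inner i j p)) k)

     path-cast : ∀ i j p k (l : Fin (suc (len i j))) → toℕ k ≡ toℕ l → path′ i j p k ≡ path i j p l
     path-cast i j p k l e = cong (path i j p) (FinP.toℕ-injective (trans (FinP.toℕ-cast (cong suc (3+inner i j p)) k) e))

     lab : (i j : Fin Δ) → i <ᶠ j → Fin (3 + inner i j) → Fin (Defs.dcard K R)
     lab i j p k = Any.index (label-in-R i j p (cast (3+inner i j p) k))

     module Bounds (i j : Fin Δ) (p : i <ᶠ j) (k : Fin (4 + inner i j)) where
       toℕ-cast : toℕ (cast (cong suc (3+inner i j p)) k) ≡ toℕ k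
       toℕ-cast = FinP.toℕ-cast (cong suc (3+inner i j p)) k
       lower : 0 < toℕ k → 0 < toℕ (cast (cong suc (3+inner i j p)) k)
       lower = subst (0 <_) (sym toℕ-cast)
       upper : toℕ k < 3 + inner i j → toℕ (cast (cong suc (3+inner i j p)) k) < len i j
       upper = subst₂ _<_ (sym toℕ-cast) (3+inner i j p)

   skeleton : Skeleton (Defs.dcard K R) m Δ
   skeleton = record
     { branch = branch ; branch-inj = branch-inj ; inner = inner ; path = path′ ; lab = lab
     ; path-start = λ i j p → trans (path-cast i j p zero zero refl) (path-start i j p)
     ; path-end = λ i j p → trans (path-cast i j p (fromℕ (3 + inner i j)) (fromℕ (len i j)) (trans (FinP.toℕ-fromℕ (3 + inner i j)) (trans (3+inner i j p) (sym (FinP.toℕ-fromℕ (len i j)))))) (path-end i j p)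
     ; internal-inj = inj
     ; internal-not-branch = λ i j p k b lo hi → internal-not-branch i j p _ b (Bounds.lower i j p k lo) (Bounds.upper i j p k hi)
     ; covering = cover }
     where
       inj : ∀ i j p k i′ j′ p′ k′ → 0 < toℕ k → toℕ k < 3 + inner i j → 0 < toℕ k′ → toℕ k′ < 3 + inner i′ j′ →
             path′ i j p k ≡ path′ i′ j′ p′ k′ → i ≡ i′ × j ≡ j′ × toℕ k ≡ toℕ k′
       inj i j p k i′ j′ p′ k′ lo hi lo′ hi′ e with internal-inj i j p _ i′ j′ p′ _ (Bounds.lower i j p k lo) (Bounds.upper i j p k hi) (Bounds.lower i′ j′ p′ k′ lo′) (Bounds.upper i′ j′ p′ k′ hi′) e
       ... | i≡ , j≡ , k≡ = i≡ , j≡ , trans (sym (Bounds.toℕ-cast i j p k)) (trans k≡ (Bounds.toℕ-cast i′ j′ p′ k′))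
       cover : ∀ v → (∃ λ b → branch b ≡ v) ⊎ (Σ (Fin Δ) λ i → Σ (Fin Δ) λ j → Σ (i <ᶠ j) λ p → Σ (Fin (4 + inner i j)) λ k →
               0 < toℕ k × toℕ k < 3 + inner i j × path′ i j p k ≡ v)
       cover v with covering v
       ... | inj₁ b = inj₁ b
       ... | inj₂ (i , j , p , k , lo , hi , e) = inj₂ (i , j , p , cast (cong suc (sym (3+inner i j p))) k , subst (0 <_) (sym k≡) lo
               , subst₂ _<_ (sym k≡) (sym (3+inner i j p)) hi , trans (path-cast i j p _ k k≡) e)
         where
           k≡ : toℕ (cast (cong suc (sym (3+inner i j p))) k) ≡ toℕ k
           k≡ = FinP.toℕ-cast (cong suc (sym (3+inner i j p))) k

   edge : ∀ i j (p : i <ᶠ j) (k : Fin (len i j)) → Fin (3 + inner i j)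
   edge i j p k = cast (sym (3+inner i j p)) k

   edge-start : ∀ i j p k → path′ i j p (inject₁ (edge i j p k)) ≡ path i j p (inject₁ k)
   edge-start i j p k = path-cast i j p _ _ (trans (FinP.toℕ-inject₁ (edge i j p k)) (trans (FinP.toℕ-cast (sym (3+inner i j p)) k) (sym (FinP.toℕ-inject₁ k))))

   edge-end : ∀ i j p k → path′ i j p (suc (edge i j p k)) ≡ path i j p (suc k)
   edge-end i j p k = path-cast i j p _ _ (cong suc (FinP.toℕ-cast (sym (3+inner i j p)) k))

   edge-label : ∀ i j p k → label i j p k K.≈ List.lookup (Defs.DistSet.elems R) (lab i j p (edge i j p k))
   edge-label i j p k = K.trans (K.reflexive (cong (label i j p) (FinP.toℕ-injective (sym (trans (FinP.toℕ-cast (3+inner i j p) (edge i j p k)) (FinP.toℕ-cast (sym (3+inner i j p)) k))))))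
     (AnyP.lookup-index (label-in-R i j p (cast (3+inner i j p) (edge i j p k))))

 module Main (q d : ℕ) (K : Defs.Field) (hc : Defs.HasCard K q) (E : Defs.PointSet K d) (R : Defs.DistSet K) where
   private
     module K = Defs.Field K
     elems = Defs.PointSet.elems E
     ∈ᴱ-lookup : ∀ i → Defs._∈ᴱ_ K (List.lookup elems i) E
     ∈ᴱ-lookup i = Any.map (λ { refl _ → K.refl }) (MP.∈-lookup {xs = elems} i)

   contains-0 : ∀ {m} (H : Defs.Subdivision K R m 0) → Defs.Contains K E H
   contains-0 {m} H = ⊥-elim ∘ empty , ⊥-elim ∘ empty , (λ u → ⊥-elim (empty u)) , λ ()
     where
       empty : Fin m → ⊥
       empty v with Defs.Subdivision.covering H v
       ... | inj₁ (() , _)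
       ... | inj₂ (() , _)

   contains-1 : ∀ {m} (H : Defs.Subdivision K R m 1) → Fin (Defs.card K E) → Defs.Contains K E H
   contains-1 {m} H x = (λ _ → List.lookup elems x) , (λ _ → ∈ᴱ-lookup x) , (λ u v _ → trans (sym (single u)) (single v)) , no-edge
     where
       open Defs.Subdivision H
       single : ∀ v → branch zero ≡ v
       single v with covering v
       ... | inj₁ (zero , e) = e
       ... | inj₂ (zero , zero , () , _)
       no-edge : ∀ (i j : Fin 1) (p : i <ᶠ j) (k : Fin (len i j)) → _
       no-edge zero zero ()

   module _ (pp : Defs.OddPrimePower q) (2≤d : 2 ≤ d) (a b : ℕ) .{{_ : NonZero a}} .{{_ : NonZero b}} (2a≤b : 2 * a ≤ b) where
     private
       p = proj₁ pp
       ν = proj₁ (proj₂ pp)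
       p-prime = proj₁ (proj₂ (proj₂ pp))
       h = proj₁ (proj₁ (proj₂ (proj₂ (proj₂ pp))))
       p-odd = proj₂ (proj₁ (proj₂ (proj₂ (proj₂ pp))))
       1≤ν = proj₁ (proj₂ (proj₂ (proj₂ (proj₂ pp))))
       q≡ = proj₂ (proj₂ (proj₂ (proj₂ (proj₂ pp))))
       open DistanceGraph K hc p ν h p-prime p-odd q≡ E R
       Q = q ^ suc d
       κ = Defs.⌈ b / a ⌉

       2≤q : 2 ≤ q
       2≤q = ≤-trans (ℕ.nonTrivial⇒n>1 p {{prime⇒nonTrivial p-prime}}) (≤-trans (n≤n^ p ν {{ℕ.>-nonZero 1≤ν}}) (≤-reflexive (sym q≡)))

       2≤Q : 2 ≤ Q
       2≤Q = ≤-trans 2≤q (n≤n^ q (suc d))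

       b≤κa : b ≤ κ * a
       b≤κa = ≤⌈/⌉* b a

       2≤κ : 2 ≤ κ
       2≤κ = *-cancelʳ-≤ 2 κ a (≤-trans 2a≤b b≤κa)

     module _ {m Δ : ℕ} (H : Defs.Subdivision K R m (2 + Δ)) (dist : Defs.MinBranchDist K H (2 * κ + 16)) (m≤n : m ≤ n)
              (big : 200 ^ (2 * b) * ρ ^ (b + 2 * a) * Q ^ (a + b) ≤ (n ∸ m) ^ (2 * b)) (dim : 2 < d ⊎ (d ≡ 2 × 4 * q * (2 + Δ) ≤ n)) where
       open Defs.Subdivision H
       private
         open FromSubdivision K R H (λ i j p → ≤-trans (≤-trans (m≤m+n 3 13) (m≤n+m 16 (2 * κ))) (dist i j p))

         r₀ : Fin ρ
         r₀ = Skeleton.lab skeleton zero (suc zero) (s≤s z≤n) zero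

         1≤ρ : 1 ≤ ρ
         1≤ρ = ≤-trans (s≤s z≤n) (FinP.toℕ<n r₀)

         open Scales (scales a b ρ Q κ (n ∸ m) 1≤ρ 2≤Q b≤κa big)

         X = D * M
         S = (2 + Δ) * suc (2 + Δ)
         Z = suc ((3 * D + 4) * M) + M

         16≤inner : ∀ i j → i <ᶠ j → 16 ≤ inner i j
         16≤inner i j p = m+n≤o⇒m≤o∸n 16 (≤-trans (+-monoʳ-≤ 16 (≤-trans (m≤m+n 3 1) (*-monoʳ-≤ 2 2≤κ))) (≤-trans (≤-reflexive (+-comm 16 (2 * κ))) (dist i j p)))

         2t≤inner : ∀ i j → i <ᶠ j → 2 * t ≤ inner i j
         2t≤inner i j p = m+n≤o⇒m≤o∸n (2 * t) (≤-trans (+-monoˡ-≤ 3 (*-monoʳ-≤ 2 t≤)) (≤-trans (≤-trans (m≤m+n _ 9) (≤-reflexive (lem κ))) (dist i j p)))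
           where
             lem : ∀ k → 2 * (k + 2) + 3 + 9 ≡ 2 * k + 16
             lem = solve-∀

         internal : (2 + Δ) * (suc Δ * 9) ≤ m
         internal = InternalVertices.9Δ²≤m skeleton 16≤inner

         3S≤m : 3 * S ≤ m
         3S≤m = ≤-trans (m≤m+n (3 * S) (6 * Δ * (2 + Δ))) (≤-trans (≤-reflexive (lem Δ)) internal)
           where
             lem : ∀ Δ → 3 * ((2 + Δ) * suc (2 + Δ)) + 6 * Δ * (2 + Δ) ≡ (2 + Δ) * (suc Δ * 9)
             lem = solve-∀

         Δ²≤m : (2 + Δ) * (2 + Δ) ≤ m
         Δ²≤m = ≤-trans (*-monoʳ-≤ (2 + Δ) (n≤1+n (2 + Δ))) (≤-trans (m≤m+n S _) 3S≤m)

         m+16X≤n : m + 16 * X ≤ n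
         m+16X≤n = ≤-trans (+-monoʳ-≤ m 16DM≤C) (≤-reflexive (m+[n∸m]≡n m≤n))

         2M≤X : 2 * M ≤ X
         2M≤X = *-monoˡ-≤ M 2≤D

         1≤X : 1 ≤ X
         1≤X = ≤-trans (≤-trans 1≤M (m≤n*m M 2)) 2M≤X

         Z≤6X : Z ≤ 6 * X
         Z≤6X = begin
           suc ((3 * D + 4) * M) + M ≡⟨ lem₁ D M ⟩
           3 * X + (5 * M + 1) ≤⟨ +-monoʳ-≤ (3 * X) (+-monoʳ-≤ (5 * M) 1≤M) ⟩
           3 * X + (5 * M + M) ≡⟨ lem₂ X M ⟩
           3 * X + 3 * (2 * M) ≤⟨ +-monoʳ-≤ (3 * X) (*-monoʳ-≤ 3 2M≤X) ⟩
           3 * X + 3 * X ≡⟨ sym (*-distribʳ-+ X 3 3) ⟩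
           6 * X ∎
           where
             open ≤-Reasoning
             lem₁ : ∀ D M → suc ((3 * D + 4) * M) + M ≡ 3 * (D * M) + (5 * M + 1)
             lem₁ = solve-∀
             lem₂ : ∀ X M → 3 * X + (5 * M + M) ≡ 3 * X + 3 * (2 * M)
             lem₂ = solve-∀

         <+16X : ∀ {x} c → c < 16 → x ≤ m + c * X → x < n
         <+16X c c<16 x≤ = ≤-trans (s≤s x≤) (≤-trans (≤-reflexive (sym (+-suc m (c * X)))) (≤-trans (+-monoʳ-≤ m (*-monoˡ-< X {{ℕ.>-nonZero 1≤X}} c<16)) m+16X≤n))

         room : m + ((D + D) * M + M + M + 4 * D ^ t) < n
         room = <+16X 7 (m≤m+n 8 8) (+-monoʳ-≤ m (begin
           (D + D) * M + M + M + 4 * D ^ t ≤⟨ +-monoʳ-≤ _ (*-monoʳ-≤ 4 Dᵗ≤DM) ⟩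
           (D + D) * M + M + M + 4 * X ≡⟨ lem₁ D M ⟩
           6 * X + 2 * M ≤⟨ +-monoʳ-≤ (6 * X) 2M≤X ⟩
           6 * X + X ≡⟨ +-comm (6 * X) X ⟩
           7 * X ∎))
           where
             open ≤-Reasoning
             lem₁ : ∀ D M → (D + D) * M + M + M + 4 * (D * M) ≡ 6 * (D * M) + 2 * M
             lem₁ = solve-∀

         stars-room₁ : n + 3 * (S + Z) ≤ 3 * n
         stars-room₁ = +-monoʳ-≤ n (begin
           3 * (S + Z) ≡⟨ *-distribˡ-+ 3 S Z ⟩
           3 * S + 3 * Z ≤⟨ +-mono-≤ 3S≤m (*-monoʳ-≤ 3 Z≤6X) ⟩
           m + 3 * (6 * X) ≤⟨ m≤m+n _ (m + 14 * X) ⟩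
           m + 3 * (6 * X) + (m + 14 * X) ≡⟨ lem m X ⟩
           2 * (m + 16 * X) ≤⟨ *-monoʳ-≤ 2 m+16X≤n ⟩
           2 * n ∎)
           where
             open ≤-Reasoning
             lem : ∀ m x → m + 3 * (6 * x) + (m + 14 * x) ≡ 2 * (m + 16 * x)
             lem = solve-∀

         stars-room₂ : 4 * M + S + Z < n
         stars-room₂ = <+16X 8 (m≤m+n 9 7) (begin
           4 * M + S + Z ≤⟨ +-mono-≤ (+-mono-≤ (≤-trans (≤-reflexive (*-assoc 2 2 M)) (*-monoʳ-≤ 2 2M≤X)) (≤-trans (m≤m+n S _) 3S≤m)) Z≤6X ⟩
           2 * X + m + 6 * X ≡⟨ lem m X ⟩
           m + 8 * X ∎)
           where
             open ≤-Reasoning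
             lem : ∀ m x → 2 * x + m + 6 * x ≡ m + 8 * x
             lem = solve-∀

         high-dimension : 2 < d → 4 * q * (2 + Δ) ≤ n
         high-dimension 2<d = square-cancel-≤ (4 * q * (2 + Δ)) n (begin
           4 * q * (2 + Δ) * (4 * q * (2 + Δ)) ≡⟨ lem₁ q (2 + Δ) ⟩
           16 * (q * q) * ((2 + Δ) * (2 + Δ)) ≤⟨ *-mono-≤ 16q²≤n (≤-trans Δ²≤m m≤n) ⟩
           n * n ∎)
           where
             open ≤-Reasoning
             lem₁ : ∀ q x → 4 * q * x * (4 * q * x) ≡ 16 * (q * q) * (x * x)
             lem₁ = solve-∀
             lem₂ : ∀ q → 3 * (q * q) * (3 * (q * q)) ≡ 9 * (q * (q * (q * (q * 1))))
             lem₂ = solve-∀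
             3q²≤M : 3 * (q * q) ≤ M
             3q²≤M = square-cancel-≤ (3 * (q * q)) M (begin
               3 * (q * q) * (3 * (q * q)) ≡⟨ lem₂ q ⟩
               9 * q ^ 4 ≤⟨ *-monoʳ-≤ 9 (^-monoʳ-≤ q {{ℕ.>-nonZero (≤-trans (s≤s z≤n) 2≤q)}} (s≤s 2<d)) ⟩
               9 * Q ≡⟨ sym (*-identityˡ (9 * Q)) ⟩
               1 * (9 * Q) ≤⟨ *-monoˡ-≤ (9 * Q) 1≤ρ ⟩
               ρ * (9 * Q) ≤⟨ ρΛ≤M² ⟩
               M * M ∎)
             16q²≤n : 16 * (q * q) ≤ n
             16q²≤n = begin
               16 * (q * q) ≤⟨ *-monoʳ-≤ 16 (≤-trans (m≤n*m (q * q) 3) 3q²≤M) ⟩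
               16 * M ≤⟨ *-monoʳ-≤ 16 (≤-trans (m≤n*m M 2) 2M≤X) ⟩
               16 * X ≤⟨ m≤n+m (16 * X) m ⟩
               m + 16 * X ≤⟨ m+16X≤n ⟩
               n ∎

         4qΔ≤n : 4 * q * (2 + Δ) ≤ n
         4qΔ≤n = [ high-dimension , proj₂ ]′ dim

         graph : ColouredExpander n ρ
         graph = record { adj = adj ; adj-sym = adj-sym ; Λ = 9 * Q ; joined = joined ; D = D ; M = M ; 1≤M = 1≤M ; 2≤D = 2≤D ; ρΛ≤M² = ρΛ≤M² }

         problem : EmbeddingProblem graph m (2 + Δ)
         problem = record { adj-irr = adj-irr ; H = skeleton ; r₀ = r₀ ; sparse = sparse (2 + Δ) 4qΔ≤n ; t = t ; Λ<D²ᵗ = Λ<D²ᵗ ; long = 2t≤inner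
                          ; room = room ; stars-room₁ = stars-room₁ ; stars-room₂ = stars-room₂ }

         embedding = Assembly.embed problem

       contains-2+ : Defs.Contains K E H
       contains-2+ = point ∘ φ , ∈ᴱ-lookup ∘ φ , (λ u v s → φ-injective u v (point-injective (φ u) (φ v) s)) , lengths
         where
           φ = proj₁ embedding
           φ-injective = proj₁ (proj₂ embedding)
           lengths : ∀ (i j : Fin (2 + Δ)) (p : i <ᶠ j) (k : Fin (len i j)) →
             Defs.‖_‖ K (Defs._−ᵥ_ K (point (φ (path i j p (inject₁ k)))) (point (φ (path i j p (suc k))))) K.≈ label i j p k
           lengths i j p k = K.trans (adj⇒distance (Skeleton.lab skeleton i j p (edge i j p k)) (φ (path i j p (inject₁ k))) (φ (path i j p (suc k)))
               (subst₂ (λ x y → adj (Skeleton.lab skeleton i j p (edge i j p k)) (φ x) (φ y) ≡ true) (edge-start i j p k) (edge-end i j p k) (proj₂ (proj₂ embedding) i j p (edge i j p k))))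
             (K.sym (edge-label i j p k))

 theorem : (q d : ℕ) → Defs.OddPrimePower q → 2 ≤ d →
     (F : Defs.Field) → Defs.HasCard F q →
     (E : Defs.PointSet F d) (R : Defs.DistSet F) →
     (a b : ℕ) .{{_ : NonZero a}} → 2 * a ≤ b →
     (200 ^ (2 * b)) * (Defs.dcard F R ^ (b + 2 * a)) * (q ^ ((a + b) * (d + 1)))
       < Defs.card F E ^ (2 * b) →
     (n Δ : ℕ) (H : Defs.Subdivision F R n Δ) →
     Defs.MinBranchDist F H (2 * Defs.⌈ b / a ⌉ + 16) →
     n ≤ Defs.card F E →
     (200 ^ (2 * b)) * (Defs.dcard F R ^ (b + 2 * a)) * (q ^ ((a + b) * (d + 1)))
       ≤ (Defs.card F E ∸ n) ^ (2 * b) →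
     (2 < d ⊎ (d ≡ 2 × 4 * q * Δ ≤ Defs.card F E)) →
     Defs.Contains F E H
 theorem q d pp 2≤d F hc E R a b 2a≤b large n zero H dist n≤ big dim = Main.contains-0 q d F hc E R H
 theorem q d pp 2≤d F hc E R a b 2a≤b large n (suc zero) H dist n≤ big dim = Main.contains-1 q d F hc E R H (some (Defs.card F E) large)
   where
     instance
       b≢0 : NonZero b
       b≢0 = ℕ.>-nonZero (≤-trans (ℕ.>-nonZero⁻¹ a) (≤-trans (m≤n*m a 2) 2a≤b))
       2b≢0 : NonZero (2 * b)
       2b≢0 = m*n≢0 2 b
     some : ∀ c {x} → x < c ^ (2 * b) → Fin c
     some (suc c) _ = zero
     some zero h = ⊥-elim (<⇒≱ h (≤-trans (≤-reflexive (0^ (2 * b))) z≤n))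
       where
         0^ : ∀ c → .{{NonZero c}} → 0 ^ c ≡ 0
         0^ (suc c) = refl
 theorem q d pp 2≤d F hc E R a b 2a≤b large n (suc (suc Δ)) H dist n≤ big dim =
   Main.contains-2+ q d F hc E R pp 2≤d a b 2a≤b H dist n≤ (subst (λ z → 200 ^ (2 * b) * Defs.dcard F R ^ (b + 2 * a) * z ≤ (Defs.card F E ∸ n) ^ (2 * b)) power big) dim
   where
     instance
       b≢0 : NonZero b
       b≢0 = ℕ.>-nonZero (≤-trans (ℕ.>-nonZero⁻¹ a) (≤-trans (m≤n*m a 2) 2a≤b))
     power : q ^ ((a + b) * (d + 1)) ≡ (q ^ suc d) ^ (a + b)
     power = trans (cong (q ^_) (trans (*-comm (a + b) (d + 1)) (cong (_* (a + b)) (+-comm d 1)))) (sym (^-*-assoc q (suc d) (a + b)))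

open import Defs
open import Data.Nat using (ℕ; _+_; _*_; _^_; _≤_; _<_; _∸_; NonZero)
open import Data.Product using (_×_)
open import Data.Sum using (_⊎_)
open import Relation.Binary.PropositionalEquality using (_≡_)

theorem1p8 : (q d : ℕ) → OddPrimePower q → 2 ≤ d →
    (F : Field) → HasCard F q →
    (E : PointSet F d) (R : DistSet F) →
    (a b : ℕ) .{{_ : NonZero a}} → 2 * a ≤ b →
    (200 ^ (2 * b)) * (dcard F R ^ (b + 2 * a)) * (q ^ ((a + b) * (d + 1)))
    < card F E ^ (2 * b) →
    (n Δ : ℕ) (H : Subdivision F R n Δ) →
    MinBranchDist F H (2 * ⌈ b / a ⌉ + 16) →
    n ≤ card F E →
    (200 ^ (2 * b)) * (dcard F R ^ (b + 2 * a)) * (q ^ ((a + b) * (d + 1)))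
    ≤ (card F E ∸ n) ^ (2 * b) →
    (2 < d ⊎ (d ≡ 2 × 4 * q * Δ ≤ card F E)) →
    Contains F E H
theorem1p8 = Containment.theorem
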